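{- Let $p\in(0,1)$ be a constant and let $G(n,p)$ be the binomial random graph. Then $G(n,p)$ obeys the $\mathcal{E}_1^2$ zero-one law (i.e. for every sentence $\varphi\in\mathcal{E}_1^2$, $\lim_{n\to\infty}{\sf P}(G(n,p)\models\varphi)$ exists and belongs to $\{0,1\}$) if and only if $p\notin\{\frac{3-\sqrt{5}}{2},\frac{\sqrt{5}-1}{2}\}$. Moreover, if $p\in\{\frac{3-\sqrt{5}}{2},\frac{\sqrt{5}-1}{2}\}$, then $G(n,p)$ does not obey the $\mathcal{E}_1^2$ convergence law, i.e. there is a sentence $\varphi\in\mathcal{E}_1^2$ such that ${\sf P}(G(n,p)\models\varphi)$ does not converge as $n\to\infty$.
   Context: $G(n,p)$ is the random graph on vertex set $\{1,\ldots,n\}$ in which each pair of vertices is joined by an edge independently with probability $p$. Sentences are about undirected graphs, built from the relations $\sim$ (adjacency) and $=$. $\mathcal{E}_1^2$ is the class of existential monadic second order sentences of the form $\exists X\,\phi(X)$, where $X$ is a single monadic (set) variable ranging over subsets of the vertex set and $\phi(X)$ is a first order sentence in $\sim,=$ and the unary predicate $X$ of quantifier depth $2$ (the maximum number of nested first order quantifiers is 2). -}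

module Defs where

open import Data.Bool.Base using (Bool; true; false; T; if_then_else_)
open import Data.Bool.Properties using (T?)
open import Data.Fin.Base using (Fin; zero; suc)
open import Data.Fin.Properties using (any?; all?) renaming (_≟_ to _≟ᶠ_)
open import Data.Fin.Subset using (Subset; _∈_)
open import Data.Fin.Subset.Properties using (_∈?_; anySubset?)
open import Data.Integer.Base as ℤ using (+_; +[1+_])
import Data.Integer.Properties as ℤ
open import Data.List.Base as List using (List; []; _∷_; cartesianProductWith; filter)
import Data.Nat.Base as ℕ
open ℕ using (ℕ; zero; suc; _⊔_)
import Data.Nat.Properties as ℕ
open import Data.Nat.Coprimality using (sym; 1-coprimeTo)
open import Data.Product.Base using (∃; _×_; _,_; proj₁; proj₂)
open import Data.Rational.Base as ℚ using (ℚ; mkℚ; 0ℚ; 1ℚ; ½; ∣_∣)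
import Data.Rational.Properties as ℚ
import Data.Rational.Unnormalised.Base as ℚᵘ
import Data.Rational.Unnormalised.Properties as ℚᵘ
open import Data.Rational.Solver using (module +-*-Solver)
open import Data.Sum.Base using (_⊎_; inj₁; inj₂)
open import Data.Vec.Base using (Vec; []; _∷_; lookup)
open import Relation.Binary.PropositionalEquality.Core using (_≡_; refl; cong; cong₂; subst; subst₂; trans) renaming (sym to ≡-sym)
open import Relation.Nullary.Decidable.Core using (Dec; ¬?; _×-dec_; _⊎-dec_; _→-dec_; toWitness)
open import Relation.Nullary.Negation.Core using (¬_)
open import Relation.Unary using (Pred; Decidable)
open import Level using (0ℓ)

------------------------------------------------------------------------
-- Real numbers: Cauchy sequences of rationals, with equality _≃_.

Cauchy : (ℕ → ℚ) → Set
Cauchy x = ∀ ε → 0ℚ ℚ.< ε → ∃ λ N → ∀ m n → N ℕ.≤ m → N ℕ.≤ n → ∣ x m ℚ.- x n ∣ ℚ.< ε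

record ℝ : Set where
  constructor mkℝ
  field
    seq    : ℕ → ℚ
    cauchy : Cauchy seq

open ℝ public

infix  4 _≃_ _<_ _⟶_
infixl 6 _+_ _-_
infixl 7 _*_
infix  8 -_

_≃_ : ℝ → ℝ → Set
x ≃ y = ∀ ε → 0ℚ ℚ.< ε → ∃ λ N → ∀ n → N ℕ.≤ n → ∣ seq x n ℚ.- seq y n ∣ ℚ.< ε

_<_ : ℝ → ℝ → Set
x < y = ∃ λ ε → 0ℚ ℚ.< ε × ∃ λ N → ∀ n → N ℕ.≤ n → seq x n ℚ.+ ε ℚ.< seq y n

private

  0<1 : 0ℚ ℚ.< 1ℚ
  0<1 = ℚ.positive⁻¹ 1ℚ

  0<* : ∀ {p q} → 0ℚ ℚ.< p → 0ℚ ℚ.< q → 0ℚ ℚ.< p ℚ.* q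
  0<* {p} {q} 0<p 0<q =
    ℚ.positive⁻¹ (p ℚ.* q) {{ℚ.pos*pos⇒pos p {{ℚ.positive 0<p}} q {{ℚ.positive 0<q}}}}

  half : ∀ {ε} → 0ℚ ℚ.< ε → 0ℚ ℚ.< ½ ℚ.* ε
  half = 0<* (ℚ.positive⁻¹ ½)

  halves : ∀ ε → ½ ℚ.* ε ℚ.+ ½ ℚ.* ε ≡ ε
  halves = solve 1 (λ e → con ½ :* e :+ con ½ :* e := e) refl
    where open +-*-Solver

  ∣0∣<ε : ∀ p {ε} → 0ℚ ℚ.< ε → ∣ p ℚ.- p ∣ ℚ.< ε
  ∣0∣<ε p = subst (λ t → ∣ t ∣ ℚ.< _) (≡-sym (ℚ.+-inverseʳ p))

  +-cauchy : ∀ x y → Cauchy x → Cauchy y → Cauchy (λ n → x n ℚ.+ y n)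
  +-cauchy x y cx cy ε 0<ε with cx (½ ℚ.* ε) (half 0<ε) | cy (½ ℚ.* ε) (half 0<ε)
  ... | N , hN | M , hM = N ⊔ M , λ m n l₁ l₂ → begin-strict
      ∣ (x m ℚ.+ y m) ℚ.- (x n ℚ.+ y n) ∣        ≡⟨ cong ∣_∣ (rearrange (x m) (y m) (x n) (y n)) ⟩
      ∣ (x m ℚ.- x n) ℚ.+ (y m ℚ.- y n) ∣        ≤⟨ ℚ.∣p+q∣≤∣p∣+∣q∣ (x m ℚ.- x n) (y m ℚ.- y n) ⟩
      ∣ x m ℚ.- x n ∣ ℚ.+ ∣ y m ℚ.- y n ∣        <⟨ ℚ.+-mono-<
                                                     (hN m n (ℕ.m⊔n≤o⇒m≤o N M l₁) (ℕ.m⊔n≤o⇒m≤o N M l₂))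
                                                     (hM m n (ℕ.m⊔n≤o⇒n≤o N M l₁) (ℕ.m⊔n≤o⇒n≤o N M l₂)) ⟩
      ½ ℚ.* ε ℚ.+ ½ ℚ.* ε                        ≡⟨ halves ε ⟩
      ε                                          ∎
    where
    open ℚ.≤-Reasoning
    open +-*-Solver
    rearrange : ∀ a b c d → (a ℚ.+ b) ℚ.- (c ℚ.+ d) ≡ (a ℚ.- c) ℚ.+ (b ℚ.- d)
    rearrange = solve 4 (λ a b c d → (a :+ b) :- (c :+ d) := (a :- c) :+ (b :- d)) refl

  neg-cauchy : ∀ x → Cauchy x → Cauchy (λ n → ℚ.- x n)
  neg-cauchy x cx ε 0<ε with cx ε 0<ε
  ... | N , hN = N , λ m n l₁ l₂ →
      subst (ℚ._< ε) (cong ∣_∣ (flip (x n) (x m))) (hN n m l₂ l₁)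
    where
    open +-*-Solver
    flip : ∀ a b → a ℚ.- b ≡ (ℚ.- b) ℚ.- (ℚ.- a)
    flip = solve 2 (λ a b → a :- b := (:- b) :- (:- a)) refl

  bounded : ∀ {x} → Cauchy x → ∃ λ B → 0ℚ ℚ.< B × ∃ λ N → ∀ n → N ℕ.≤ n → ∣ x n ∣ ℚ.≤ B
  bounded {x} cx with cx 1ℚ 0<1
  ... | N , hN = 1ℚ ℚ.+ ∣ x N ∣ , ℚ.+-mono-<-≤ 0<1 (ℚ.0≤∣p∣ (x N)) , N , λ n l → begin
      ∣ x n ∣                              ≡⟨ cong ∣_∣ (split (x n) (x N)) ⟩
      ∣ (x n ℚ.- x N) ℚ.+ x N ∣            ≤⟨ ℚ.∣p+q∣≤∣p∣+∣q∣ (x n ℚ.- x N) (x N) ⟩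
      ∣ x n ℚ.- x N ∣ ℚ.+ ∣ x N ∣          ≤⟨ ℚ.+-monoˡ-≤ ∣ x N ∣ (ℚ.<⇒≤ (hN n N l ℕ.≤-refl)) ⟩
      1ℚ ℚ.+ ∣ x N ∣                       ∎
    where
    open ℚ.≤-Reasoning
    open +-*-Solver
    split : ∀ a b → a ≡ (a ℚ.- b) ℚ.+ b
    split = solve 2 (λ a b → a := (a :- b) :+ b) refl

  shrink : ∀ {B ε} → 0ℚ ℚ.< B → 0ℚ ℚ.< ε → ∃ λ δ → 0ℚ ℚ.< δ × B ℚ.* δ ≡ ε
  shrink {B} {ε} 0<B 0<ε =
    (ℚ.1/ B) ℚ.* ε ,
    0<* (ℚ.positive⁻¹ (ℚ.1/ B) {{ℚ.1/pos⇒pos B}}) 0<ε ,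
    trans (≡-sym (ℚ.*-assoc B (ℚ.1/ B) ε))
      (trans (cong (ℚ._* ε) (ℚ.*-inverseʳ B)) (ℚ.*-identityˡ ε))
    where
    instance
      B-pos : ℚ.Positive B
      B-pos = ℚ.positive 0<B
      B≢0 : ℚ.NonZero B
      B≢0 = ℚ.pos⇒nonZero B

  ∣*∣< : ∀ {a b B δ} → ∣ a ∣ ℚ.≤ B → 0ℚ ℚ.< B → ∣ b ∣ ℚ.< δ → ∣ a ℚ.* b ∣ ℚ.< B ℚ.* δ
  ∣*∣< {a} {b} {B} {δ} a≤B 0<B b<δ = begin-strict
    ∣ a ℚ.* b ∣        ≡⟨ ℚ.∣p*q∣≡∣p∣*∣q∣ a b ⟩
    ∣ a ∣ ℚ.* ∣ b ∣    ≤⟨ ℚ.*-monoʳ-≤-nonNeg ∣ b ∣ {{ℚ.nonNegative (ℚ.0≤∣p∣ b)}} a≤B ⟩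
    B ℚ.* ∣ b ∣        <⟨ ℚ.*-monoʳ-<-pos B {{ℚ.positive 0<B}} b<δ ⟩
    B ℚ.* δ            ∎
    where open ℚ.≤-Reasoning

  *-close : ∀ a b c d {A B α β ε} → 0ℚ ℚ.< A → 0ℚ ℚ.< B →
            A ℚ.* α ≡ ½ ℚ.* ε → B ℚ.* β ≡ ½ ℚ.* ε →
            ∣ a ∣ ℚ.≤ A → ∣ d ∣ ℚ.≤ B → ∣ a ℚ.- c ∣ ℚ.< β → ∣ b ℚ.- d ∣ ℚ.< α →
            ∣ a ℚ.* b ℚ.- c ℚ.* d ∣ ℚ.< ε
  *-close a b c d {A} {B} {α} {β} {ε} 0<A 0<B Aα Bβ a≤A d≤B ac bd = begin-strict
      ∣ a ℚ.* b ℚ.- c ℚ.* d ∣                             ≡⟨ cong ∣_∣ (rearrange a b c d) ⟩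
      ∣ a ℚ.* (b ℚ.- d) ℚ.+ d ℚ.* (a ℚ.- c) ∣             ≤⟨ ℚ.∣p+q∣≤∣p∣+∣q∣ (a ℚ.* (b ℚ.- d)) (d ℚ.* (a ℚ.- c)) ⟩
      ∣ a ℚ.* (b ℚ.- d) ∣ ℚ.+ ∣ d ℚ.* (a ℚ.- c) ∣         <⟨ ℚ.+-mono-< (∣*∣< {a} {b ℚ.- d} a≤A 0<A bd)
                                                                        (∣*∣< {d} {a ℚ.- c} d≤B 0<B ac) ⟩
      A ℚ.* α ℚ.+ B ℚ.* β                                 ≡⟨ cong₂ ℚ._+_ Aα Bβ ⟩
      ½ ℚ.* ε ℚ.+ ½ ℚ.* ε                                 ≡⟨ halves ε ⟩
      ε                                                   ∎
    where
    open ℚ.≤-Reasoning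
    open +-*-Solver
    rearrange : ∀ a b c d → a ℚ.* b ℚ.- c ℚ.* d ≡ a ℚ.* (b ℚ.- d) ℚ.+ d ℚ.* (a ℚ.- c)
    rearrange = solve 4 (λ a b c d → a :* b :- c :* d := a :* (b :- d) :+ d :* (a :- c)) refl

  *-cauchy : ∀ x y → Cauchy x → Cauchy y → Cauchy (λ n → x n ℚ.* y n)
  *-cauchy x y cx cy ε 0<ε = go (bounded {x} cx) (bounded {y} cy)
    where
    Bounded : (ℕ → ℚ) → Set
    Bounded z = ∃ λ B → 0ℚ ℚ.< B × ∃ λ N → ∀ n → N ℕ.≤ n → ∣ z n ∣ ℚ.≤ B
    Close : (ℕ → ℚ) → ℚ → Set
    Close z δ = ∃ λ N → ∀ m n → N ℕ.≤ m → N ℕ.≤ n → ∣ z m ℚ.- z n ∣ ℚ.< δ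
    go″ : ∀ {A B α β} → 0ℚ ℚ.< A → 0ℚ ℚ.< B → A ℚ.* α ≡ ½ ℚ.* ε → B ℚ.* β ≡ ½ ℚ.* ε →
          (∃ λ N → ∀ n → N ℕ.≤ n → ∣ x n ∣ ℚ.≤ A) → (∃ λ N → ∀ n → N ℕ.≤ n → ∣ y n ∣ ℚ.≤ B) →
          Close x β → Close y α → Close (λ n → x n ℚ.* y n) ε
    go″ 0<A 0<B Aα Bβ (K , hA) (L , hB) (N , hN) (M , hM) = (K ⊔ L) ⊔ (N ⊔ M) , λ m n l₁ l₂ →
      let KL₁ = ℕ.m⊔n≤o⇒m≤o (K ⊔ L) (N ⊔ M) l₁
          KL₂ = ℕ.m⊔n≤o⇒m≤o (K ⊔ L) (N ⊔ M) l₂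
          NM₁ = ℕ.m⊔n≤o⇒n≤o (K ⊔ L) (N ⊔ M) l₁
          NM₂ = ℕ.m⊔n≤o⇒n≤o (K ⊔ L) (N ⊔ M) l₂
      in *-close (x m) (y m) (x n) (y n) 0<A 0<B Aα Bβ
           (hA m (ℕ.m⊔n≤o⇒m≤o K L KL₁)) (hB n (ℕ.m⊔n≤o⇒n≤o K L KL₂))
           (hN m n (ℕ.m⊔n≤o⇒m≤o N M NM₁) (ℕ.m⊔n≤o⇒m≤o N M NM₂))
           (hM m n (ℕ.m⊔n≤o⇒n≤o N M NM₁) (ℕ.m⊔n≤o⇒n≤o N M NM₂))
    go′ : ∀ {A B} → 0ℚ ℚ.< A → 0ℚ ℚ.< B →
          (∃ λ N → ∀ n → N ℕ.≤ n → ∣ x n ∣ ℚ.≤ A) → (∃ λ N → ∀ n → N ℕ.≤ n → ∣ y n ∣ ℚ.≤ B) →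
          (∃ λ α → 0ℚ ℚ.< α × A ℚ.* α ≡ ½ ℚ.* ε) → (∃ λ β → 0ℚ ℚ.< β × B ℚ.* β ≡ ½ ℚ.* ε) →
          Close (λ n → x n ℚ.* y n) ε
    go′ 0<A 0<B hA hB (α , 0<α , Aα) (β , 0<β , Bβ) =
      go″ 0<A 0<B Aα Bβ hA hB (cx β 0<β) (cy α 0<α)
    go : Bounded x → Bounded y → Close (λ n → x n ℚ.* y n) ε
    go (A , 0<A , hA) (B , 0<B , hB) =
      go′ 0<A 0<B hA hB (shrink 0<A (half 0<ε)) (shrink 0<B (half 0<ε))

fromℚ : ℚ → ℝ
fromℚ q = mkℝ (λ _ → q) (λ ε 0<ε → 0 , λ _ _ _ _ → ∣0∣<ε q 0<ε)

fromℕ : ℕ → ℝ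
fromℕ n = fromℚ (+ n ℚ./ 1)

0ℝ 1ℝ : ℝ
0ℝ = fromℕ 0
1ℝ = fromℕ 1

_+_ : ℝ → ℝ → ℝ
x + y = mkℝ (λ n → seq x n ℚ.+ seq y n) (+-cauchy (seq x) (seq y) (cauchy x) (cauchy y))

-_ : ℝ → ℝ
- x = mkℝ (λ n → ℚ.- seq x n) (neg-cauchy (seq x) (cauchy x))

_-_ : ℝ → ℝ → ℝ
x - y = x + (- y)

_*_ : ℝ → ℝ → ℝ
x * y = mkℝ (λ n → seq x n ℚ.* seq y n) (*-cauchy (seq x) (seq y) (cauchy x) (cauchy y))

_⟶_ : (ℕ → ℝ) → ℝ → Set
a ⟶ L = ∀ ε → 0ℝ < ε → ∃ λ N → ∀ n → N ℕ.≤ n → (L - ε < a n) × (a n < L + ε)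

Converges : (ℕ → ℝ) → Set
Converges a = ∃ λ L → a ⟶ L

------------------------------------------------------------------------
-- The square root of 5, as the limit of y ↦ y + (5 - y²)/4 iterated from
-- 2.  On [2 , 3] this map is a contraction with factor ½, and its fixed
-- point satisfies y² = 5; see √5-square and √5-positive below.

private

  2ℚ 3ℚ 4ℚ 5ℚ ¼ : ℚ
  2ℚ = + 2 ℚ./ 1
  3ℚ = + 3 ℚ./ 1
  4ℚ = + 4 ℚ./ 1
  5ℚ = + 5 ℚ./ 1
  ¼  = + 1 ℚ./ 4

step : ℚ → ℚ
step y = y ℚ.+ (5ℚ ℚ.- y ℚ.* y) ℚ.* ¼

√5-seq : ℕ → ℚ
√5-seq zero    = 2ℚ
√5-seq (suc n) = step (√5-seq n)

private

  2^- : ℕ → ℚ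
  2^- zero    = 1ℚ
  2^- (suc n) = ½ ℚ.* 2^- n

  ι : ℕ → ℚ
  ι n = mkℚ (+ n) 0 (sym (1-coprimeTo n))

  In[2,3] : ℚ → Set
  In[2,3] y = 2ℚ ℚ.≤ y × y ℚ.≤ 3ℚ

  0≤ : ∀ {a b} → a ℚ.≤ b → 0ℚ ℚ.≤ b ℚ.- a
  0≤ {a} {b} a≤b = subst (ℚ._≤ b ℚ.- a) (ℚ.+-inverseʳ a) (ℚ.+-monoˡ-≤ (ℚ.- a) a≤b)

  ≤0 : ∀ {a b} → 0ℚ ℚ.≤ b ℚ.- a → a ℚ.≤ b
  ≤0 {a} {b} h = subst₂ ℚ._≤_ (ℚ.+-identityˡ a) (cancel b a) (ℚ.+-monoˡ-≤ a h)
    where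
    open +-*-Solver
    cancel : ∀ b a → (b ℚ.- a) ℚ.+ a ≡ b
    cancel = solve 2 (λ b a → (b :- a) :+ a := b) refl

  0≤* : ∀ {p q} → 0ℚ ℚ.≤ p → 0ℚ ℚ.≤ q → 0ℚ ℚ.≤ p ℚ.* q
  0≤* {p} {q} 0≤p 0≤q =
    subst (ℚ._≤ p ℚ.* q) (ℚ.*-zeroˡ q) (ℚ.*-monoʳ-≤-nonNeg q {{ℚ.nonNegative 0≤q}} 0≤p)

  step-in : ∀ {y} → In[2,3] y → In[2,3] (step y)
  step-in {y} (2≤y , y≤3) =
      ≤0 (subst (0ℚ ℚ.≤_) (lower y)
           (0≤* (0≤* (0≤ y≤3) (ℚ.+-mono-≤ (0≤ 2≤y) (ℚ.<⇒≤ 0<1))) 0≤¼))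
    , ≤0 (subst (0ℚ ℚ.≤_) (upper y)
           (ℚ.+-mono-≤ (0≤* (0≤* (0≤ 2≤y) (0≤ 2≤y)) 0≤¼) (ℚ.nonNegative⁻¹ (+ 3 ℚ./ 4))))
    where
    open +-*-Solver
    0≤¼ : 0ℚ ℚ.≤ ¼
    0≤¼ = ℚ.nonNegative⁻¹ ¼
    lower : ∀ y → (3ℚ ℚ.- y) ℚ.* ((y ℚ.- 2ℚ) ℚ.+ 1ℚ) ℚ.* ¼ ≡ step y ℚ.- 2ℚ
    lower = solve 1 (λ y → (con 3ℚ :- y) :* ((y :- con 2ℚ) :+ con 1ℚ) :* con ¼
                         := (y :+ (con 5ℚ :- y :* y) :* con ¼) :- con 2ℚ) refl
    upper : ∀ y → (y ℚ.- 2ℚ) ℚ.* (y ℚ.- 2ℚ) ℚ.* ¼ ℚ.+ (+ 3 ℚ./ 4) ≡ 3ℚ ℚ.- step y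
    upper = solve 1 (λ y → (y :- con 2ℚ) :* (y :- con 2ℚ) :* con ¼ :+ con (+ 3 ℚ./ 4)
                         := con 3ℚ :- (y :+ (con 5ℚ :- y :* y) :* con ¼)) refl

  seq-in : ∀ n → In[2,3] (√5-seq n)
  seq-in zero    = ℚ.≤-refl , toWitness {a? = 2ℚ ℚ.≤? 3ℚ} _
  seq-in (suc n) = step-in (seq-in n)

  ∣∣≤ : ∀ {t c} → t ℚ.≤ c → ℚ.- t ℚ.≤ c → ∣ t ∣ ℚ.≤ c
  ∣∣≤ {t} t≤c -t≤c with ℚ.∣p∣≡p∨∣p∣≡-p t
  ... | inj₁ eq = subst (ℚ._≤ _) (≡-sym eq) t≤c
  ... | inj₂ eq = subst (ℚ._≤ _) (≡-sym eq) -t≤c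

  diam : ∀ {y z} → In[2,3] y → In[2,3] z → ∣ y ℚ.- z ∣ ℚ.≤ 1ℚ
  diam {y} {z} (2≤y , y≤3) (2≤z , z≤3) = ∣∣≤
      (≤0 (subst (0ℚ ℚ.≤_) (e₁ y z) (ℚ.+-mono-≤ (0≤ y≤3) (0≤ 2≤z))))
      (≤0 (subst (0ℚ ℚ.≤_) (e₂ y z) (ℚ.+-mono-≤ (0≤ 2≤y) (0≤ z≤3))))
    where
    open +-*-Solver
    e₁ : ∀ y z → (3ℚ ℚ.- y) ℚ.+ (z ℚ.- 2ℚ) ≡ 1ℚ ℚ.- (y ℚ.- z)
    e₁ = solve 2 (λ y z → (con 3ℚ :- y) :+ (z :- con 2ℚ) := con 1ℚ :- (y :- z)) refl
    e₂ : ∀ y z → (y ℚ.- 2ℚ) ℚ.+ (3ℚ ℚ.- z) ≡ 1ℚ ℚ.- (ℚ.- (y ℚ.- z))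
    e₂ = solve 2 (λ y z → (y :- con 2ℚ) :+ (con 3ℚ :- z) := con 1ℚ :- (:- (y :- z))) refl

  contract : ∀ {y z c} → In[2,3] y → In[2,3] z → ∣ y ℚ.- z ∣ ℚ.≤ c →
             ∣ step y ℚ.- step z ∣ ℚ.≤ ½ ℚ.* c
  contract {y} {z} {c} (2≤y , y≤3) (2≤z , z≤3) h = begin
      ∣ step y ℚ.- step z ∣             ≡⟨ cong ∣_∣ (factor y z) ⟩
      ∣ w ℚ.* (y ℚ.- z) ∣               ≡⟨ ℚ.∣p*q∣≡∣p∣*∣q∣ w (y ℚ.- z) ⟩
      ∣ w ∣ ℚ.* ∣ y ℚ.- z ∣             ≤⟨ ℚ.*-monoʳ-≤-nonNeg ∣ y ℚ.- z ∣ {{ℚ.nonNegative (ℚ.0≤∣p∣ (y ℚ.- z))}} ∣w∣≤½ ⟩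
      ½ ℚ.* ∣ y ℚ.- z ∣                 ≤⟨ ℚ.*-monoˡ-≤-nonNeg ½ h ⟩
      ½ ℚ.* c                           ∎
    where
    open ℚ.≤-Reasoning
    open +-*-Solver
    w : ℚ
    w = 1ℚ ℚ.- (y ℚ.+ z) ℚ.* ¼
    factor : ∀ y z → step y ℚ.- step z ≡ (1ℚ ℚ.- (y ℚ.+ z) ℚ.* ¼) ℚ.* (y ℚ.- z)
    factor = solve 2 (λ y z → (y :+ (con 5ℚ :- y :* y) :* con ¼) :- (z :+ (con 5ℚ :- z :* z) :* con ¼)
                            := (con 1ℚ :- (y :+ z) :* con ¼) :* (y :- z)) refl
    e₁ : ∀ y z → ((y ℚ.- 2ℚ) ℚ.+ (z ℚ.- 2ℚ)) ℚ.* ¼ ℚ.+ ½ ≡ ½ ℚ.- (1ℚ ℚ.- (y ℚ.+ z) ℚ.* ¼)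
    e₁ = solve 2 (λ y z → ((y :- con 2ℚ) :+ (z :- con 2ℚ)) :* con ¼ :+ con ½
                        := con ½ :- (con 1ℚ :- (y :+ z) :* con ¼)) refl
    e₂ : ∀ y z → ((3ℚ ℚ.- y) ℚ.+ (3ℚ ℚ.- z)) ℚ.* ¼ ≡ ½ ℚ.- (ℚ.- (1ℚ ℚ.- (y ℚ.+ z) ℚ.* ¼))
    e₂ = solve 2 (λ y z → ((con 3ℚ :- y) :+ (con 3ℚ :- z)) :* con ¼
                        := con ½ :- (:- (con 1ℚ :- (y :+ z) :* con ¼))) refl
    ∣w∣≤½ : ∣ w ∣ ℚ.≤ ½
    ∣w∣≤½ = ∣∣≤
      (≤0 (subst (0ℚ ℚ.≤_) (e₁ y z)
        (ℚ.+-mono-≤ (0≤* (ℚ.+-mono-≤ (0≤ 2≤y) (0≤ 2≤z)) (ℚ.nonNegative⁻¹ ¼)) (ℚ.nonNegative⁻¹ ½))))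
      (≤0 (subst (0ℚ ℚ.≤_) (e₂ y z)
        (0≤* (ℚ.+-mono-≤ (0≤ y≤3) (0≤ z≤3)) (ℚ.nonNegative⁻¹ ¼))))

  close : ∀ N k l → ∣ √5-seq (N ℕ.+ k) ℚ.- √5-seq (N ℕ.+ l) ∣ ℚ.≤ 2^- N
  close zero    k l = diam (seq-in k) (seq-in l)
  close (suc N) k l = contract (seq-in (N ℕ.+ k)) (seq-in (N ℕ.+ l)) (close N k l)

  ι-suc : ∀ n → ι (suc n) ≡ 1ℚ ℚ.+ ι n
  ι-suc n = ℚ.toℚᵘ-injective (ℚᵘ.≃-trans
    (ℚᵘ.*≡* (cong (ℤ._* + 1) (cong (ℤ._+_ (+ 1)) (≡-sym (ℤ.*-identityʳ (+ n))))))
    (ℚᵘ.≃-sym (ℚ.toℚᵘ-homo-+ 1ℚ (ι n))))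

  2^-≥0 : ∀ n → 0ℚ ℚ.≤ 2^- n
  2^-≥0 zero    = ℚ.<⇒≤ 0<1
  2^-≥0 (suc n) = 0≤* (ℚ.nonNegative⁻¹ ½) (2^-≥0 n)

  2^-*ι≤1 : ∀ n → 2^- n ℚ.* ι (suc n) ℚ.≤ 1ℚ
  2^-*ι≤1 zero    = ℚ.≤-refl
  2^-*ι≤1 (suc n) = begin
      (½ ℚ.* 2^- n) ℚ.* ι (suc (suc n))                       ≡⟨ cong ((½ ℚ.* 2^- n) ℚ.*_) (ι-suc (suc n)) ⟩
      (½ ℚ.* 2^- n) ℚ.* (1ℚ ℚ.+ ι (suc n))                    ≤⟨ ℚ.*-monoˡ-≤-nonNeg (½ ℚ.* 2^- n) {{ℚ.nonNegative (2^-≥0 (suc n))}}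
                                                                   (ℚ.+-monoˡ-≤ (ι (suc n)) 1≤ι) ⟩
      (½ ℚ.* 2^- n) ℚ.* (ι (suc n) ℚ.+ ι (suc n))             ≡⟨ e (2^- n) (ι (suc n)) ⟩
      2^- n ℚ.* ι (suc n)                                     ≤⟨ 2^-*ι≤1 n ⟩
      1ℚ                                                      ∎
    where
    open ℚ.≤-Reasoning
    open +-*-Solver
    e : ∀ h i → (½ ℚ.* h) ℚ.* (i ℚ.+ i) ≡ h ℚ.* i
    e = solve 2 (λ h i → (con ½ :* h) :* (i :+ i) := h :* i) refl
    1≤ι : 1ℚ ℚ.≤ ι (suc n)
    1≤ι = ℚ.*≤* (ℤ.+≤+ (ℕ.s≤s ℕ.z≤n))

  archimedean : ∀ ε → 0ℚ ℚ.< ε → ∃ λ N → 2^- N ℚ.< ε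
  archimedean ε@(mkℚ (+ 0)      d c) (ℚ.*<* (ℤ.+<+ ()))
  archimedean ε@(mkℚ +[1+ a ]   d c) _ = suc d , ℚ.*-cancelʳ-<-nonNeg (ι (suc (suc d))) (begin-strict
      2^- (suc d) ℚ.* ι (suc (suc d))   ≤⟨ 2^-*ι≤1 (suc d) ⟩
      1ℚ                                <⟨ ℚ.toℚᵘ-cancel-< (ℚᵘ.<-respʳ-≃ (ℚᵘ.≃-sym (ℚ.toℚᵘ-homo-* ε (ι (suc (suc d)))))
                                             (ℚᵘ.*<* (ℤ.+<+ bound))) ⟩
      ε ℚ.* ι (suc (suc d))             ∎)
    where
    open ℚ.≤-Reasoning
    bound : 1 ℕ.* suc (d ℕ.* 1) ℕ.< suc a ℕ.* suc (suc d) ℕ.* 1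
    bound rewrite ℕ.*-identityʳ (suc a ℕ.* suc (suc d)) | ℕ.*-identityʳ d | ℕ.+-identityʳ d =
      ℕ.s≤s (ℕ.s≤s (ℕ.m≤m+n d (a ℕ.* suc (suc d))))
  archimedean (mkℚ ℤ.-[1+ a ] d c) (ℚ.*<* ())

  √5-cauchy : Cauchy √5-seq
  √5-cauchy ε 0<ε with archimedean ε 0<ε
  ... | N , hN = N , λ m n l₁ l₂ → ℚ.≤-<-trans
      (subst₂ (λ i j → ∣ √5-seq i ℚ.- √5-seq j ∣ ℚ.≤ 2^- N)
        (ℕ.m+[n∸m]≡n l₁) (ℕ.m+[n∸m]≡n l₂) (close N (m ℕ.∸ N) (n ℕ.∸ N)))
      hN

√5 : ℝ
√5 = mkℝ √5-seq √5-cauchy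

√5-positive : 0ℝ < √5
√5-positive = 1ℚ , 0<1 , 0 , λ n _ →
  ℚ.<-≤-trans (toWitness {a? = 0ℚ ℚ.+ 1ℚ ℚ.<? 2ℚ} _) (proj₁ (seq-in n))

√5-square : √5 * √5 ≃ fromℕ 5
√5-square ε 0<ε with √5-cauchy (¼ ℚ.* ε) (0<* (ℚ.positive⁻¹ ¼) 0<ε)
... | N , hN = N , λ n l → subst₂ ℚ._<_ (lhs n) (rhs ε)
    (ℚ.*-monoʳ-<-pos 4ℚ (hN n (suc n) l (ℕ.m≤n⇒m≤1+n l)))
  where
  open +-*-Solver
  e : ∀ y → 4ℚ ℚ.* (y ℚ.- step y) ≡ y ℚ.* y ℚ.- 5ℚ
  e = solve 1 (λ y → con 4ℚ :* (y :- (y :+ (con 5ℚ :- y :* y) :* con ¼)) := y :* y :- con 5ℚ) refl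
  lhs : ∀ n → 4ℚ ℚ.* ∣ √5-seq n ℚ.- √5-seq (suc n) ∣ ≡ ∣ √5-seq n ℚ.* √5-seq n ℚ.- 5ℚ ∣
  lhs n = trans (≡-sym (ℚ.∣p*q∣≡∣p∣*∣q∣ 4ℚ (√5-seq n ℚ.- √5-seq (suc n)))) (cong ∣_∣ (e (√5-seq n)))
  rhs : ∀ ε → 4ℚ ℚ.* (¼ ℚ.* ε) ≡ ε
  rhs = solve 1 (λ t → con 4ℚ :* (con ¼ :* t) := t) refl

------------------------------------------------------------------------
-- Finite simple graphs on the vertex set Fin n.  A graph on suc n
-- vertices is a graph on the vertices suc i together with the row
-- telling which of them are adjacent to the vertex zero, so that every
-- labelled graph is represented exactly once, by one Boolean per
-- unordered pair of vertices.

data Graph : ℕ → Set where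
  []  : Graph 0
  _∷_ : ∀ {n} → Vec Bool n → Graph n → Graph (suc n)

adjacent : ∀ {n} → Graph n → Fin n → Fin n → Bool
adjacent (r ∷ G) zero    zero    = false
adjacent (r ∷ G) zero    (suc j) = lookup r j
adjacent (r ∷ G) (suc i) zero    = lookup r i
adjacent (r ∷ G) (suc i) (suc j) = adjacent G i j

allRows : ∀ n → List (Vec Bool n)
allRows zero    = [] ∷ []
allRows (suc n) = cartesianProductWith _∷_ (true ∷ false ∷ []) (allRows n)

allGraphs : ∀ n → List (Graph n)
allGraphs zero    = [] ∷ []
allGraphs (suc n) = cartesianProductWith _∷_ (allRows n) (allGraphs n)

------------------------------------------------------------------------

rowWeight : ℝ → ∀ {n} → Vec Bool n → ℝ
rowWeight p []      = 1ℝ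
rowWeight p (b ∷ r) = (if b then p else 1ℝ - p) * rowWeight p r

-- The probability that G(n,p) is the given graph.
weight : ℝ → ∀ {n} → Graph n → ℝ
weight p []      = 1ℝ
weight p (r ∷ G) = rowWeight p r * weight p G

sumℝ : List ℝ → ℝ
sumℝ = List.foldr _+_ 0ℝ

ℙ : ∀ n → ℝ → {E : Pred (Graph n) 0ℓ} → Decidable E → ℝ
ℙ n p E? = sumℝ (List.map (weight p) (filter E? (allGraphs n)))

------------------------------------------------------------------------
-- First order formulas in ∼, = and one unary predicate X, with free
-- variables among Fin k (de Bruijn indices: zero is the innermost one).

infix  7 _∼ᶠ_ _=ᶠ_
infix  6 ¬ᶠ_
infixr 5 _∧ᶠ_
infixr 4 _∨ᶠ_
infixr 3 _⇒ᶠ_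

data Formula (k : ℕ) : Set where
  _∼ᶠ_ _=ᶠ_      : Fin k → Fin k → Formula k
  Xᶠ             : Fin k → Formula k
  ¬ᶠ_            : Formula k → Formula k
  _∧ᶠ_ _∨ᶠ_ _⇒ᶠ_ : Formula k → Formula k → Formula k
  ∀ᶠ ∃ᶠ          : Formula (suc k) → Formula k

depth : ∀ {k} → Formula k → ℕ
depth (x ∼ᶠ y) = 0
depth (x =ᶠ y) = 0
depth (Xᶠ x)   = 0
depth (¬ᶠ φ)   = depth φ
depth (φ ∧ᶠ ψ) = depth φ ⊔ depth ψ
depth (φ ∨ᶠ ψ) = depth φ ⊔ depth ψ
depth (φ ⇒ᶠ ψ) = depth φ ⊔ depth ψ
depth (∀ᶠ φ)   = suc (depth φ)
depth (∃ᶠ φ)   = suc (depth φ)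

Sat : ∀ {n k} → Graph n → Subset n → Vec (Fin n) k → Formula k → Set
Sat G X ρ (x ∼ᶠ y) = T (adjacent G (lookup ρ x) (lookup ρ y))
Sat G X ρ (x =ᶠ y) = lookup ρ x ≡ lookup ρ y
Sat G X ρ (Xᶠ x)   = lookup ρ x ∈ X
Sat G X ρ (¬ᶠ φ)   = ¬ Sat G X ρ φ
Sat G X ρ (φ ∧ᶠ ψ) = Sat G X ρ φ × Sat G X ρ ψ
Sat G X ρ (φ ∨ᶠ ψ) = Sat G X ρ φ ⊎ Sat G X ρ ψ
Sat G X ρ (φ ⇒ᶠ ψ) = Sat G X ρ φ → Sat G X ρ ψ
Sat G X ρ (∀ᶠ φ)   = ∀ v → Sat G X (v ∷ ρ) φ
Sat G X ρ (∃ᶠ φ)   = ∃ λ v → Sat G X (v ∷ ρ) φ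

sat? : ∀ {n k} (G : Graph n) (X : Subset n) (ρ : Vec (Fin n) k) (φ : Formula k) → Dec (Sat G X ρ φ)
sat? G X ρ (x ∼ᶠ y) = T? _
sat? G X ρ (x =ᶠ y) = lookup ρ x ≟ᶠ lookup ρ y
sat? G X ρ (Xᶠ x)   = lookup ρ x ∈? X
sat? G X ρ (¬ᶠ φ)   = ¬? (sat? G X ρ φ)
sat? G X ρ (φ ∧ᶠ ψ) = sat? G X ρ φ ×-dec sat? G X ρ ψ
sat? G X ρ (φ ∨ᶠ ψ) = sat? G X ρ φ ⊎-dec sat? G X ρ ψ
sat? G X ρ (φ ⇒ᶠ ψ) = sat? G X ρ φ →-dec sat? G X ρ ψ
sat? G X ρ (∀ᶠ φ)   = all? λ v → sat? G X (v ∷ ρ) φ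
sat? G X ρ (∃ᶠ φ)   = any? λ v → sat? G X (v ∷ ρ) φ

record 𝓔₁² : Set where
  constructor ∃X
  field
    matrix  : Formula 0
    depth≡2 : depth matrix ≡ 2

open 𝓔₁² public

infix 4 _⊨_ _⊨?_

_⊨_ : ∀ {n} → Graph n → 𝓔₁² → Set
G ⊨ φ = ∃ λ (X : Subset _) → Sat G X [] (matrix φ)

_⊨?_ : ∀ {n} (G : Graph n) (φ : 𝓔₁²) → Dec (G ⊨ φ)
G ⊨? φ = anySubset? λ X → sat? G X [] (matrix φ)

------------------------------------------------------------------------

probability : ℝ → 𝓔₁² → ℕ → ℝ
probability p φ n = ℙ n p (_⊨? φ)

ZeroOneLaw : ℝ → Set
ZeroOneLaw p = ∀ φ → ∃ λ L → probability p φ ⟶ L × (L ≃ 0ℝ ⊎ L ≃ 1ℝ)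

½ℝ : ℝ
½ℝ = fromℚ ½

Exceptional : ℝ → Set
Exceptional p = p ≃ (fromℕ 3 - √5) * ½ℝ ⊎ p ≃ (√5 - 1ℝ) * ½ℝ

{-# OPTIONS --safe #-}

-- Of a coloured graph (G, X) a sentence of quantifier depth two sees only which
-- vertex types occur, the type of v being its side together with the pairs
-- (adjacency to v, side) occurring among the other vertices.  If G has the
-- extension property for sufficiently many vertices, then either the types of
-- (G, X) can be realised in every other graph with the extension property, or
-- one side is homogeneous, a clique say, and it only matters whether some outside
-- vertex is joined to all or to none of it.  By the second moment method every
-- such shape occurs with high probability, except that a clique of colour
-- probability ω dominating all other vertices exists when q² < ω and, by a first
-- moment computation, does not when ω < q², where q = 1 − ω.
--
-- For ω = q² the expected number of k-cliques that dominate and are not maximal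
-- is exactly (k + 1) P(Bin(n, qᵏ) = k + 1).  If k + 1 is the mode this is bounded
-- below and a second moment argument gives positive probability; if n qᵏ/(k + 1)
-- stays away from 1 for all k, the Chernoff bound makes the total expectation
-- vanish.  Both happen for infinitely many n, so the probability diverges.
--
-- All estimates are made for the rational approximations of p, uniformly.

module Submission where

-- A real `p` is a Cauchy sequence, and the i-th term of a probability is exactly the expectation
-- for the rational weights `weights p i`. A limit in `n` therefore needs thresholds in `n` that
-- serve all late `i` at once; hence the zero-one law is proved for all weight functions in a
-- `Regime`, where ω and q² differ by a margin κ. At a critical `p` there is no margin, and ω = q²
-- holds at no rational approximation. The order `n` depends on the approximate q, while `i` must
-- exceed a modulus of convergence that depends on `n`. `orderBound` breaks this circle: it limits
-- `n` by the clique size alone, so that `i` can be taken beyond finitely many moduli, and so far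
-- that the powers of ω and q² in use agree up to a factor 2. Non-maximality makes the critical
-- count usable. The mean number of dominating k-cliques is a binomial probability times q to the
-- power -k; a vertex extending the clique adds just the k edges that make the exponents match.
-- Consecutive values of n qᵏ/(k + 1) have ratio at most q ≤ 5/8, which leaves room for 1 well
-- between two of them.

open import Defs hiding (_+_; _-_; _*_; -_; _<_)
open import Axiom.ExcludedMiddle using (ExcludedMiddle)
open import Algebra.Bundles using (CommutativeRing)
import Algebra.Solver.Ring as RingSolver
open import Algebra.Solver.Ring.AlmostCommutativeRing using (fromCommutativeRing; _-Raw-AlmostCommutative⟶_)
open import Algebra.Structures using (IsCommutativeRing)
open import Data.Bool.Base using (Bool; true; false; not; _∧_; _∨_; _xor_; if_then_else_; T)
import Data.Bool.Properties as Bool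
open import Data.Empty using (⊥; ⊥-elim)
open import Data.Fin.Base using (Fin; zero; suc)
import Data.Fin.Properties as Fin
open import Data.Fin.Subset using (_∈_)
open import Data.Integer.Base as ℤ using (-[1+_])
import Data.Integer.Properties as ℤ
open import Data.List.Base as List using (List; cartesianProductWith)
import Data.List.Properties as List
open import Data.List.Membership.Propositional using () renaming (_∈_ to _∈ᴸ_)
open import Data.List.Membership.Propositional.Properties using (∈-cartesianProductWith⁺)
open import Data.List.Relation.Unary.Any as Any using (here; there)
open import Data.List.Relation.Unary.Any.Properties using (lookup-index)
open import Data.Maybe.Base using (Maybe; just; nothing)
import Data.Nat.Base as ℕ
open ℕ using (ℕ; zero; suc; _⊔_)
open import Data.Nat.Coprimality using (1-coprimeTo) renaming (sym to coprime-sym)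
import Data.Nat.Properties as ℕ
import Data.Nat.Solver as ℕ
open import Data.Product.Base using (∃; _×_; _,_; proj₁; proj₂)
open import Data.Rational.Base as ℚ using (ℚ; mkℚ; 0ℚ; 1ℚ; ½; _≤_; _<_; ∣_∣)
import Data.Rational.Properties as ℚ
open import Data.Rational.Properties using (≤-refl; ≤-trans; ≤-reflexive; <⇒≤; ≤-total; ≤-<-trans; <-≤-trans; <-irrefl; <-trans)
import Data.Rational.Unnormalised.Base as ℚᵘ
import Data.Rational.Unnormalised.Properties as ℚᵘ
open import Data.Sum.Base using (_⊎_; inj₁; inj₂)
open import Data.Vec.Base as Vec using (Vec; []; _∷_; lookup)
import Data.Vec.Properties as Vec
open import Function.Base using (_∘_; id; case_of_)
open import Function.Bundles using (_⇔_; mk⇔)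
open import Level using (0ℓ)
open import Relation.Binary.Consequences using (dec⇒weaklyDec)
open import Relation.Binary.PropositionalEquality using (_≡_; _≢_; refl; sym; trans; cong; cong₂; subst; subst₂)
open import Relation.Nullary using (Dec; yes; no; does; ¬_; contradiction)
open import Relation.Nullary.Decidable using (toWitness; ¬?; _×-dec_)

-- Rational arithmetic behind opaque operations: the type checker can then
-- read off the arguments of a sum or product.

infixl 6 _+_ _-_
infixl 7 _*_
infix  8 -_
infixr 9 _^_

opaque
  _+_ _*_ : ℚ → ℚ → ℚ
  _+_ = ℚ._+_
  _*_ = ℚ._*_
  -_ : ℚ → ℚ
  -_ = ℚ.-_

_-_ : ℚ → ℚ → ℚ
x - y = x + (- y)

opaque
  unfolding _+_

  isCommutativeRing : IsCommutativeRing _≡_ _+_ _*_ -_ 0ℚ 1ℚ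
  isCommutativeRing = ℚ.+-*-isCommutativeRing

  +≡ : ∀ x y → x + y ≡ x ℚ.+ y
  +≡ x y = refl

  *≡ : ∀ x y → x * y ≡ x ℚ.* y
  *≡ x y = refl

  -≡ : ∀ x → - x ≡ ℚ.- x
  -≡ x = refl

commutativeRing : CommutativeRing 0ℓ 0ℓ
commutativeRing = record { isCommutativeRing = isCommutativeRing }

open CommutativeRing commutativeRing using (+-comm; +-assoc; *-comm; *-assoc; +-identityˡ; +-identityʳ; *-identityˡ; *-identityʳ; zeroˡ; zeroʳ; distribˡ; distribʳ)

coefficients : CommutativeRing.rawRing ℚ.+-*-commutativeRing -Raw-AlmostCommutative⟶ fromCommutativeRing commutativeRing
coefficients = record
  { ⟦_⟧ = id
  ; +-homo = λ x y → sym (+≡ x y)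
  ; *-homo = λ x y → sym (*≡ x y)
  ; -‿homo = λ x → sym (-≡ x)
  ; 0-homo = refl
  ; 1-homo = refl
  }

module Solver = RingSolver (CommutativeRing.rawRing ℚ.+-*-commutativeRing) (fromCommutativeRing commutativeRing) coefficients (dec⇒weaklyDec ℚ._≟_)
open Solver using (solve; con; _:+_; _:*_; _:-_; :-_; _:=_)

opaque
  unfolding _+_

  +-mono-≤ : ∀ {a b c d} → a ≤ b → c ≤ d → a + c ≤ b + d
  +-mono-≤ = ℚ.+-mono-≤

  +-mono-<-≤ : ∀ {a b c d} → a < b → c ≤ d → a + c < b + d
  +-mono-<-≤ = ℚ.+-mono-<-≤

  *-monoˡ-≤ : ∀ {a b c} → 0ℚ ≤ c → a ≤ b → c * a ≤ c * b
  *-monoˡ-≤ {c = c} 0≤c = ℚ.*-monoˡ-≤-nonNeg c {{ℚ.nonNegative 0≤c}}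

  *-pos : ∀ {a b} → 0ℚ < a → 0ℚ < b → 0ℚ < a * b
  *-pos {a} {b} 0<a 0<b = ℚ.positive⁻¹ (a ℚ.* b) {{ℚ.pos*pos⇒pos a {{ℚ.positive 0<a}} b {{ℚ.positive 0<b}}}}

  *-cancelˡ-≤ : ∀ {a b c} → 0ℚ < c → c * a ≤ c * b → a ≤ b
  *-cancelˡ-≤ {c = c} 0<c = ℚ.*-cancelˡ-≤-pos c {{ℚ.positive 0<c}}

opaque
  -- The value 0 at 0 is a convention that makes inversion total; `*-inv` is the one property from
  -- which the others are derived.
  inv : ℚ → ℚ
  inv x with x ℚ.≟ 0ℚ
  ... | yes _ = 0ℚ
  ... | no x≢0 = ℚ.1/_ x {{ℚ.≢-nonZero x≢0}}

opaque
  unfolding _+_ inv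

  *-inv : ∀ {x} → 0ℚ < x → x * inv x ≡ 1ℚ
  *-inv {x} 0<x with x ℚ.≟ 0ℚ
  ... | yes refl = contradiction 0<x (<-irrefl refl)
  ... | no x≢0 = ℚ.*-inverseʳ x {{ℚ.≢-nonZero x≢0}}

-- Inequalities between rationals

0<1 : 0ℚ < 1ℚ
0<1 = ℚ.positive⁻¹ 1ℚ

0≤1 : 0ℚ ≤ 1ℚ
0≤1 = <⇒≤ 0<1

+-nonneg : ∀ {a b} → 0ℚ ≤ a → 0ℚ ≤ b → 0ℚ ≤ a + b
+-nonneg {a} {b} p q = subst (_≤ a + b) (+-identityˡ 0ℚ) (+-mono-≤ p q)

+-pos : ∀ {a b} → 0ℚ < a → 0ℚ ≤ b → 0ℚ < a + b
+-pos {a} {b} p q = subst (_< a + b) (+-identityˡ 0ℚ) (+-mono-<-≤ p q)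

*-nonneg : ∀ {a b} → 0ℚ ≤ a → 0ℚ ≤ b → 0ℚ ≤ a * b
*-nonneg {a} {b} p q = subst (_≤ a * b) (zeroʳ a) (*-monoˡ-≤ p q)

*-monoʳ-≤ : ∀ {a b c} → 0ℚ ≤ c → a ≤ b → a * c ≤ b * c
*-monoʳ-≤ {a} {b} {c} p q = subst₂ _≤_ (*-comm c a) (*-comm c b) (*-monoˡ-≤ p q)

*-mono-≤ : ∀ {a b c d} → 0ℚ ≤ a → a ≤ b → 0ℚ ≤ c → c ≤ d → a * c ≤ b * d
*-mono-≤ 0≤a a≤b 0≤c c≤d = ≤-trans (*-monoʳ-≤ 0≤c a≤b) (*-monoˡ-≤ (≤-trans 0≤a a≤b) c≤d)

+-monoˡ-≤ : ∀ {a b} c → a ≤ b → c + a ≤ c + b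
+-monoˡ-≤ c = +-mono-≤ (≤-refl {c})

+-monoʳ-≤ : ∀ {a b} c → a ≤ b → a + c ≤ b + c
+-monoʳ-≤ c p = +-mono-≤ p (≤-refl {c})

≤-by : ∀ {a b} d → 0ℚ ≤ d → b ≡ a + d → a ≤ b
≤-by {a} {b} d 0≤d eq = subst₂ _≤_ (+-identityʳ a) (sym eq) (+-monoˡ-≤ a 0≤d)

≤⇒0≤ : ∀ {a b} → a ≤ b → 0ℚ ≤ b - a
≤⇒0≤ {a} {b} p = subst (_≤ b - a) (solve 1 (λ a → a :- a := con 0ℚ) refl a) (+-monoʳ-≤ (- a) p)

<⇒0< : ∀ {a b} → a < b → 0ℚ < b - a
<⇒0< {a} {b} p = subst (_< b - a) (solve 1 (λ a → a :- a := con 0ℚ) refl a) (+-mono-<-≤ p (≤-refl { - a}))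

0<⇒< : ∀ {a b} → 0ℚ < b - a → a < b
0<⇒< {a} {b} p = subst₂ _<_ (+-identityˡ a) (solve 2 (λ b a → b :- a :+ a := b) refl b a) (+-mono-<-≤ p (≤-refl {a}))

0≤⇒≤ : ∀ {a b} → 0ℚ ≤ b - a → a ≤ b
0≤⇒≤ {a} {b} p = ≤-by (b - a) p (solve 2 (λ b a → b := a :+ (b :- a)) refl b a)

≤-+ʳ : ∀ {a b} → 0ℚ ≤ b → a ≤ a + b
≤-+ʳ {a} {b} p = ≤-by b p refl

≤-+ˡ : ∀ {a b} → 0ℚ ≤ b → a ≤ b + a
≤-+ˡ {a} {b} p = ≤-by b p (+-comm b a)

*-cancelʳ-≤ : ∀ {a b c} → 0ℚ < c → a * c ≤ b * c → a ≤ b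
*-cancelʳ-≤ {a} {b} {c} 0<c p = *-cancelˡ-≤ 0<c (subst₂ _≤_ (*-comm a c) (*-comm b c) p)

inv-nonneg : ∀ {x} → 0ℚ < x → 0ℚ ≤ inv x
inv-nonneg {x} p = *-cancelˡ-≤ p (subst₂ _≤_ (sym (zeroʳ x)) (sym (*-inv p)) 0≤1)

inv-pos : ∀ {x} → 0ℚ < x → 0ℚ < inv x
inv-pos {x} p = ℚ.≰⇒> λ i≤0 → <-irrefl refl
  (<-≤-trans 0<1 (subst₂ _≤_ (*-inv p) (zeroʳ x) (*-monoˡ-≤ (<⇒≤ p) i≤0)))

inv-anti : ∀ {x y} → 0ℚ < x → x ≤ y → inv y ≤ inv x
inv-anti {x} {y} 0<x x≤y = *-cancelˡ-≤ 0<x (*-cancelˡ-≤ 0<y (subst₂ _≤_ e₁ e₂ x≤y))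
  where
  0<y = <-≤-trans 0<x x≤y
  e₁ : x ≡ y * (x * inv y)
  e₁ = trans (sym (*-identityʳ x)) (trans (cong (x *_) (sym (*-inv 0<y)))
    (solve 3 (λ x y i → x :* (y :* i) := y :* (x :* i)) refl x y (inv y)))
  e₂ : y ≡ y * (x * inv x)
  e₂ = trans (sym (*-identityʳ y)) (cong (y *_) (sym (*-inv 0<x)))

*≤⇒≤*inv : ∀ {a b c} → 0ℚ < c → a * c ≤ b → a ≤ b * inv c
*≤⇒≤*inv {a} {b} {c} 0<c p = subst (_≤ b * inv c)
  (trans (*-assoc a c (inv c)) (trans (cong (a *_) (*-inv 0<c)) (*-identityʳ a)))
  (*-monoʳ-≤ (inv-nonneg 0<c) p)

square-nonneg : ∀ x → 0ℚ ≤ x * x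
square-nonneg x with ≤-total 0ℚ x
... | inj₁ p = *-nonneg p p
... | inj₂ p = subst (0ℚ ≤_) (solve 1 (λ x → (con 0ℚ :- x) :* (con 0ℚ :- x) := x :* x) refl x)
  (*-nonneg (≤⇒0≤ p) (≤⇒0≤ p))

-- Powers, natural numbers as rationals, and Bernoulli's inequalities

_^_ : ℚ → ℕ → ℚ
x ^ zero = 1ℚ
x ^ suc n = x * x ^ n

^-nonneg : ∀ {x} n → 0ℚ ≤ x → 0ℚ ≤ x ^ n
^-nonneg zero p = 0≤1
^-nonneg (suc n) p = *-nonneg p (^-nonneg n p)

^-pos : ∀ {x} n → 0ℚ < x → 0ℚ < x ^ n
^-pos zero p = 0<1
^-pos (suc n) p = *-pos p (^-pos n p)

^-mono : ∀ {x y} n → 0ℚ ≤ x → x ≤ y → x ^ n ≤ y ^ n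
^-mono zero p q = ≤-refl
^-mono (suc n) p q = *-mono-≤ p q (^-nonneg n p) (^-mono n p q)

1^ : ∀ n → 1ℚ ^ n ≡ 1ℚ
1^ zero = refl
1^ (suc n) = trans (*-identityˡ _) (1^ n)

^≤1 : ∀ {x} n → 0ℚ ≤ x → x ≤ 1ℚ → x ^ n ≤ 1ℚ
^≤1 {x} n p q = subst (x ^ n ≤_) (1^ n) (^-mono n p q)

1≤^ : ∀ {x} n → 1ℚ ≤ x → 1ℚ ≤ x ^ n
1≤^ {x} n q = subst (_≤ x ^ n) (1^ n) (^-mono n 0≤1 q)

^-+ : ∀ x m n → x ^ (m ℕ.+ n) ≡ x ^ m * x ^ n
^-+ x zero n = sym (*-identityˡ _)
^-+ x (suc m) n = trans (cong (x *_) (^-+ x m n)) (sym (*-assoc x _ _))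

*-^ : ∀ x y n → (x * y) ^ n ≡ x ^ n * y ^ n
*-^ x y zero = sym (*-identityˡ _)
*-^ x y (suc n) = trans (cong (x * y *_) (*-^ x y n))
  (solve 4 (λ x y a b → x :* y :* (a :* b) := x :* a :* (y :* b)) refl x y (x ^ n) (y ^ n))

^-* : ∀ x m n → x ^ (m ℕ.* n) ≡ (x ^ n) ^ m
^-* x zero n = refl
^-* x (suc m) n = trans (^-+ x n (m ℕ.* n)) (cong (x ^ n *_) (^-* x m n))

^-antitone : ∀ {x m n} → 0ℚ ≤ x → x ≤ 1ℚ → m ℕ.≤ n → x ^ n ≤ x ^ m
^-antitone {x} {m} {n} p q l = subst₂ _≤_
  (trans (sym (^-+ x m (n ℕ.∸ m))) (cong (x ^_) (ℕ.m+[n∸m]≡n l))) (*-identityʳ (x ^ m))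
  (*-monoˡ-≤ (^-nonneg m p) (^≤1 (n ℕ.∸ m) p q))

^-monotone : ∀ {x m n} → 1ℚ ≤ x → m ℕ.≤ n → x ^ m ≤ x ^ n
^-monotone {x} {m} {n} q l = subst₂ _≤_ (*-identityʳ (x ^ m))
  (trans (sym (^-+ x m (n ℕ.∸ m))) (cong (x ^_) (ℕ.m+[n∸m]≡n l)))
  (*-monoˡ-≤ (^-nonneg m (≤-trans 0≤1 q)) (1≤^ (n ℕ.∸ m) q))

^-inv : ∀ {x} n → 0ℚ < x → x ^ n * inv x ^ n ≡ 1ℚ
^-inv {x} n p = trans (sym (*-^ x (inv x) n)) (trans (cong (_^ n) (*-inv p)) (1^ n))

ι : ℕ → ℚ
ι zero = 0ℚ
ι (suc n) = 1ℚ + ι n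

ι-nonneg : ∀ n → 0ℚ ≤ ι n
ι-nonneg zero = ≤-refl
ι-nonneg (suc n) = +-nonneg 0≤1 (ι-nonneg n)

ι-pos : ∀ n → 0ℚ < ι (suc n)
ι-pos n = +-pos 0<1 (ι-nonneg n)

1≤ι-suc : ∀ n → 1ℚ ≤ ι (suc n)
1≤ι-suc n = ≤-+ʳ (ι-nonneg n)

ι-mono : ∀ {m n} → m ℕ.≤ n → ι m ≤ ι n
ι-mono {n = n} ℕ.z≤n = ι-nonneg n
ι-mono (ℕ.s≤s p) = +-monoˡ-≤ 1ℚ (ι-mono p)

ι-+ : ∀ m n → ι (m ℕ.+ n) ≡ ι m + ι n
ι-+ zero n = sym (+-identityˡ _)
ι-+ (suc m) n = trans (cong (1ℚ +_) (ι-+ m n)) (sym (+-assoc 1ℚ _ _))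

ι-* : ∀ m n → ι (m ℕ.* n) ≡ ι m * ι n
ι-* zero n = sym (zeroˡ _)
ι-* (suc m) n = trans (ι-+ n (m ℕ.* n)) (trans (cong (ι n +_) (ι-* m n))
  (solve 2 (λ m n → n :+ m :* n := (con 1ℚ :+ m) :* n) refl (ι m) (ι n)))

ι-cancel-< : ∀ {m n} → ι m < ι n → m ℕ.< n
ι-cancel-< {m} {n} p with m ℕ.<? n
... | yes q = q
... | no q = contradiction (<-≤-trans p (ι-mono (ℕ.≮⇒≥ q))) (<-irrefl refl)

opaque
  unfolding _+_

  ι≡ : ∀ n → ι n ≡ mkℚ (ℤ.+ n) 0 (coprime-sym (1-coprimeTo n))
  ι≡ zero = refl
  ι≡ (suc n) = trans (cong (1ℚ ℚ.+_) (ι≡ n)) (ℚ.toℚᵘ-injective (ℚᵘ.≃-trans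
    (ℚ.toℚᵘ-homo-+ 1ℚ (mkℚ (ℤ.+ n) 0 (coprime-sym (1-coprimeTo n))))
    (ℚᵘ.*≡* (cong (ℤ._* ℤ.+ 1) (cong (ℤ._+_ (ℤ.+ 1)) (ℤ.*-identityʳ (ℤ.+ n)))))))

archimedean : ∀ x → ∃ λ n → x ≤ ι n
archimedean (mkℚ (ℤ.+ a) d c) = a , subst (mkℚ (ℤ.+ a) d c ≤_) (sym (ι≡ a))
  (ℚ.*≤* (ℤ.*-monoˡ-≤-nonNeg (ℤ.+ a) (ℤ.+≤+ (ℕ.s≤s ℕ.z≤n))))
archimedean (mkℚ -[1+ a ] d c) = 0 , ℚ.*≤* ℤ.-≤+

bernoulli : ∀ n {u} → 0ℚ ≤ u → 1ℚ + ι n * u ≤ (1ℚ + u) ^ n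
bernoulli zero {u} p = ≤-reflexive (solve 1 (λ u → con 1ℚ :+ con 0ℚ :* u := con 1ℚ) refl u)
bernoulli (suc n) {u} p = ≤-trans
  (≤-by (ι n * (u * u)) (*-nonneg (ι-nonneg n) (square-nonneg u))
    (solve 2 (λ n u → (con 1ℚ :+ u) :* (con 1ℚ :+ n :* u) := con 1ℚ :+ (con 1ℚ :+ n) :* u :+ n :* (u :* u)) refl (ι n) u))
  (*-monoˡ-≤ (+-nonneg 0≤1 p) (bernoulli n p))

bernoulli⁻ : ∀ n {u} → 0ℚ ≤ u → u ≤ 1ℚ → 1ℚ - ι n * u ≤ (1ℚ - u) ^ n
bernoulli⁻ zero {u} p q = ≤-reflexive (solve 1 (λ u → con 1ℚ :- con 0ℚ :* u := con 1ℚ) refl u)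
bernoulli⁻ (suc n) {u} p q = ≤-trans
  (≤-by (ι n * (u * u)) (*-nonneg (ι-nonneg n) (square-nonneg u))
    (solve 2 (λ n u → (con 1ℚ :- u) :* (con 1ℚ :- n :* u) := con 1ℚ :- (con 1ℚ :+ n) :* u :+ n :* (u :* u)) refl (ι n) u))
  (*-monoˡ-≤ (≤⇒0≤ q) (bernoulli⁻ n p q))

-- A substitute for (1 + u)ⁿ ≤ exp(nu) that uses neither exponentials nor division. Passing from `n`
-- to `suc n` loses only a nonnegative multiple of u².
[1+u]^n*[1-nu]≤1 : ∀ n {u} → 0ℚ ≤ u → (1ℚ + u) ^ n * (1ℚ - ι n * u) ≤ 1ℚ
[1+u]^n*[1-nu]≤1 zero {u} p = ≤-reflexive (solve 1 (λ u → con 1ℚ :* (con 1ℚ :- con 0ℚ :* u) := con 1ℚ) refl u)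
[1+u]^n*[1-nu]≤1 (suc n) {u} p = ≤-trans
  (≤-by (y * ((1ℚ + ι n) * (u * u)))
    (*-nonneg (^-nonneg n (+-nonneg 0≤1 p)) (*-nonneg (ι-nonneg (suc n)) (square-nonneg u)))
    (solve 3 (λ n u y → y :* (con 1ℚ :- n :* u)
       := (con 1ℚ :+ u) :* y :* (con 1ℚ :- (con 1ℚ :+ n) :* u) :+ y :* ((con 1ℚ :+ n) :* (u :* u))) refl (ι n) u y))
  ([1+u]^n*[1-nu]≤1 n p)
  where y = (1ℚ + u) ^ n

[1-u]^n*[1+nu]≤1 : ∀ n {u} → 0ℚ ≤ u → u ≤ 1ℚ → (1ℚ - u) ^ n * (1ℚ + ι n * u) ≤ 1ℚ
[1-u]^n*[1+nu]≤1 zero {u} p q = ≤-reflexive (solve 1 (λ u → con 1ℚ :* (con 1ℚ :+ con 0ℚ :* u) := con 1ℚ) refl u)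
[1-u]^n*[1+nu]≤1 (suc n) {u} p q = ≤-trans
  (≤-by (y * ((1ℚ + ι n) * (u * u)))
    (*-nonneg (^-nonneg n (≤⇒0≤ q)) (*-nonneg (ι-nonneg (suc n)) (square-nonneg u)))
    (solve 3 (λ n u y → y :* (con 1ℚ :+ n :* u)
       := (con 1ℚ :- u) :* y :* (con 1ℚ :+ (con 1ℚ :+ n) :* u) :+ y :* ((con 1ℚ :+ n) :* (u :* u))) refl (ι n) u y))
  ([1-u]^n*[1+nu]≤1 n p q)
  where y = (1ℚ - u) ^ n

-- Exponential decay beats polynomial growth

-- The mean of ρ and 1 lies above the square root of ρ but below 1. Writing ρⁿ ≤ σⁿσⁿ leaves one
-- factor σⁿ to absorb a power of n.
√-bound : ∀ {ρ} → 0ℚ ≤ ρ → ρ < 1ℚ → ∃ λ σ → 0ℚ ≤ σ × σ < 1ℚ × ρ ≤ σ * σ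
√-bound {ρ} 0≤ρ ρ<1 = ½ * (1ℚ + ρ) ,
  *-nonneg 0≤½ (+-nonneg 0≤1 0≤ρ) ,
  0<⇒< (subst (0ℚ <_) (solve 1 (λ r → con ½ :* (con 1ℚ :- r) := con 1ℚ :- con ½ :* (con 1ℚ :+ r)) refl ρ)
    (*-pos (ℚ.positive⁻¹ ½) (<⇒0< ρ<1))) ,
  ≤-by ((½ * (1ℚ - ρ)) * (½ * (1ℚ - ρ))) (square-nonneg (½ * (1ℚ - ρ)))
    (solve 1 (λ r → con ½ :* (con 1ℚ :+ r) :* (con ½ :* (con 1ℚ :+ r)) := r :+ con ½ :* (con 1ℚ :- r) :* (con ½ :* (con 1ℚ :- r))) refl ρ)
  where
  0≤½ : 0ℚ ≤ ½
  0≤½ = ℚ.nonNegative⁻¹ ½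

n*ρ^n-bounded : ∀ {ρ} → 0ℚ ≤ ρ → ρ < 1ℚ → ∀ n → ι n * ρ ^ n ≤ inv (1ℚ - ρ)
n*ρ^n-bounded {ρ} 0≤ρ ρ<1 n = subst (ι n * ρ ^ n ≤_) (*-identityˡ _) (*≤⇒≤*inv (<⇒0< ρ<1) (≤-trans
    (≤-by (ρ ^ n) (^-nonneg n 0≤ρ) (solve 3 (λ n r u → r :* (con 1ℚ :+ n :* u) := n :* r :* u :+ r) refl (ι n) (ρ ^ n) (1ℚ - ρ)))
    (subst (λ t → t ^ n * (1ℚ + ι n * (1ℚ - ρ)) ≤ 1ℚ) (solve 1 (λ r → con 1ℚ :- (con 1ℚ :- r) := r) refl ρ)
      ([1-u]^n*[1+nu]≤1 n (≤⇒0≤ (<⇒≤ ρ<1)) (≤-by ρ 0≤ρ (solve 1 (λ r → con 1ℚ := con 1ℚ :- r :+ r) refl ρ))))))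

poly*exp-bounded : ∀ a {ρ} → 0ℚ ≤ ρ → ρ < 1ℚ → ∃ λ C → 0ℚ ≤ C × ∀ n → ι n ^ a * ρ ^ n ≤ C
poly*exp-bounded zero 0≤ρ ρ<1 = 1ℚ , 0≤1 , λ n → subst (_≤ 1ℚ) (sym (*-identityˡ _)) (^≤1 n 0≤ρ (<⇒≤ ρ<1))
poly*exp-bounded (suc a) {ρ} 0≤ρ ρ<1 =
  let σ , 0≤σ , σ<1 , ρ≤σ² = √-bound 0≤ρ ρ<1
      C , 0≤C , hC = poly*exp-bounded a 0≤σ σ<1
  in inv (1ℚ - σ) * C , *-nonneg (inv-nonneg (<⇒0< σ<1)) 0≤C , λ n → ≤-trans
      (*-monoˡ-≤ {ρ ^ n} {σ ^ n * σ ^ n} (^-nonneg (suc a) (ι-nonneg n)) (subst (ρ ^ n ≤_) (*-^ σ σ n) (^-mono n 0≤ρ ρ≤σ²)))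
      (subst (_≤ inv (1ℚ - σ) * C)
        (solve 3 (λ i p s → (i :* s) :* (p :* s) := (i :* p) :* (s :* s)) refl (ι n) (ι n ^ a) (σ ^ n))
        (*-mono-≤ (*-nonneg (ι-nonneg n) (^-nonneg n 0≤σ)) (n*ρ^n-bounded 0≤σ σ<1 n)
          (*-nonneg (^-nonneg a (ι-nonneg n)) (^-nonneg n 0≤σ)) (hC n)))

*-inv-cancel : ∀ {x} a → 0ℚ < x → a * inv x * x ≡ a
*-inv-cancel {x} a p = trans (solve 3 (λ c i e → c :* i :* e := c :* (e :* i)) refl a (inv x) x)
  (trans (cong (a *_) (*-inv p)) (*-identityʳ a))

-- Boundedness with exponent `suc a` gives decay with exponent `a`: one factor n is divided out.
poly*exp→0 : ∀ a {ρ ε} → 0ℚ ≤ ρ → ρ < 1ℚ → 0ℚ < ε → ∃ λ N → ∀ n → N ℕ.≤ n → ι n ^ a * ρ ^ n ≤ ε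
poly*exp→0 a {ρ} {ε} 0≤ρ ρ<1 0<ε =
  let C , 0≤C , hC = poly*exp-bounded (suc a) 0≤ρ ρ<1
      N , hN = archimedean (C * inv ε)
  in suc N , λ { (suc n) (ℕ.s≤s l) → *-cancelˡ-≤ (ι-pos n) (≤-trans
      (subst (_≤ C) (*-assoc (ι (suc n)) (ι (suc n) ^ a) (ρ ^ suc n)) (hC (suc n)))
      (≤-trans (subst (_≤ ι N * ε) (*-inv-cancel C 0<ε) (*-monoʳ-≤ (<⇒≤ 0<ε) hN))
        (*-monoʳ-≤ (<⇒≤ 0<ε) (ι-mono (ℕ.m≤n⇒m≤1+n l))))) }

-- Expectations over independent bits

opaque
  rowE : (Bool → ℚ) → ∀ {n} → (Vec Bool n → ℚ) → ℚ
  rowE w {zero}  f = f []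
  rowE w {suc n} f = w true * rowE w (f ∘ (true ∷_)) + w false * rowE w (f ∘ (false ∷_))

  graphE : (Bool → ℚ) → ∀ {n} → (Graph n → ℚ) → ℚ
  graphE w {zero}  f = f []
  graphE w {suc n} f = rowE w (λ r → graphE w (λ G → f (r ∷ G)))

record IsDistribution (w : Bool → ℚ) : Set where
  field
    nonneg : ∀ b → 0ℚ ≤ w b
    total  : w true + w false ≡ 1ℚ

  ≤1 : ∀ b → w b ≤ 1ℚ
  ≤1 true = ≤-by (w false) (nonneg false) (sym total)
  ≤1 false = ≤-by (w true) (nonneg true) (trans (sym total) (+-comm (w true) (w false)))

  average : ∀ x → w true * x + w false * x ≡ x
  average x = trans (sym (distribʳ x (w true) (w false))) (trans (cong (_* x) total) (*-identityˡ x))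

opaque
  unfolding rowE

  rowE-cong : ∀ w {n} {f g : Vec Bool n → ℚ} → (∀ v → f v ≡ g v) → rowE w f ≡ rowE w g
  rowE-cong w {zero} e = e []
  rowE-cong w {suc n} e = cong₂ _+_ (cong (w true *_) (rowE-cong w (e ∘ (true ∷_)))) (cong (w false *_) (rowE-cong w (e ∘ (false ∷_))))

  rowE-+ : ∀ w {n} (f g : Vec Bool n → ℚ) → rowE w (λ v → f v + g v) ≡ rowE w f + rowE w g
  rowE-+ w {zero} f g = refl
  rowE-+ w {suc n} f g = trans
    (cong₂ (λ x y → w true * x + w false * y) (rowE-+ w (f ∘ (true ∷_)) (g ∘ (true ∷_))) (rowE-+ w (f ∘ (false ∷_)) (g ∘ (false ∷_))))
    (solve 6 (λ p q a b c d → p :* (a :+ b) :+ q :* (c :+ d) := p :* a :+ q :* c :+ (p :* b :+ q :* d)) refl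
      (w true) (w false) (rowE w (f ∘ (true ∷_))) (rowE w (g ∘ (true ∷_))) (rowE w (f ∘ (false ∷_))) (rowE w (g ∘ (false ∷_))))

  rowE-*ˡ : ∀ w {n} c (f : Vec Bool n → ℚ) → rowE w (λ v → c * f v) ≡ c * rowE w f
  rowE-*ˡ w {zero} c f = refl
  rowE-*ˡ w {suc n} c f = trans
    (cong₂ (λ x y → w true * x + w false * y) (rowE-*ˡ w c (f ∘ (true ∷_))) (rowE-*ˡ w c (f ∘ (false ∷_))))
    (solve 5 (λ p q c a b → p :* (c :* a) :+ q :* (c :* b) := c :* (p :* a :+ q :* b)) refl
      (w true) (w false) c (rowE w (f ∘ (true ∷_))) (rowE w (f ∘ (false ∷_))))

  rowE-*ʳ : ∀ w {n} c (f : Vec Bool n → ℚ) → rowE w (λ v → f v * c) ≡ rowE w f * c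
  rowE-*ʳ w {n} c f = trans (rowE-cong w (λ v → *-comm (f v) c)) (trans (rowE-*ˡ w c f) (*-comm c (rowE w f)))

  graphE-cong : ∀ w {n} {f g : Graph n → ℚ} → (∀ G → f G ≡ g G) → graphE w f ≡ graphE w g
  graphE-cong w {zero} e = e []
  graphE-cong w {suc n} e = rowE-cong w (λ r → graphE-cong w (λ G → e (r ∷ G)))

  graphE-+ : ∀ w {n} (f g : Graph n → ℚ) → graphE w (λ G → f G + g G) ≡ graphE w f + graphE w g
  graphE-+ w {zero} f g = refl
  graphE-+ w {suc n} f g = trans (rowE-cong w (λ r → graphE-+ w (λ G → f (r ∷ G)) (λ G → g (r ∷ G)))) (rowE-+ w {n} _ _)

  graphE-*ˡ : ∀ w {n} c (f : Graph n → ℚ) → graphE w (λ G → c * f G) ≡ c * graphE w f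
  graphE-*ˡ w {zero} c f = refl
  graphE-*ˡ w {suc n} c f = trans (rowE-cong w (λ r → graphE-*ˡ w c (λ G → f (r ∷ G)))) (rowE-*ˡ w {n} c _)

  rowE-0 : ∀ w {n} → rowE w {n} (λ _ → 0ℚ) ≡ 0ℚ
  rowE-0 w {n} = trans (rowE-cong w {n} (λ _ → sym (zeroˡ 0ℚ))) (trans (rowE-*ˡ w {n} 0ℚ (λ _ → 0ℚ)) (zeroˡ _))

  graphE-0 : ∀ w {n} → graphE w {n} (λ _ → 0ℚ) ≡ 0ℚ
  graphE-0 w {n} = trans (graphE-cong w {n} (λ _ → sym (zeroˡ 0ℚ))) (trans (graphE-*ˡ w {n} 0ℚ (λ _ → 0ℚ)) (zeroˡ _))

  rowE-mono : ∀ {w} → (∀ b → 0ℚ ≤ w b) → ∀ {n} {f g : Vec Bool n → ℚ} → (∀ v → f v ≤ g v) → rowE w f ≤ rowE w g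
  rowE-mono w≥0 {zero} e = e []
  rowE-mono w≥0 {suc n} e = +-mono-≤ (*-monoˡ-≤ (w≥0 true) (rowE-mono w≥0 (e ∘ (true ∷_)))) (*-monoˡ-≤ (w≥0 false) (rowE-mono w≥0 (e ∘ (false ∷_))))

  rowE-nonneg : ∀ {w} → (∀ b → 0ℚ ≤ w b) → ∀ {n} {f : Vec Bool n → ℚ} → (∀ v → 0ℚ ≤ f v) → 0ℚ ≤ rowE w f
  rowE-nonneg {w} w≥0 {n} {f = f} e = subst (_≤ rowE w f) (rowE-0 w {n}) (rowE-mono w≥0 e)

  graphE-mono : ∀ {w} → (∀ b → 0ℚ ≤ w b) → ∀ {n} {f g : Graph n → ℚ} → (∀ G → f G ≤ g G) → graphE w f ≤ graphE w g
  graphE-mono w≥0 {zero} e = e []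
  graphE-mono w≥0 {suc n} e = rowE-mono w≥0 (λ r → graphE-mono w≥0 (λ G → e (r ∷ G)))

  graphE-nonneg : ∀ {w} → (∀ b → 0ℚ ≤ w b) → ∀ {n} {f : Graph n → ℚ} → (∀ G → 0ℚ ≤ f G) → 0ℚ ≤ graphE w f
  graphE-nonneg {w} w≥0 {n} {f = f} e = subst (_≤ graphE w f) (graphE-0 w {n}) (graphE-mono w≥0 e)

  rowE-const : ∀ {w} → IsDistribution w → ∀ {n} c → rowE w {n} (λ _ → c) ≡ c
  rowE-const d {zero} c = refl
  rowE-const {w} d {suc n} c = trans (cong₂ (λ x y → w true * x + w false * y) (rowE-const d {n} c) (rowE-const d {n} c)) (IsDistribution.average d c)

  graphE-const : ∀ {w} → IsDistribution w → ∀ {n} c → graphE w {n} (λ _ → c) ≡ c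
  graphE-const d {zero} c = refl
  graphE-const {w} d {suc n} c = trans (rowE-cong w {n} (λ r → graphE-const d {n} c)) (rowE-const d {n} c)

-- Products over the vertices, and sizes of sets

∏ : ∀ n → (Fin n → ℚ) → ℚ
∏ zero f = 1ℚ
∏ (suc n) f = f zero * ∏ n (f ∘ suc)

∏-cong : ∀ n {f g : Fin n → ℚ} → (∀ i → f i ≡ g i) → ∏ n f ≡ ∏ n g
∏-cong zero e = refl
∏-cong (suc n) e = cong₂ _*_ (e zero) (∏-cong n (e ∘ suc))

∏-nonneg : ∀ n {f : Fin n → ℚ} → (∀ i → 0ℚ ≤ f i) → 0ℚ ≤ ∏ n f
∏-nonneg zero e = 0≤1
∏-nonneg (suc n) e = *-nonneg (e zero) (∏-nonneg n (e ∘ suc))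

∏-mono : ∀ n {f g : Fin n → ℚ} → (∀ i → 0ℚ ≤ f i) → (∀ i → f i ≤ g i) → ∏ n f ≤ ∏ n g
∏-mono zero p e = ≤-refl
∏-mono (suc n) p e = *-mono-≤ (p zero) (e zero) (∏-nonneg n (p ∘ suc)) (∏-mono n (p ∘ suc) (e ∘ suc))

∏-* : ∀ n (f g : Fin n → ℚ) → ∏ n (λ i → f i * g i) ≡ ∏ n f * ∏ n g
∏-* zero f g = sym (*-identityˡ 1ℚ)
∏-* (suc n) f g = trans (cong (f zero * g zero *_) (∏-* n (f ∘ suc) (g ∘ suc)))
  (solve 4 (λ a b c d → a :* b :* (c :* d) := a :* c :* (b :* d)) refl (f zero) (g zero) (∏ n (f ∘ suc)) (∏ n (g ∘ suc)))

∏-zero : ∀ n {f : Fin n → ℚ} i → f i ≡ 0ℚ → ∏ n f ≡ 0ℚ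
∏-zero (suc n) {f} zero e = trans (cong (_* ∏ n (f ∘ suc)) e) (zeroˡ _)
∏-zero (suc n) {f} (suc i) e = trans (cong (f zero *_) (∏-zero n i e)) (zeroʳ _)

∏-one : ∀ n {f : Fin n → ℚ} → (∀ i → f i ≡ 1ℚ) → ∏ n f ≡ 1ℚ
∏-one zero e = refl
∏-one (suc n) e = trans (cong₂ _*_ (e zero) (∏-one n (e ∘ suc))) (*-identityˡ 1ℚ)

-- Members of `s` contribute the factor 1, so a product over all vertices becomes one over the
-- complement of `s` without reindexing.
outside-of : ∀ {n} → Vec Bool n → Fin n → ℚ → ℚ
outside-of s i x = if lookup s i then 1ℚ else x

size co-size : ∀ {n} → Vec Bool n → ℕ
size [] = 0
size (true ∷ s) = suc (size s)
size (false ∷ s) = size s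
co-size [] = 0
co-size (true ∷ s) = co-size s
co-size (false ∷ s) = suc (co-size s)

size+co-size : ∀ {n} (s : Vec Bool n) → size s ℕ.+ co-size s ≡ n
size+co-size [] = refl
size+co-size (true ∷ s) = cong suc (size+co-size s)
size+co-size (false ∷ s) = trans (ℕ.+-suc (size s) (co-size s)) (cong suc (size+co-size s))

∏-outside : ∀ {n} (s : Vec Bool n) x → ∏ n (λ i → outside-of s i x) ≡ x ^ co-size s
∏-outside [] x = refl
∏-outside (true ∷ s) x = trans (*-identityˡ _) (∏-outside s x)
∏-outside (false ∷ s) x = cong (x *_) (∏-outside s x)

-- Independence of the edges inside a set s from the edges between s and each outside vertex

mask : ∀ {n} → Vec Bool n → Vec Bool n → Vec Bool n
mask [] [] = []
mask (true ∷ s) (b ∷ v) = b ∷ mask s v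
mask (false ∷ s) (b ∷ v) = false ∷ mask s v

maskG : ∀ {n} → Vec Bool n → Graph n → Graph n
maskG [] [] = []
maskG (true ∷ s) (r ∷ G) = mask s r ∷ maskG s G
maskG (false ∷ s) (r ∷ G) = Vec.replicate _ false ∷ maskG s G

mask-idem : ∀ {n} (s v : Vec Bool n) → mask s (mask s v) ≡ mask s v
mask-idem [] [] = refl
mask-idem (true ∷ s) (b ∷ v) = cong (b ∷_) (mask-idem s v)
mask-idem (false ∷ s) (b ∷ v) = cong (false ∷_) (mask-idem s v)

maskG-idem : ∀ {n} (s : Vec Bool n) (G : Graph n) → maskG s (maskG s G) ≡ maskG s G
maskG-idem [] [] = refl
maskG-idem (true ∷ s) (r ∷ G) = cong₂ _∷_ (mask-idem s r) (maskG-idem s G)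
maskG-idem (false ∷ s) (r ∷ G) = cong (Vec.replicate _ false ∷_) (maskG-idem s G)

nbr : ∀ {n} → Graph n → Fin n → Vec Bool n
nbr (r ∷ G) zero = false ∷ r
nbr (r ∷ G) (suc i) = lookup r i ∷ nbr G i

lookup-nbr : ∀ {n} (G : Graph n) i j → lookup (nbr G i) j ≡ adjacent G i j
lookup-nbr (r ∷ G) zero zero = refl
lookup-nbr (r ∷ G) zero (suc j) = refl
lookup-nbr (r ∷ G) (suc i) zero = refl
lookup-nbr (r ∷ G) (suc i) (suc j) = lookup-nbr G i j

-- Dependence on the coordinates in `s` alone, expressed through the idempotent `mask` so that
-- vectors keep their length.
Local : ∀ {n} → Vec Bool n → (Vec Bool n → ℚ) → Set
Local s h = ∀ v → h v ≡ h (mask s v)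

opaque
  unfolding rowE

  row-indep : ∀ {w} → IsDistribution w → ∀ {n} (s : Vec Bool n) (F : Vec Bool n → ℚ) (g : Fin n → Bool → ℚ) → Local s F →
    rowE w (λ r → F r * ∏ n (λ i → outside-of s i (g i (lookup r i))))
      ≡ rowE w F * ∏ n (λ i → outside-of s i (w true * g i true + w false * g i false))
  row-indep d [] F g loc = refl
  row-indep {w} d (true ∷ s) F g loc = trans
    (cong₂ (λ x y → w true * x + w false * y) (part true) (part false))
    (solve 5 (λ p q a b c → p :* (a :* c) :+ q :* (b :* c) := (p :* a :+ q :* b) :* (con 1ℚ :* c)) refl
      (w true) (w false) (rowE w (F ∘ (true ∷_))) (rowE w (F ∘ (false ∷_))) Q)
    where
    Q : ℚ
    Q = ∏ _ (λ i → outside-of s i (w true * g (suc i) true + w false * g (suc i) false))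
    part : ∀ b → rowE w (λ r → F (b ∷ r) * (1ℚ * ∏ _ (λ i → outside-of s i (g (suc i) (lookup r i))))) ≡ rowE w (F ∘ (b ∷_)) * Q
    part b = trans (rowE-cong w (λ r → cong (F (b ∷ r) *_) (*-identityˡ _)))
      (row-indep d s (F ∘ (b ∷_)) (g ∘ suc) (λ v → loc (b ∷ v)))
  row-indep {w} d {suc n} (false ∷ s) F g loc = trans
    (cong₂ (λ x y → w true * x + w false * y) (part true) (part false))
    (trans (solve 6 (λ p q a b e c → p :* (a :* (e :* c)) :+ q :* (b :* (e :* c)) := e :* ((p :* a :+ q :* b) :* c)) refl
        (w true) (w false) (g zero true) (g zero false) E₀ Q)
      (cong (_* _) (sym (trans (cong₂ (λ x y → w true * x + w false * y) (same true) (same false)) (IsDistribution.average d E₀)))))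
    where
    Q : ℚ
    Q = ∏ _ (λ i → outside-of s i (w true * g (suc i) true + w false * g (suc i) false))
    E₀ : ℚ
    E₀ = rowE w (F ∘ (false ∷_))
    same : ∀ b → rowE w (F ∘ (b ∷_)) ≡ E₀
    same b = rowE-cong w (λ v → trans (loc (b ∷ v)) (sym (loc (false ∷ v))))
    part : ∀ b → rowE w (λ r → F (b ∷ r) * (g zero b * ∏ _ (λ i → outside-of s i (g (suc i) (lookup r i))))) ≡ g zero b * (E₀ * Q)
    part b = trans (rowE-cong w (λ r → solve 3 (λ a b c → a :* (b :* c) := b :* (a :* c)) refl
        (F (b ∷ r)) (g zero b) (∏ _ (λ i → outside-of s i (g (suc i) (lookup r i))))))
      (trans (rowE-*ˡ w {n} (g zero b) _) (cong (g zero b *_) (trans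
        (row-indep d s (F ∘ (b ∷_)) (g ∘ suc) (λ v → trans (loc (b ∷ v)) (sym (trans (loc (b ∷ mask s v)) (cong (λ u → F (false ∷ u)) (mask-idem s v))))))
        (cong (_* Q) (same b)))))

  -- The edges inside `s` determine `f`, those between `s` and an outside vertex i determine `h i`,
  -- and these groups of edges are disjoint. By induction on the vertices: the row of a vertex in
  -- `s` feeds one bit to every outside factor, which `row-indep` separates, while the row of an
  -- outside vertex matters for its own factor only.
  graph-indep : ∀ {w} → IsDistribution w → ∀ {n} (s : Vec Bool n) (f : Graph n → ℚ) (h : Fin n → Vec Bool n → ℚ) →
    (∀ G → f G ≡ f (maskG s G)) → (∀ i → Local s (h i)) →
    graphE w (λ G → f G * ∏ n (λ i → outside-of s i (h i (nbr G i))))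
      ≡ graphE w f * ∏ n (λ i → outside-of s i (rowE w (h i)))
  graph-indep d [] f h lf lh = refl
  graph-indep {w} d {suc n} (true ∷ s) f h lf lh = trans
    (rowE-cong w (λ r → trans
      (graphE-cong w (λ G → cong (f (r ∷ G) *_) (*-identityˡ _)))
      (graph-indep d s (λ G → f (r ∷ G)) (λ i v → h (suc i) (lookup r i ∷ v))
        (λ G → trans (lf (r ∷ G)) (sym (trans (lf (r ∷ maskG s G)) (cong (λ u → f (mask s r ∷ u)) (maskG-idem s G)))))
        (λ i v → lh (suc i) (lookup r i ∷ v)))))
    (trans (row-indep d s (λ r → graphE w (λ G → f (r ∷ G))) (λ i b → rowE w (λ v → h (suc i) (b ∷ v)))
        (λ r → graphE-cong w (λ G → trans (lf (r ∷ G)) (sym (trans (lf (mask s r ∷ G)) (cong (λ u → f (u ∷ maskG s G)) (mask-idem s r)))))))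
      (cong (graphE w f *_) (sym (*-identityˡ _))))
  graph-indep {w} d {suc n} (false ∷ s) f h lf lh = trans
    (rowE-cong w (λ r → trans
      (graphE-cong w (λ G → trans (cong₂ (λ x y → x * (h zero (false ∷ r) * y)) (f≡ r G) (∏-cong n (λ i → cong (outside-of s i) (h≡ i (lookup r i) (nbr G i)))))
        (solve 3 (λ a b c → a :* (b :* c) := b :* (a :* c)) refl (f (z ∷ G)) (h zero (false ∷ r)) (∏ n (λ i → outside-of s i (h (suc i) (false ∷ nbr G i)))))))
      (trans (graphE-*ˡ w {n} (h zero (false ∷ r)) _) (cong (h zero (false ∷ r) *_)
        (graph-indep d s (λ G → f (z ∷ G)) (λ i v → h (suc i) (false ∷ v))
          (λ G → trans (lf (z ∷ G)) (sym (trans (lf (z ∷ maskG s G)) (cong (λ u → f (z ∷ u)) (maskG-idem s G)))))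
          (λ i v → lh (suc i) (false ∷ v)))))))
    (trans (rowE-*ʳ w {n} (F * Q) _)
      (trans (solve 3 (λ a b c → a :* (b :* c) := b :* (a :* c)) refl (rowE w (λ r → h zero (false ∷ r))) F Q)
        (cong₂ _*_ (sym (trans (rowE-cong w (λ r → graphE-cong w (f≡ r))) (rowE-const d {n} F)))
          (cong₂ _*_ (sym (rowE≡ zero)) (∏-cong n (λ i → cong (outside-of s i) (sym (rowE≡ (suc i)))))))))
    where
    z : Vec Bool n
    z = Vec.replicate n false
    F : ℚ
    F = graphE w (λ G → f (z ∷ G))
    Q : ℚ
    Q = ∏ n (λ i → outside-of s i (rowE w (λ v → h (suc i) (false ∷ v))))
    f≡ : ∀ r G → f (r ∷ G) ≡ f (z ∷ G)
    f≡ r G = trans (lf (r ∷ G)) (sym (lf (z ∷ G)))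
    h≡ : ∀ i b v → h (suc i) (b ∷ v) ≡ h (suc i) (false ∷ v)
    h≡ i b v = trans (lh (suc i) (b ∷ v)) (sym (lh (suc i) (false ∷ v)))
    rowE≡ : ∀ i → rowE w (h i) ≡ rowE w (λ v → h i (false ∷ v))
    rowE≡ i = trans (cong (λ x → w true * x + w false * rowE w (λ v → h i (false ∷ v)))
        (rowE-cong w (λ v → trans (lh i (true ∷ v)) (sym (lh i (false ∷ v))))))
      (IsDistribution.average d _)

-- Homogeneous sets and cliques of a given colour

𝟙 : Bool → ℚ
𝟙 true = 1ℚ
𝟙 false = 0ℚ

𝟙-∧ : ∀ a b → 𝟙 (a ∧ b) ≡ 𝟙 a * 𝟙 b
𝟙-∧ true b = sym (*-identityˡ _)
𝟙-∧ false b = sym (zeroˡ _)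

𝟙-not : ∀ a → 𝟙 (not a) ≡ 1ℚ - 𝟙 a
𝟙-not true = solve 0 (con 0ℚ := con 1ℚ :- con 1ℚ) refl
𝟙-not false = solve 0 (con 1ℚ := con 1ℚ :- con 0ℚ) refl

𝟙-nonneg : ∀ a → 0ℚ ≤ 𝟙 a
𝟙-nonneg true = 0≤1
𝟙-nonneg false = ≤-refl

𝟙≤1 : ∀ a → 𝟙 a ≤ 1ℚ
𝟙≤1 true = ≤-refl
𝟙≤1 false = 0≤1

same : Bool → Bool → Bool
same true b = b
same false b = not b

same⇒≡ : ∀ {c b} → same c b ≡ true → b ≡ c
same⇒≡ {true} e = e
same⇒≡ {false} {false} e = refl

≡⇒same : ∀ {c b} → b ≡ c → same c b ≡ true
≡⇒same {true} refl = refl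
≡⇒same {false} refl = refl

∧-true : ∀ {a b} → a ∧ b ≡ true → a ≡ true × b ≡ true
∧-true {true} e = refl , e

hom : (Bool → Bool) → ∀ {n} → Vec Bool n → Vec Bool n → Bool
hom P [] [] = true
hom P (true ∷ K) (b ∷ v) = P b ∧ hom P K v
hom P (false ∷ K) (b ∷ v) = hom P K v

clique : Bool → ∀ {n} → Vec Bool n → Graph n → Bool
clique c [] [] = true
clique c (true ∷ K) (r ∷ G) = hom (same c) K r ∧ clique c K G
clique c (false ∷ K) (r ∷ G) = clique c K G

hom-sound : ∀ P {n} (K v : Vec Bool n) → hom P K v ≡ true → ∀ i → lookup K i ≡ true → P (lookup v i) ≡ true
hom-sound P (true ∷ K) (b ∷ v) e zero _ = proj₁ (∧-true e)
hom-sound P (true ∷ K) (b ∷ v) e (suc i) l = hom-sound P K v (proj₂ (∧-true {P b} e)) i l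
hom-sound P (false ∷ K) (b ∷ v) e (suc i) l = hom-sound P K v e i l

hom-complete : ∀ P {n} (K v : Vec Bool n) → (∀ i → lookup K i ≡ true → P (lookup v i) ≡ true) → hom P K v ≡ true
hom-complete P [] [] h = refl
hom-complete P (true ∷ K) (b ∷ v) h = cong₂ _∧_ (h zero refl) (hom-complete P K v (h ∘ suc))
hom-complete P (false ∷ K) (b ∷ v) h = hom-complete P K v (h ∘ suc)

clique-sound : ∀ c {n} (K : Vec Bool n) (G : Graph n) → clique c K G ≡ true →
  ∀ i j → i ≢ j → lookup K i ≡ true → lookup K j ≡ true → adjacent G i j ≡ c
clique-sound c (k ∷ K) (r ∷ G) e zero zero i≢j _ _ = contradiction refl i≢j
clique-sound c (true ∷ K) (r ∷ G) e zero (suc j) _ _ l = same⇒≡ (hom-sound (same c) K r (proj₁ (∧-true e)) j l)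
clique-sound c (true ∷ K) (r ∷ G) e (suc i) zero _ l _ = same⇒≡ (hom-sound (same c) K r (proj₁ (∧-true e)) i l)
clique-sound c (true ∷ K) (r ∷ G) e (suc i) (suc j) i≢j l l′ = clique-sound c K G (proj₂ (∧-true {hom (same c) K r} e)) i j (i≢j ∘ cong suc) l l′
clique-sound c (false ∷ K) (r ∷ G) e (suc i) (suc j) i≢j l l′ = clique-sound c K G e i j (i≢j ∘ cong suc) l l′

clique-complete : ∀ c {n} (K : Vec Bool n) (G : Graph n) →
  (∀ i j → i ≢ j → lookup K i ≡ true → lookup K j ≡ true → adjacent G i j ≡ c) → clique c K G ≡ true
clique-complete c [] [] h = refl
clique-complete c (true ∷ K) (r ∷ G) h = cong₂ _∧_
  (hom-complete (same c) K r (λ i l → ≡⇒same (h zero (suc i) (λ ()) refl l)))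
  (clique-complete c K G (λ i j i≢j → h (suc i) (suc j) (i≢j ∘ Fin.suc-injective)))
clique-complete c (false ∷ K) (r ∷ G) h = clique-complete c K G (λ i j i≢j → h (suc i) (suc j) (i≢j ∘ Fin.suc-injective))

infix 4 _⊑_

data _⊑_ : ∀ {n} → Vec Bool n → Vec Bool n → Set where
  []   : [] ⊑ []
  keep : ∀ {n} {K s : Vec Bool n} → K ⊑ s → (true ∷ K) ⊑ (true ∷ s)
  skip : ∀ {n} {b} {K s : Vec Bool n} → K ⊑ s → (false ∷ K) ⊑ (b ∷ s)

⊑-refl : ∀ {n} (K : Vec Bool n) → K ⊑ K
⊑-refl [] = []
⊑-refl (true ∷ K) = keep (⊑-refl K)
⊑-refl (false ∷ K) = skip (⊑-refl K)

⊑-trans : ∀ {n} {K L M : Vec Bool n} → K ⊑ L → L ⊑ M → K ⊑ M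
⊑-trans [] [] = []
⊑-trans (keep p) (keep q) = keep (⊑-trans p q)
⊑-trans (skip p) (keep q) = skip (⊑-trans p q)
⊑-trans (skip p) (skip q) = skip (⊑-trans p q)

infixr 6 _∪_ _∩_

_∪_ _∩_ : ∀ {n} → Vec Bool n → Vec Bool n → Vec Bool n
_∪_ = Vec.zipWith _∨_
_∩_ = Vec.zipWith _∧_

⊑-∪ˡ : ∀ {n} (K L : Vec Bool n) → K ⊑ K ∪ L
⊑-∪ˡ [] [] = []
⊑-∪ˡ (true ∷ K) (l ∷ L) = keep (⊑-∪ˡ K L)
⊑-∪ˡ (false ∷ K) (l ∷ L) = skip (⊑-∪ˡ K L)

⊑-∪ʳ : ∀ {n} (K L : Vec Bool n) → L ⊑ K ∪ L
⊑-∪ʳ [] [] = []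
⊑-∪ʳ (true ∷ K) (true ∷ L) = keep (⊑-∪ʳ K L)
⊑-∪ʳ (false ∷ K) (true ∷ L) = keep (⊑-∪ʳ K L)
⊑-∪ʳ (k ∷ K) (false ∷ L) = skip (⊑-∪ʳ K L)

size-mono : ∀ {n} {K L : Vec Bool n} → K ⊑ L → size K ℕ.≤ size L
size-mono [] = ℕ.z≤n
size-mono (keep p) = ℕ.s≤s (size-mono p)
size-mono (skip {b = true} p) = ℕ.m≤n⇒m≤1+n (size-mono p)
size-mono (skip {b = false} p) = size-mono p

∩-mono : ∀ {n} {K L K′ L′ : Vec Bool n} → K ⊑ L → K′ ⊑ L′ → K ∩ K′ ⊑ L ∩ L′
∩-mono [] [] = []
∩-mono (keep p) (keep q) = keep (∩-mono p q)
∩-mono (keep p) (skip q) = skip (∩-mono p q)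
∩-mono (skip p) (keep q) = skip (∩-mono p q)
∩-mono (skip p) (skip q) = skip (∩-mono p q)

size-∪+∩ : ∀ {n} (K L : Vec Bool n) → size (K ∪ L) ℕ.+ size (K ∩ L) ≡ size K ℕ.+ size L
size-∪+∩ [] [] = refl
size-∪+∩ (true ∷ K) (true ∷ L) = cong suc (trans (ℕ.+-suc _ _) (trans (cong suc (size-∪+∩ K L)) (sym (ℕ.+-suc _ _))))
size-∪+∩ (true ∷ K) (false ∷ L) = cong suc (size-∪+∩ K L)
size-∪+∩ (false ∷ K) (true ∷ L) = trans (cong suc (size-∪+∩ K L)) (sym (ℕ.+-suc _ _))
size-∪+∩ (false ∷ K) (false ∷ L) = size-∪+∩ K L

hom-local : ∀ P {n} {K s : Vec Bool n} → K ⊑ s → ∀ v → hom P K v ≡ hom P K (mask s v)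
hom-local P [] [] = refl
hom-local P (keep p) (b ∷ v) = cong (P b ∧_) (hom-local P p v)
hom-local P (skip {b = true} p) (b ∷ v) = hom-local P p v
hom-local P (skip {b = false} p) (b ∷ v) = hom-local P p v

clique-local : ∀ c {n} {K s : Vec Bool n} → K ⊑ s → ∀ G → clique c K G ≡ clique c K (maskG s G)
clique-local c [] [] = refl
clique-local c (keep p) (r ∷ G) = cong₂ _∧_ (hom-local (same c) p r) (clique-local c p G)
clique-local c (skip {b = true} p) (r ∷ G) = clique-local c p G
clique-local c (skip {b = false} p) (r ∷ G) = clique-local c p G

hom-∪ : ∀ P {n} (K L v : Vec Bool n) → hom P K v ∧ hom P L v ≡ hom P (K ∪ L) v
hom-∪ P [] [] [] = refl
hom-∪ P (true ∷ K) (true ∷ L) (b ∷ v) = lemma (P b)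
  where
  lemma : ∀ x → (x ∧ hom P K v) ∧ (x ∧ hom P L v) ≡ x ∧ hom P (K ∪ L) v
  lemma true = hom-∪ P K L v
  lemma false = refl
hom-∪ P (true ∷ K) (false ∷ L) (b ∷ v) = trans (Bool.∧-assoc (P b) _ _) (cong (P b ∧_) (hom-∪ P K L v))
hom-∪ P (false ∷ K) (true ∷ L) (b ∷ v) = lemma (P b)
  where
  lemma : ∀ x → hom P K v ∧ (x ∧ hom P L v) ≡ x ∧ hom P (K ∪ L) v
  lemma true = hom-∪ P K L v
  lemma false = Bool.∧-zeroʳ _
hom-∪ P (false ∷ K) (false ∷ L) (b ∷ v) = hom-∪ P K L v

𝟙-hom-∪ : ∀ P {n} (K L v : Vec Bool n) → 𝟙 (hom P K v) * 𝟙 (hom P L v) ≡ 𝟙 (hom P (K ∪ L) v)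
𝟙-hom-∪ P K L v = trans (sym (𝟙-∧ (hom P K v) _)) (cong 𝟙 (hom-∪ P K L v))

prob : (Bool → ℚ) → (Bool → Bool) → ℚ
prob w P = w true * 𝟙 (P true) + w false * 𝟙 (P false)

prob-same : ∀ w c → prob w (same c) ≡ w c
prob-same w true = solve 2 (λ p q → p :* con 1ℚ :+ q :* con 0ℚ := p) refl (w true) (w false)
prob-same w false = solve 2 (λ p q → p :* con 0ℚ :+ q :* con 1ℚ := q) refl (w true) (w false)

-- The number of edges of a complete graph on that many vertices.
tri : ℕ → ℕ
tri zero = 0
tri (suc m) = m ℕ.+ tri m

opaque
  unfolding rowE

  rowE-hom : ∀ {w} → IsDistribution w → ∀ P {n} (K : Vec Bool n) → rowE w (λ v → 𝟙 (hom P K v)) ≡ prob w P ^ size K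
  rowE-hom d P [] = refl
  rowE-hom {w} d P {suc n} (true ∷ K) = trans
    (cong₂ (λ x y → w true * x + w false * y) (part true) (part false))
    (solve 5 (λ p q a b e → p :* (a :* e) :+ q :* (b :* e) := (p :* a :+ q :* b) :* e) refl
      (w true) (w false) (𝟙 (P true)) (𝟙 (P false)) (prob w P ^ size K))
    where
    part : ∀ b → rowE w (λ v → 𝟙 (P b ∧ hom P K v)) ≡ 𝟙 (P b) * prob w P ^ size K
    part b = trans (rowE-cong w (λ v → 𝟙-∧ (P b) (hom P K v)))
      (trans (rowE-*ˡ w {n} (𝟙 (P b)) _) (cong (𝟙 (P b) *_) (rowE-hom d P K)))
  rowE-hom {w} d P (false ∷ K) = trans (IsDistribution.average d _) (rowE-hom d P K)

  graphE-clique : ∀ {w} → IsDistribution w → ∀ c {n} (K : Vec Bool n) → graphE w (λ G → 𝟙 (clique c K G)) ≡ w c ^ tri (size K)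
  graphE-clique d c [] = refl
  graphE-clique {w} d c {suc n} (true ∷ K) = trans
    (rowE-cong w (λ r → trans (graphE-cong w {n} (λ G → 𝟙-∧ (hom (same c) K r) (clique c K G)))
      (trans (graphE-*ˡ w {n} (𝟙 (hom (same c) K r)) _) (cong (𝟙 (hom (same c) K r) *_) (graphE-clique d c K)))))
    (trans (rowE-*ʳ w {n} (w c ^ tri (size K)) _)
      (trans (cong (_* w c ^ tri (size K)) (trans (rowE-hom d (same c) K) (cong (_^ size K) (prob-same w c))))
        (sym (^-+ (w c) (size K) (tri (size K))))))
  graphE-clique {w} d c {suc n} (false ∷ K) = trans (rowE-const d {n} _) (graphE-clique d c K)

  -- Adding the edges of both cliques counts the pairs inside K ∩ L twice; multiplying by the weight
  -- of these pairs avoids a quotient.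
  graphE-clique² : ∀ {w} → IsDistribution w → ∀ c {n} (K L : Vec Bool n) →
    graphE w (λ G → 𝟙 (clique c K G) * 𝟙 (clique c L G)) * w c ^ tri (size (K ∩ L)) ≡ w c ^ tri (size K) * w c ^ tri (size L)
  graphE-clique² d c [] [] = cong (_* 1ℚ) (*-identityˡ 1ℚ)
  graphE-clique² {w} d c {suc n} (true ∷ K) (true ∷ L) = trans
    (cong₂ _*_ (trans
      (rowE-cong w (λ r → trans (graphE-cong w (λ G → trans (cong₂ _*_ (𝟙-∧ (hom (same c) K r) _) (𝟙-∧ (hom (same c) L r) _))
          (trans (solve 4 (λ a b c d → a :* b :* (c :* d) := a :* c :* (b :* d)) refl (𝟙 (hom (same c) K r)) (𝟙 (clique c K G)) (𝟙 (hom (same c) L r)) (𝟙 (clique c L G)))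
            (cong (_* (𝟙 (clique c K G) * 𝟙 (clique c L G))) (𝟙-hom-∪ (same c) K L r)))))
        (graphE-*ˡ w {n} (𝟙 (hom (same c) (K ∪ L) r)) _)))
      (trans (rowE-*ʳ w {n} E _) (cong (_* E) (trans (rowE-hom d (same c) (K ∪ L)) (cong (_^ size (K ∪ L)) (prob-same w c))))))
      (^-+ (w c) (size (K ∩ L)) (tri (size (K ∩ L)))))
    (trans (solve 4 (λ u e i t → u :* e :* (i :* t) := u :* i :* (e :* t)) refl (w c ^ size (K ∪ L)) E (w c ^ size (K ∩ L)) (w c ^ tri (size (K ∩ L))))
      (trans (cong₂ _*_ (trans (sym (^-+ (w c) (size (K ∪ L)) (size (K ∩ L)))) (trans (cong (w c ^_) (size-∪+∩ K L)) (^-+ (w c) (size K) (size L)))) (graphE-clique² d c K L))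
        (trans (solve 4 (λ a b x y → a :* b :* (x :* y) := a :* x :* (b :* y)) refl (w c ^ size K) (w c ^ size L) (w c ^ tri (size K)) (w c ^ tri (size L)))
          (cong₂ _*_ (sym (^-+ (w c) (size K) (tri (size K)))) (sym (^-+ (w c) (size L) (tri (size L))))))))
    where
    E : ℚ
    E = graphE w (λ G → 𝟙 (clique c K G) * 𝟙 (clique c L G))
  graphE-clique² {w} d c {suc n} (true ∷ K) (false ∷ L) = trans
    (cong (_* t) (trans
      (rowE-cong w (λ r → trans (graphE-cong w (λ G → trans (cong (_* 𝟙 (clique c L G)) (𝟙-∧ (hom (same c) K r) _)) (*-assoc _ _ _)))
        (graphE-*ˡ w {n} (𝟙 (hom (same c) K r)) _)))
      (trans (rowE-*ʳ w {n} E _) (cong (_* E) (trans (rowE-hom d (same c) K) (cong (_^ size K) (prob-same w c)))))))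
    (trans (*-assoc _ E t) (trans (cong (w c ^ size K *_) (graphE-clique² d c K L))
      (trans (sym (*-assoc _ _ _)) (cong (_* w c ^ tri (size L)) (sym (^-+ (w c) (size K) (tri (size K))))))))
    where
    E t : ℚ
    E = graphE w (λ G → 𝟙 (clique c K G) * 𝟙 (clique c L G))
    t = w c ^ tri (size (K ∩ L))
  graphE-clique² {w} d c {suc n} (false ∷ K) (true ∷ L) = trans
    (cong (_* t) (trans
      (rowE-cong w (λ r → trans (graphE-cong w (λ G → trans (cong (𝟙 (clique c K G) *_) (𝟙-∧ (hom (same c) L r) _))
          (solve 3 (λ a b c → a :* (b :* c) := b :* (a :* c)) refl (𝟙 (clique c K G)) (𝟙 (hom (same c) L r)) (𝟙 (clique c L G)))))
        (graphE-*ˡ w {n} (𝟙 (hom (same c) L r)) _)))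
      (trans (rowE-*ʳ w {n} E _) (cong (_* E) (trans (rowE-hom d (same c) L) (cong (_^ size L) (prob-same w c)))))))
    (trans (*-assoc _ E t) (trans (cong (w c ^ size L *_) (graphE-clique² d c K L))
      (trans (solve 3 (λ a b c → a :* (b :* c) := b :* (a :* c)) refl (w c ^ size L) (w c ^ tri (size K)) (w c ^ tri (size L)))
        (cong (w c ^ tri (size K) *_) (sym (^-+ (w c) (size L) (tri (size L))))))))
    where
    E t : ℚ
    E = graphE w (λ G → 𝟙 (clique c K G) * 𝟙 (clique c L G))
    t = w c ^ tri (size (K ∩ L))
  graphE-clique² {w} d c {suc n} (false ∷ K) (false ∷ L) = trans (cong (_* w c ^ tri (size (K ∩ L))) (rowE-const d {n} _)) (graphE-clique² d c K L)

graphE-clique-outside : ∀ {w} → IsDistribution w → ∀ c {n} (K : Vec Bool n) (h : Vec Bool n → ℚ) → Local K h →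
  graphE w (λ G → 𝟙 (clique c K G) * ∏ n (λ i → outside-of K i (h (nbr G i)))) ≡ w c ^ tri (size K) * rowE w h ^ co-size K
graphE-clique-outside {w} d c K h loc = trans
  (graph-indep d K (λ G → 𝟙 (clique c K G)) (λ _ → h) (λ G → cong 𝟙 (clique-local c (⊑-refl K) G)) (λ _ → loc))
  (cong₂ _*_ (graphE-clique d c K) (∏-outside K (rowE w h)))

graphE-clique²-outside : ∀ {w} → IsDistribution w → ∀ c {n} (K L : Vec Bool n) (h : Vec Bool n → ℚ) → Local (K ∪ L) h →
  graphE w (λ G → 𝟙 (clique c K G) * 𝟙 (clique c L G) * ∏ n (λ i → outside-of (K ∪ L) i (h (nbr G i))))
    ≡ graphE w (λ G → 𝟙 (clique c K G) * 𝟙 (clique c L G)) * rowE w h ^ co-size (K ∪ L)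
graphE-clique²-outside {w} d c K L h loc = trans
  (graph-indep d (K ∪ L) (λ G → 𝟙 (clique c K G) * 𝟙 (clique c L G)) (λ _ → h)
    (λ G → cong₂ (λ x y → 𝟙 x * 𝟙 y) (clique-local c (⊑-∪ˡ K L) G) (clique-local c (⊑-∪ʳ K L) G)) (λ _ → loc))
  (cong (graphE w _ *_) (∏-outside (K ∪ L) (rowE w h)))

-- Sums over subsets of a given size, and binomial coefficients

opaque
  subs : ∀ {n} → ℕ → (Vec Bool n → ℚ) → ℚ
  subs {zero}  zero    f = f []
  subs {zero}  (suc m) f = 0ℚ
  subs {suc n} zero    f = subs zero (f ∘ (false ∷_))
  subs {suc n} (suc m) f = subs m (f ∘ (true ∷_)) + subs (suc m) (f ∘ (false ∷_))

B : ℕ → ℕ → ℚ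
B n zero = 1ℚ
B zero (suc m) = 0ℚ
B (suc n) (suc m) = B n m + B n (suc m)

antidiag : ℕ → (ℕ → ℕ → ℚ) → ℚ
antidiag zero f = f 0 0
antidiag (suc m) f = f 0 (suc m) + antidiag m (λ i j → f (suc i) j)

antidiag-cong : ∀ m {f g : ℕ → ℕ → ℚ} → (∀ i j → f i j ≡ g i j) → antidiag m f ≡ antidiag m g
antidiag-cong zero e = e 0 0
antidiag-cong (suc m) e = cong₂ _+_ (e 0 (suc m)) (antidiag-cong m (λ i → e (suc i)))

antidiag-mono : ∀ m {f g : ℕ → ℕ → ℚ} → (∀ i j → i ℕ.+ j ≡ m → f i j ≤ g i j) → antidiag m f ≤ antidiag m g
antidiag-mono zero e = e 0 0 refl
antidiag-mono (suc m) e = +-mono-≤ (e 0 (suc m) refl) (antidiag-mono m (λ i j eq → e (suc i) j (cong suc eq)))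

antidiag-+ : ∀ m (f g : ℕ → ℕ → ℚ) → antidiag m (λ i j → f i j + g i j) ≡ antidiag m f + antidiag m g
antidiag-+ zero f g = refl
antidiag-+ (suc m) f g = trans (cong (f 0 (suc m) + g 0 (suc m) +_) (antidiag-+ m _ _))
  (solve 4 (λ a b c d → a :+ b :+ (c :+ d) := a :+ c :+ (b :+ d)) refl (f 0 (suc m)) (g 0 (suc m))
    (antidiag m (λ i j → f (suc i) j)) (antidiag m (λ i j → g (suc i) j)))

antidiag-*ˡ : ∀ m c (f : ℕ → ℕ → ℚ) → antidiag m (λ i j → c * f i j) ≡ c * antidiag m f
antidiag-*ˡ zero c f = refl
antidiag-*ˡ (suc m) c f = trans (cong (c * f 0 (suc m) +_) (antidiag-*ˡ m c _)) (sym (distribˡ c _ _))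

antidiag-0 : ∀ m → antidiag m (λ _ _ → 0ℚ) ≡ 0ℚ
antidiag-0 zero = refl
antidiag-0 (suc m) = trans (+-identityˡ _) (antidiag-0 m)

antidiag-last : ∀ m (f : ℕ → ℕ → ℚ) → antidiag (suc m) f ≡ antidiag m (λ i j → f i (suc j)) + f (suc m) 0
antidiag-last zero f = refl
antidiag-last (suc m) f = trans (cong (f 0 (suc (suc m)) +_) (antidiag-last m (λ i j → f (suc i) j))) (sym (+-assoc _ _ _))

opaque
  unfolding subs

  subs-cong : ∀ {n} m {f g : Vec Bool n → ℚ} → (∀ K → size K ≡ m → f K ≡ g K) → subs m f ≡ subs m g
  subs-cong {zero} zero e = e [] refl
  subs-cong {zero} (suc m) e = refl
  subs-cong {suc n} zero e = subs-cong zero (λ K eq → e (false ∷ K) eq)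
  subs-cong {suc n} (suc m) e = cong₂ _+_ (subs-cong m (λ K eq → e (true ∷ K) (cong suc eq))) (subs-cong (suc m) (λ K eq → e (false ∷ K) eq))

  subs-mono : ∀ {n} m {f g : Vec Bool n → ℚ} → (∀ K → size K ≡ m → f K ≤ g K) → subs m f ≤ subs m g
  subs-mono {zero} zero e = e [] refl
  subs-mono {zero} (suc m) e = ≤-refl
  subs-mono {suc n} zero e = subs-mono zero (λ K eq → e (false ∷ K) eq)
  subs-mono {suc n} (suc m) e = +-mono-≤ (subs-mono m (λ K eq → e (true ∷ K) (cong suc eq))) (subs-mono (suc m) (λ K eq → e (false ∷ K) eq))

  subs-*ˡ : ∀ {n} m c (f : Vec Bool n → ℚ) → subs m (λ K → c * f K) ≡ c * subs m f
  subs-*ˡ {zero} zero c f = refl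
  subs-*ˡ {zero} (suc m) c f = sym (zeroʳ c)
  subs-*ˡ {suc n} zero c f = subs-*ˡ {n} zero c _
  subs-*ˡ {suc n} (suc m) c f = trans (cong₂ _+_ (subs-*ˡ {n} m c _) (subs-*ˡ {n} (suc m) c _)) (sym (distribˡ c _ _))

  subs-const : ∀ {n} m c → subs {n} m (λ _ → c) ≡ B n m * c
  subs-const {zero} zero c = sym (*-identityˡ c)
  subs-const {zero} (suc m) c = sym (zeroˡ c)
  subs-const {suc n} zero c = subs-const {n} zero c
  subs-const {suc n} (suc m) c = trans (cong₂ _+_ (subs-const {n} m c) (subs-const {n} (suc m) c)) (sym (distribʳ c _ _))

  subs-graphE : ∀ w {n m} k (f : Vec Bool m → Graph n → ℚ) →
    graphE w (λ G → subs k (λ K → f K G)) ≡ subs k (λ K → graphE w (f K))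
  subs-graphE w {m = zero} zero f = refl
  subs-graphE w {n} {m = zero} (suc k) f = graphE-0 w {n}
  subs-graphE w {m = suc m} zero f = subs-graphE w zero (λ K → f (false ∷ K))
  subs-graphE w {m = suc m} (suc k) f = trans (graphE-+ w _ _)
    (cong₂ _+_ (subs-graphE w k (λ K → f (true ∷ K))) (subs-graphE w (suc k) (λ K → f (false ∷ K))))

  subs-rowE : ∀ w {n m} k (f : Vec Bool m → Vec Bool n → ℚ) →
    rowE w (λ r → subs k (λ K → f K r)) ≡ subs k (λ K → rowE w (f K))
  subs-rowE w {m = zero} zero f = refl
  subs-rowE w {n} {m = zero} (suc k) f = rowE-0 w {n}
  subs-rowE w {m = suc m} zero f = subs-rowE w zero (λ K → f (false ∷ K))
  subs-rowE w {m = suc m} (suc k) f = trans (rowE-+ w _ _)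
    (cong₂ _+_ (subs-rowE w k (λ K → f (true ∷ K))) (subs-rowE w (suc k) (λ K → f (false ∷ K))))

  subs-nonneg : ∀ {n} m {f : Vec Bool n → ℚ} → (∀ K → 0ℚ ≤ f K) → 0ℚ ≤ subs m f
  subs-nonneg {zero} zero e = e []
  subs-nonneg {zero} (suc m) e = ≤-refl
  subs-nonneg {suc n} zero e = subs-nonneg zero (λ K → e (false ∷ K))
  subs-nonneg {suc n} (suc m) e = +-nonneg (subs-nonneg m (λ K → e (true ∷ K))) (subs-nonneg (suc m) (λ K → e (false ∷ K)))

  ≤-subs : ∀ {n} {f : Vec Bool n → ℚ} → (∀ K → 0ℚ ≤ f K) → ∀ K → f K ≤ subs (size K) f
  ≤-subs e [] = ≤-refl
  ≤-subs e (true ∷ K) = ≤-trans (≤-subs (λ K → e (true ∷ K)) K) (≤-+ʳ (subs-nonneg (suc (size K)) (λ K → e (false ∷ K))))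
  ≤-subs {f = f} e (false ∷ K) = ≤-trans (≤-subs (λ K → e (false ∷ K)) K) (go (size K))
    where
    go : ∀ m → subs m (f ∘ (false ∷_)) ≤ subs m f
    go zero = ≤-refl
    go (suc m) = ≤-+ˡ (subs-nonneg m (λ K → e (true ∷ K)))

  -- L splits into j elements of K and i elements outside, with `B (size K) j * B (co-size K) i`
  -- choices. The induction is Pascal's rule in the factor to which the head of K belongs.
  subs-∩ : ∀ {n} (K : Vec Bool n) m (g : ℕ → ℚ) →
    subs m (λ L → g (size (K ∩ L))) ≡ antidiag m (λ j i → B (size K) j * B (co-size K) i * g j)
  subs-∩ [] zero g = solve 1 (λ x → x := con 1ℚ :* con 1ℚ :* x) refl (g 0)
  subs-∩ [] (suc m) g = sym (trans (antidiag-cong (suc m) {g = λ j i → B 0 j * B 0 i * g j} (λ _ _ → refl))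
    (trans (cong₂ _+_ (trans (cong (_* g 0) (zeroʳ 1ℚ)) (zeroˡ _))
      (trans (antidiag-cong m (λ i j → trans (cong (_* g (suc i)) (zeroˡ _)) (zeroˡ _))) (antidiag-0 m))) (+-identityˡ 0ℚ)))
  subs-∩ (true ∷ K) zero g = subs-∩ K zero g
  subs-∩ (true ∷ K) (suc m) g = trans
    (cong₂ _+_ (subs-∩ K m (g ∘ suc)) (subs-∩ K (suc m) g))
    (trans (solve 3 (λ a b c → a :+ (b :+ c) := b :+ (a :+ c)) refl
        (antidiag m (λ j i → B (size K) j * B (co-size K) i * g (suc j))) (1ℚ * B (co-size K) (suc m) * g 0)
        (antidiag m (λ j i → B (size K) (suc j) * B (co-size K) i * g (suc j))))
      (cong (1ℚ * B (co-size K) (suc m) * g 0 +_) (trans (sym (antidiag-+ m _ _))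
        (antidiag-cong m (λ j i → solve 4 (λ a a′ b g → a :* b :* g :+ a′ :* b :* g := (a :+ a′) :* b :* g) refl
          (B (size K) j) (B (size K) (suc j)) (B (co-size K) i) (g (suc j)))))))
  subs-∩ (false ∷ K) zero g = subs-∩ K zero g
  subs-∩ (false ∷ K) (suc m) g = trans
    (cong₂ _+_ (subs-∩ K m g) (trans (subs-∩ K (suc m) g) (antidiag-last m (λ j i → B (size K) j * B (co-size K) i * g j))))
    (trans (sym (+-assoc _ _ _)) (trans
      (cong (_+ B (size K) (suc m) * 1ℚ * g (suc m)) (trans (sym (antidiag-+ m _ _))
        (antidiag-cong m (λ j i → solve 4 (λ a b b′ g → a :* b :* g :+ a :* b′ :* g := a :* (b :+ b′) :* g) refl
          (B (size K) j) (B (co-size K) i) (B (co-size K) (suc i)) (g j)))))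
      (sym (antidiag-last m (λ j i → B (size K) j * B (suc (co-size K)) i * g j)))))

B-nonneg : ∀ n m → 0ℚ ≤ B n m
B-nonneg n zero = 0≤1
B-nonneg zero (suc m) = ≤-refl
B-nonneg (suc n) (suc m) = +-nonneg (B-nonneg n m) (B-nonneg n (suc m))

B-pos : ∀ {n m} → m ℕ.≤ n → 0ℚ < B n m
B-pos {n} {zero} _ = 0<1
B-pos {suc n} {suc m} (ℕ.s≤s l) = +-pos (B-pos l) (B-nonneg n (suc m))

B-zero : ∀ {n m} → n ℕ.< m → B n m ≡ 0ℚ
B-zero {zero} {suc m} _ = refl
B-zero {suc n} {suc m} (ℕ.s≤s l) = trans (cong₂ _+_ (B-zero l) (B-zero (ℕ.m≤n⇒m≤1+n l))) (+-identityˡ 0ℚ)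

B-monoˡ : ∀ {n n′} m → n ℕ.≤ n′ → B n m ≤ B n′ m
B-monoˡ zero _ = ≤-refl
B-monoˡ (suc m) (ℕ.z≤n {n′}) = B-nonneg n′ (suc m)
B-monoˡ (suc m) (ℕ.s≤s l) = +-mono-≤ (B-monoˡ m l) (B-monoˡ (suc m) l)

-- Subtraction in ℚ keeps the identity valid for i ≥ n, where both sides vanish.
B-absorb : ∀ n i → ι (suc i) * B n (suc i) ≡ (ι n - ι i) * B n i
B-absorb zero zero = solve 0 ((con 1ℚ :+ con 0ℚ) :* con 0ℚ := (con 0ℚ :- con 0ℚ) :* con 1ℚ) refl
B-absorb zero (suc i) = trans (zeroʳ _) (sym (zeroʳ _))
B-absorb (suc n) zero = trans (solve 1 (λ b → (con 1ℚ :+ con 0ℚ) :* (con 1ℚ :+ b) := con 1ℚ :+ (con 1ℚ :+ con 0ℚ) :* b) refl (B n 1))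
  (trans (cong (1ℚ +_) (B-absorb n zero)) (solve 1 (λ n → con 1ℚ :+ (n :- con 0ℚ) :* con 1ℚ := (con 1ℚ :+ n :- con 0ℚ) :* con 1ℚ) refl (ι n)))
B-absorb (suc n) (suc i) = trans
  (solve 3 (λ i x y → (con 1ℚ :+ (con 1ℚ :+ i)) :* (x :+ y) := (con 1ℚ :+ (con 1ℚ :+ i)) :* x :+ (con 1ℚ :+ (con 1ℚ :+ i)) :* y) refl (ι i) (B n (suc i)) (B n (suc (suc i))))
  (trans (cong (ι (suc (suc i)) * B n (suc i) +_) (B-absorb n (suc i)))
    (trans (solve 3 (λ i n x → (con 1ℚ :+ (con 1ℚ :+ i)) :* x :+ (n :- (con 1ℚ :+ i)) :* x := (con 1ℚ :+ i) :* x :+ (n :- i) :* x) refl (ι i) (ι n) (B n (suc i)))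
      (trans (cong (_+ (ι n - ι i) * B n (suc i)) (B-absorb n i))
        (solve 4 (λ i n x y → (n :- i) :* y :+ (n :- i) :* x := (con 1ℚ :+ n :- (con 1ℚ :+ i)) :* (y :+ x)) refl (ι i) (ι n) (B n (suc i)) (B n i)))))

-- By `B-absorb`, raising the lower index from i to i + 1 multiplies the coefficient by (n - i)/(i +
-- 1), which is at least ν/m as long as i < m.
B-step : ∀ n m {ν} → 0ℚ ≤ ν → ν ≤ ι n - ι m → ∀ j i → j ℕ.+ i ℕ.≤ m → B n i * ν ^ j ≤ ι m ^ j * B n (j ℕ.+ i)
B-step n m 0≤ν hν zero i l = ≤-reflexive (*-comm _ _)
B-step n m {ν} 0≤ν hν (suc j) i l = ≤-trans
  (subst (_≤ ν * (ι m ^ j * B n (j ℕ.+ i))) (solve 3 (λ a b v → v :* (a :* b) := a :* (v :* b)) refl (B n i) (ν ^ j) ν)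
    (*-monoˡ-≤ 0≤ν (B-step n m 0≤ν hν j i (ℕ.<⇒≤ l))))
  (subst₂ _≤_ (solve 3 (λ v a b → a :* (v :* b) := v :* (a :* b)) refl ν (ι m ^ j) (B n (j ℕ.+ i)))
    (solve 3 (λ a m b → a :* (m :* b) := m :* a :* b) refl (ι m ^ j) (ι m) (B n (suc (j ℕ.+ i))))
    (*-monoˡ-≤ (^-nonneg j (ι-nonneg m)) (≤-trans
      (*-monoʳ-≤ (B-nonneg n (j ℕ.+ i)) (≤-trans hν (+-monoˡ-≤ (ι n) (neg-anti (ι-mono (ℕ.<⇒≤ l))))))
      (subst (_≤ ι m * B n (suc (j ℕ.+ i))) (B-absorb n (j ℕ.+ i)) (*-monoʳ-≤ (B-nonneg n (suc (j ℕ.+ i))) (ι-mono l))))))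
  where
  neg-anti : ∀ {a b} → a ≤ b → - b ≤ - a
  neg-anti {a} {b} p = ≤-by (b - a) (≤⇒0≤ p) (solve 2 (λ a b → :- a := (:- b) :+ (b :- a)) refl a b)

B≤^ : ∀ n j → B n j ≤ ι n ^ j
B≤^ n zero = ≤-refl
B≤^ zero (suc j) = ≤-reflexive (sym (zeroˡ _))
B≤^ (suc n) (suc j) = ≤-trans (+-mono-≤ (B≤^ n j) (B≤^ n (suc j)))
  (≤-trans (≤-reflexive (solve 2 (λ n x → x :+ n :* x := (con 1ℚ :+ n) :* x) refl (ι n) (ι n ^ j)))
    (*-monoˡ-≤ (ι-nonneg (suc n)) (^-mono j (ι-nonneg n) (≤-+ˡ 0≤1))))

B≤^′ : ∀ n j i → j ℕ.+ i ≡ n → B n j ≤ ι n ^ i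
B≤^′ zero zero zero refl = ≤-refl
B≤^′ (suc n) zero (suc i) refl = 1≤^ (suc i) (1≤ι-suc n)
B≤^′ (suc n) (suc j) zero eq = subst (_≤ 1ℚ) (sym (trans (cong (B n j +_) (B-zero (ℕ.s≤s (ℕ.≤-reflexive n≡j)))) (+-identityʳ _))) (B≤^′ n j zero (ℕ.suc-injective eq))
  where
  n≡j : n ≡ j
  n≡j = trans (sym (ℕ.suc-injective eq)) (ℕ.+-identityʳ j)
B≤^′ (suc n) (suc j) (suc i) eq = ≤-trans
  (+-mono-≤ (B≤^′ n j (suc i) (ℕ.suc-injective eq)) (B≤^′ n (suc j) i (trans (sym (ℕ.+-suc j i)) (ℕ.suc-injective eq))))
  (≤-trans (≤-reflexive (solve 2 (λ n x → n :* x :+ x := (con 1ℚ :+ n) :* x) refl (ι n) (ι n ^ i)))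
    (*-monoˡ-≤ (ι-nonneg (suc n)) (^-mono i (ι-nonneg n) (≤-+ˡ 0≤1))))

-- A single term of the binomial theorem; Pascal's rule bounds it directly, so the full expansion
-- never has to be written.
binomial-term≤ : ∀ {a b} → 0ℚ ≤ a → 0ℚ ≤ b → ∀ n m i → m ℕ.+ i ≡ n → B n m * a ^ m * b ^ i ≤ (a + b) ^ n
binomial-term≤ {a} {b} p q n zero i refl = subst (_≤ (a + b) ^ i) (sym (trans (cong (_* b ^ i) (*-identityˡ 1ℚ)) (*-identityˡ _))) (^-mono i q (≤-+ˡ p))
binomial-term≤ {a} {b} p q (suc n) (suc m) zero eq = ≤-trans
  (≤-reflexive (trans (cong (λ x → (B n m + x) * (a * a ^ m) * 1ℚ) (B-zero (ℕ.s≤s (ℕ.≤-reflexive n≡m))))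
    (solve 3 (λ x a y → (x :+ con 0ℚ) :* (a :* y) :* con 1ℚ := a :* (x :* y :* con 1ℚ)) refl (B n m) a (a ^ m))))
  (*-mono-≤ p (≤-+ʳ q) (*-nonneg (*-nonneg (B-nonneg n m) (^-nonneg m p)) 0≤1) (binomial-term≤ p q n m zero (ℕ.suc-injective eq)))
  where
  n≡m : n ≡ m
  n≡m = trans (sym (ℕ.suc-injective eq)) (ℕ.+-identityʳ m)
binomial-term≤ {a} {b} p q (suc n) (suc m) (suc i) eq = ≤-trans
  (≤-reflexive (solve 6 (λ x y a b u v → (x :+ y) :* (a :* u) :* (b :* v) := a :* (x :* u :* (b :* v)) :+ b :* (y :* (a :* u) :* v)) refl
    (B n m) (B n (suc m)) a b (a ^ m) (b ^ i)))
  (≤-trans (+-mono-≤ (*-monoˡ-≤ p (binomial-term≤ p q n m (suc i) (ℕ.suc-injective eq)))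
      (*-monoˡ-≤ q (binomial-term≤ p q n (suc m) i (trans (sym (ℕ.+-suc m i)) (ℕ.suc-injective eq)))))
    (≤-reflexive (sym (distribʳ ((a + b) ^ n) a b))))

-- Sums over initial segments and the geometric series

Sum : ℕ → (ℕ → ℚ) → ℚ
Sum zero f = 0ℚ
Sum (suc n) f = f 0 + Sum n (f ∘ suc)

Sum-mono : ∀ n {f g : ℕ → ℚ} → (∀ i → i ℕ.< n → f i ≤ g i) → Sum n f ≤ Sum n g
Sum-mono zero e = ≤-refl
Sum-mono (suc n) e = +-mono-≤ (e 0 (ℕ.s≤s ℕ.z≤n)) (Sum-mono n (λ i l → e (suc i) (ℕ.s≤s l)))

Sum-*ˡ : ∀ n c f → Sum n (λ i → c * f i) ≡ c * Sum n f
Sum-*ˡ zero c f = sym (zeroʳ c)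
Sum-*ˡ (suc n) c f = trans (cong (c * f 0 +_) (Sum-*ˡ n c (f ∘ suc))) (sym (distribˡ c _ _))

Sum-const : ∀ n c → Sum n (λ _ → c) ≡ ι n * c
Sum-const zero c = sym (zeroˡ c)
Sum-const (suc n) c = trans (cong (c +_) (Sum-const n c)) (solve 2 (λ n c → c :+ n :* c := (con 1ℚ :+ n) :* c) refl (ι n) c)

Sum-nonneg : ∀ n {f : ℕ → ℚ} → (∀ i → 0ℚ ≤ f i) → 0ℚ ≤ Sum n f
Sum-nonneg zero e = ≤-refl
Sum-nonneg (suc n) e = +-nonneg (e 0) (Sum-nonneg n (e ∘ suc))

≤-Sum : ∀ n {f : ℕ → ℚ} → (∀ i → 0ℚ ≤ f i) → ∀ i → i ℕ.< n → f i ≤ Sum n f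
≤-Sum (suc n) e zero l = ≤-+ʳ (Sum-nonneg n (e ∘ suc))
≤-Sum (suc n) e (suc i) (ℕ.s≤s l) = ≤-trans (≤-Sum n (e ∘ suc) i l) (≤-+ˡ (e 0))

Sum-++ : ∀ m n f → Sum (m ℕ.+ n) f ≡ Sum m f + Sum n (λ i → f (m ℕ.+ i))
Sum-++ zero n f = sym (+-identityˡ _)
Sum-++ (suc m) n f = trans (cong (f 0 +_) (Sum-++ m n (f ∘ suc))) (sym (+-assoc _ _ _))

graphE-Sum : ∀ w {n} k (f : ℕ → Graph n → ℚ) → graphE w (λ G → Sum k (λ i → f i G)) ≡ Sum k (λ i → graphE w (f i))
graphE-Sum w {n} zero f = graphE-0 w {n}
graphE-Sum w (suc k) f = trans (graphE-+ w _ _) (cong (graphE w (f 0) +_) (graphE-Sum w k (f ∘ suc)))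

geometric : ∀ n {ρ} → 0ℚ ≤ ρ → ρ < 1ℚ → Sum n (ρ ^_) * (1ℚ - ρ) ≤ 1ℚ
geometric n {ρ} 0≤ρ ρ<1 = ≤-by (ρ ^ n) (^-nonneg n 0≤ρ) (sym (telescope n))
  where
  telescope : ∀ n → Sum n (ρ ^_) * (1ℚ - ρ) + ρ ^ n ≡ 1ℚ
  telescope zero = solve 1 (λ r → con 0ℚ :* (con 1ℚ :- r) :+ con 1ℚ := con 1ℚ) refl ρ
  telescope (suc n) = trans (cong (λ s → (1ℚ + s) * (1ℚ - ρ) + ρ * ρ ^ n) (Sum-*ˡ n ρ (ρ ^_)))
    (trans (solve 3 (λ r s t → (con 1ℚ :+ r :* s) :* (con 1ℚ :- r) :+ r :* t := con 1ℚ :- r :+ r :* (s :* (con 1ℚ :- r) :+ t)) refl ρ (Sum n (ρ ^_)) (ρ ^ n))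
      (trans (cong (λ s → 1ℚ - ρ + ρ * s) (telescope n)) (solve 1 (λ r → con 1ℚ :- r :+ r :* con 1ℚ := con 1ℚ) refl ρ)))

-- Coloured graphs up to sentences of quantifier depth two

record Coloured : Set where
  constructor coloured
  field
    {order} : ℕ
    graph   : Graph order
    colours : Vec Bool order

  adj : Fin order → Fin order → Bool
  adj = adjacent graph

  side : Fin order → Bool
  side = lookup colours

open Coloured using (order; graph; colours; adj; side)

V : Coloured → Set
V M = Fin (order M)

adjacent-sym : ∀ {n} (G : Graph n) i j → adjacent G i j ≡ adjacent G j i
adjacent-sym (r ∷ G) zero zero = refl
adjacent-sym (r ∷ G) zero (suc j) = refl
adjacent-sym (r ∷ G) (suc i) zero = refl
adjacent-sym (r ∷ G) (suc i) (suc j) = adjacent-sym G i j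

Has : (M : Coloured) → V M → Bool → Bool → Set
Has M v e s = ∃ λ w → w ≢ v × adj M v w ≡ e × side M w ≡ s

SameType : (M : Coloured) → V M → (N : Coloured) → V N → Set
SameType M v N u = side M v ≡ side N u × ∀ e s → (Has M v e s → Has N u e s) × (Has N u e s → Has M v e s)

SameType-sym : ∀ {M v N u} → SameType M v N u → SameType N u M v
SameType-sym (e , h) = sym e , λ a s → proj₂ (h a s) , proj₁ (h a s)

SameType-trans : ∀ {M v N u P x} → SameType M v N u → SameType N u P x → SameType M v P x
SameType-trans (e , h) (e′ , h′) = trans e e′ , λ a s → proj₁ (h′ a s) ∘ proj₁ (h a s) , proj₂ (h a s) ∘ proj₂ (h′ a s)

SameCode : Coloured → Coloured → Set
SameCode M N = (∀ v → ∃ λ u → SameType M v N u) × (∀ u → ∃ λ v → SameType M v N u)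

AtomEq : ∀ {k} (M N : Coloured) → Vec (V M) k → Vec (V N) k → Set
AtomEq M N ρ τ = (∀ x y → adj M (lookup ρ x) (lookup ρ y) ≡ adj N (lookup τ x) (lookup τ y))
  × (∀ x y → (lookup ρ x ≡ lookup ρ y → lookup τ x ≡ lookup τ y) × (lookup τ x ≡ lookup τ y → lookup ρ x ≡ lookup ρ y))
  × (∀ x → side M (lookup ρ x) ≡ side N (lookup τ x))

-- Equivalence in the back-and-forth game of Ehrenfeucht and Fraïssé with that many rounds left.
EF : ℕ → ∀ {k} (M N : Coloured) → Vec (V M) k → Vec (V N) k → Set
EF zero M N ρ τ = AtomEq M N ρ τ
EF (suc d) M N ρ τ = AtomEq M N ρ τ × (∀ v → ∃ λ u → EF d M N (v ∷ ρ) (u ∷ τ)) × (∀ u → ∃ λ v → EF d M N (v ∷ ρ) (u ∷ τ))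

EF-atoms : ∀ d {k M N} {ρ : Vec (V M) k} {τ : Vec (V N) k} → EF d M N ρ τ → AtomEq M N ρ τ
EF-atoms zero h = h
EF-atoms (suc d) h = proj₁ h

Sat-EF : ∀ d {k} M N (ρ : Vec (V M) k) (τ : Vec (V N) k) → EF d M N ρ τ → ∀ φ → depth φ ℕ.≤ d →
  (Sat (graph M) (colours M) ρ φ → Sat (graph N) (colours N) τ φ) × (Sat (graph N) (colours N) τ φ → Sat (graph M) (colours M) ρ φ)
Sat-EF d M N ρ τ h (x ∼ᶠ y) l = let e = proj₁ (EF-atoms d h) x y in subst T e , subst T (sym e)
Sat-EF d M N ρ τ h (x =ᶠ y) l = proj₁ (proj₂ (EF-atoms d h)) x y
Sat-EF d M N ρ τ h (Xᶠ x) l = let e = proj₂ (proj₂ (EF-atoms d h)) x in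
  (λ p → Vec.lookup⇒[]= _ (colours N) (trans (sym e) (Vec.[]=⇒lookup p))) ,
  (λ p → Vec.lookup⇒[]= _ (colours M) (trans e (Vec.[]=⇒lookup p)))
Sat-EF d M N ρ τ h (¬ᶠ φ) l = let p , q = Sat-EF d M N ρ τ h φ l in (_∘ q) , (_∘ p)
Sat-EF d M N ρ τ h (φ ∧ᶠ ψ) l =
  let p , q = Sat-EF d M N ρ τ h φ (ℕ.m⊔n≤o⇒m≤o (depth φ) (depth ψ) l)
      p′ , q′ = Sat-EF d M N ρ τ h ψ (ℕ.m⊔n≤o⇒n≤o (depth φ) (depth ψ) l)
  in (λ (a , b) → p a , p′ b) , (λ (a , b) → q a , q′ b)
Sat-EF d M N ρ τ h (φ ∨ᶠ ψ) l =
  let p , q = Sat-EF d M N ρ τ h φ (ℕ.m⊔n≤o⇒m≤o (depth φ) (depth ψ) l)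
      p′ , q′ = Sat-EF d M N ρ τ h ψ (ℕ.m⊔n≤o⇒n≤o (depth φ) (depth ψ) l)
  in (λ { (inj₁ a) → inj₁ (p a) ; (inj₂ b) → inj₂ (p′ b) }) , (λ { (inj₁ a) → inj₁ (q a) ; (inj₂ b) → inj₂ (q′ b) })
Sat-EF d M N ρ τ h (φ ⇒ᶠ ψ) l =
  let p , q = Sat-EF d M N ρ τ h φ (ℕ.m⊔n≤o⇒m≤o (depth φ) (depth ψ) l)
      p′ , q′ = Sat-EF d M N ρ τ h ψ (ℕ.m⊔n≤o⇒n≤o (depth φ) (depth ψ) l)
  in (λ f a → p′ (f (q a))) , (λ f a → q′ (f (p a)))
Sat-EF (suc d) M N ρ τ (_ , fwd , bwd) (∀ᶠ φ) (ℕ.s≤s l) =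
  (λ f u → let v , h = bwd u in proj₁ (Sat-EF d M N (v ∷ ρ) (u ∷ τ) h φ l) (f v)) ,
  (λ f v → let u , h = fwd v in proj₂ (Sat-EF d M N (v ∷ ρ) (u ∷ τ) h φ l) (f u))
Sat-EF (suc d) M N ρ τ (_ , fwd , bwd) (∃ᶠ φ) (ℕ.s≤s l) =
  (λ (v , a) → let u , h = fwd v in u , proj₁ (Sat-EF d M N (v ∷ ρ) (u ∷ τ) h φ l) a) ,
  (λ (u , a) → let v , h = bwd u in v , proj₂ (Sat-EF d M N (v ∷ ρ) (u ∷ τ) h φ l) a)

adjacent-irrefl : ∀ {n} (G : Graph n) i → adjacent G i i ≡ false
adjacent-irrefl (r ∷ G) zero = refl
adjacent-irrefl (r ∷ G) (suc i) = adjacent-irrefl G i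

-- A move to the pebbled vertex is answered by the pebbled vertex; any other move realises a pair of
-- the type, and that pair together with the sides fixes all atoms about the two pebbles.
SameType⇒EF₁ : ∀ {M N v u} → SameType M v N u → EF 1 M N (v ∷ []) (u ∷ [])
SameType⇒EF₁ {M} {N} {v} {u} (e , h) = atoms₁ , fwd , bwd
  where
  atoms₁ : AtomEq M N (v ∷ []) (u ∷ [])
  atoms₁ = (λ { zero zero → trans (adjacent-irrefl (graph M) v) (sym (adjacent-irrefl (graph N) u)) })
    , (λ { zero zero → (λ _ → refl) , (λ _ → refl) }) , (λ { zero → e })
  atoms₂ : ∀ {w x} → w ≢ v → x ≢ u → adj M v w ≡ adj N u x → side M w ≡ side N x → AtomEq M N (w ∷ v ∷ []) (x ∷ u ∷ [])
  atoms₂ {w} {x} w≢v x≢u a s =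
    (λ { zero zero → trans (adjacent-irrefl (graph M) w) (sym (adjacent-irrefl (graph N) x))
       ; zero (suc zero) → trans (adjacent-sym (graph M) w v) (trans a (adjacent-sym (graph N) u x))
       ; (suc zero) zero → a
       ; (suc zero) (suc zero) → proj₁ atoms₁ zero zero })
    , (λ { zero zero → (λ _ → refl) , (λ _ → refl)
         ; zero (suc zero) → (λ p → contradiction p w≢v) , (λ p → contradiction p x≢u)
         ; (suc zero) zero → (λ p → contradiction (sym p) w≢v) , (λ p → contradiction (sym p) x≢u)
         ; (suc zero) (suc zero) → (λ _ → refl) , (λ _ → refl) })
    , (λ { zero → s ; (suc zero) → e })
  atomsᵣ : AtomEq M N (v ∷ v ∷ []) (u ∷ u ∷ [])
  atomsᵣ = (λ { zero zero → proj₁ atoms₁ zero zero ; zero (suc zero) → proj₁ atoms₁ zero zero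
              ; (suc zero) zero → proj₁ atoms₁ zero zero ; (suc zero) (suc zero) → proj₁ atoms₁ zero zero })
    , (λ { zero zero → (λ _ → refl) , (λ _ → refl) ; zero (suc zero) → (λ _ → refl) , (λ _ → refl)
         ; (suc zero) zero → (λ _ → refl) , (λ _ → refl) ; (suc zero) (suc zero) → (λ _ → refl) , (λ _ → refl) })
    , (λ { zero → e ; (suc zero) → e })
  fwd : ∀ w → ∃ λ x → AtomEq M N (w ∷ v ∷ []) (x ∷ u ∷ [])
  fwd w with w Fin.≟ v
  ... | yes refl = u , atomsᵣ
  ... | no w≢v = let x , x≢u , a , s = proj₁ (h (adj M v w) (side M w)) (w , w≢v , refl , refl)
                 in x , atoms₂ w≢v x≢u (sym a) (sym s)
  bwd : ∀ x → ∃ λ w → AtomEq M N (w ∷ v ∷ []) (x ∷ u ∷ [])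
  bwd x with x Fin.≟ u
  ... | yes refl = v , atomsᵣ
  ... | no x≢u = let w , w≢v , a , s = proj₂ (h (adj N u x) (side N x)) (x , x≢u , refl , refl)
                 in w , atoms₂ w≢v x≢u a s

Sat-SameCode : ∀ {M N} → SameCode M N → ∀ φ → depth φ ≡ 2 → Sat (graph M) (colours M) [] φ → Sat (graph N) (colours N) [] φ
Sat-SameCode {M} {N} (fwd , bwd) φ eq = proj₁ (Sat-EF 2 M N [] []
  (((λ ()) , (λ ()) , (λ ()))
  , (λ v → let u , t = fwd v in u , SameType⇒EF₁ {M} {N} {v} {u} t)
  , (λ u → let v , t = bwd u in v , SameType⇒EF₁ {M} {N} {v} {u} t)) φ (ℕ.≤-reflexive eq))

-- The extension property

infixr 5 _◂_

_◂_ : ∀ {A : Set} {k} → A → (Fin k → A) → Fin (suc k) → A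
(x ◂ f) zero = x
(x ◂ f) (suc i) = f i

Consistent : ∀ {n k} → (Fin k → Fin n) → (Fin k → Bool) → Set
Consistent f b = ∀ i j → f i ≡ f j → b i ≡ b j

-- The list `f` may repeat a vertex, provided the demands on it are `Consistent`. Allowing all k ≤ t
-- makes the property monotone in t.
Ext : ℕ → ∀ {n} → Graph n → Set
Ext t {n} G = ∀ k → k ℕ.≤ t → (f : Fin k → Fin n) (b : Fin k → Bool) → Consistent f b →
  ∃ λ w → ∀ i → w ≢ f i × adjacent G w (f i) ≡ b i

◂-consistent : ∀ {n k} {f : Fin k → Fin n} {b x y} → Consistent f b → (∀ i → x ≡ f i → y ≡ b i) → Consistent (x ◂ f) (y ◂ b)
◂-consistent h p zero zero _ = refl
◂-consistent h p zero (suc j) e = p j e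
◂-consistent h p (suc i) zero e = sym (p i (sym e))
◂-consistent h p (suc i) (suc j) e = h i j e

none : ∀ {A : Set} → Fin 0 → A
none ()

ext₂ : ∀ {t n} (G : Graph n) → Ext t G → 2 ℕ.≤ t → ∀ {u v} → u ≢ v → ∀ a b →
  ∃ λ w → w ≢ u × w ≢ v × adjacent G w u ≡ a × adjacent G w v ≡ b
ext₂ G ext l {u} {v} u≢v a b =
  let w , h = ext 2 l (u ◂ v ◂ none) (a ◂ b ◂ none) (◂-consistent {k = 1} (◂-consistent (λ ()) (λ ())) (λ { zero e → contradiction e u≢v }))
  in w , proj₁ (h zero) , proj₁ (h (suc zero)) , proj₂ (h zero) , proj₂ (h (suc zero))

ext₃ : ∀ {t n} (G : Graph n) → Ext t G → 3 ℕ.≤ t → ∀ {u v x} → u ≢ v → u ≢ x → v ≢ x → ∀ a b c →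
  ∃ λ w → w ≢ u × w ≢ v × w ≢ x × adjacent G w u ≡ a × adjacent G w v ≡ b × adjacent G w x ≡ c
ext₃ G ext l {u} {v} {x} u≢v u≢x v≢x a b c =
  let w , h = ext 3 l (u ◂ v ◂ x ◂ none) (a ◂ b ◂ c ◂ none)
        (◂-consistent {k = 2} (◂-consistent {k = 1} (◂-consistent (λ ()) (λ ())) (λ { zero e → contradiction e v≢x }))
          (λ { zero e → contradiction e u≢v ; (suc zero) e → contradiction e u≢x }))
  in w , proj₁ (h zero) , proj₁ (h (suc zero)) , proj₁ (h (suc (suc zero))) ,
     proj₂ (h zero) , proj₂ (h (suc zero)) , proj₂ (h (suc (suc zero)))

-- Transfer of colourings between graphs with the extension property

has? : (M : Coloured) → ∀ v e s → Dec (Has M v e s)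
has? M v e s = Fin.any? λ w → ¬? (w Fin.≟ v) ×-dec (adj M v w Bool.≟ e) ×-dec (side M w Bool.≟ s)

code : (M : Coloured) → V M → Vec Bool 5
code M v = side M v ∷ does (has? M v true true) ∷ does (has? M v true false) ∷ does (has? M v false true) ∷ does (has? M v false false) ∷ []

does-≡ : ∀ {P Q : Set} (p? : Dec P) (q? : Dec Q) → does p? ≡ does q? → (P → Q) × (Q → P)
does-≡ (yes p) (yes q) _ = (λ _ → q) , (λ _ → p)
does-≡ (no ¬p) (no ¬q) _ = (λ p → contradiction p ¬p) , (λ q → contradiction q ¬q)

code⇒SameType : ∀ {M v u} → code M v ≡ code M u → SameType M v M u
code⇒SameType {M} {v} {u} eq = cong Vec.head eq , λ
  { true true → does-≡ (has? M v true true) (has? M u true true) (cong (λ c → lookup c (suc zero)) eq)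
  ; true false → does-≡ (has? M v true false) (has? M u true false) (cong (λ c → lookup c (suc (suc zero))) eq)
  ; false true → does-≡ (has? M v false true) (has? M u false true) (cong (λ c → lookup c (suc (suc (suc zero)))) eq)
  ; false false → does-≡ (has? M v false false) (has? M u false false) (cong (λ c → lookup c (suc (suc (suc (suc zero))))) eq) }

∈-allRows : ∀ {n} (r : Vec Bool n) → r ∈ᴸ allRows n
∈-allRows [] = here refl
∈-allRows (true ∷ r) = ∈-cartesianProductWith⁺ _∷_ {xs = true List.∷ false List.∷ List.[]} (here refl) (∈-allRows r)
∈-allRows (false ∷ r) = ∈-cartesianProductWith⁺ _∷_ {xs = true List.∷ false List.∷ List.[]} (there (here refl)) (∈-allRows r)

typeCount : ℕ
typeCount = List.length (allRows 5)

representatives : (M : Coloured) → V M → ∃ λ (R : Fin typeCount → V M) → ∀ v → ∃ λ i → SameType M v M (R i)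
representatives M v₀ = R , λ v → let i = Any.index (∈-allRows (code M v)) in
    i , code⇒SameType {M} (sym (pick-correct (List.lookup (allRows 5) i) (v , lookup-index (∈-allRows (code M v))) (dec i)))
  where
  dec : ∀ i → Dec (∃ λ v → code M v ≡ List.lookup (allRows 5) i)
  dec i = Fin.any? λ v → Vec.≡-dec Bool._≟_ (code M v) (List.lookup (allRows 5) i)
  pick : ∀ {c} → Dec (∃ λ v → code M v ≡ c) → V M
  pick (yes (v , _)) = v
  -- A code that no vertex has is assigned the arbitrary vertex v₀, so that the number of
  -- representatives does not depend on M.
  pick (no _) = v₀
  R : Fin typeCount → V M
  R i = pick (dec i)
  pick-correct : ∀ c → (h : ∃ λ v → code M v ≡ c) (d : Dec (∃ λ v → code M v ≡ c)) → code M (pick d) ≡ code M (proj₁ h)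
  pick-correct c (v , e) (yes (u , e′)) = trans e′ (sym e)
  pick-correct c h (no ¬h) = contradiction h ¬h

-- Greedy embedding: a repeated entry of `R` reuses the earlier image, a new one is placed by the
-- extension property, whose consistency condition follows from the equalities already matched.
embed : ∀ {n n′} (G : Graph n) (G′ : Graph n′) k → Ext k G′ → (R : Fin k → Fin n) →
  ∃ λ (R′ : Fin k → Fin n′) → (∀ i j → (R i ≡ R j → R′ i ≡ R′ j) × (R′ i ≡ R′ j → R i ≡ R j))
    × (∀ i j → adjacent G (R i) (R j) ≡ adjacent G′ (R′ i) (R′ j))
embed G G′ zero ext R = none , (λ ()) , (λ ())
embed {n} {n′} G G′ (suc k) ext R = go (embed G G′ k (λ j l → ext j (ℕ.m≤n⇒m≤1+n l)) (R ∘ suc)) (Fin.any? λ i → R (suc i) Fin.≟ R zero)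
  where
  Emb : ∀ {k} → (Fin k → Fin n) → Set
  Emb {k} R = ∃ λ (R′ : Fin k → Fin n′) → (∀ i j → (R i ≡ R j → R′ i ≡ R′ j) × (R′ i ≡ R′ j → R i ≡ R j))
    × (∀ i j → adjacent G (R i) (R j) ≡ adjacent G′ (R′ i) (R′ j))
  go : Emb (R ∘ suc) → Dec (∃ λ i → R (suc i) ≡ R zero) → Emb R
  go (R′ , inj , hom′) (yes (i , e)) = R′ i ◂ R′
    , (λ { zero zero → (λ _ → refl) , (λ _ → refl)
         ; zero (suc j) → (λ p → proj₁ (inj i j) (trans e p)) , (λ p → trans (sym e) (proj₂ (inj i j) p))
         ; (suc j) zero → (λ p → proj₁ (inj j i) (trans p (sym e))) , (λ p → trans (proj₂ (inj j i) p) e)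
         ; (suc j) (suc l) → inj j l })
    , (λ { zero zero → trans (adjacent-irrefl G (R zero)) (sym (adjacent-irrefl G′ (R′ i)))
         ; zero (suc j) → trans (cong (λ x → adjacent G x (R (suc j))) (sym e)) (hom′ i j)
         ; (suc j) zero → trans (cong (adjacent G (R (suc j))) (sym e)) (hom′ j i)
         ; (suc j) (suc l) → hom′ j l })
  go (R′ , inj , hom′) (no new) =
    let w , h = ext k (ℕ.n≤1+n k) R′ (λ i → adjacent G (R zero) (R (suc i))) (λ i j p → cong (adjacent G (R zero)) (proj₂ (inj i j) p))
    in w ◂ R′
    , (λ { zero zero → (λ _ → refl) , (λ _ → refl)
         ; zero (suc j) → (λ p → contradiction (j , sym p) new) , (λ p → contradiction p (proj₁ (h j)))
         ; (suc j) zero → (λ p → contradiction (j , p) new) , (λ p → contradiction (sym p) (proj₁ (h j)))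
         ; (suc j) (suc l) → inj j l })
    , (λ { zero zero → trans (adjacent-irrefl G (R zero)) (sym (adjacent-irrefl G′ w))
         ; zero (suc j) → sym (proj₂ (h j))
         ; (suc j) zero → trans (adjacent-sym G (R (suc j)) (R zero)) (trans (sym (proj₂ (h j))) (adjacent-sym G′ w (R′ j)))
         ; (suc j) (suc l) → hom′ j l })

-- Colours outside the representatives. Either only one occurs, and the extension property then
-- makes the type of such a vertex depend on its adjacencies to the representatives alone; or both
-- occur and each side has a vertex of the richest type, which can serve as a model for any outside
-- vertex of a copy.
Monochrome Rich : (M : Coloured) → ∀ {k} → (Fin k → V M) → Set
Monochrome M R = ∃ λ s → ∀ v → (∀ i → v ≢ R i) → side M v ≡ s
Rich M R = (∀ s → ∃ λ v → (∀ i → v ≢ R i) × side M v ≡ s) × (∀ s → ∃ λ v → side M v ≡ s × ∀ e s′ → Has M v e s′)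

-- The representatives are copied into G′, and every other vertex of G′ gets a colour borne in M by
-- an outside vertex with the same adjacencies to the representatives. Thus each copy sees exactly
-- the pairs that its original sees. A vertex outside the copies has, in the monochrome case, the
-- type of a vertex of M with its pattern; in the rich case it sees all four pairs.
transfer : ExcludedMiddle 0ℓ → ∀ M {k} (R : Fin k → V M) → (∀ v → ∃ λ i → SameType M v M (R i)) → Monochrome M R ⊎ Rich M R →
  Ext (3 ℕ.+ k) (graph M) → ∀ {n′} (G′ : Graph n′) → Ext (3 ℕ.+ k) G′ → ∃ λ X′ → SameCode M (coloured G′ X′)
transfer em M {k} R reps alt ext {n′} G′ ext′ = X′ , fwd , bwd
  where
  G = graph M
  k≤ : k ℕ.≤ 3 ℕ.+ k
  k≤ = ℕ.m≤n+m k 3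
  emb = embed G G′ k (λ j l → ext′ j (ℕ.≤-trans l k≤)) R
  R′ = proj₁ emb
  to : ∀ {i j} → R i ≡ R j → R′ i ≡ R′ j
  to {i} {j} = proj₁ (proj₁ (proj₂ emb) i j)
  from : ∀ {i j} → R′ i ≡ R′ j → R i ≡ R j
  from {i} {j} = proj₂ (proj₁ (proj₂ emb) i j)
  R-adj : ∀ i j → adjacent G (R i) (R j) ≡ adjacent G′ (R′ i) (R′ j)
  R-adj = proj₂ (proj₂ emb)
  Out : V M → Set
  Out v = ∀ i → v ≢ R i
  Out′ : Fin n′ → Set
  Out′ v = ∀ i → v ≢ R′ i
  const-consistent : ∀ {n k} {f : Fin k → Fin n} {b} → Consistent f (λ _ → b)
  const-consistent _ _ _ = refl
  first = ext′ k k≤ R′ (λ _ → true) const-consistent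
  z₁ = proj₁ first
  z₁∉ : Out′ z₁
  z₁∉ i = proj₁ (proj₂ first i)
  second = ext′ (suc k) (ℕ.m≤n+m (suc k) 2) (z₁ ◂ R′) (λ _ → true) const-consistent
  z₂ = proj₁ second
  z₂∉ : Out′ z₂
  z₂∉ i = proj₁ (proj₂ second (suc i))
  z₁≢z₂ : z₁ ≢ z₂
  z₁≢z₂ e = proj₁ (proj₂ second zero) (sym e)
  Compat : Fin n′ → Bool → Set
  Compat v′ s = ∃ λ v → Out v × (∀ i → adjacent G v (R i) ≡ adjacent G′ v′ (R′ i)) × side M v ≡ s
  match : ∀ v′ → ∃ λ v → Out v × (∀ i → adjacent G v (R i) ≡ adjacent G′ v′ (R′ i))
  match v′ = let v , h = ext k k≤ R (λ i → adjacent G′ v′ (R′ i)) (λ i j e → cong (adjacent G′ v′) (to e))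
             in v , proj₁ ∘ h , proj₂ ∘ h
  -- A vertex compatible with both colours is coloured by the parity of its adjacencies
  -- to z₁ and z₂, so that both colours occur with every pattern on R′, z₁ (or R′, z₂).
  paint′ : ∀ v′ → Dec (Compat v′ true) → Dec (Compat v′ false) → Bool
  paint′ v′ (yes _) (yes _) = adjacent G′ v′ z₁ xor adjacent G′ v′ z₂
  paint′ v′ (yes _) (no _) = true
  paint′ v′ (no _) _ = false
  paint : ∀ v′ → Dec (∃ λ i → R′ i ≡ v′) → Bool
  paint v′ (yes (i , _)) = side M (R i)
  paint v′ (no _) = paint′ v′ em em
  old? : ∀ v′ → Dec (∃ λ i → R′ i ≡ v′)
  old? v′ = Fin.any? λ i → R′ i Fin.≟ v′
  X′ = Vec.tabulate (λ v′ → paint v′ (old? v′))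
  N = coloured G′ X′
  side-N : ∀ v′ → side N v′ ≡ paint v′ (old? v′)
  side-N v′ = Vec.lookup∘tabulate (λ v′ → paint v′ (old? v′)) v′
  side-R′ : ∀ i → side N (R′ i) ≡ side M (R i)
  side-R′ i = trans (side-N (R′ i)) (lemma (old? (R′ i)))
    where
    lemma : ∀ d → paint (R′ i) d ≡ side M (R i)
    lemma (yes (j , e)) = cong (side M) (from e)
    lemma (no ¬p) = contradiction (i , refl) ¬p
  side-compat : ∀ v′ → Out′ v′ → Compat v′ (side N v′)
  side-compat v′ out = subst (Compat v′) (sym (side-N v′)) (lemma (old? v′))
    where
    some : Compat v′ true ⊎ Compat v′ false
    some = let v , o , m = match v′ in pick (side M v) refl o m
      where
      pick : ∀ {v} s → side M v ≡ s → Out v → (∀ i → adjacent G v (R i) ≡ adjacent G′ v′ (R′ i)) → Compat v′ true ⊎ Compat v′ false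
      pick true e o m = inj₁ (_ , o , m , e)
      pick false e o m = inj₂ (_ , o , m , e)
    lemma′ : (p : Dec (Compat v′ true)) (q : Dec (Compat v′ false)) → Compat v′ (paint′ v′ p q)
    lemma′ (yes p) (yes q) = both (adjacent G′ v′ z₁ xor adjacent G′ v′ z₂)
      where
      both : ∀ s → Compat v′ s
      both true = p
      both false = q
    lemma′ (yes p) (no q) = p
    lemma′ (no p) (yes q) = q
    lemma′ (no p) (no q) = case some of λ { (inj₁ x) → contradiction x p ; (inj₂ x) → contradiction x q }
    lemma : ∀ d → Compat v′ (paint v′ d)
    lemma (yes (i , e)) = contradiction (sym e) (out i)
    lemma (no _) = lemma′ em em
  side-parity : ∀ v′ s → Out′ v′ → Compat v′ s → adjacent G′ v′ z₁ xor adjacent G′ v′ z₂ ≡ s → side N v′ ≡ s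
  side-parity v′ s out c e = trans (side-N v′) (lemma (old? v′))
    where
    lemma′ : ∀ s → Compat v′ s → adjacent G′ v′ z₁ xor adjacent G′ v′ z₂ ≡ s → (p : Dec (Compat v′ true)) (q : Dec (Compat v′ false)) → paint′ v′ p q ≡ s
    lemma′ s c e (yes p) (yes q) = e
    lemma′ true c e (yes p) (no q) = refl
    lemma′ false c e (yes p) (no q) = contradiction c q
    lemma′ true c e (no p) _ = contradiction c p
    lemma′ false c e (no p) _ = refl
    lemma : ∀ d → paint v′ d ≡ s
    lemma (yes (i , e)) = contradiction (sym e) (out i)
    lemma (no _) = lemma′ s c e em em
  xor-cancel : ∀ s e → e xor (s xor e) ≡ s
  xor-cancel true true = refl
  xor-cancel true false = refl
  xor-cancel false true = refl
  xor-cancel false false = refl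
  -- Demands on v′, z₁, z₂ and the copies use up the whole order 3 + k. If v′ is z₁ or z₂, the
  -- adjacency e to it is prescribed, and the other one of the two is free to set the parity.
  find : ∀ u → Out u → ∀ v′ → Out′ v′ → ∀ e →
    ∃ λ w′ → Out′ w′ × w′ ≢ v′ × adjacent G′ w′ v′ ≡ e × (∀ i → adjacent G′ w′ (R′ i) ≡ adjacent G u (R i)) × side N w′ ≡ side M u
  find u out v′ out′ e = build (v′ Fin.≟ z₁) (v′ Fin.≟ z₂)
    where
    s = side M u
    with-bits : ∀ a b → (v′ ≡ z₁ → e ≡ a) → (v′ ≡ z₂ → e ≡ b) → a xor b ≡ s →
      ∃ λ w′ → Out′ w′ × w′ ≢ v′ × adjacent G′ w′ v′ ≡ e × (∀ i → adjacent G′ w′ (R′ i) ≡ adjacent G u (R i)) × side N w′ ≡ side M u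
    with-bits a b ea eb parity =
      let w′ , h = ext′ (3 ℕ.+ k) ℕ.≤-refl (v′ ◂ z₁ ◂ z₂ ◂ R′) (e ◂ a ◂ b ◂ (λ i → adjacent G u (R i)))
            (◂-consistent (◂-consistent (◂-consistent (λ i j p → cong (adjacent G u) (from p))
              (λ i p → contradiction p (z₂∉ i)))
              (λ { zero p → contradiction p z₁≢z₂ ; (suc i) p → contradiction p (z₁∉ i) }))
              (λ { zero p → ea p ; (suc zero) p → eb p ; (suc (suc i)) p → contradiction p (out′ i) }))
          pattern′ = λ i → proj₂ (h (suc (suc (suc i))))
          w′∉ = λ i → proj₁ (h (suc (suc (suc i))))
      in w′ , w′∉ , proj₁ (h zero) , proj₂ (h zero) , pattern′ ,
         side-parity w′ s w′∉ (u , out , sym ∘ pattern′ , refl) (trans (cong₂ _xor_ (proj₂ (h (suc zero))) (proj₂ (h (suc (suc zero))))) parity)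
    build : Dec (v′ ≡ z₁) → Dec (v′ ≡ z₂) → ∃ λ w′ → Out′ w′ × w′ ≢ v′ × adjacent G′ w′ v′ ≡ e × (∀ i → adjacent G′ w′ (R′ i) ≡ adjacent G u (R i)) × side N w′ ≡ side M u
    build (yes p) _ = with-bits e (s xor e) (λ _ → refl) (λ q → contradiction (trans (sym p) q) z₁≢z₂) (xor-cancel s e)
    build (no p) (yes q) = with-bits (s xor e) e (λ q → contradiction q p) (λ _ → refl) (trans (Bool.xor-comm (s xor e) e) (xor-cancel s e))
    build (no p) (no q) = with-bits s false (λ r → contradiction r p) (λ r → contradiction r q) (Bool.xor-identityʳ s)
  new? : ∀ v → Dec (∃ λ i → R i ≡ v)
  new? v = Fin.any? λ i → R i Fin.≟ v
  out-of : ∀ {v} → ¬ (∃ λ i → R i ≡ v) → Out v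
  out-of h i e = h (i , sym e)
  out-of′ : ∀ {v} → ¬ (∃ λ i → R′ i ≡ v) → Out′ v
  out-of′ h i e = h (i , sym e)
  R≈R′ : ∀ i → SameType M (R i) N (R′ i)
  R≈R′ i = sym (side-R′ i) , λ e s → (λ (w , w≢ , a , c) → there′ e s w w≢ a c (new? w)) , (λ (w′ , w≢ , a , c) → back e s w′ w≢ a c (old? w′))
    where
    there′ : ∀ e s w → w ≢ R i → adj M (R i) w ≡ e → side M w ≡ s → Dec (∃ λ j → R j ≡ w) → Has N (R′ i) e s
    there′ e s w w≢ a c (yes (j , refl)) = R′ j , (λ p → w≢ (from p)) , trans (sym (R-adj i j)) a , trans (side-R′ j) c
    there′ e s w w≢ a c (no new) =
      let w′ , o , _ , _ , m , c′ = find w (out-of new) z₁ z₁∉ true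
      in w′ , o i , trans (adjacent-sym G′ (R′ i) w′) (trans (m i) (trans (adjacent-sym G w (R i)) a)) , trans c′ c
    back : ∀ e s w′ → w′ ≢ R′ i → adj N (R′ i) w′ ≡ e → side N w′ ≡ s → Dec (∃ λ j → R′ j ≡ w′) → Has M (R i) e s
    back e s w′ w≢ a c (yes (j , refl)) = R j , (λ p → w≢ (to p)) , trans (R-adj i j) a , trans (sym (side-R′ j)) c
    back e s w′ w≢ a c (no new) =
      let v , o , m , c′ = side-compat w′ (out-of′ new)
      in v , o i , trans (adjacent-sym G (R i) v) (trans (m i) (trans (adjacent-sym G′ w′ (R′ i)) a)) , trans c′ c
  fwd : ∀ v → ∃ λ u → SameType M v N u
  fwd v = let i , t = reps v in R′ i , SameType-trans {M} {v} {M} {R i} {N} {R′ i} t (R≈R′ i)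
  outer : Monochrome M R ⊎ Rich M R → ∀ v′ → Out′ v′ → ∃ λ v → SameType M v N v′
  outer (inj₁ (s₀ , mono)) v′ out′ =
    let v , out , m = match v′
        u , outᵤ , _ , cᵤ = side-compat v′ out′
    in v , trans (mono v out) (trans (sym (mono u outᵤ)) cᵤ) ,
       λ e s → (λ (w , w≢ , a , c) → there′ v m e s w w≢ a c (new? w)) , (λ (w′ , w≢ , a , c) → back v out m e s w′ w≢ a c (old? w′))
    where
    there′ : ∀ v → (∀ i → adjacent G v (R i) ≡ adjacent G′ v′ (R′ i)) → ∀ e s w → w ≢ v → adj M v w ≡ e → side M w ≡ s → Dec (∃ λ j → R j ≡ w) → Has N v′ e s
    there′ v m e s w w≢ a c (yes (j , refl)) = R′ j , (λ p → out′ j (sym p)) , trans (sym (m j)) a , trans (side-R′ j) c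
    there′ v m e s w w≢ a c (no new) =
      let w′ , _ , w′≢ , a′ , _ , c′ = find w (out-of new) v′ out′ e
      in w′ , w′≢ , trans (adjacent-sym G′ v′ w′) a′ , trans c′ c
    back : ∀ v → Out v → (∀ i → adjacent G v (R i) ≡ adjacent G′ v′ (R′ i)) → ∀ e s w′ → w′ ≢ v′ → adj N v′ w′ ≡ e → side N w′ ≡ s → Dec (∃ λ j → R′ j ≡ w′) → Has M v e s
    back v out m e s w′ w≢ a c (yes (j , refl)) = R j , (λ p → out j (sym p)) , trans (m j) a , trans (sym (side-R′ j)) c
    back v out m e s w′ w≢ a c (no new) =
      let u , outᵤ , _ , cᵤ = side-compat w′ (out-of′ new)
          w , h = ext (suc k) (ℕ.m≤n+m (suc k) 2) (v ◂ R) (e ◂ (λ _ → false)) (◂-consistent const-consistent (λ i p → contradiction p (out i)))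
      in w , proj₁ (h zero) , trans (adjacent-sym G v w) (proj₂ (h zero)) ,
         trans (mono w (λ i → proj₁ (h (suc i)))) (trans (sym (mono u outᵤ)) (trans cᵤ c))
  outer (inj₂ (both , full)) v′ out′ =
    let v , c , h = full (side N v′)
    in v , c , λ e s → (λ _ → let u , outᵤ , cᵤ = both s
                                  w′ , _ , w′≢ , a , _ , c′ = find u outᵤ v′ out′ e
                              in w′ , w′≢ , trans (adjacent-sym G′ v′ w′) a , trans c′ cᵤ) , (λ _ → h e s)
  bwd : ∀ v′ → ∃ λ v → SameType M v N v′
  bwd v′ = cases (old? v′)
    where
    cases : Dec (∃ λ i → R′ i ≡ v′) → ∃ λ v → SameType M v N v′
    cases (yes (i , refl)) = R i , R≈R′ i
    cases (no new) = outer alt v′ (out-of′ new)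

-- Colourings with a homogeneous colour class

-- The flag `t e` says whether some outside vertex is joined in colour `e` to the whole homogeneous
-- side. The fields `leave`, `stay` and `mixed` provide everything else that can occur.
record Shape (M : Coloured) (s c : Bool) (t : Bool → Bool) : Set where
  field
    homogeneous : ∀ a b → a ≢ b → side M a ≡ s → side M b ≡ s → adj M a b ≡ c
    pair        : ∃ λ a → ∃ λ b → a ≢ b × side M a ≡ s × side M b ≡ s
    leave       : ∀ a e → side M a ≡ s → Has M a e (not s)
    stay        : ∀ b e → side M b ≡ not s → Has M b e (not s)
    mixed       : ∃ λ b → side M b ≡ not s × ∀ e → Has M b e s
    uniform     : ∀ e → t e ≡ true → ∃ λ b → side M b ≡ not s × ∀ a → side M a ≡ s → adj M b a ≡ e
    diverse     : ∀ e → t e ≡ false → ∀ b → side M b ≡ not s → ∃ λ a → side M a ≡ s × adj M b a ≡ not e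

different-sides : ∀ {M s a b} → side M a ≡ s → side M b ≡ not s → a ≢ b
different-sides p q refl = Bool.not-¬ p q

-- The parameters determine the types. A vertex of the homogeneous side sees only `c` on its own
-- side and everything on the other. An outside vertex sees everything on its own side, and on the
-- homogeneous side either both adjacencies or a single `e`; the latter happens just when `t e` is
-- set.
Shape⇒types : ∀ {M N s c t} → Shape M s c t → Shape N s c t → ∀ v → ∃ λ u → SameType M v N u
Shape⇒types {M} {N} {s} {c} {t} S T v = go (side M v Bool.≟ s)
  where
  module S = Shape S
  module T = Shape T
  Inside : ∀ {M} → Shape M s c t → ∀ a → side M a ≡ s → ∀ e → (Has M a e s → e ≡ c) × (e ≡ c → Has M a e s)
  Inside {M} Q a p e = (λ (w , w≢a , ae , q) → trans (sym ae) (Q.homogeneous a w (w≢a ∘ sym) p q)) , λ { refl → other Q.pair }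
    where
    module Q = Shape Q
    other : (∃ λ x → ∃ λ y → x ≢ y × side M x ≡ s × side M y ≡ s) → Has M a c s
    other (x , y , x≢y , px , py) with x Fin.≟ a
    ... | no x≢a = x , x≢a , Q.homogeneous a x (x≢a ∘ sym) p px , px
    ... | yes refl = y , x≢y ∘ sym , Q.homogeneous x y x≢y px py , py
  Uniform : ∀ {M} → Shape M s c t → ∀ b e₀ → side M b ≡ not s → (∀ a → side M a ≡ s → adj M b a ≡ e₀) → ∀ e → (Has M b e s → e ≡ e₀) × (e ≡ e₀ → Has M b e s)
  Uniform {M} S b e₀ p u e = (λ (w , _ , ae , q) → trans (sym ae) (u w q)) ,
    λ { refl → let x , _ , _ , px , _ = Shape.pair S in x , different-sides {M} px p , u x px , px }
  by-side : ∀ {M N v u} → (∀ e → (Has M v e s → Has N u e s) × (Has N u e s → Has M v e s)) →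
    (∀ e → Has M v e (not s)) → (∀ e → Has N u e (not s)) → ∀ e s′ → (Has M v e s′ → Has N u e s′) × (Has N u e s′ → Has M v e s′)
  by-side h p q e s′ with s′ Bool.≟ s
  ... | yes refl = h e
  ... | no s′≢s with Bool.¬-not s′≢s
  ... | refl = (λ _ → q e) , (λ _ → p e)
  go : Dec (side M v ≡ s) → ∃ λ u → SameType M v N u
  go (yes p) = let x , _ , _ , px , _ = T.pair in x , trans p (sym px) ,
    by-side {M} {N} {v} {x} (λ e → let f , g = Inside S v p e ; f′ , g′ = Inside T x px e in g′ ∘ f , g ∘ f′)
      (λ e → S.leave v e p) (λ e → T.leave x e px)
  go (no ¬p) = outer (has? M v true s) (has? M v false s)
    where
    p : side M v ≡ not s
    p = Bool.¬-not ¬p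
    one-colour : ∀ e₀ → ¬ Has M v (not e₀) s → ∃ λ u → SameType M v N u
    one-colour e₀ ¬h = with-t (t e₀) refl
      where
      all-e₀ : ∀ a → side M a ≡ s → adj M v a ≡ e₀
      all-e₀ a q = lemma (adj M v a Bool.≟ e₀)
        where
        lemma : Dec (adj M v a ≡ e₀) → adj M v a ≡ e₀
        lemma (yes e) = e
        lemma (no ne) = contradiction (a , different-sides {M} q p , Bool.¬-not ne , q) ¬h
      with-t : ∀ b → t e₀ ≡ b → ∃ λ u → SameType M v N u
      with-t true te = let u , q , h = T.uniform e₀ te in u , trans p (sym q) ,
        by-side {M} {N} {v} {u} (λ e → let f , g = Uniform S v e₀ p all-e₀ e ; f′ , g′ = Uniform T u e₀ q h e in g′ ∘ f , g ∘ f′)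
          (λ e → S.stay v e p) (λ e → T.stay u e q)
      with-t false te = let a , q , ae = S.diverse e₀ te v p in contradiction (a , different-sides {M} q p , ae , q) ¬h
    outer : Dec (Has M v true s) → Dec (Has M v false s) → ∃ λ u → SameType M v N u
    outer (yes h₁) (yes h₂) = let u , q , h = T.mixed in u , trans p (sym q) ,
      by-side {M} {N} {v} {u} (λ { true → (λ _ → h true) , (λ _ → h₁) ; false → (λ _ → h false) , (λ _ → h₂) })
        (λ e → S.stay v e p) (λ e → T.stay u e q)
    outer _ (no ¬h) = one-colour true ¬h
    outer (no ¬h) (yes _) = one-colour false ¬h

Shape⇒SameCode : ∀ {M N s c t} → Shape M s c t → Shape N s c t → SameCode M N
Shape⇒SameCode {M} {N} S T = Shape⇒types S T , λ u → let v , h = Shape⇒types T S u in v , SameType-sym {N} {u} {M} {v} h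

-- A vertex joined in colour `not c` to a member of the homogeneous side cannot lie on that side.
-- The extension property yields such vertices with one more adjacency prescribed, which gives
-- `leave`, `stay` and `mixed`.
homogeneous⇒Shape : ∀ {r} M → Ext r (graph M) → 3 ℕ.≤ r → ∀ s c t →
  (∀ a b → a ≢ b → side M a ≡ s → side M b ≡ s → adj M a b ≡ c) →
  (∃ λ a → ∃ λ b → a ≢ b × side M a ≡ s × side M b ≡ s) →
  (∀ e → t e ≡ true → ∃ λ b → side M b ≡ not s × ∀ a → side M a ≡ s → adj M b a ≡ e) →
  (∀ e → t e ≡ false → ∀ b → side M b ≡ not s → ∃ λ a → side M a ≡ s × adj M b a ≡ not e) → Shape M s c t
homogeneous⇒Shape M ext 3≤r s c t hom′ pair@(x , y , x≢y , px , py) uni div = record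
  { homogeneous = hom′ ; pair = pair ; leave = leave ; stay = stay ; mixed = mixed ; uniform = uni ; diverse = div }
  where
  G = graph M
  2≤r = ℕ.≤-trans (ℕ.n≤1+n 2) 3≤r
  outside : ∀ {a w} → side M a ≡ s → w ≢ a → adjacent G w a ≡ not c → side M w ≡ not s
  outside {a} {w} p w≢a e = Bool.¬-not (λ q → Bool.not-¬ (hom′ w a w≢a q p) e)
  leave : ∀ a e → side M a ≡ s → Has M a e (not s)
  leave a e p with x Fin.≟ a
  ... | no x≢a = let w , w≢a , w≢x , ea , ex = ext₂ G ext 2≤r (x≢a ∘ sym) e (not c)
                 in w , w≢a , trans (adjacent-sym G a w) ea , outside px w≢x ex
  ... | yes refl = let w , w≢x , w≢y , ex , ey = ext₂ G ext 2≤r x≢y e (not c)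
                   in w , w≢x , trans (adjacent-sym G x w) ex , outside py w≢y ey
  stay : ∀ b e → side M b ≡ not s → Has M b e (not s)
  stay b e p = let w , w≢b , w≢x , eb , ex = ext₂ G ext 2≤r (different-sides {M} px p ∘ sym) e (not c)
               in w , w≢b , trans (adjacent-sym G b w) eb , outside px w≢x ex
  mixed : ∃ λ b → side M b ≡ not s × ∀ e → Has M b e s
  mixed = let w , w≢x , w≢y , ex , ey = ext₂ G ext 2≤r x≢y c (not c)
              has : ∀ e → Dec (e ≡ c) → Has M w e s
              has = λ { e (yes refl) → x , w≢x ∘ sym , ex , px ; e (no ne) → y , w≢y ∘ sym , trans ey (sym (Bool.¬-not ne)) , py }
          in w , outside py w≢y ey , λ e → has e (e Bool.≟ c)

-- A vertex that misses a pair is joined uniformly to one of the sides. Two distinct vertices cannot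
-- be uniform to different sides, since a vertex joined wrongly to both would have no side. Once
-- uniformity to the opposite side is excluded, all vertices of side `s` are uniform to `s`, and any
-- two of them agree on the colour.
no-full⇒homogeneous : ∀ {r} M → Ext r (graph M) → 3 ℕ.≤ r → ∀ s →
  (∀ s → ∃ λ a → ∃ λ b → a ≢ b × side M a ≡ s × side M b ≡ s) →
  ¬ (∃ λ v → side M v ≡ s × ∀ e s′ → Has M v e s′) →
  ∃ λ c → ∀ a b → a ≢ b → side M a ≡ s → side M b ≡ s → adj M a b ≡ c
no-full⇒homogeneous M ext 3≤r s pairs none-full =
  let x , y , x≢y , px , py = pairs s
      c , hx = inner x px
  in c , λ a b a≢b pa pb → let cₐ , hₐ = inner a pa in
     trans (hₐ b (a≢b ∘ sym) pb) (same-colour x px c hx a pa cₐ hₐ)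
  where
  G = graph M
  2≤r = ℕ.≤-trans (ℕ.n≤1+n 2) 3≤r
  Uni : V M → Bool → Bool → Set
  Uni a c s′ = ∀ w → w ≢ a → side M w ≡ s′ → adj M a w ≡ c
  some-uniform : ∀ a → side M a ≡ s → ∃ λ c → ∃ λ s′ → Uni a c s′
  some-uniform a p = go (has? M a true true) (has? M a true false) (has? M a false true) (has? M a false false)
    where
    uni : ∀ e s′ → ¬ Has M a e s′ → Uni a (not e) s′
    uni e s′ ¬h w w≢a q = Bool.¬-not (λ ae → ¬h (w , w≢a , ae , q))
    go : Dec (Has M a true true) → Dec (Has M a true false) → Dec (Has M a false true) → Dec (Has M a false false) → ∃ λ c → ∃ λ s′ → Uni a c s′
    go (no h) _ _ _ = false , true , uni true true h
    go (yes _) (no h) _ _ = false , false , uni true false h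
    go (yes _) (yes _) (no h) _ = true , true , uni false true h
    go (yes _) (yes _) (yes _) (no h) = true , false , uni false false h
    go (yes a₁) (yes a₂) (yes a₃) (yes a₄) = contradiction
      (a , p , λ { true true → a₁ ; true false → a₂ ; false true → a₃ ; false false → a₄ }) none-full
  clash : ∀ {a b c d s₁} → a ≢ b → Uni a c s₁ → ¬ Uni b d (not s₁)
  clash {a} {b} {c} {d} {s₁} a≢b u u′ =
    let w , w≢a , w≢b , ea , eb = ext₂ G ext 2≤r a≢b (not c) (not d)
        ¬in = λ q → Bool.not-¬ (u w w≢a q) (trans (adjacent-sym G a w) ea)
    in Bool.not-¬ (u′ w w≢b (Bool.¬-not ¬in)) (trans (adjacent-sym G b w) eb)
  inner : ∀ a → side M a ≡ s → ∃ λ c → Uni a c s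
  inner a p = let c , s′ , u = some-uniform a p in go c s′ u (s′ Bool.≟ s)
    where
    go : ∀ c s′ → Uni a c s′ → Dec (s′ ≡ s) → ∃ λ c → Uni a c s
    go c s′ u (yes refl) = c , u
    go c s′ u (no ne) = ⊥-elim (absurd (subst (Uni a c) (Bool.¬-not ne) u))
      where
      absurd : ¬ Uni a c (not s)
      absurd u′ =
        let b₁ , b₂ , b₁≢b₂ , p₁ , p₂ = pairs (not s)
            -- Joined wrongly to a, the vertex w lies on side `s`; differing on b₁ and b₂, it is not
            -- uniform to the opposite side, so it is uniform to `s` and clashes with a.
            w , w≢a , w≢b₁ , w≢b₂ , ea , e₁ , e₂ = ext₃ G ext 3≤r (different-sides {M} p p₁) (different-sides {M} p p₂) b₁≢b₂ (not c) true false
            w-in = λ q → Bool.not-¬ (u′ w w≢a q) (trans (adjacent-sym G a w) ea)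
            pw = trans (Bool.¬-not w-in) (Bool.not-involutive s)
            d , s″ , uw = some-uniform w pw
        in split d s″ uw (s″ Bool.≟ s) w≢a w≢b₁ w≢b₂ p₁ p₂ e₁ e₂
        where
        split : ∀ {w b₁ b₂} d s″ → Uni w d s″ → Dec (s″ ≡ s) → w ≢ a → w ≢ b₁ → w ≢ b₂ → side M b₁ ≡ not s → side M b₂ ≡ not s →
          adjacent G w b₁ ≡ true → adjacent G w b₂ ≡ false → ⊥
        split d s″ uw (yes refl) w≢a _ _ _ _ _ _ = clash w≢a uw u′
        split d s″ uw (no ne′) _ w≢b₁ w≢b₂ p₁ p₂ e₁ e₂ =
          let uw′ = subst (Uni _ d) (Bool.¬-not ne′) uw
          in case trans (sym e₁) (trans (uw′ _ (w≢b₁ ∘ sym) p₁) (trans (sym (uw′ _ (w≢b₂ ∘ sym) p₂)) e₂)) of λ ()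
  same-colour : ∀ x → side M x ≡ s → ∀ c → Uni x c s → ∀ a → side M a ≡ s → ∀ cₐ → Uni a cₐ s → cₐ ≡ c
  same-colour x px c hx a pa cₐ hₐ = go (a Fin.≟ x)
    where
    go : Dec (a ≡ x) → cₐ ≡ c
    go (no a≢x) = trans (sym (hₐ x (a≢x ∘ sym) px)) (trans (adjacent-sym G a x) (hx a a≢x pa))
    go (yes refl) =
      let y , z , y≢z , py , pz = pairs s
          o , o≢a , po = other y z y≢z py pz (y Fin.≟ a)
      in trans (sym (hₐ o o≢a po)) (hx o o≢a po)
      where
      other : ∀ y z → y ≢ z → side M y ≡ s → side M z ≡ s → Dec (y ≡ a) → ∃ λ o → o ≢ a × side M o ≡ s
      other y z y≢z py pz (no y≢a) = y , y≢a , py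
      other y z y≢z py pz (yes refl) = z , y≢z ∘ sym , pz

-- The order that `transfer` asks for, with one representative for each possible type.
Typical : ∀ {n} → Graph n → Set
Typical = Ext (3 ℕ.+ typeCount)

Transferable : Coloured → Set
Transferable M = ∀ n (G : Graph n) → Typical G → ∃ λ X → SameCode M (coloured G X)

-- If a colour does not occur outside the representatives, or if both sides contain a vertex of full
-- type, the coloured graph transfers; otherwise a side without such a vertex is homogeneous.
dichotomy : ExcludedMiddle 0ℓ → ∀ M → Typical (graph M) → Transferable M ⊎ ∃ λ s → ∃ λ c → ∃ λ t → Shape M s c t
dichotomy em M ext = go em em
  where
  3≤r : 3 ℕ.≤ 3 ℕ.+ typeCount
  3≤r = ℕ.m≤m+n 3 typeCount
  v₀ : V M
  v₀ = proj₁ (ext 0 ℕ.z≤n none none (λ ()))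
  R = proj₁ (representatives M v₀)
  reps = proj₂ (representatives M v₀)
  Escapes : Bool → Set
  Escapes s = ∃ λ v → (∀ i → v ≢ R i) × side M v ≡ s
  move : Monochrome M R ⊎ Rich M R → Transferable M
  move alt n G = transfer em M R reps alt ext G
  shape : ∀ s → (∀ s → ∃ λ a → ∃ λ b → a ≢ b × side M a ≡ s × side M b ≡ s) →
    ¬ (∃ λ v → side M v ≡ s × ∀ e s′ → Has M v e s′) → ∃ λ s → ∃ λ c → ∃ λ t → Shape M s c t
  shape s pairs none-full =
    let c , hom′ = no-full⇒homogeneous M ext 3≤r s pairs none-full
    in s , c , (λ e → does (uni? e)) , homogeneous⇒Shape M ext 3≤r s c (λ e → does (uni? e)) hom′ (pairs s)
         (λ e → witness (uni? e)) (λ e → no-witness e (uni? e))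
    where
    Uni : Bool → Set
    Uni e = ∃ λ b → side M b ≡ not s × ∀ a → side M a ≡ s → adj M b a ≡ e
    uni? : ∀ e → Dec (Uni e)
    uni? e = em
    witness : ∀ {e} (d : Dec (Uni e)) → does d ≡ true → Uni e
    witness (yes u) _ = u
    no-witness : ∀ e (d : Dec (Uni e)) → does d ≡ false → ∀ b → side M b ≡ not s → ∃ λ a → side M a ≡ s × adj M b a ≡ not e
    no-witness e (no ¬u) _ b p = search (Fin.any? λ a → (side M a Bool.≟ s) ×-dec (adj M b a Bool.≟ not e))
      where
      search : Dec (∃ λ a → side M a ≡ s × adj M b a ≡ not e) → ∃ λ a → side M a ≡ s × adj M b a ≡ not e
      search (yes h) = h
      search (no ¬h) = contradiction (b , p , λ a q → decide a q (adj M b a Bool.≟ e)) ¬u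
        where
        decide : ∀ a → side M a ≡ s → Dec (adj M b a ≡ e) → adj M b a ≡ e
        decide a q (yes x) = x
        decide a q (no x) = contradiction (a , q , Bool.¬-not x) ¬h
  go : Dec (Escapes true) → Dec (Escapes false) → Transferable M ⊎ ∃ λ s → ∃ λ c → ∃ λ t → Shape M s c t
  go (no ¬h) _ = inj₁ (move (inj₁ (false , λ v out → Bool.¬-not (λ p → ¬h (v , out , p)))))
  go (yes _) (no ¬h) = inj₁ (move (inj₁ (true , λ v out → Bool.¬-not (λ p → ¬h (v , out , p)))))
  go (yes h₁) (yes h₀) = full em em
    where
    escape : ∀ s → Escapes s
    escape true = h₁
    escape false = h₀
    pairs : ∀ s → ∃ λ a → ∃ λ b → a ≢ b × side M a ≡ s × side M b ≡ s
    -- An outside vertex and its representative are two vertices on the same side.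
    pairs s = let v , out , p = escape s
                  i , same-side , _ = reps v
              in v , R i , out i , p , trans (sym same-side) p
    full : Dec (∃ λ v → side M v ≡ true × ∀ e s′ → Has M v e s′) → Dec (∃ λ v → side M v ≡ false × ∀ e s′ → Has M v e s′) →
      Transferable M ⊎ ∃ λ s → ∃ λ c → ∃ λ t → Shape M s c t
    full (no ¬f) _ = inj₂ (shape true pairs ¬f)
    full (yes _) (no ¬f) = inj₂ (shape false pairs ¬f)
    full (yes f₁) (yes f₀) = inj₁ (move (inj₂ (escape , λ { true → f₁ ; false → f₀ })))

-- Rare events, and the extension property of the random graph

-- A majorant of the indicator with small expectation stands for a small probability. This makes
-- sense for properties without a decision procedure, and union bounds become sums of majorants.
Rare : ℚ → (Bool → ℚ) → ∀ {n} → (Graph n → Set) → Set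
Rare ε w {n} P = ∃ λ (f : Graph n → ℚ) → (∀ G → 0ℚ ≤ f G) × (∀ G → P G → 1ℚ ≤ f G) × graphE w f ≤ ε

rare-⊆ : ∀ {ε w n} {P Q : Graph n → Set} → (∀ G → P G → Q G) → Rare ε w Q → Rare ε w P
rare-⊆ sub (f , f≥0 , f≥1 , Ef) = f , f≥0 , (λ G p → f≥1 G (sub G p)) , Ef

rare-≤ : ∀ {ε δ w n} {P : Graph n → Set} → ε ≤ δ → Rare ε w P → Rare δ w P
rare-≤ ε≤δ (f , f≥0 , f≥1 , Ef) = f , f≥0 , f≥1 , ≤-trans Ef ε≤δ

rare-∪ : ∀ {ε δ w n} {P Q : Graph n → Set} → Rare ε w P → Rare δ w Q → Rare (ε + δ) w (λ G → P G ⊎ Q G)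
rare-∪ {w = w} (f , f≥0 , f≥1 , Ef) (g , g≥0 , g≥1 , Eg) = (λ G → f G + g G) , (λ G → +-nonneg (f≥0 G) (g≥0 G)) ,
  (λ { G (inj₁ p) → ≤-trans (f≥1 G p) (≤-+ʳ (g≥0 G)) ; G (inj₂ q) → ≤-trans (g≥1 G q) (≤-+ˡ (f≥0 G)) }) ,
  subst (_≤ _) (sym (graphE-+ w f g)) (+-mono-≤ Ef Eg)

-- Prescribed adjacency patterns and the union bound over them

Pattern : ℕ → Set
Pattern = Vec (Maybe Bool)

dom : ∀ {n} → Pattern n → Vec Bool n
dom [] = []
dom (just _ ∷ π) = true ∷ dom π
dom (nothing ∷ π) = false ∷ dom π

matches : ∀ {n} → Pattern n → Vec Bool n → Bool
matches [] [] = true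
matches (just c ∷ π) (b ∷ v) = same c b ∧ matches π v
matches (nothing ∷ π) (b ∷ v) = matches π v

matches-local : ∀ {n} (π : Pattern n) v → matches π v ≡ matches π (mask (dom π) v)
matches-local [] [] = refl
matches-local (just c ∷ π) (b ∷ v) = cong (same c b ∧_) (matches-local π v)
matches-local (nothing ∷ π) (b ∷ v) = matches-local π v

matches-sound : ∀ {n} (π : Pattern n) v → matches π v ≡ true → ∀ i {c} → lookup π i ≡ just c → lookup v i ≡ c
matches-sound (just c ∷ π) (b ∷ v) e zero refl = same⇒≡ (proj₁ (∧-true e))
matches-sound (just c ∷ π) (b ∷ v) e (suc i) l = matches-sound π v (proj₂ (∧-true {same c b} e)) i l
matches-sound (nothing ∷ π) (b ∷ v) e (suc i) l = matches-sound π v e i l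

opaque
  unfolding rowE

  rowE-matches : ∀ {w ω} → IsDistribution w → 0ℚ ≤ ω → (∀ b → ω ≤ w b) → ∀ {n} (π : Pattern n) → ω ^ size (dom π) ≤ rowE w (λ v → 𝟙 (matches π v))
  rowE-matches d 0≤ω h [] = ≤-refl
  rowE-matches {w} {ω} d 0≤ω h {suc n} (just true ∷ π) = subst (ω * ω ^ size (dom π) ≤_)
    (sym (trans (cong (w true * rowE w (λ v → 𝟙 (matches π v)) +_) (trans (cong (w false *_) (rowE-0 w {n})) (zeroʳ _))) (+-identityʳ _)))
    (*-mono-≤ 0≤ω (h true) (^-nonneg (size (dom π)) 0≤ω) (rowE-matches d 0≤ω h π))
  rowE-matches {w} {ω} d 0≤ω h {suc n} (just false ∷ π) = subst (ω * ω ^ size (dom π) ≤_)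
    (sym (trans (cong (_+ w false * rowE w (λ v → 𝟙 (matches π v))) (trans (cong (w true *_) (rowE-0 w {n})) (zeroʳ _))) (+-identityˡ _)))
    (*-mono-≤ 0≤ω (h false) (^-nonneg (size (dom π)) 0≤ω) (rowE-matches d 0≤ω h π))
  rowE-matches d 0≤ω h (nothing ∷ π) = subst (_ ≤_) (sym (IsDistribution.average d _)) (rowE-matches d 0≤ω h π)

opaque
  patterns : ∀ {n} → ℕ → (Pattern n → ℚ) → ℚ
  patterns {zero} zero f = f []
  patterns {zero} (suc j) f = 0ℚ
  patterns {suc n} zero f = patterns zero (f ∘ (nothing ∷_))
  patterns {suc n} (suc j) f = patterns j (f ∘ (just true ∷_)) + patterns j (f ∘ (just false ∷_)) + patterns (suc j) (f ∘ (nothing ∷_))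

  patterns-nonneg : ∀ {n} j {f : Pattern n → ℚ} → (∀ π → 0ℚ ≤ f π) → 0ℚ ≤ patterns j f
  patterns-nonneg {zero} zero e = e []
  patterns-nonneg {zero} (suc j) e = ≤-refl
  patterns-nonneg {suc n} zero e = patterns-nonneg zero (e ∘ (nothing ∷_))
  patterns-nonneg {suc n} (suc j) e = +-nonneg (+-nonneg (patterns-nonneg j (e ∘ (just true ∷_))) (patterns-nonneg j (e ∘ (just false ∷_)))) (patterns-nonneg (suc j) (e ∘ (nothing ∷_)))

  ≤-patterns : ∀ {n} {f : Pattern n → ℚ} → (∀ π → 0ℚ ≤ f π) → ∀ π → f π ≤ patterns (size (dom π)) f
  ≤-patterns e [] = ≤-refl
  ≤-patterns e (just true ∷ π) = ≤-trans (≤-patterns (e ∘ (just true ∷_)) π)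
    (≤-trans (≤-+ʳ (patterns-nonneg _ (e ∘ (just false ∷_)))) (≤-+ʳ (patterns-nonneg _ (e ∘ (nothing ∷_)))))
  ≤-patterns e (just false ∷ π) = ≤-trans (≤-patterns (e ∘ (just false ∷_)) π)
    (≤-trans (≤-+ˡ (patterns-nonneg _ (e ∘ (just true ∷_)))) (≤-+ʳ (patterns-nonneg _ (e ∘ (nothing ∷_)))))
  ≤-patterns {f = f} e (nothing ∷ π) = ≤-trans (≤-patterns (e ∘ (nothing ∷_)) π) (go (size (dom π)))
    where
    go : ∀ j → patterns j (f ∘ (nothing ∷_)) ≤ patterns j f
    go zero = ≤-refl
    go (suc j) = ≤-+ˡ (+-nonneg (patterns-nonneg j (e ∘ (just true ∷_))) (patterns-nonneg j (e ∘ (just false ∷_))))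

  -- Each of the j prescribed entries has a place and a value, so there are at most (2n)ʲ patterns.
  patterns-bound : ∀ {n} j {f : Pattern n → ℚ} {c} → 0ℚ ≤ c → (∀ π → size (dom π) ≡ j → f π ≤ c) → patterns j f ≤ (ι n + ι n) ^ j * c
  patterns-bound {zero} zero {c = c} 0≤c h = subst (_ ≤_) (sym (*-identityˡ c)) (h [] refl)
  patterns-bound {zero} (suc j) 0≤c h = *-nonneg (^-nonneg (suc j) (+-nonneg ≤-refl ≤-refl)) 0≤c
  patterns-bound {suc n} zero 0≤c h = patterns-bound {n} zero 0≤c (λ π e → h (nothing ∷ π) e)
  patterns-bound {suc n} (suc j) {c = c} 0≤c h = ≤-trans
    (+-mono-≤ (+-mono-≤ (patterns-bound j 0≤c (λ π e → h (just true ∷ π) (cong suc e))) (patterns-bound j 0≤c (λ π e → h (just false ∷ π) (cong suc e))))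
      (patterns-bound (suc j) 0≤c (λ π e → h (nothing ∷ π) e)))
    (≤-trans (≤-reflexive (solve 3 (λ n x c → x :* c :+ x :* c :+ (n :+ n) :* x :* c := (con 1ℚ :+ n :+ (con 1ℚ :+ n)) :* x :* c) refl (ι n) ((ι n + ι n) ^ j) c))
      (*-monoʳ-≤ 0≤c (*-monoˡ-≤ (+-nonneg (ι-nonneg (suc n)) (ι-nonneg (suc n)))
        (^-mono j (+-nonneg (ι-nonneg n) (ι-nonneg n)) (+-mono-≤ (≤-+ˡ 0≤1) (≤-+ˡ 0≤1))))))

  patterns-graphE : ∀ w {n m} j (f : Pattern m → Graph n → ℚ) → graphE w (λ G → patterns j (λ π → f π G)) ≡ patterns j (λ π → graphE w (f π))
  patterns-graphE w {m = zero} zero f = refl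
  patterns-graphE w {n} {m = zero} (suc j) f = graphE-0 w {n}
  patterns-graphE w {m = suc m} zero f = patterns-graphE w zero (f ∘ (nothing ∷_))
  patterns-graphE w {m = suc m} (suc j) f = trans (graphE-+ w _ _) (cong₂ _+_
    (trans (graphE-+ w _ _) (cong₂ _+_ (patterns-graphE w j (f ∘ (just true ∷_))) (patterns-graphE w j (f ∘ (just false ∷_)))))
    (patterns-graphE w (suc j) (f ∘ (nothing ∷_))))

unmatched : ∀ {n} → Pattern n → Graph n → ℚ
unmatched {n} π G = ∏ n (λ i → outside-of (dom π) i (1ℚ - 𝟙 (matches π (nbr G i))))

1-𝟙-nonneg : ∀ b → 0ℚ ≤ 1ℚ - 𝟙 b
1-𝟙-nonneg b = ≤⇒0≤ (𝟙≤1 b)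

outside-nonneg : ∀ {n} (s : Vec Bool n) i {x} → 0ℚ ≤ x → 0ℚ ≤ outside-of s i x
outside-nonneg s i p with lookup s i
... | true = 0≤1
... | false = p

unmatched-nonneg : ∀ {n} (π : Pattern n) G → 0ℚ ≤ unmatched π G
unmatched-nonneg {n} π G = ∏-nonneg n (λ i → outside-nonneg (dom π) i (1-𝟙-nonneg (matches π (nbr G i))))

rowE-complement : ∀ {w} → IsDistribution w → ∀ {n} (f : Vec Bool n → ℚ) → rowE w (λ v → 1ℚ - f v) ≡ 1ℚ - rowE w f
rowE-complement {w} d f = trans (rowE-cong w (λ v → solve 1 (λ x → con 1ℚ :- x := con 1ℚ :+ (:- con 1ℚ) :* x) refl (f v)))
  (trans (rowE-+ w (λ _ → 1ℚ) (λ v → (- 1ℚ) * f v)) (trans (cong₂ _+_ (rowE-const d 1ℚ) (rowE-*ˡ w (- 1ℚ) f))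
    (solve 1 (λ x → con 1ℚ :+ (:- con 1ℚ) :* x := con 1ℚ :- x) refl (rowE w f))))

complement-anti : ∀ {a b} → a ≤ b → 1ℚ - b ≤ 1ℚ - a
complement-anti {a} {b} p = ≤-by (b - a) (≤⇒0≤ p) (solve 2 (λ a b → con 1ℚ :- a := con 1ℚ :- b :+ (b :- a)) refl a b)

-- Vertices outside the domain match the pattern independently, each with probability at least ω to
-- the size of the domain.
graphE-unmatched : ∀ {w ω} → IsDistribution w → 0ℚ ≤ ω → (∀ b → ω ≤ w b) → ∀ {n} (π : Pattern n) →
  graphE w (unmatched π) ≤ (1ℚ - ω ^ size (dom π)) ^ co-size (dom π)
graphE-unmatched {w} {ω} d 0≤ω h {n} π = subst (_≤ (1ℚ - ω ^ size (dom π)) ^ co-size (dom π)) (sym E≡)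
  (^-mono (co-size (dom π)) (subst (0ℚ ≤_) (rowE-complement d _) (rowE-nonneg (IsDistribution.nonneg d) (λ v → 1-𝟙-nonneg (matches π v))))
    (complement-anti (rowE-matches d 0≤ω h π)))
  where
  E≡ : graphE w (unmatched π) ≡ (1ℚ - rowE w (λ v → 𝟙 (matches π v))) ^ co-size (dom π)
  E≡ = trans (graphE-cong w (λ G → sym (*-identityˡ _)))
    (trans (graph-indep d (dom π) (λ _ → 1ℚ) (λ _ v → 1ℚ - 𝟙 (matches π v)) (λ _ → refl) (λ _ v → cong (λ b → 1ℚ - 𝟙 b) (matches-local π v)))
      (trans (cong₂ _*_ (graphE-const d 1ℚ) (∏-outside (dom π) (rowE w (λ v → 1ℚ - 𝟙 (matches π v)))))
        (trans (*-identityˡ _) (cong (_^ co-size (dom π)) (rowE-complement d _)))))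

size-update : ∀ {n} (π : Pattern n) i c → size (dom (π Vec.[ i ]≔ just c)) ℕ.≤ suc (size (dom π))
size-update (just _ ∷ π) zero c = ℕ.n≤1+n _
size-update (nothing ∷ π) zero c = ℕ.≤-refl
size-update (just _ ∷ π) (suc i) c = ℕ.s≤s (size-update π i c)
size-update (nothing ∷ π) (suc i) c = size-update π i c

size-empty : ∀ n → size (dom (Vec.replicate n nothing)) ≡ 0
size-empty zero = refl
size-empty (suc n) = size-empty n

pattern-of : ∀ {n} k (f : Fin k → Fin n) (b : Fin k → Bool) → Consistent f b →
  ∃ λ (π : Pattern n) → size (dom π) ℕ.≤ k × ∀ i → lookup π (f i) ≡ just (b i)
pattern-of {n} zero f b con′ = Vec.replicate n nothing , ℕ.≤-reflexive (size-empty n) , λ ()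
pattern-of (suc k) f b con′ =
  let π , l , h = pattern-of k (f ∘ suc) (b ∘ suc) (λ i j → con′ (suc i) (suc j))
  in π Vec.[ f zero ]≔ just (b zero) , ℕ.≤-trans (size-update π (f zero) (b zero)) (ℕ.s≤s l) ,
     λ { zero → Vec.lookup∘updateAt (f zero) π ; (suc i) → other π i (h i) (f (suc i) Fin.≟ f zero) }
  where
  other : ∀ π i → lookup π (f (suc i)) ≡ just (b (suc i)) → Dec (f (suc i) ≡ f zero) → lookup (π Vec.[ f zero ]≔ just (b zero)) (f (suc i)) ≡ just (b (suc i))
  other π i e (yes p) = trans (cong (lookup (π Vec.[ f zero ]≔ just (b zero))) p) (trans (Vec.lookup∘updateAt (f zero) π) (cong just (con′ zero (suc i) (sym p))))
  other π i e (no ¬p) = trans (Vec.lookup∘updateAt′ (f (suc i)) (f zero) ¬p π) e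

lookup-dom : ∀ {n} (π : Pattern n) i {c} → lookup π i ≡ just c → lookup (dom π) i ≡ true
lookup-dom (just _ ∷ π) zero e = refl
lookup-dom (just _ ∷ π) (suc i) e = lookup-dom π i e
lookup-dom (nothing ∷ π) (suc i) e = lookup-dom π i e

Unmatched : ∀ {n} → Pattern n → Graph n → Set
Unmatched π G = ∀ w → lookup (dom π) w ≡ false → matches π (nbr G w) ≡ false

unmatched-one : ∀ {n} (π : Pattern n) G → Unmatched π G → unmatched π G ≡ 1ℚ
unmatched-one {n} π G h = ∏-one n λ i → lemma i (lookup (dom π) i) refl
  where
  lemma : ∀ i b → lookup (dom π) i ≡ b → (if b then 1ℚ else (1ℚ - 𝟙 (matches π (nbr G i)))) ≡ 1ℚ
  lemma i true e = refl
  lemma i false e = trans (cong (λ b → 1ℚ - 𝟙 b) (h i e)) (solve 0 (con 1ℚ :- con 0ℚ := con 1ℚ) refl)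

¬Ext⇒Unmatched : ExcludedMiddle 0ℓ → ∀ {n t} (G : Graph n) → ¬ Ext t G → ∃ λ π → size (dom π) ℕ.≤ t × Unmatched π G
¬Ext⇒Unmatched em {n} {t} G ¬ext = go em
  where
  go : Dec (∃ λ π → size (dom π) ℕ.≤ t × Unmatched π G) → ∃ λ π → size (dom π) ℕ.≤ t × Unmatched π G
  go (yes h) = h
  go (no ¬h) = contradiction ext ¬ext
    where
    ext : Ext t G
    ext k k≤t f b con′ = search (Fin.any? λ w → (lookup (dom π) w Bool.≟ false) ×-dec (matches π (nbr G w) Bool.≟ true))
      where
      π : Pattern n
      π = proj₁ (pattern-of k f b con′)
      small : size (dom π) ℕ.≤ k
      small = proj₁ (proj₂ (pattern-of k f b con′))
      π-f : ∀ i → lookup π (f i) ≡ just (b i)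
      π-f = proj₂ (proj₂ (pattern-of k f b con′))
      search : Dec (∃ λ w → lookup (dom π) w ≡ false × matches π (nbr G w) ≡ true) → ∃ λ w → ∀ i → w ≢ f i × adjacent G w (f i) ≡ b i
      search (yes (w , out , m)) = w , λ i →
        (λ e → case trans (sym out) (trans (cong (lookup (dom π)) e) (lookup-dom π (f i) (π-f i))) of λ ()) ,
        trans (sym (lookup-nbr G w (f i))) (matches-sound π (nbr G w) m (f i) (π-f i))
      search (no ¬w) = contradiction (π , ℕ.≤-trans small k≤t , λ w out → Bool.¬-not (λ m → ¬w (w , out , m))) ¬h

record Bounded (ω : ℚ) (w : Bool → ℚ) : Set where
  field
    dist  : IsDistribution w
    lower : ∀ b → ω ≤ w b

rare-Unmatched : ∀ t {ω ε} → 0ℚ < ω → 0ℚ < ε → ∃ λ N → ∀ n → N ℕ.≤ n → ∀ w → Bounded ω w → Rare ε w {n} (λ G → ∃ λ π → size (dom π) ℕ.≤ t × Unmatched π G)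
rare-Unmatched t {ω} {ε} 0<ω 0<ε = N , bound
  where
  0≤ω = <⇒≤ 0<ω
  τ = ι (suc t)
  -- For l = n - t ≥ 1 one has n ≤ τl, hence (2n)ᵗ ≤ (2τ)ᵗlᵗ; the further τ counts the sizes from 0
  -- to t.
  C = τ * (τ + τ) ^ t
  0<C : 0ℚ < C
  0<C = *-pos (ι-pos t) (^-pos t (+-pos (ι-pos t) (<⇒≤ (ι-pos t))))
  ρ = 1ℚ - ω ^ t
  limit : 0ℚ ≤ ρ → ∃ λ N → ∀ l → N ℕ.≤ l → ι l ^ t * ρ ^ l ≤ ε * inv C
  limit 0≤ρ = poly*exp→0 t 0≤ρ (0<⇒< (subst (0ℚ <_) (solve 1 (λ x → x := con 1ℚ :- (con 1ℚ :- x)) refl (ω ^ t)) (^-pos t 0<ω))) (*-pos 0<ε (inv-pos 0<C))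
  -- That ω ≤ 1 is known only once a weight function is given, but N is chosen before. If ρ is
  -- negative there is no weight function to treat, and N may be anything.
  0≤ρ? : Dec (0ℚ ≤ ρ)
  0≤ρ? = 0ℚ ℚ.≤? ρ
  pickN : Dec (0ℚ ≤ ρ) → ℕ
  pickN (yes p) = proj₁ (limit p)
  pickN (no _) = 0
  N = t ℕ.+ suc (pickN 0≤ρ?)
  bound : ∀ n → N ℕ.≤ n → ∀ w → Bounded ω w → Rare ε w {n} (λ G → ∃ λ π → size (dom π) ℕ.≤ t × Unmatched π G)
  bound n N≤n w bd = f , f≥0 , f≥1 , Ef 0≤ρ? refl
    where
    module Bd = Bounded bd
    module D = IsDistribution Bd.dist
    ω≤1 : ω ≤ 1ℚ
    ω≤1 = ≤-trans (Bd.lower true) (D.≤1 true)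
    l = n ℕ.∸ t
    t≤n : t ℕ.≤ n
    t≤n = ℕ.≤-trans (ℕ.m≤m+n t _) N≤n
    n≡ : t ℕ.+ l ≡ n
    n≡ = ℕ.m+[n∸m]≡n t≤n
    l> : suc (pickN 0≤ρ?) ℕ.≤ l
    l> = ℕ.+-cancelˡ-≤ t _ _ (subst (N ℕ.≤_) (sym n≡) N≤n)
    1≤l : 1ℚ ≤ ι l
    1≤l = ≤-trans (1≤ι-suc 0) (ι-mono (ℕ.≤-trans (ℕ.s≤s ℕ.z≤n) l>))
    n≤τl : ι n ≤ τ * ι l
    n≤τl = subst (_≤ τ * ι l) (trans (sym (ι-+ t l)) (cong ι n≡))
      (≤-by (ι t * (ι l - 1ℚ)) (*-nonneg (ι-nonneg t) (≤⇒0≤ 1≤l)) (solve 2 (λ t l → (con 1ℚ :+ t) :* l := t :+ l :+ t :* (l :- con 1ℚ)) refl (ι t) (ι l)))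
    0≤ρ : 0ℚ ≤ ρ
    0≤ρ = ≤⇒0≤ (^≤1 t 0≤ω ω≤1)
    f : Graph n → ℚ
    f G = Sum (suc t) (λ j → patterns j (λ π → unmatched π G))
    f≥0 : ∀ G → 0ℚ ≤ f G
    f≥0 G = Sum-nonneg (suc t) (λ j → patterns-nonneg j (λ π → unmatched-nonneg π G))
    f≥1 : ∀ G → (∃ λ π → size (dom π) ℕ.≤ t × Unmatched π G) → 1ℚ ≤ f G
    f≥1 G (π , small , un) = ≤-trans (≤-reflexive (sym (unmatched-one π G un))) (≤-trans (≤-patterns (λ π → unmatched-nonneg π G) π)
        (≤-Sum (suc t) (λ j → patterns-nonneg j (λ π → unmatched-nonneg π G)) (size (dom π)) (ℕ.s≤s small)))
    1≤2n : 1ℚ ≤ ι n + ι n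
    1≤2n = ≤-trans 1≤l (≤-trans (ι-mono (ℕ.m∸n≤m n t)) (≤-+ʳ (ι-nonneg n)))
    each : ∀ j → j ℕ.< suc t → graphE w (λ G → patterns j (λ π → unmatched π G)) ≤ (ι n + ι n) ^ t * ρ ^ l
    each j (ℕ.s≤s j≤t) = subst (_≤ (ι n + ι n) ^ t * ρ ^ l) (sym (patterns-graphE w j unmatched))
      (≤-trans (patterns-bound j (^-nonneg l 0≤ρ) λ π e → ≤-trans (graphE-unmatched Bd.dist 0≤ω Bd.lower π)
          (≤-trans (^-mono (co-size (dom π)) (≤⇒0≤ (^≤1 (size (dom π)) 0≤ω ω≤1)) (complement-anti (^-antitone 0≤ω ω≤1 (subst (ℕ._≤ t) (sym e) j≤t))))
            (^-antitone 0≤ρ (≤-by (ω ^ t) (^-nonneg t 0≤ω) (solve 1 (λ x → con 1ℚ := con 1ℚ :- x :+ x) refl (ω ^ t)))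
              (ℕ.+-cancelˡ-≤ t _ _ (ℕ.≤-trans (ℕ.≤-reflexive (trans n≡ (sym (size+co-size (dom π))))) (ℕ.+-monoˡ-≤ (co-size (dom π)) (subst (ℕ._≤ t) (sym e) j≤t)))))))
        (*-monoʳ-≤ (^-nonneg l 0≤ρ) (^-monotone 1≤2n j≤t)))
    final : ι l ^ t * ρ ^ l ≤ ε * inv C → τ * ((ι n + ι n) ^ t * ρ ^ l) ≤ ε
    final h = ≤-trans (*-monoˡ-≤ (ι-nonneg (suc t)) (*-monoʳ-≤ (^-nonneg l 0≤ρ) (≤-trans
        (^-mono t (+-nonneg (ι-nonneg n) (ι-nonneg n)) (subst (ι n + ι n ≤_) (sym (distribʳ (ι l) τ τ)) (+-mono-≤ n≤τl n≤τl)))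
        (≤-reflexive (*-^ (τ + τ) (ι l) t)))))
      (≤-trans (≤-reflexive (solve 4 (λ t a b r → t :* (a :* b :* r) := t :* a :* (b :* r)) refl τ ((τ + τ) ^ t) (ι l ^ t) (ρ ^ l)))
        (≤-trans (*-monoˡ-≤ (<⇒≤ 0<C) h) (≤-reflexive (trans (*-comm C _) (*-inv-cancel ε 0<C)))))
    Ef : (d : Dec (0ℚ ≤ ρ)) → 0≤ρ? ≡ d → graphE w f ≤ ε
    Ef (no ¬p) _ = contradiction 0≤ρ ¬p
    Ef (yes p) eq = ≤-trans (≤-reflexive (graphE-Sum w (suc t) (λ j G → patterns j (λ π → unmatched π G))))
      (≤-trans (Sum-mono (suc t) each) (≤-trans (≤-reflexive (Sum-const (suc t) _))
        (final (proj₂ (limit p) l (ℕ.≤-trans (ℕ.n≤1+n _) (subst (λ d → suc (pickN d) ℕ.≤ l) eq l>))))))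

rare-¬Ext : ExcludedMiddle 0ℓ → ∀ t {ω ε} → 0ℚ < ω → 0ℚ < ε → ∃ λ N → ∀ n → N ℕ.≤ n → ∀ w → Bounded ω w → Rare ε w {n} (λ G → ¬ Ext t G)
rare-¬Ext em t 0<ω 0<ε = let N , h = rare-Unmatched t 0<ω 0<ε in
  N , λ n l w bd → rare-⊆ (λ G → ¬Ext⇒Unmatched em G) (h n l w bd)

-- The second moment method for cliques with prescribed behaviour outside

open ℕ.+-*-Solver using () renaming (solve to solveℕ; con to conℕ; _:+_ to _⊹_; _:*_ to _⊛_; _:=_ to _≋_)

+-halve : ∀ {a b} → a ℕ.+ a ℕ.≤ b ℕ.+ b → a ℕ.≤ b
+-halve {a} {b} p with a ℕ.≤? b
... | yes q = q
... | no q = contradiction p (ℕ.<⇒≱ (ℕ.+-mono-< (ℕ.≰⇒> q) (ℕ.≰⇒> q)))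

tri-double : ∀ j → tri j ℕ.+ tri j ℕ.+ j ≡ j ℕ.* j
tri-double zero = refl
tri-double (suc j) = trans (lemma j (tri j)) (trans (cong (λ x → x ℕ.+ (j ℕ.+ suc j)) (tri-double j)) (lemma′ j))
  where
  lemma : ∀ j t → j ℕ.+ t ℕ.+ (j ℕ.+ t) ℕ.+ suc j ≡ t ℕ.+ t ℕ.+ j ℕ.+ (j ℕ.+ suc j)
  lemma = solveℕ 2 (λ j t → j ⊹ t ⊹ (j ⊹ t) ⊹ (conℕ 1 ⊹ j) ≋ t ⊹ t ⊹ j ⊹ (j ⊹ (conℕ 1 ⊹ j))) refl
  lemma′ : ∀ j → j ℕ.* j ℕ.+ (j ℕ.+ suc j) ≡ suc j ℕ.* suc j
  lemma′ = solveℕ 1 (λ j → j ⊛ j ⊹ (j ⊹ (conℕ 1 ⊹ j)) ≋ (conℕ 1 ⊹ j) ⊛ (conℕ 1 ⊹ j)) refl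

tri≤* : ∀ {j h} → j ℕ.≤ suc (h ℕ.+ h) → tri j ℕ.≤ h ℕ.* j
tri≤* {j} {h} l = +-halve (ℕ.+-cancelʳ-≤ j _ _ (ℕ.≤-trans (ℕ.≤-reflexive (tri-double j))
    (ℕ.≤-trans (ℕ.*-monoˡ-≤ j l) (ℕ.≤-reflexive (lemma j h)))))
  where
  lemma : ∀ j h → suc (h ℕ.+ h) ℕ.* j ≡ h ℕ.* j ℕ.+ h ℕ.* j ℕ.+ j
  lemma = solveℕ 2 (λ j h → (conℕ 1 ⊹ (h ⊹ h)) ⊛ j ≋ h ⊛ j ⊹ h ⊛ j ⊹ j) refl

subs-*ʳ : ∀ {n} m c (f : Vec Bool n → ℚ) → subs m (λ K → f K * c) ≡ subs m f * c
subs-*ʳ m c f = trans (subs-cong m (λ K _ → *-comm (f K) c)) (trans (subs-*ˡ m c f) (*-comm c _))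

subs-square : ∀ {n} m (f : Vec Bool n → ℚ) → subs m f * subs m f ≡ subs m (λ K → subs m (λ L → f K * f L))
subs-square m f = trans (sym (subs-*ʳ m (subs m f) f)) (subs-cong m (λ K _ → sym (subs-*ˡ m (f K) f)))

opaque
  unfolding rowE

  graphE-suc : ∀ w {n} (f : Graph (suc n) → ℚ) → graphE w f ≡ rowE w (λ r → graphE w (λ G → f (r ∷ G)))
  graphE-suc w f = refl

product-E : ∀ w {n k} (a : Vec Bool k → ℚ) (b : Graph n → ℚ) → rowE w (λ r → graphE w (λ G → a r * b G)) ≡ rowE w a * graphE w b
product-E w a b = trans (rowE-cong w (λ r → graphE-*ˡ w (a r) b)) (rowE-*ʳ w (graphE w b) a)

antidiag-first : ∀ m (f : ℕ → ℚ) → antidiag m (λ j _ → f j) ≡ Sum (suc m) f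
antidiag-first zero f = sym (+-identityʳ _)
antidiag-first (suc m) f = cong (f 0 +_) (antidiag-first m (f ∘ suc))

½+½ : ½ + ½ ≡ 1ℚ
½+½ = solve 0 (con ½ :+ con ½ := con 1ℚ) refl

0<½ : 0ℚ < ½
0<½ = ℚ.positive⁻¹ ½

geometric-½ : ∀ n {δ} → 0ℚ ≤ δ → δ ≤ ½ → Sum n (δ ^_) ≤ 1ℚ + (δ + δ)
geometric-½ n {δ} 0≤δ δ≤½ = *-cancelʳ-≤ 0<1-δ (≤-trans (geometric n 0≤δ (≤-<-trans δ≤½ ½<1))
    (≤-by (δ * (½ - δ + (½ - δ))) (*-nonneg 0≤δ (+-nonneg (≤⇒0≤ δ≤½) (≤⇒0≤ δ≤½)))
      (solve 1 (λ d → (con 1ℚ :+ (d :+ d)) :* (con 1ℚ :- d) := con 1ℚ :+ d :* (con ½ :- d :+ (con ½ :- d))) refl δ)))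
  where
  ½<1 : ½ < 1ℚ
  ½<1 = toWitness {a? = ½ ℚ.<? 1ℚ} _
  0<1-δ : 0ℚ < 1ℚ - δ
  0<1-δ = <⇒0< (≤-<-trans δ≤½ ½<1)

-- Relative to all m-sets, those meeting a given one in j elements number at most (m²/ν)ʲ: C(m,j) ≤
-- mʲ, and `B-step` compares C(n,m - j) with C(n,m). A joint weight τʲ is therefore harmless as soon
-- as m²τ ≤ δν.
overlap-term : ∀ n m {ν τ δ} → 0ℚ < ν → ν ≤ ι n - ι m → 0ℚ ≤ τ → 0ℚ ≤ δ → ι m * ι m * τ ≤ δ * ν →
  ∀ {b j i} g → b ℕ.≤ n → j ℕ.+ i ≡ m → 0ℚ ≤ g → g ≤ τ ^ j → B m j * B b i * g ≤ B n m * δ ^ j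
overlap-term n m {ν} {τ} {δ} 0<ν ν≤ 0≤τ 0≤δ small {b} {j} {i} g b≤n eq 0≤g g≤ = *-cancelʳ-≤ (^-pos j 0<ν) (≤-trans
  (*-monoʳ-≤ (^-nonneg j (<⇒≤ 0<ν)) (*-mono-≤ (*-nonneg (B-nonneg m j) (B-nonneg b i))
    (*-mono-≤ (B-nonneg m j) (B≤^ m j) (B-nonneg b i) (B-monoˡ i b≤n)) 0≤g g≤))
  (≤-trans (≤-reflexive (solve 4 (λ a b t v → a :* b :* t :* v := (a :* t) :* (b :* v)) refl (ι m ^ j) (B n i) (τ ^ j) (ν ^ j)))
    (≤-trans (*-monoˡ-≤ (*-nonneg (^-nonneg j (ι-nonneg m)) (^-nonneg j 0≤τ))
        (subst (λ k → B n i * ν ^ j ≤ ι m ^ j * B n k) eq (B-step n m (<⇒≤ 0<ν) ν≤ j i (ℕ.≤-reflexive eq))))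
      (≤-trans (≤-reflexive (trans (solve 3 (λ a t x → (a :* t) :* (a :* x) := x :* (a :* a :* t)) refl (ι m ^ j) (τ ^ j) (B n m))
          (cong (B n m *_) (trans (cong (_* τ ^ j) (sym (*-^ (ι m) (ι m) j))) (sym (*-^ (ι m * ι m) τ j))))))
        (≤-trans (*-monoˡ-≤ (B-nonneg n m) (^-mono j (*-nonneg (*-nonneg (ι-nonneg m) (ι-nonneg m)) 0≤τ) small))
          (≤-reflexive (trans (cong (B n m *_) (*-^ δ ν j)) (sym (*-assoc _ _ _)))))))))

-- Vertex zero is set apart: K avoids it, `R` prescribes how it is joined to K, and `h` does so for
-- the other vertices outside K.
NoGood : Bool → ∀ {n} → ℕ → (R h : Vec Bool n → Vec Bool n → Bool) → Graph (suc n) → Set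
NoGood c m R h (r ∷ G) = ¬ ∃ λ K → size K ≡ m × R K r ≡ true × clique c K G ≡ true × ∀ i → lookup K i ≡ false → h K (nbr G i) ≡ true

outside-≤1 : ∀ {n} (s : Vec Bool n) i {x} → x ≤ 1ℚ → outside-of s i x ≤ 1ℚ
outside-≤1 s i p with lookup s i
... | true = ≤-refl
... | false = p

-- Chebyshev's inequality with the majorant f = (1 - M/μ)², where M counts the good sets and μ is
-- the main term of its mean. The outside conditions cost the mean at most a factor (1 - β)ⁿ⁺¹; in
-- the second moment they are bounded by 1, and overlap j contributes at most δʲ relative to μ².
second-moment : ∀ {w} → IsDistribution w → ∀ c → 0ℚ < w c → ∀ n m (R h : Vec Bool n → Vec Bool n → Bool) →
  (∀ K → Local K (λ v → 𝟙 (h K v))) → ∀ {θ β δ} l → 0ℚ < θ → 0ℚ ≤ β → β ≤ 1ℚ →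
  (∀ K → size K ≡ m → θ ^ m * (1ℚ - β) ≤ rowE w (λ v → 𝟙 (R K v))) →
  (∀ K → size K ≡ m → 1ℚ - β ≤ rowE w (λ v → 𝟙 (h K v))) →
  (∀ K L → size K ≡ m → size L ≡ m → rowE w (λ v → 𝟙 (R K v) * 𝟙 (R L v)) * θ ^ size (K ∩ L) ≤ θ ^ m * θ ^ m) →
  m ℕ.≤ suc (l ℕ.+ l) → m ℕ.< n → ι m * ι m * (inv θ * inv (w c) ^ l) ≤ δ * (ι n - ι m) → 0ℚ ≤ δ → δ ≤ ½ →
  Rare (ι (suc n) * β + ι (suc n) * β + (δ + δ)) w (NoGood c m R h)
second-moment {w} dst c 0<ω n m R h loc {θ} {β} {δ} l 0<θ 0≤β β≤1 ER Eh ERR m≤ m<n small 0≤δ δ≤½ = f , f≥0 , f≥1 , Ef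
  where
  module D = IsDistribution dst
  ω = w c
  good : Vec Bool n → Vec Bool n → Graph n → ℚ
  good K r G = 𝟙 (R K r) * (𝟙 (clique c K G) * ∏ n (λ i → outside-of K i (𝟙 (h K (nbr G i)))))
  M : Graph (suc n) → ℚ
  M (r ∷ G) = subs m (λ K → good K r G)
  u = θ ^ m * ω ^ tri m
  0<u : 0ℚ < u
  0<u = *-pos (^-pos m 0<θ) (^-pos (tri m) 0<ω)
  μ = B n m * u
  0<μ : 0ℚ < μ
  0<μ = *-pos (B-pos (ℕ.<⇒≤ m<n)) 0<u
  t = inv μ
  f : Graph (suc n) → ℚ
  f G = 1ℚ + ((- (t + t)) * M G + t * t * (M G * M G))
  f≡ : ∀ x → 1ℚ + ((- (t + t)) * x + t * t * (x * x)) ≡ (1ℚ - t * x) * (1ℚ - t * x)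
  f≡ x = solve 2 (λ t x → con 1ℚ :+ ((:- (t :+ t)) :* x :+ t :* t :* (x :* x)) := (con 1ℚ :- t :* x) :* (con 1ℚ :- t :* x)) refl t x
  f≥0 : ∀ G → 0ℚ ≤ f G
  f≥0 G = subst (0ℚ ≤_) (sym (f≡ (M G))) (square-nonneg (1ℚ - t * M G))
  good≥0 : ∀ K r G → 0ℚ ≤ good K r G
  good≥0 K r G = *-nonneg (𝟙-nonneg (R K r)) (*-nonneg (𝟙-nonneg (clique c K G)) (∏-nonneg n (λ i → outside-nonneg K i (𝟙-nonneg (h K (nbr G i))))))
  M≡0 : ∀ r G → NoGood c m R h (r ∷ G) → M (r ∷ G) ≡ 0ℚ
  M≡0 r G no-good = trans (subs-cong m (λ K e → zero-term K e (R K r) refl (clique c K G) refl)) (trans (subs-const m 0ℚ) (zeroʳ _))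
    where
    zero-term : ∀ K → size K ≡ m → ∀ a → R K r ≡ a → ∀ b → clique c K G ≡ b → good K r G ≡ 0ℚ
    zero-term K e false ea b eb = trans (cong (λ x → 𝟙 x * _) ea) (zeroˡ _)
    zero-term K e true ea false eb = trans (cong (𝟙 (R K r) *_) (trans (cong (λ x → 𝟙 x * _) eb) (zeroˡ _))) (zeroʳ _)
    zero-term K e true ea true eb = search (Fin.any? λ i → (lookup K i Bool.≟ false) ×-dec (h K (nbr G i) Bool.≟ false))
      where
      search : Dec (∃ λ i → lookup K i ≡ false × h K (nbr G i) ≡ false) → good K r G ≡ 0ℚ
      search (yes (i , out , bad)) = trans (cong (λ x → 𝟙 (R K r) * (𝟙 (clique c K G) * x))
          (∏-zero n i (trans (cong (λ b → if b then 1ℚ else 𝟙 (h K (nbr G i))) out) (cong 𝟙 bad))))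
        (trans (cong (𝟙 (R K r) *_) (zeroʳ _)) (zeroʳ _))
      search (no ¬bad) = contradiction (K , e , ea , eb , λ i out → Bool.¬-not (λ bad → ¬bad (i , out , bad))) no-good
  f≥1 : ∀ G → NoGood c m R h G → 1ℚ ≤ f G
  f≥1 (r ∷ G) p = ≤-reflexive (sym (trans (cong (λ x → 1ℚ + ((- (t + t)) * x + t * t * (x * x))) (M≡0 r G p))
    (solve 1 (λ t → con 1ℚ :+ ((:- (t :+ t)) :* con 0ℚ :+ t :* t :* (con 0ℚ :* con 0ℚ)) := con 1ℚ) refl t)))
  γ = (1ℚ - β) ^ suc n
  EM : μ * (1ℚ - ι (suc n) * β) ≤ graphE w M
  EM = ≤-trans (*-monoˡ-≤ (<⇒≤ 0<μ) (bernoulli⁻ (suc n) 0≤β β≤1))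
    (≤-trans (≤-reflexive (*-assoc _ _ _)) (subst₂ _≤_ (subs-const m (u * γ)) (sym split) (subs-mono m each)))
    where
    split : graphE w M ≡ subs m (λ K → rowE w (λ v → 𝟙 (R K v)) * graphE w (λ G → 𝟙 (clique c K G) * ∏ n (λ i → outside-of K i (𝟙 (h K (nbr G i))))))
    split = trans (graphE-suc w M) (trans (rowE-cong w (λ r → subs-graphE w m (λ K → good K r)))
      (trans (subs-rowE w m (λ K r → graphE w (good K r))) (subs-cong m (λ K _ → product-E w (λ v → 𝟙 (R K v)) _))))
    each : ∀ K → size K ≡ m → u * γ ≤ rowE w (λ v → 𝟙 (R K v)) * graphE w (λ G → 𝟙 (clique c K G) * ∏ n (λ i → outside-of K i (𝟙 (h K (nbr G i)))))
    each K e = ≤-trans (≤-reflexive (solve 4 (λ a b x y → a :* b :* (x :* y) := a :* x :* (b :* y)) refl (θ ^ m) (ω ^ tri m) (1ℚ - β) ((1ℚ - β) ^ n)))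
      (*-mono-≤ (*-nonneg (^-nonneg m (<⇒≤ 0<θ)) (≤⇒0≤ β≤1)) (ER K e)
        (*-nonneg (^-nonneg (tri m) (<⇒≤ 0<ω)) (^-nonneg n (≤⇒0≤ β≤1)))
        (subst (ω ^ tri m * (1ℚ - β) ^ n ≤_) (sym (trans (graphE-clique-outside dst c K (λ v → 𝟙 (h K v)) (loc K)) (cong (λ k → ω ^ tri k * _) e)))
          (*-monoˡ-≤ (^-nonneg (tri m) (<⇒≤ 0<ω)) (≤-trans
            (^-antitone (≤⇒0≤ β≤1) (≤-by β 0≤β (solve 1 (λ b → con 1ℚ := con 1ℚ :- b :+ b) refl β)) (subst (co-size K ℕ.≤_) (size+co-size K) (ℕ.m≤n+m _ _)))
            (^-mono (co-size K) (≤⇒0≤ β≤1) (Eh K e))))))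
  τ = inv θ * inv ω ^ l
  g : ℕ → ℚ
  g j = inv θ ^ j * inv ω ^ tri j
  0≤τ : 0ℚ ≤ τ
  0≤τ = *-nonneg (inv-nonneg 0<θ) (^-nonneg l (inv-nonneg 0<ω))
  0≤g : ∀ j → 0ℚ ≤ g j
  0≤g j = *-nonneg (^-nonneg j (inv-nonneg 0<θ)) (^-nonneg (tri j) (inv-nonneg 0<ω))
  1≤ω⁻¹ : 1ℚ ≤ inv ω
  1≤ω⁻¹ = subst (1ℚ ≤_) (*-identityˡ _) (*≤⇒≤*inv 0<ω (subst (_≤ 1ℚ) (sym (*-identityˡ ω)) (D.≤1 c)))
  g≤τ^ : ∀ j → j ℕ.≤ m → g j ≤ τ ^ j
  g≤τ^ j j≤m = ≤-trans (*-monoˡ-≤ (^-nonneg j (inv-nonneg 0<θ)) (^-monotone 1≤ω⁻¹ (tri≤* {j} {l} (ℕ.≤-trans j≤m m≤))))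
    (≤-reflexive (trans (cong (inv θ ^ j *_) (trans (cong (inv ω ^_) (ℕ.*-comm l j)) (^-* (inv ω) j l))) (sym (*-^ (inv θ) (inv ω ^ l) j))))
  pair : ∀ K L → size K ≡ m → size L ≡ m → rowE w (λ r → graphE w (λ G → good K r G * good L r G)) ≤ u * u * g (size (K ∩ L))
  pair K L eK eL = ≤-trans (rowE-mono D.nonneg (λ r → graphE-mono D.nonneg (λ G → bound r G)))
    (≤-trans (≤-reflexive (product-E w _ _)) (*-cancelʳ-≤ 0<x (≤-trans
      (≤-trans (≤-reflexive (solve 4 (λ a b x y → a :* b :* (x :* y) := a :* x :* (b :* y)) refl A C (θ ^ j) (ω ^ tri j)))
        (≤-trans (≤-reflexive (cong (A * θ ^ j *_) (trans (graphE-clique² dst c K L) (cong₂ (λ x y → ω ^ tri x * ω ^ tri y) eK eL))))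
          (*-monoʳ-≤ (*-nonneg (^-nonneg (tri m) (<⇒≤ 0<ω)) (^-nonneg (tri m) (<⇒≤ 0<ω))) (ERR K L eK eL))))
      (≤-reflexive (trans (solve 2 (λ a b → a :* a :* (b :* b) := a :* b :* (a :* b) :* con 1ℚ) refl (θ ^ m) (ω ^ tri m))
        (trans (cong (u * u *_) (sym gx)) (sym (*-assoc _ _ _))))))))
    where
    j = size (K ∩ L)
    A = rowE w (λ v → 𝟙 (R K v) * 𝟙 (R L v))
    C = graphE w (λ G → 𝟙 (clique c K G) * 𝟙 (clique c L G))
    0<x : 0ℚ < θ ^ j * ω ^ tri j
    0<x = *-pos (^-pos j 0<θ) (^-pos (tri j) 0<ω)
    gx : g j * (θ ^ j * ω ^ tri j) ≡ 1ℚ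
    gx = trans (solve 4 (λ a b x y → a :* b :* (x :* y) := x :* a :* (y :* b)) refl (inv θ ^ j) (inv ω ^ tri j) (θ ^ j) (ω ^ tri j))
      (trans (cong₂ _*_ (^-inv j 0<θ) (^-inv (tri j) 0<ω)) (*-identityˡ 1ℚ))
    ∏≤1 : ∀ K G → ∏ n (λ i → outside-of K i (𝟙 (h K (nbr G i)))) ≤ 1ℚ
    ∏≤1 K G = ≤-trans (∏-mono n (λ i → outside-nonneg K i (𝟙-nonneg (h K (nbr G i)))) (λ i → outside-≤1 K i (𝟙≤1 (h K (nbr G i))))) (≤-reflexive (∏-one n (λ _ → refl)))
    good≤ : ∀ K r G → good K r G ≤ 𝟙 (R K r) * 𝟙 (clique c K G)
    good≤ K r G = *-monoˡ-≤ (𝟙-nonneg (R K r)) (≤-trans (*-monoˡ-≤ (𝟙-nonneg (clique c K G)) (∏≤1 K G)) (≤-reflexive (*-identityʳ (𝟙 (clique c K G)))))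
    bound : ∀ r G → good K r G * good L r G ≤ 𝟙 (R K r) * 𝟙 (R L r) * (𝟙 (clique c K G) * 𝟙 (clique c L G))
    bound r G = ≤-trans (*-mono-≤ (good≥0 K r G) (good≤ K r G) (good≥0 L r G) (good≤ L r G))
      (≤-reflexive (solve 4 (λ a b x y → a :* b :* (x :* y) := a :* x :* (b :* y)) refl (𝟙 (R K r)) (𝟙 (clique c K G)) (𝟙 (R L r)) (𝟙 (clique c L G))))
  row-sum : ∀ K → size K ≡ m → subs m (λ L → u * u * g (size (K ∩ L))) ≤ u * u * (B n m * (1ℚ + (δ + δ)))
  row-sum K e = subst (_≤ u * u * (B n m * (1ℚ + (δ + δ)))) (sym (subs-*ˡ m (u * u) (λ L → g (size (K ∩ L)))))
    (*-monoˡ-≤ (square-nonneg u) (≤-trans (≤-reflexive (subs-∩ K m g)) (≤-trans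
      (antidiag-mono m (λ j i eq → subst (λ k → B k j * B (co-size K) i * g j ≤ B n m * δ ^ j) (sym e)
        (overlap-term n m (<⇒0< (ι<ι m<n)) ≤-refl 0≤τ 0≤δ small {co-size K} {j} {i} (g j) (subst (co-size K ℕ.≤_) (size+co-size K) (ℕ.m≤n+m _ _)) eq (0≤g j)
          (g≤τ^ j (subst (j ℕ.≤_) eq (ℕ.m≤m+n j i))))))
      (≤-trans (≤-reflexive (trans (antidiag-*ˡ m (B n m) (λ j _ → δ ^ j)) (cong (B n m *_) (antidiag-first m (δ ^_)))))
        (*-monoˡ-≤ (B-nonneg n m) (geometric-½ (suc m) 0≤δ δ≤½))))))
    where
    ι<ι : ∀ {a b} → a ℕ.< b → ι a < ι b
    ι<ι {a} {b} p = <-≤-trans (subst (ι a <_) refl (0<⇒< (subst (0ℚ <_) (solve 1 (λ x → con 1ℚ := con 1ℚ :+ x :- x) refl (ι a)) 0<1))) (ι-mono p)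
  EM² : graphE w (λ G → M G * M G) ≤ μ * μ * (1ℚ + (δ + δ))
  EM² = ≤-trans (≤-reflexive split) (≤-trans (subs-mono m (λ K eK → ≤-trans (subs-mono m (λ L eL → pair K L eK eL)) (row-sum K eK)))
    (≤-reflexive (trans (subs-const m _) (solve 3 (λ b u d → b :* (u :* u :* (b :* d)) := b :* u :* (b :* u) :* d) refl (B n m) u (1ℚ + (δ + δ))))))
    where
    split : graphE w (λ G → M G * M G) ≡ subs m (λ K → subs m (λ L → rowE w (λ r → graphE w (λ G → good K r G * good L r G))))
    split = trans (graphE-suc w (λ G → M G * M G)) (trans
      (rowE-cong w (λ r → trans (graphE-cong w (λ G → subs-square m (λ K → good K r G)))
        (trans (subs-graphE w m (λ K G → subs m (λ L → good K r G * good L r G))) (subs-cong m (λ K _ → subs-graphE w m (λ L G → good K r G * good L r G))))))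
      (trans (subs-rowE w m (λ K r → subs m (λ L → graphE w (λ G → good K r G * good L r G))))
        (subs-cong m (λ K _ → subs-rowE w m (λ L r → graphE w (λ G → good K r G * good L r G))))))
  Ef : graphE w f ≤ ι (suc n) * β + ι (suc n) * β + (δ + δ)
  Ef = ≤-trans (≤-reflexive (trans (graphE-+ w (λ _ → 1ℚ) _) (cong₂ _+_ (graphE-const dst 1ℚ)
      (trans (graphE-+ w (λ G → (- (t + t)) * M G) (λ G → t * t * (M G * M G))) (cong₂ _+_ (graphE-*ˡ w (- (t + t)) M) (graphE-*ˡ w (t * t) (λ G → M G * M G)))))))
    (≤-trans (+-monoˡ-≤ 1ℚ (+-mono-≤ first (*-monoˡ-≤ (square-nonneg t) EM²)))
      (≤-reflexive (trans (cong₂ (λ x y → 1ℚ + (x + y)) (e₁) e₂)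
        (solve 2 (λ b d → con 1ℚ :+ (:- (con 1ℚ :- b :+ (con 1ℚ :- b)) :+ (con 1ℚ :+ (d :+ d))) := b :+ b :+ (d :+ d)) refl (ι (suc n) * β) δ))))
    where
    y = 1ℚ - ι (suc n) * β
    tμ : t * μ ≡ 1ℚ
    tμ = trans (*-comm t μ) (*-inv 0<μ)
    first : (- (t + t)) * graphE w M ≤ (- (t + t)) * (μ * y)
    first = ≤-by ((t + t) * (graphE w M - μ * y)) (*-nonneg (+-nonneg (inv-nonneg 0<μ) (inv-nonneg 0<μ)) (≤⇒0≤ EM))
      (solve 3 (λ t a b → (:- (t :+ t)) :* b := (:- (t :+ t)) :* a :+ (t :+ t) :* (a :- b)) refl t (graphE w M) (μ * y))
    e₁ : (- (t + t)) * (μ * y) ≡ - (y + y)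
    e₁ = trans (solve 3 (λ t m y → (:- (t :+ t)) :* (m :* y) := :- (t :* m :* y :+ t :* m :* y)) refl t μ y)
      (cong (λ x → - (x + x)) (trans (cong (_* y) tμ) (*-identityˡ y)))
    e₂ : t * t * (μ * μ * (1ℚ + (δ + δ))) ≡ 1ℚ + (δ + δ)
    e₂ = trans (solve 3 (λ t m y → t :* t :* (m :* m :* y) := t :* m :* (t :* m) :* y) refl t μ (1ℚ + (δ + δ)))
      (trans (cong (λ x → x * x * (1ℚ + (δ + δ))) tμ) (trans (cong (_* (1ℚ + (δ + δ))) (*-identityˡ 1ℚ)) (*-identityˡ _)))

-- Existence of maximal, dominating and non-dominating cliques

crossing : ∀ {P : ℕ → Set} → (∀ k → Dec (P k)) → ¬ P 0 → ∀ M → P M → ∃ λ k → suc k ℕ.≤ M × ¬ P k × P (suc k)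
crossing P? ¬P0 zero p = contradiction p ¬P0
crossing P? ¬P0 (suc M) p = go (P? M)
  where
  go : Dec _ → _
  go (yes q) = let k , l , h = crossing P? ¬P0 M q in k , ℕ.m≤n⇒m≤1+n l , h
  go (no ¬q) = M , ℕ.≤-refl , ¬q , p

halve : ∀ m → ∃ λ l → m ℕ.≤ suc (l ℕ.+ l) × l ℕ.+ l ℕ.≤ m
halve zero = 0 , ℕ.z≤n , ℕ.z≤n
halve (suc zero) = 0 , ℕ.s≤s ℕ.z≤n , ℕ.z≤n
halve (suc (suc m)) = let l , p , q = halve m in
  suc l , subst (λ x → suc (suc m) ℕ.≤ suc (suc x)) (sym (ℕ.+-suc l l)) (ℕ.s≤s (ℕ.s≤s p)) , subst (λ x → suc x ℕ.≤ suc (suc m)) (sym (ℕ.+-suc l l)) (ℕ.s≤s (ℕ.s≤s q))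

ι-<-+ : ∀ {m n} → ι m + ι m < ι n → m ℕ.< n
ι-<-+ {m} p = ι-cancel-< (≤-<-trans (≤-+ʳ (ι-nonneg m)) p)

2ℚ 4ℚ : ℚ
2ℚ = 1ℚ + 1ℚ
4ℚ = 2ℚ + 2ℚ

-- By `sparse` it is unlikely that any vertex fails its condition; by `dense` the overlapping pairs
-- add little to the second moment.
record SizeChoice (ε : ℚ) (n : ℕ) (ω β θ : ℚ) : Set where
  field
    m l   : ℕ
    2≤m   : 2 ℕ.≤ m
    m<n   : m ℕ.< n
    m≤    : m ℕ.≤ suc (l ℕ.+ l)
    sparse : ι (suc n) * (β ^ m + β ^ m) ≤ ε
    dense  : ι m * ι m * (inv θ * inv ω ^ l) ≤ ε * (ι n - ι m)

-- The size m satisfies n(m + 1)βᵐ ≤ 1 while m - 1 does not, so m is about the logarithm of n to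
-- base 1/β. The extra factor m + 1 makes `sparse` small. Failure at m - 1 bounds β to the power -m
-- by nm/β; with l about m/2 and β² ≤ ω(1 - κ), the power ω to -l is then at most (1 - κ)ˡnm/β, and
-- (1 - κ)ˡ beats the powers of m in `dense`.
choose-size : ∀ {ω₀ κ ε} → 0ℚ < ω₀ → 0ℚ < 1ℚ - ω₀ → 0ℚ < κ → κ ≤ 1ℚ → 0ℚ < ε →
  ∃ λ N → ∀ n → N ℕ.≤ n → ∀ {ω β θ} → ω₀ ≤ ω → ω₀ ≤ β → β ≤ 1ℚ - ω₀ → ω₀ ≤ θ → β * β ≤ ω * (1ℚ - κ) → SizeChoice ε n ω β θ
choose-size {ω₀} {κ} {ε} 0<ω₀ 0<ρ 0<κ κ≤1 0<ε = N , choice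
  where
  ρ = 1ℚ - ω₀
  0≤ρ = <⇒≤ 0<ρ
  ρ<1 : ρ < 1ℚ
  ρ<1 = 0<⇒< (subst (0ℚ <_) (solve 1 (λ x → x := con 1ℚ :- (con 1ℚ :- x)) refl ω₀) 0<ω₀)
  i₀ = inv ω₀
  0<i₀ = inv-pos 0<ω₀
  1≤i₀ : 1ℚ ≤ i₀
  1≤i₀ = subst (1ℚ ≤_) (*-identityˡ i₀) (*≤⇒≤*inv 0<ω₀ (subst (_≤ 1ℚ) (sym (*-identityˡ ω₀)) (≤-by ρ 0≤ρ (solve 1 (λ x → con 1ℚ := x :+ (con 1ℚ :- x)) refl ω₀))))
  3ℚ = 1ℚ + 2ℚ
  0<3 : 0ℚ < 3ℚ
  0<3 = +-pos 0<1 (+-nonneg 0≤1 0≤1)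
  -- From m ≤ 2l + 1 ≤ 3l; the cube is m² times the m in the bound for ω to the power -l, and the
  -- two factors i₀ bound 1/θ and 1/β.
  C = 3ℚ ^ 3 * (i₀ * i₀)
  0<C : 0ℚ < C
  0<C = *-pos (^-pos 3 0<3) (*-pos 0<i₀ 0<i₀)
  decay = poly*exp→0 3 (≤⇒0≤ κ≤1) (0<⇒< (subst (0ℚ <_) (solve 1 (λ x → x := con 1ℚ :- (con 1ℚ :- x)) refl κ) 0<κ)) (*-pos (*-pos 0<½ 0<ε) (inv-pos 0<C))
  L₀ = suc (proj₁ decay)
  decay₂ = poly*exp→0 2 0≤ρ ρ<1 (*-pos 0<½ 0<ρ)
  m₁ = proj₁ decay₂
  arch = archimedean (4ℚ * inv ε)
  m₂ = proj₁ arch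
  m₀ = suc (L₀ ℕ.+ L₀) ℕ.+ (m₁ ℕ.+ (m₂ ℕ.+ 2))
  archN = archimedean (i₀ ^ m₀)
  N = suc (suc (proj₁ archN))
  choice : ∀ n → N ℕ.≤ n → ∀ {ω β θ} → ω₀ ≤ ω → ω₀ ≤ β → β ≤ 1ℚ - ω₀ → ω₀ ≤ θ → β * β ≤ ω * (1ℚ - κ) → SizeChoice ε n ω β θ
  choice n N≤n {ω} {β} {θ} ω₀≤ω ω₀≤β β≤ρ ω₀≤θ β²≤ = record
    { m = m ; l = l ; 2≤m = ℕ.≤-trans (ℕ.m≤n+m 2 m₂) (ℕ.≤-trans (ℕ.m≤n+m (m₂ ℕ.+ 2) m₁) (ℕ.≤-trans (ℕ.m≤n+m (m₁ ℕ.+ (m₂ ℕ.+ 2)) (suc (L₀ ℕ.+ L₀))) (ℕ.<⇒≤ m₀<m)))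
    ; m<n = ι-<-+ 2m<n ; m≤ = proj₁ (proj₂ (halve m)) ; sparse = sparse ; dense = dense }
    where
    0<ω = <-≤-trans 0<ω₀ ω₀≤ω
    0<β = <-≤-trans 0<ω₀ ω₀≤β
    0<θ = <-≤-trans 0<ω₀ ω₀≤θ
    0≤β = <⇒≤ 0<β
    β≤1 = ≤-trans β≤ρ (<⇒≤ ρ<1)
    0<n : 0ℚ < ι n
    0<n = <-≤-trans (ι-pos 0) (ι-mono (ℕ.≤-trans (ℕ.s≤s ℕ.z≤n) N≤n))
    P : ℕ → Set
    P k = ι n * (ι (suc k) * β ^ k) ≤ 1ℚ
    P? : ∀ k → Dec (P k)
    P? k = (ι n * (ι (suc k) * β ^ k)) ℚ.≤? 1ℚ
    ¬P0 : ¬ P 0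
    ¬P0 p = <-irrefl refl (<-≤-trans (subst (1ℚ <_) (solve 0 (con 1ℚ :+ con 1ℚ := con 1ℚ :+ con 1ℚ) refl) (0<⇒< (subst (0ℚ <_) (solve 0 (con 1ℚ := con 1ℚ :+ con 1ℚ :- con 1ℚ) refl) 0<1)))
      (≤-trans (subst (_≤ ι n) (cong (1ℚ +_) (+-identityʳ 1ℚ)) (ι-mono (ℕ.≤-trans (ℕ.s≤s (ℕ.s≤s ℕ.z≤n)) N≤n)))
        (subst (_≤ 1ℚ) (solve 1 (λ n → n :* ((con 1ℚ :+ con 0ℚ) :* con 1ℚ) := n) refl (ι n)) p)))
    far = poly*exp→0 1 0≤ρ ρ<1 (*-pos 0<ρ (inv-pos 0<n))
    PM : P (proj₁ far)
    PM = ≤-trans (*-monoˡ-≤ (<⇒≤ 0<n) (≤-trans (*-monoˡ-≤ (ι-nonneg (suc (proj₁ far))) (^-mono (proj₁ far) 0≤β β≤ρ))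
        (*-cancelˡ-≤ 0<ρ (≤-trans (≤-reflexive (solve 3 (λ r i x → r :* (i :* x) := i :* con 1ℚ :* (r :* x)) refl ρ (ι (suc (proj₁ far))) (ρ ^ proj₁ far)))
          (proj₂ far (suc (proj₁ far)) (ℕ.n≤1+n _))))))
      (≤-reflexive (*-inv 0<n))
    cr = crossing P? ¬P0 (proj₁ far) PM
    k = proj₁ cr
    m = suc k
    Pm : ι n * (ι (suc m) * β ^ m) ≤ 1ℚ
    Pm = proj₂ (proj₂ (proj₂ cr))
    ¬Pk : 1ℚ < ι n * (ι m * β ^ k)
    ¬Pk = ℚ.≰⇒> (proj₁ (proj₂ (proj₂ cr)))
    l = proj₁ (halve m)
    m≤2l+1 = proj₁ (proj₂ (halve m))
    2l≤m = proj₂ (proj₂ (halve m))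
    nβ^m≤1 : ι n * β ^ m ≤ 1ℚ
    nβ^m≤1 = ≤-trans (*-monoˡ-≤ (<⇒≤ 0<n) (subst (_≤ ι (suc m) * β ^ m) (*-identityˡ _) (*-monoʳ-≤ (^-nonneg m 0≤β) (1≤ι-suc m)))) Pm
    m₀<m : m₀ ℕ.< m
    m₀<m = ℕ.≰⇒> λ m≤m₀ → <-irrefl refl (<-≤-trans
      (≤-<-trans (proj₂ archN) (subst (_< ι (suc (proj₁ archN))) (+-identityˡ _) (+-mono-<-≤ 0<1 (≤-refl {ι (proj₁ archN)}))))
      (≤-trans (ι-mono (ℕ.≤-trans (ℕ.n≤1+n _) N≤n)) (≤-trans
        (subst (ι n ≤_) (*-identityˡ _) (*≤⇒≤*inv (^-pos m 0<β) nβ^m≤1))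
        (≤-trans (≤-reflexive (inv-^ m 0<β)) (≤-trans (^-mono m (inv-nonneg 0<β) (inv-anti 0<ω₀ ω₀≤β)) (^-monotone 1≤i₀ m≤m₀))))))
      where
      inv-^ : ∀ k {x} → 0ℚ < x → inv (x ^ k) ≡ inv x ^ k
      inv-^ k {x} p = trans (sym (*-identityʳ _)) (trans (cong (inv (x ^ k) *_) (sym (^-inv k p)))
        (trans (sym (*-assoc _ _ _)) (trans (cong (_* inv x ^ k) (trans (*-comm _ _) (*-inv (^-pos k p)))) (*-identityˡ _))))
    L₀≤l : L₀ ℕ.≤ l
    L₀≤l = ℕ.≮⇒≥ λ l<L₀ → ℕ.<-irrefl refl (ℕ.<-≤-trans m₀<m (ℕ.≤-trans m≤2l+1
      (ℕ.≤-trans (ℕ.s≤s (ℕ.+-mono-≤ (ℕ.<⇒≤ l<L₀) (ℕ.<⇒≤ l<L₀))) (ℕ.m≤m+n (suc (L₀ ℕ.+ L₀)) _))))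
    m₂≤m : m₂ ℕ.≤ suc m
    m₂≤m = ℕ.≤-trans (ℕ.m≤m+n m₂ 2) (ℕ.≤-trans (ℕ.m≤n+m _ m₁) (ℕ.≤-trans (ℕ.m≤n+m _ (suc (L₀ ℕ.+ L₀))) (ℕ.≤-trans (ℕ.<⇒≤ m₀<m) (ℕ.n≤1+n m))))
    m₁≤m : m₁ ℕ.≤ m
    m₁≤m = ℕ.≤-trans (ℕ.m≤m+n m₁ _) (ℕ.≤-trans (ℕ.m≤n+m _ (suc (L₀ ℕ.+ L₀))) (ℕ.<⇒≤ m₀<m))
    sparse : ι (suc n) * (β ^ m + β ^ m) ≤ ε
    sparse = *-cancelʳ-≤ (ι-pos m) (≤-trans (*-monoʳ-≤ (ι-nonneg (suc m)) (*-monoʳ-≤ (+-nonneg (^-nonneg m 0≤β) (^-nonneg m 0≤β))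
        (+-monoʳ-≤ (ι n) (≤-trans (1≤ι-suc 0) (ι-mono {1} (ℕ.≤-trans (ℕ.s≤s ℕ.z≤n) N≤n))))))
      (≤-trans (≤-reflexive (solve 3 (λ n b s → (n :+ n) :* (b :+ b) :* s := (con 1ℚ :+ con 1ℚ :+ (con 1ℚ :+ con 1ℚ)) :* (n :* (s :* b))) refl (ι n) (β ^ m) (ι (suc m))))
        (≤-trans (*-monoˡ-≤ (+-nonneg 0≤2 0≤2) Pm) (≤-trans (≤-reflexive (trans (*-identityʳ 4ℚ) (sym (trans (*-comm ε _) (*-inv-cancel 4ℚ 0<ε)))))
          (*-monoˡ-≤ (<⇒≤ 0<ε) (≤-trans (proj₂ arch) (ι-mono m₂≤m)))))))
      where
      0≤2 : 0ℚ ≤ 2ℚ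
      0≤2 = +-nonneg 0≤1 0≤1
    2m<n : ι m + ι m < ι n
    2m<n = ℚ.≰⇒> λ n≤2m → <-irrefl refl (<-≤-trans ¬Pk (≤-trans (*-monoʳ-≤ (*-nonneg (ι-nonneg m) (^-nonneg k 0≤β)) n≤2m)
      (*-cancelˡ-≤ 0<ρ (≤-trans (*-monoˡ-≤ 0≤ρ (*-monoˡ-≤ (+-nonneg (ι-nonneg m) (ι-nonneg m)) (*-monoˡ-≤ (ι-nonneg m) (^-mono k 0≤β β≤ρ))))
        (≤-trans (≤-reflexive (solve 3 (λ r m x → r :* ((m :+ m) :* (m :* x)) := m :* (m :* con 1ℚ) :* (r :* x) :+ m :* (m :* con 1ℚ) :* (r :* x)) refl ρ (ι m) (ρ ^ k)))
          (≤-trans (+-mono-≤ (proj₂ decay₂ m m₁≤m) (proj₂ decay₂ m m₁≤m))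
            (≤-reflexive (trans (sym (distribʳ ρ ½ ½)) (trans (cong (_* ρ) ½+½) (*-comm 1ℚ ρ))))))))))
    ω⁻ˡ : inv ω ^ l ≤ (1ℚ - κ) ^ l * (inv β * (ι n * ι m))
    ω⁻ˡ = *-cancelʳ-≤ (^-pos (suc k) 0<β) (≤-trans
      (*-monoˡ-≤ (^-nonneg l (inv-nonneg 0<ω)) (≤-trans (^-antitone 0≤β β≤1 2l≤m) (≤-trans (≤-reflexive (trans (^-+ β l l) (sym (*-^ β β l))))
        (≤-trans (^-mono l (*-nonneg 0≤β 0≤β) β²≤) (≤-reflexive (*-^ ω (1ℚ - κ) l))))))
      (≤-trans (≤-reflexive (trans (sym (*-assoc _ _ _)) (trans (cong (_* (1ℚ - κ) ^ l) (trans (*-comm _ _) (^-inv l 0<ω))) (*-identityˡ _))))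
        (≤-trans (subst (_≤ (1ℚ - κ) ^ l * (ι n * (ι m * β ^ k))) (*-identityʳ _) (*-monoˡ-≤ (^-nonneg l (≤⇒0≤ κ≤1)) (<⇒≤ ¬Pk)))
          (≤-reflexive (trans (cong ((1ℚ - κ) ^ l *_) (trans (sym (*-identityˡ _)) (cong (_* (ι n * (ι m * β ^ k))) (sym (*-inv 0<β)))))
            (solve 6 (λ x b i n m y → x :* (b :* i :* (n :* (m :* y))) := x :* (i :* (n :* m)) :* (b :* y)) refl ((1ℚ - κ) ^ l) β (inv β) (ι n) (ι m) (β ^ k)))))))
    m≤3l : ι m ≤ 3ℚ * ι l
    m≤3l = ≤-trans (ι-mono m≤2l+1) (≤-trans (≤-reflexive (cong (1ℚ +_) (ι-+ l l)))
      (≤-by (ι l - 1ℚ) (≤⇒0≤ (≤-trans (1≤ι-suc 0) (ι-mono {1} (ℕ.≤-trans (ℕ.s≤s ℕ.z≤n) L₀≤l))))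
        (solve 1 (λ l → (con 1ℚ :+ (con 1ℚ :+ con 1ℚ)) :* l := con 1ℚ :+ (l :+ l) :+ (l :- con 1ℚ)) refl (ι l))))
    cube : ι m ^ 3 * (i₀ * i₀) * (1ℚ - κ) ^ l ≤ ½ * ε
    cube = ≤-trans (*-monoʳ-≤ (^-nonneg l (≤⇒0≤ κ≤1)) (*-monoʳ-≤ (*-nonneg (<⇒≤ 0<i₀) (<⇒≤ 0<i₀)) (≤-trans (^-mono 3 (ι-nonneg m) m≤3l) (≤-reflexive (*-^ 3ℚ (ι l) 3)))))
      (≤-trans (≤-reflexive (solve 4 (λ a b i x → a :* b :* i :* x := a :* i :* (b :* x)) refl (3ℚ ^ 3) (ι l ^ 3) (i₀ * i₀) ((1ℚ - κ) ^ l)))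
        (≤-trans (*-monoˡ-≤ (<⇒≤ 0<C) (proj₂ decay l (ℕ.≤-trans (ℕ.n≤1+n _) L₀≤l))) (≤-reflexive (trans (*-comm C _) (*-inv-cancel (½ * ε) 0<C)))))
    dense : ι m * ι m * (inv θ * inv ω ^ l) ≤ ε * (ι n - ι m)
    dense = ≤-trans (*-monoˡ-≤ (*-nonneg (ι-nonneg m) (ι-nonneg m)) (*-mono-≤ (inv-nonneg 0<θ) (inv-anti 0<ω₀ ω₀≤θ) (^-nonneg l (inv-nonneg 0<ω))
        (≤-trans ω⁻ˡ (*-monoˡ-≤ (^-nonneg l (≤⇒0≤ κ≤1)) (*-monoʳ-≤ (*-nonneg (ι-nonneg n) (ι-nonneg m)) (inv-anti 0<ω₀ ω₀≤β))))))
      (≤-trans (≤-reflexive (solve 4 (λ m i x n → m :* m :* (i :* (x :* (i :* (n :* m)))) := m :* (m :* (m :* con 1ℚ)) :* (i :* i) :* x :* n) refl (ι m) i₀ ((1ℚ - κ) ^ l) (ι n)))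
        (≤-trans (*-monoʳ-≤ (ι-nonneg n) cube) (≤-by (½ * ε * (ι n - (ι m + ι m))) (*-nonneg (<⇒≤ (*-pos 0<½ 0<ε)) (≤⇒0≤ (<⇒≤ 2m<n)))
          (solve 3 (λ e n m → e :* (n :- m) := con ½ :* e :* n :+ con ½ :* e :* (n :- (m :+ m))) refl ε (ι n) (ι m)))))

-- Cliques that realise a given shape

same-swap : ∀ s b → same s b ≡ s → b ≡ true
same-swap true b e = e
same-swap false false ()
same-swap false true e = refl

same-true : ∀ s → same s true ≡ s
same-true true = refl
same-true false = refl

same-false : ∀ s → same s false ≡ not s
same-false true = refl
same-false false = refl

same-not : ∀ s b → same s b ≡ not s → b ≡ false
same-not true b e = e
same-not false false e = refl

hom-false : ∀ P {n} (K v : Vec Bool n) → hom P K v ≡ false → ∃ λ i → lookup K i ≡ true × P (lookup v i) ≡ false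
hom-false P [] [] ()
hom-false P (true ∷ K) (b ∷ v) e with P b in eq
... | false = zero , refl , eq
... | true = let i , l , h = hom-false P K v e in suc i , l , h
hom-false P (false ∷ K) (b ∷ v) e = let i , l , h = hom-false P K v e in suc i , l , h

one-element : ∀ {n} (K : Vec Bool n) → 1 ℕ.≤ size K → ∃ λ i → lookup K i ≡ true
one-element (true ∷ K) _ = zero , refl
one-element (false ∷ K) l = let i , e = one-element K l in suc i , e

two-elements : ∀ {n} (K : Vec Bool n) → 2 ℕ.≤ size K → ∃ λ i → ∃ λ j → i ≢ j × lookup K i ≡ true × lookup K j ≡ true
two-elements (true ∷ K) (ℕ.s≤s l) = let i , e = one-element K l in zero , suc i , (λ ()) , refl , e
two-elements (false ∷ K) l = let i , j , ne , e , e′ = two-elements K l in suc i , suc j , ne ∘ Fin.suc-injective , e , e′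

clique⇒Shape : ∀ {n} (G : Graph n) → Typical G → ∀ (K : Vec Bool n) s c t → 2 ℕ.≤ size K → clique c K G ≡ true →
  (∀ e → t e ≡ true → ∃ λ b → lookup K b ≡ false × hom (same e) K (nbr G b) ≡ true) →
  (∀ e → t e ≡ false → ∀ b → lookup K b ≡ false → hom (same e) K (nbr G b) ≡ false) →
  Shape (coloured G (Vec.map (same s) K)) s c t
clique⇒Shape G ext K s c t 2≤ cl uni div = homogeneous⇒Shape M ext (ℕ.m≤m+n 3 typeCount) s c t
  (λ a b a≢b p q → clique-sound c K G cl a b a≢b (inside a p) (inside b q))
  (let i , j , ne , p , q = two-elements K 2≤ in i , j , ne , side-in i p , side-in j q)
  (λ e te → let b , out , h = uni e te in b , trans (side≡ b) (trans (cong (same s) out) (same-false s)) ,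
    λ a p → trans (sym (lookup-nbr G b a)) (same⇒≡ (hom-sound (same e) K (nbr G b) h a (inside a p))))
  (λ e te b p → let a , q , ne = hom-false (same e) K (nbr G b) (div e te b (same-not s _ (trans (sym (side≡ b)) p)))
                in a , side-in a q , Bool.¬-not (λ eq → Bool.not-¬ (≡⇒same (trans (lookup-nbr G b a) eq)) ne))
  where
  M = coloured G (Vec.map (same s) K)
  side≡ : ∀ i → side M i ≡ same s (lookup K i)
  side≡ i = Vec.lookup-map i (same s) K
  inside : ∀ a → side M a ≡ s → lookup K a ≡ true
  inside a p = same-swap s _ (trans (sym (side≡ a)) p)
  side-in : ∀ i → lookup K i ≡ true → side M i ≡ s
  side-in i p = trans (side≡ i) (trans (cong (same s) p) (same-true s))

Realised : ∀ {n} → Bool → Bool → (Bool → Bool) → Graph n → Set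
Realised s c t G = ∃ λ X → Shape (coloured G X) s c t

-- A homogeneous pair suffices: the extension property supplies, for either colour, a vertex joined
-- in it to both members. Every typical graph qualifies.
both-uniform : ∀ {n} (G : Graph n) → Typical G → ∀ s c t → (∀ e → t e ≡ true) → Realised s c t G
both-uniform {n} G ext s c t all-t = X , homogeneous⇒Shape M ext 3≤ s c t
  (λ a b a≢b p q → homog a b a≢b (inside a p) (inside b q))
  (x , y , x≢y , in-side (inj₁ refl) , in-side (inj₂ refl))
  (λ e _ → let b , b≢x , b≢y , ex , ey = ext₂ G ext 2≤ x≢y e e in
    b , out-side b≢x b≢y , λ a p → case inside a p of λ { (inj₁ refl) → ex ; (inj₂ refl) → ey })
  (λ e te → case trans (sym te) (all-t e) of λ ())
  where
  3≤ = ℕ.m≤m+n 3 typeCount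
  2≤ : 2 ℕ.≤ 3 ℕ.+ typeCount
  2≤ = ℕ.≤-trans (ℕ.n≤1+n 2) 3≤
  x = proj₁ (ext 0 ℕ.z≤n none none (λ ()))
  next = ext 1 (ℕ.≤-trans (ℕ.n≤1+n 1) 2≤) (x ◂ none) (c ◂ none) (◂-consistent {k = 0} (λ ()) (λ ()))
  y = proj₁ next
  x≢y : x ≢ y
  x≢y e = proj₁ (proj₂ next zero) (sym e)
  y~x : adjacent G y x ≡ c
  y~x = proj₂ (proj₂ next zero)
  member : Fin n → Bool
  member v = does (v Fin.≟ x) ∨ does (v Fin.≟ y)
  X = Vec.tabulate (λ v → same s (member v))
  M = coloured G X
  inside : ∀ a → side M a ≡ s → a ≡ x ⊎ a ≡ y
  inside a p = lemma (a Fin.≟ x) (a Fin.≟ y) (same-swap s _ (trans (sym (Vec.lookup∘tabulate _ a)) p))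
    where
    lemma : (d : Dec (a ≡ x)) (d′ : Dec (a ≡ y)) → does d ∨ does d′ ≡ true → a ≡ x ⊎ a ≡ y
    lemma (yes p) _ _ = inj₁ p
    lemma (no _) (yes p) _ = inj₂ p
  member-in : ∀ {a} (d : Dec (a ≡ x)) (d′ : Dec (a ≡ y)) → a ≡ x ⊎ a ≡ y → does d ∨ does d′ ≡ true
  member-in (yes _) _ _ = refl
  member-in (no _) (yes _) _ = refl
  member-in (no p) (no q) (inj₁ e) = contradiction e p
  member-in (no p) (no q) (inj₂ e) = contradiction e q
  in-side : ∀ {a} → a ≡ x ⊎ a ≡ y → side M a ≡ s
  in-side {a} p = trans (Vec.lookup∘tabulate _ a) (trans (cong (same s) (member-in (a Fin.≟ x) (a Fin.≟ y) p)) (same-true s))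
  member-out : ∀ {a} (d : Dec (a ≡ x)) (d′ : Dec (a ≡ y)) → a ≢ x → a ≢ y → does d ∨ does d′ ≡ false
  member-out (no _) (no _) _ _ = refl
  member-out (yes p) _ ne _ = contradiction p ne
  member-out (no _) (yes p) _ ne = contradiction p ne
  out-side : ∀ {a} → a ≢ x → a ≢ y → side M a ≡ not s
  out-side {a} p q = trans (Vec.lookup∘tabulate _ a) (trans (cong (same s) (member-out (a Fin.≟ x) (a Fin.≟ y) p q)) (same-false s))
  homog : ∀ a b → a ≢ b → a ≡ x ⊎ a ≡ y → b ≡ x ⊎ b ≡ y → adjacent G a b ≡ c
  homog a b ne (inj₁ refl) (inj₁ refl) = contradiction refl ne
  homog a b ne (inj₁ refl) (inj₂ refl) = trans (adjacent-sym G x y) y~x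
  homog a b ne (inj₂ refl) (inj₁ refl) = y~x
  homog a b ne (inj₂ refl) (inj₂ refl) = contradiction refl ne

rowE-hom-same : ∀ {w} → IsDistribution w → ∀ e {n} (K : Vec Bool n) → rowE w (λ v → 𝟙 (hom (same e) K v)) ≡ w e ^ size K
rowE-hom-same {w} d e K = trans (rowE-hom d (same e) K) (cong (_^ size K) (prob-same w e))

Bounded-upper : ∀ {ω w} → Bounded ω w → ∀ b → w b ≤ 1ℚ - ω
Bounded-upper {ω} {w} bd b = upper b
  where
  open Bounded bd
  open IsDistribution dist
  upper : ∀ b → w b ≤ 1ℚ - ω
  upper true = ≤-by (w false - ω) (≤⇒0≤ (lower false)) (trans (cong (_- ω) (sym total)) (solve 3 (λ p q o → p :+ q :- o := p :+ (q :- o)) refl (w true) (w false) ω))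
  upper false = ≤-by (w true - ω) (≤⇒0≤ (lower true)) (trans (cong (_- ω) (sym total)) (solve 3 (λ p q o → p :+ q :- o := q :+ (p :- o)) refl (w true) (w false) ω))

1-ω-pos : ∀ {ω w} → 0ℚ < ω → Bounded ω w → 0ℚ < 1ℚ - ω
1-ω-pos 0<ω bd = <-≤-trans 0<ω (≤-trans (Bounded.lower bd true) (Bounded-upper bd true))

𝟙-not-hom-local : ∀ P {n} (K : Vec Bool n) → Local K (λ v → 𝟙 (not (hom P K v)))
𝟙-not-hom-local P K v = cong (𝟙 ∘ not) (hom-local P (⊑-refl K) v)

rowE-not-hom : ∀ {w} → IsDistribution w → ∀ e {n} (K : Vec Bool n) → rowE w (λ v → 𝟙 (not (hom (same e) K v))) ≡ 1ℚ - w e ^ size K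
rowE-not-hom {w} d e K = trans (rowE-cong w (λ v → 𝟙-not (hom (same e) K v))) (trans (rowE-complement d _) (cong (λ x → 1ℚ - x) (rowE-hom-same d e K)))


four-terms : ∀ {a ε} → a ≤ ε → a + a + (ε + ε) ≤ 4ℚ * ε
four-terms {a} {ε} h = ≤-trans (+-monoʳ-≤ (ε + ε) (+-mono-≤ h h))
  (≤-reflexive (solve 1 (λ e → e :+ e :+ (e :+ e) := (con 1ℚ :+ con 1ℚ :+ (con 1ℚ :+ con 1ℚ)) :* e) refl ε))

-- Vertex zero is joined to the clique in colour d; no other vertex is joined to it in the opposite colour.
attached : ∀ {w ω₀ ε} → Bounded ω₀ w → 0ℚ < ω₀ → ∀ {n} c d → 0ℚ < ε → ε ≤ ½ → SizeChoice ε n (w c) (w (not d)) (w d) →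
  ∃ λ m → 2 ℕ.≤ m × Rare (4ℚ * ε) w {suc n} (NoGood c m (hom (same d)) (λ K v → not (hom (same (not d)) K v)))
attached {w} {ω₀} {ε} bd 0<ω₀ {n} c d 0<ε ε≤½ ch = m , 2≤m , rare-≤ (four-terms sparse) (second-moment dist c (0<w c) n m (hom (same d)) (λ K v → not (hom (same (not d)) K v))
    (𝟙-not-hom-local (same (not d))) {w d} {b} {ε} l (0<w d) 0≤b b≤1
    (λ K e → subst (w d ^ m * (1ℚ - b) ≤_) (sym (trans (rowE-hom-same dist d K) (cong (w d ^_) e)))
      (≤-trans (*-monoˡ-≤ (^-nonneg m (nonneg d)) (1-b≤1)) (≤-reflexive (*-identityʳ _))))
    (λ K e → ≤-trans (complement-anti β^≤b) (≤-reflexive (sym (trans (rowE-not-hom dist (not d) K) (cong (λ k → 1ℚ - w (not d) ^ k) e)))))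
    (λ K L eK eL → ≤-reflexive (trans (cong (_* w d ^ size (K ∩ L)) (trans (rowE-cong w (λ v → 𝟙-hom-∪ (same d) K L v)) (rowE-hom-same dist d (K ∪ L))))
      (trans (sym (^-+ (w d) (size (K ∪ L)) (size (K ∩ L)))) (trans (cong (w d ^_) (trans (size-∪+∩ K L) (cong₂ ℕ._+_ eK eL))) (^-+ (w d) m m)))))
    m≤ m<n dense (<⇒≤ 0<ε) ε≤½)
  where
  open Bounded bd
  open IsDistribution dist
  open SizeChoice ch
  0<w : ∀ b → 0ℚ < w b
  0<w b = <-≤-trans 0<ω₀ (lower b)
  b = w (not d) ^ m + w (not d) ^ m
  0≤b : 0ℚ ≤ b
  0≤b = +-nonneg (^-nonneg m (nonneg (not d))) (^-nonneg m (nonneg (not d)))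
  b≤1 : b ≤ 1ℚ
  b≤1 = ≤-trans (≤-trans (subst (_≤ ι (suc n) * b) (*-identityˡ b) (*-monoʳ-≤ 0≤b (1≤ι-suc n))) sparse) (≤-trans ε≤½ (≤-by ½ (<⇒≤ 0<½) (sym ½+½)))
  1-b≤1 : 1ℚ - b ≤ 1ℚ
  1-b≤1 = ≤-by b 0≤b (solve 1 (λ b → con 1ℚ := con 1ℚ :- b :+ b) refl b)
  β^≤b : w (not d) ^ m ≤ b
  β^≤b = ≤-+ʳ (^-nonneg m (nonneg (not d)))

-- No vertex is to be uniform to the clique, so vertex zero obeys the same condition as the others:
-- `R` and `h` coincide and θ = 1. The two forbidden uniform patterns give failure probability at
-- most 2βᵐ, with β a common bound for both weights.
isolated : ∀ {w ω₀ ε β} → Bounded ω₀ w → 0ℚ < ω₀ → ∀ {n} c → 0ℚ < ε → ε ≤ ½ → (∀ b → w b ≤ β) → SizeChoice ε n (w c) β 1ℚ →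
  ∃ λ m → 2 ℕ.≤ m × Rare (4ℚ * ε) w {suc n}
    (NoGood c m (λ K v → not (hom (same true) K v) ∧ not (hom (same false) K v)) (λ K v → not (hom (same true) K v) ∧ not (hom (same false) K v)))
isolated {w} {ω₀} {ε} {β} bd 0<ω₀ {n} c 0<ε ε≤½ w≤β ch = m , 2≤m , rare-≤ (four-terms sparse) (second-moment dist c (0<w c) n m h h
    (λ K v → cong₂ (λ x y → 𝟙 (not x ∧ not y)) (hom-local (same true) (⊑-refl K) v) (hom-local (same false) (⊑-refl K) v)) {1ℚ} {b} {ε} l 0<1 0≤b b≤1
    (λ K e → ≤-trans (≤-reflexive (trans (cong (_* (1ℚ - b)) (1^ m)) (*-identityˡ _))) (Eh K e)) Eh
    (λ K L _ _ → ≤-trans (≤-reflexive (trans (cong (rowE w (λ v → 𝟙 (h K v) * 𝟙 (h L v)) *_) (1^ (size (K ∩ L)))) (*-identityʳ _)))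
      (≤-trans (rowE-mono nonneg (λ v → ≤-trans (*-mono-≤ (𝟙-nonneg (h K v)) (𝟙≤1 (h K v)) (𝟙-nonneg (h L v)) (𝟙≤1 (h L v))) (≤-reflexive (*-identityˡ 1ℚ))))
        (≤-reflexive (trans (rowE-const dist 1ℚ) (sym (trans (cong₂ _*_ (1^ m) (1^ m)) (*-identityˡ 1ℚ)))))))
    m≤ m<n dense (<⇒≤ 0<ε) ε≤½)
  where
  open Bounded bd
  open IsDistribution dist
  open SizeChoice ch
  h : Vec Bool n → Vec Bool n → Bool
  h K v = not (hom (same true) K v) ∧ not (hom (same false) K v)
  0<w : ∀ b → 0ℚ < w b
  0<w b = <-≤-trans 0<ω₀ (lower b)
  0≤β : 0ℚ ≤ β
  0≤β = ≤-trans (nonneg c) (w≤β c)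
  b = β ^ m + β ^ m
  0≤b : 0ℚ ≤ b
  0≤b = +-nonneg (^-nonneg m 0≤β) (^-nonneg m 0≤β)
  b≤1 : b ≤ 1ℚ
  b≤1 = ≤-trans (≤-trans (subst (_≤ ι (suc n) * b) (*-identityˡ b) (*-monoʳ-≤ 0≤b (1≤ι-suc n))) sparse) (≤-trans ε≤½ (≤-by ½ (<⇒≤ 0<½) (sym ½+½)))
  union : ∀ x y → 1ℚ - (𝟙 x + 𝟙 y) ≤ 𝟙 (not x ∧ not y)
  union true true = ≤-by 1ℚ 0≤1 (solve 0 (con 0ℚ := con 1ℚ :- (con 1ℚ :+ con 1ℚ) :+ con 1ℚ) refl)
  union true false = ≤-reflexive (solve 0 (con 1ℚ :- (con 1ℚ :+ con 0ℚ) := con 0ℚ) refl)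
  union false true = ≤-reflexive (solve 0 (con 1ℚ :- (con 0ℚ :+ con 1ℚ) := con 0ℚ) refl)
  union false false = ≤-reflexive (solve 0 (con 1ℚ :- (con 0ℚ :+ con 0ℚ) := con 1ℚ) refl)
  Eh : ∀ K → size K ≡ m → 1ℚ - b ≤ rowE w (λ v → 𝟙 (h K v))
  Eh K e = ≤-trans (complement-anti (+-mono-≤ (^-mono m (nonneg true) (w≤β true)) (^-mono m (nonneg false) (w≤β false))))
    (≤-trans (≤-reflexive (sym (trans (rowE-complement dist _) (cong (λ x → 1ℚ - x) (trans (rowE-+ w _ _)
        (cong₂ _+_ (trans (rowE-hom-same dist true K) (cong (w true ^_) e)) (trans (rowE-hom-same dist false K) (cong (w false ^_) e))))))))
      (rowE-mono nonneg (λ v → union (hom (same true) K v) (hom (same false) K v))))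

¬¬-elim : ExcludedMiddle 0ℓ → ∀ {P : Set} → ¬ ¬ P → P
¬¬-elim em {P} h = go em
  where
  go : Dec P → P
  go (yes p) = p
  go (no ¬p) = contradiction ¬p h

not-true : ∀ {b} → not b ≡ true → b ≡ false
not-true {false} _ = refl

attached⇒Realised : ∀ {n m} (G : Graph (suc n)) → Typical G → ∀ s c d t → 2 ℕ.≤ m → t d ≡ true → t (not d) ≡ false →
  ¬ Realised s c t G → NoGood c m (hom (same d)) (λ K v → not (hom (same (not d)) K v)) G
attached⇒Realised (r ∷ G) ext s c d t 2≤m td tnd ¬r (K , refl , hr , cl , h) = ¬r (_ , clique⇒Shape (r ∷ G) ext (false ∷ K) s c t 2≤m cl uni div)
  where
  uni : ∀ e → t e ≡ true → ∃ λ b → lookup (false ∷ K) b ≡ false × hom (same e) (false ∷ K) (nbr (r ∷ G) b) ≡ true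
  uni e te = zero , refl , subst (λ e → hom (same e) K r ≡ true) (sym (lemma (e Bool.≟ d))) hr
    where
    lemma : Dec (e ≡ d) → e ≡ d
    lemma (yes p) = p
    lemma (no p) = case trans (sym te) (trans (cong t (Bool.¬-not p)) tnd) of λ ()
  div : ∀ e → t e ≡ false → ∀ b → lookup (false ∷ K) b ≡ false → hom (same e) (false ∷ K) (nbr (r ∷ G) b) ≡ false
  div e te b out = subst (λ e → hom (same e) (false ∷ K) (nbr (r ∷ G) b) ≡ false) (sym (lemma (e Bool.≟ d))) (go b out)
    where
    lemma : Dec (e ≡ d) → e ≡ not d
    lemma (yes refl) = case trans (sym te) td of λ ()
    lemma (no p) = Bool.¬-not p
    go : ∀ b → lookup (false ∷ K) b ≡ false → hom (same (not d)) (false ∷ K) (nbr (r ∷ G) b) ≡ false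
    go zero _ = Bool.¬-not λ h′ → let i , l = one-element K (ℕ.≤-trans (ℕ.n≤1+n 1) 2≤m) in
      Bool.not-¬ (same⇒≡ {d} (hom-sound (same d) K r hr i l)) (same⇒≡ {not d} (hom-sound (same (not d)) K r h′ i l))
    go (suc b) out = not-true (h b out)

isolated⇒Realised : ∀ {n m} (G : Graph (suc n)) → Typical G → ∀ s c t → 2 ℕ.≤ m → (∀ e → t e ≡ false) → ¬ Realised s c t G →
  NoGood c m (λ K v → not (hom (same true) K v) ∧ not (hom (same false) K v)) (λ K v → not (hom (same true) K v) ∧ not (hom (same false) K v)) G
isolated⇒Realised (r ∷ G) ext s c t 2≤m tf ¬r (K , refl , hr , cl , h) = ¬r (_ , clique⇒Shape (r ∷ G) ext (false ∷ K) s c t 2≤m cl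
    (λ e te → case trans (sym te) (tf e) of λ ()) (λ { e _ zero _ → split e K r hr ; e _ (suc b) out → split e K (nbr G b) (h b out) }))
  where
  split : ∀ e K v → not (hom (same true) K v) ∧ not (hom (same false) K v) ≡ true → hom (same e) K v ≡ false
  split true K v p = not-true (proj₁ (∧-true p))
  split false K v p = not-true (proj₂ (∧-true {not (hom (same true) K v)} p))

-- The margin κ is relative, so that the comparison can hold for all late rational approximations at
-- once.
Subcritical Supercritical : ℚ → (Bool → ℚ) → Bool → Set
Subcritical κ w c = w (not c) * w (not c) ≤ w c * (1ℚ - κ)
Supercritical κ w c = w c ≤ w (not c) * w (not c) * (1ℚ - κ)

-- The flags select the construction: a pair if both are set, a clique attached to vertex zero if
-- one is, an isolated clique if none is. If only `t (not c)` is set, the vertices to be avoided are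
-- those joined in colour `c`, and ω² ≤ ω(1 - κ) holds because ω ≤ 1 - ω₀. With `t (not c)` unset,
-- q² ≤ ω(1 - κ) is what makes room for the clique.
rare-¬Realised : ExcludedMiddle 0ℓ → ∀ {ω₀ κ ε} → 0ℚ < ω₀ → 0ℚ < κ → κ ≤ ω₀ → 0ℚ < ε → ∀ s c t →
  ∃ λ N → ∀ n → N ℕ.≤ n → ∀ w → Bounded ω₀ w → t (not c) ≡ true ⊎ Subcritical κ w c → Rare ε w {n} (λ G → ¬ Realised s c t G)
rare-¬Realised em {ω₀} {κ} {ε} 0<ω₀ 0<κ κ≤ω₀ 0<ε s c t = go (0ℚ ℚ.<? 1ℚ - ω₀)
  where
  Goal : Set
  Goal = ∃ λ N → ∀ n → N ℕ.≤ n → ∀ w → Bounded ω₀ w → t (not c) ≡ true ⊎ Subcritical κ w c → Rare ε w {n} (λ G → ¬ Realised s c t G)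
  go : Dec (0ℚ < 1ℚ - ω₀) → Goal
  go (no ¬p) = 0 , λ n _ w bd _ → contradiction (1-ω-pos 0<ω₀ bd) ¬p
  go (yes 0<ρ) = N , bound
    where
    -- The second moment bound needs δ ≤ 1/2, and the two exceptional events cost 4η each.
    η = ℚ._⊓_ ½ (inv (4ℚ + 4ℚ) * ε)
    0<8 : 0ℚ < 4ℚ + 4ℚ
    0<8 = +-pos 0<4 (<⇒≤ 0<4)
      where
      0<4 : 0ℚ < 4ℚ
      0<4 = +-pos (+-pos 0<1 0≤1) (+-nonneg 0≤1 0≤1)
    0<η : 0ℚ < η
    0<η = lemma (ℚ.⊓-sel ½ (inv (4ℚ + 4ℚ) * ε))
      where
      lemma : η ≡ ½ ⊎ η ≡ inv (4ℚ + 4ℚ) * ε → 0ℚ < η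
      lemma (inj₁ e) = subst (0ℚ <_) (sym e) 0<½
      lemma (inj₂ e) = subst (0ℚ <_) (sym e) (*-pos (inv-pos 0<8) 0<ε)
    η≤½ : η ≤ ½
    η≤½ = ℚ.p⊓q≤p ½ (inv (4ℚ + 4ℚ) * ε)
    8η≤ε : 4ℚ * η + 4ℚ * η ≤ ε
    8η≤ε = ≤-trans (≤-reflexive (sym (distribʳ η 4ℚ 4ℚ))) (≤-trans (*-monoˡ-≤ (<⇒≤ 0<8) (ℚ.p⊓q≤q ½ (inv (4ℚ + 4ℚ) * ε)))
      (≤-reflexive (trans (sym (*-assoc _ _ _)) (trans (cong (_* ε) (*-inv 0<8)) (*-identityˡ ε)))))
    κ≤1 = ≤-trans κ≤ω₀ (<⇒≤ (0<⇒< 0<ρ))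
    sizes = choose-size 0<ω₀ 0<ρ 0<κ κ≤1 0<η
    0<4η : 0ℚ < 4ℚ * η
    0<4η = *-pos (+-pos (+-pos 0<1 0≤1) (+-nonneg 0≤1 0≤1)) 0<η
    typical = rare-¬Ext em (3 ℕ.+ typeCount) 0<ω₀ 0<4η
    N = suc (proj₁ sizes ⊔ proj₁ typical)
    bound : ∀ n → N ℕ.≤ n → ∀ w → Bounded ω₀ w → t (not c) ≡ true ⊎ Subcritical κ w c → Rare ε w {n} (λ G → ¬ Realised s c t G)
    bound (suc n) (ℕ.s≤s N≤n) w bd alt = finish (cases (t c) refl (t (not c)) refl)
      where
      open Bounded bd
      open IsDistribution dist
      Missing : Graph (suc n) → Set
      Missing G = Typical G × ¬ Realised s c t G
      choice : ∀ {β θ} → ω₀ ≤ β → β ≤ 1ℚ - ω₀ → ω₀ ≤ θ → β * β ≤ w c * (1ℚ - κ) → SizeChoice η n (w c) β θ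
      choice = proj₂ sizes n (ℕ.m⊔n≤o⇒m≤o (proj₁ sizes) (proj₁ typical) N≤n) (lower c)
      own : w c * w c ≤ w c * (1ℚ - κ)
      own = *-monoˡ-≤ (nonneg c) (≤-trans (Bounded-upper bd c) (complement-anti κ≤ω₀))
      no-case : Rare (4ℚ * η) w (λ (G : Graph (suc n)) → ⊥)
      no-case = (λ _ → 0ℚ) , (λ _ → ≤-refl) , (λ _ ()) , ≤-trans (≤-reflexive (graphE-0 w)) (<⇒≤ 0<4η)
      sub : t (not c) ≡ false → Subcritical κ w c
      sub e = lemma alt
        where
        lemma : t (not c) ≡ true ⊎ Subcritical κ w c → Subcritical κ w c
        lemma (inj₁ p) = case trans (sym e) p of λ ()
        lemma (inj₂ p) = p
      every : ∀ {b} → t c ≡ b → t (not c) ≡ b → ∀ e → t e ≡ b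
      every p q e = lemma (e Bool.≟ c)
        where
        lemma : Dec (e ≡ c) → t e ≡ _
        lemma (yes refl) = p
        lemma (no ne) = trans (cong t (Bool.¬-not ne)) q
      cases : ∀ a → t c ≡ a → ∀ b → t (not c) ≡ b → Rare (4ℚ * η) w Missing
      cases true p true q = rare-⊆ (λ G (ext , ¬r) → ¬r (both-uniform G ext s c t (every p q))) no-case
      cases true p false q = let m , 2≤m , r = attached bd 0<ω₀ c c 0<η η≤½ (choice (lower (not c)) (Bounded-upper bd (not c)) (lower c) (sub q))
        in rare-⊆ (λ G (ext , ¬r) → attached⇒Realised G ext s c c t 2≤m p q ¬r) r
      cases false p true q = let m , 2≤m , r = attached bd 0<ω₀ c (not c) 0<η η≤½
                                    (choice (subst (λ b → ω₀ ≤ w b) (sym nn) (lower c)) (subst (λ b → w b ≤ 1ℚ - ω₀) (sym nn) (Bounded-upper bd c)) (lower (not c))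
                                      (subst (λ b → w b * w b ≤ w c * (1ℚ - κ)) (sym nn) own))
        in rare-⊆ (λ G (ext , ¬r) → attached⇒Realised G ext s c (not c) t 2≤m q (trans (cong t nn) p) ¬r) r
        where
        nn : not (not c) ≡ c
        nn = Bool.not-involutive c
      cases false p false q = max (≤-total (w c) (w (not c)))
        where
        two : ∀ {β} → w c ≤ β → w (not c) ≤ β → ∀ b → w b ≤ β
        two p q b = lemma (b Bool.≟ c)
          where
          lemma : Dec (b ≡ c) → w b ≤ _
          lemma (yes refl) = p
          lemma (no ne) = subst (λ b → w b ≤ _) (sym (Bool.¬-not ne)) q
        ω₀≤1 : ω₀ ≤ 1ℚ
        ω₀≤1 = ≤-trans (lower c) (≤1 c)
        finish′ : ∀ {β} → (∀ b → w b ≤ β) → ω₀ ≤ β → β ≤ 1ℚ - ω₀ → β * β ≤ w c * (1ℚ - κ) → Rare (4ℚ * η) w Missing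
        finish′ w≤β a b e = let m , 2≤m , r = isolated bd 0<ω₀ c 0<η η≤½ w≤β (choice a b ω₀≤1 e)
          in rare-⊆ (λ G (ext , ¬r) → isolated⇒Realised G ext s c t 2≤m (every p q) ¬r) r
        max : w c ≤ w (not c) ⊎ w (not c) ≤ w c → Rare (4ℚ * η) w Missing
        max (inj₁ le) = finish′ (two le ≤-refl) (lower (not c)) (Bounded-upper bd (not c)) (sub q)
        max (inj₂ le) = finish′ (two ≤-refl le) (lower c) (Bounded-upper bd c) own
      finish : Rare (4ℚ * η) w Missing → Rare ε w (λ G → ¬ Realised s c t G)
      finish r = rare-≤ 8η≤ε (rare-⊆ decide (rare-∪ r (proj₂ typical (suc n) (ℕ.≤-trans (ℕ.m⊔n≤o⇒n≤o (proj₁ sizes) (proj₁ typical) N≤n) (ℕ.n≤1+n n)) w bd)))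
        where
        decide : ∀ G → ¬ Realised s c t G → Missing G ⊎ ¬ Typical G
        decide G ¬r = lemma em
          where
          lemma : Dec (Typical G) → Missing G ⊎ ¬ Typical G
          lemma (yes p) = inj₁ (p , ¬r)
          lemma (no p) = inj₂ p

-- Non-existence of dominating cliques in the supercritical regime

Dominating : Bool → ∀ {n} → Graph n → Set
Dominating c {n} G = ∃ λ (K : Vec Bool n) → clique c K G ≡ true × ∀ b → lookup K b ≡ false → hom (same (not c)) K (nbr G b) ≡ false

-- The sets A and K are kept apart because in the critical sentence the outside vertices are to be
-- dominated by the clique K with one vertex removed.
dominates : Bool → ∀ {n} → Vec Bool n → Vec Bool n → Graph n → ℚ
dominates c {n} A K G = 𝟙 (clique c K G) * ∏ n (λ i → outside-of K i (𝟙 (not (hom (same (not c)) A (nbr G i)))))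

dominates-nonneg : ∀ c {n} (A K : Vec Bool n) G → 0ℚ ≤ dominates c A K G
dominates-nonneg c {n} A K G = *-nonneg (𝟙-nonneg (clique c K G)) (∏-nonneg n (λ i → outside-nonneg K i (𝟙-nonneg (not (hom (same (not c)) A (nbr G i))))))

dominates-one : ∀ c {n} (A K : Vec Bool n) G → clique c K G ≡ true → (∀ b → lookup K b ≡ false → hom (same (not c)) A (nbr G b) ≡ false) → dominates c A K G ≡ 1ℚ
dominates-one c {n} A K G cl h = trans (cong₂ _*_ (cong 𝟙 cl) (∏-one n (λ i → lemma i (lookup K i) refl))) (*-identityˡ 1ℚ)
  where
  lemma : ∀ i b → lookup K i ≡ b → (if b then 1ℚ else 𝟙 (not (hom (same (not c)) A (nbr G i)))) ≡ 1ℚ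
  lemma i true e = refl
  lemma i false e = cong (𝟙 ∘ not) (h i e)

graphE-dominates : ∀ {w} → IsDistribution w → ∀ c {n} {A K : Vec Bool n} → A ⊑ K →
  graphE w (dominates c A K) ≡ w c ^ tri (size K) * (1ℚ - w (not c) ^ size A) ^ co-size K
graphE-dominates {w} d c {A = A} {K} A⊑K = trans (graphE-clique-outside d c K (λ v → 𝟙 (not (hom (same (not c)) A v))) (λ v → cong (𝟙 ∘ not) (hom-local (same (not c)) A⊑K v)))
  (cong (λ x → w c ^ tri (size K) * x ^ co-size K) (rowE-not-hom d (not c) A))

constant : Bool → ∀ {n} → Vec Bool n → Pattern n
constant e [] = []
constant e (true ∷ K) = just e ∷ constant e K
constant e (false ∷ K) = nothing ∷ constant e K

dom-constant : ∀ e {n} (K : Vec Bool n) → dom (constant e K) ≡ K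
dom-constant e [] = refl
dom-constant e (true ∷ K) = cong (true ∷_) (dom-constant e K)
dom-constant e (false ∷ K) = cong (false ∷_) (dom-constant e K)

matches-constant : ∀ e {n} (K v : Vec Bool n) → matches (constant e K) v ≡ hom (same e) K v
matches-constant e [] [] = refl
matches-constant e (true ∷ K) (b ∷ v) = cong (same e b ∧_) (matches-constant e K v)
matches-constant e (false ∷ K) (b ∷ v) = matches-constant e K v

≤*tri : ∀ {l k} → suc (l ℕ.+ l) ℕ.≤ k → l ℕ.* k ℕ.≤ tri k
≤*tri {l} {k} p = +-halve (ℕ.+-cancelʳ-≤ k _ _ (ℕ.≤-trans (ℕ.≤-reflexive (lemma k l)) (ℕ.≤-trans (ℕ.*-monoˡ-≤ k p) (ℕ.≤-reflexive (sym (tri-double k))))))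
  where
  lemma : ∀ j h → h ℕ.* j ℕ.+ h ℕ.* j ℕ.+ j ≡ suc (h ℕ.+ h) ℕ.* j
  lemma = solveℕ 2 (λ j h → h ⊛ j ⊹ h ⊛ j ⊹ j ≋ (conℕ 1 ⊹ (h ⊹ h)) ⊛ j) refl

1-x+x : ∀ x → x + (1ℚ - x) ≡ 1ℚ
1-x+x = solve 1 (λ x → x :+ (con 1ℚ :- x) := con 1ℚ) refl

-- The expected number of dominating k-cliques is at most q⁻ᵏ(1 − κ)^(k choose 2): since
-- (q²)^(k choose 2) qᵏ = (qᵏ)ᵏ, a binomial probability with success rate qᵏ splits off.
dominating-mean : ∀ {ω q κ ω₀} n k i l → k ℕ.+ i ≡ n → 0ℚ < ω₀ → ω₀ ≤ q → q ≤ 1ℚ → 0ℚ ≤ ω → 0ℚ ≤ κ → κ ≤ 1ℚ → ω ≤ q * q * (1ℚ - κ) →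
  (1ℚ - κ) ^ l ≤ ½ * ω₀ → suc (l ℕ.+ l) ℕ.≤ k → B n k * (ω ^ tri k * (1ℚ - q ^ k) ^ i) ≤ ½ ^ k
dominating-mean {ω} {q} {κ} {ω₀} n k i l k+i≡n 0<ω₀ ω₀≤q q≤1 0≤ω 0≤κ κ≤1 ω≤ small l≤k = *-cancelʳ-≤ (^-pos k 0<q) (≤-trans
  (≤-reflexive (solve 4 (λ b o y x → b :* (o :* y) :* x := b :* y :* (o :* x)) refl (B n k) (ω ^ tri k) ((1ℚ - x) ^ i) x))
  (≤-trans (*-monoˡ-≤ (*-nonneg (B-nonneg n k) (^-nonneg i (≤⇒0≤ x≤1))) (≤-trans (*-monoʳ-≤ (^-nonneg k 0≤q) (^-mono (tri k) 0≤ω ω≤)) (≤-reflexive power)))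
    (≤-trans (≤-reflexive (solve 4 (λ b y u v → b :* y :* (u :* v) := b :* u :* y :* v) refl (B n k) ((1ℚ - x) ^ i) (x ^ k) ((1ℚ - κ) ^ tri k)))
      (≤-trans (*-monoʳ-≤ (^-nonneg (tri k) 0≤1-κ) (≤-trans (binomial-term≤ (^-nonneg k 0≤q) (≤⇒0≤ x≤1) n k i k+i≡n) (≤-reflexive (trans (cong (_^ n) (1-x+x x)) (1^ n)))))
        (≤-trans (≤-reflexive (*-identityˡ _)) (≤-trans (^-antitone 0≤1-κ 1-κ≤1 (≤*tri {l} {k} l≤k))
          (≤-trans (≤-reflexive (trans (cong ((1ℚ - κ) ^_) (ℕ.*-comm l k)) (^-* (1ℚ - κ) k l)))
            (≤-trans (^-mono k (^-nonneg l 0≤1-κ) (≤-trans small (*-monoˡ-≤ (<⇒≤ 0<½) ω₀≤q))) (≤-reflexive (*-^ ½ q k))))))))))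
  where
  0<q = <-≤-trans 0<ω₀ ω₀≤q
  0≤q = <⇒≤ 0<q
  x = q ^ k
  x≤1 : x ≤ 1ℚ
  x≤1 = ^≤1 k 0≤q q≤1
  0≤1-κ = ≤⇒0≤ κ≤1
  1-κ≤1 : 1ℚ - κ ≤ 1ℚ
  1-κ≤1 = ≤-by κ 0≤κ (solve 1 (λ k → con 1ℚ := con 1ℚ :- k :+ k) refl κ)
  power : (q * q * (1ℚ - κ)) ^ tri k * x ≡ x ^ k * (1ℚ - κ) ^ tri k
  power = trans (cong (_* x) (trans (*-^ (q * q) (1ℚ - κ) (tri k)) (cong (_* (1ℚ - κ) ^ tri k) (*-^ q q (tri k)))))
    (trans (solve 3 (λ a y x → a :* a :* y :* x := a :* a :* x :* y) refl (q ^ tri k) ((1ℚ - κ) ^ tri k) x)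
      (cong (_* (1ℚ - κ) ^ tri k) (trans (cong (_* x) (sym (^-+ q (tri k) (tri k)))) (trans (sym (^-+ q (tri k ℕ.+ tri k) k)) (trans (cong (q ^_) (tri-double k)) (^-* q k k))))))

-- A dominating set of bounded size violates the extension property, since a constant pattern on it
-- is unmatched; the means for larger sizes are bounded by a geometric series with ratio 1/2.
rare-Dominating : ∀ {ω₀ κ ε} → 0ℚ < ω₀ → 0ℚ < κ → κ ≤ 1ℚ → 0ℚ < ε → ∀ c →
  ∃ λ N → ∀ n → N ℕ.≤ n → ∀ w → Bounded ω₀ w → Supercritical κ w c → Rare ε w {n} (Dominating c)
rare-Dominating {ω₀} {κ} {ε} 0<ω₀ 0<κ κ≤1 0<ε c = proj₁ small-sets , bound
  where
  1-κ<1 : 1ℚ - κ < 1ℚ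
  1-κ<1 = 0<⇒< (subst (0ℚ <_) (solve 1 (λ x → x := con 1ℚ :- (con 1ℚ :- x)) refl κ) 0<κ)
  -- With (1 - κ)ˡ ≤ ω₀/2 the margin outweighs the factor q to the power -k and still leaves 1/2 per
  -- vertex of the clique.
  power = poly*exp→0 0 (≤⇒0≤ κ≤1) 1-κ<1 (*-pos 0<½ 0<ω₀)
  l = proj₁ power
  tail = poly*exp→0 0 (<⇒≤ 0<½) (toWitness {a? = ½ ℚ.<? 1ℚ} _) (*-pos 0<½ (*-pos 0<½ 0<ε))
  K₀ = suc (l ℕ.+ l) ⊔ proj₁ tail
  small-sets = rare-Unmatched K₀ 0<ω₀ (*-pos 0<½ 0<ε)
  bound : ∀ n → proj₁ small-sets ℕ.≤ n → ∀ w → Bounded ω₀ w → Supercritical κ w c → Rare ε w {n} (Dominating c)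
  bound n N≤n w bd sup = rare-≤ (≤-reflexive (trans (sym (distribʳ ε ½ ½)) (trans (cong (_* ε) ½+½) (*-identityˡ ε))))
      (rare-⊆ split (rare-∪ (proj₂ small-sets n N≤n w bd) large))
    where
    open Bounded bd
    open IsDistribution dist
    Large : Graph n → Set
    Large G = ∃ λ (K : Vec Bool n) → K₀ ℕ.≤ size K × clique c K G ≡ true × ∀ b → lookup K b ≡ false → hom (same (not c)) K (nbr G b) ≡ false
    split : ∀ G → Dominating c G → (∃ λ π → size (dom π) ℕ.≤ K₀ × Unmatched π G) ⊎ Large G
    split G (K , cl , h) = lemma (ℕ.≤-total (size K) K₀)
      where
      lemma : size K ℕ.≤ K₀ ⊎ K₀ ℕ.≤ size K → (∃ λ π → size (dom π) ℕ.≤ K₀ × Unmatched π G) ⊎ Large G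
      lemma (inj₁ p) = inj₁ (constant (not c) K , subst (λ s → size s ℕ.≤ K₀) (sym (dom-constant (not c) K)) p ,
        λ v out → trans (matches-constant (not c) K (nbr G v)) (h v (subst (λ s → lookup s v ≡ false) (dom-constant (not c) K) out)))
      lemma (inj₂ p) = inj₂ (K , p , cl , h)
    term : ℕ → Graph n → ℚ
    term j G = subs (K₀ ℕ.+ j) (λ K → dominates c K K G)
    term≥0 : ∀ j G → 0ℚ ≤ term j G
    term≥0 j G = subs-nonneg (K₀ ℕ.+ j) (λ K → dominates-nonneg c K K G)
    large : Rare (½ * ε) w Large
    large = (λ G → Sum (suc n) (λ j → term j G)) , (λ G → Sum-nonneg (suc n) (λ j → term≥0 j G)) ,
      (λ { G (K , p , cl , h) → ≤-trans (≤-reflexive (sym (dominates-one c K K G cl h)))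
        (≤-trans (≤-subs (λ K → dominates-nonneg c K K G) K)
          (≤-trans (≤-reflexive (cong (λ k → subs k (λ K → dominates c K K G)) (sym (ℕ.m+[n∸m]≡n p))))
            (≤-Sum (suc n) (λ j → term≥0 j G) (size K ℕ.∸ K₀) (ℕ.s≤s (ℕ.≤-trans (ℕ.m∸n≤m (size K) K₀) (subst (size K ℕ.≤_) (size+co-size K) (ℕ.m≤m+n _ _)))))))}) ,
      ≤-trans (≤-reflexive (graphE-Sum w (suc n) term)) (≤-trans (Sum-mono (suc n) (λ j _ → mean j)) total≤)
      where
      mean : ∀ j → graphE w (term j) ≤ ½ ^ K₀ * ½ ^ j
      mean j = ≤-trans (≤-reflexive (subs-graphE w (K₀ ℕ.+ j) (λ K → dominates c K K))) (≤-trans (go (ℕ.≤-total (K₀ ℕ.+ j) n)) (≤-reflexive (^-+ ½ K₀ j)))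
        where
        k = K₀ ℕ.+ j
        q = w (not c)
        go : k ℕ.≤ n ⊎ n ℕ.≤ k → subs k (λ K → graphE w (dominates c K K)) ≤ ½ ^ k
        go (inj₁ k≤n) = ≤-trans (≤-reflexive (trans (subs-cong k λ K e → trans (graphE-dominates dist c (⊑-refl K))
              (cong₂ (λ a b → w c ^ tri a * (1ℚ - q ^ a) ^ b) e (co K e))) (subs-const k _)))
            (dominating-mean n k (n ℕ.∸ k) l (ℕ.m+[n∸m]≡n k≤n) 0<ω₀ (lower (not c)) (≤1 (not c)) (nonneg c) (<⇒≤ 0<κ) κ≤1 sup
              (subst (_≤ ½ * ω₀) (*-identityˡ _) (proj₂ power l ℕ.≤-refl)) (ℕ.≤-trans (ℕ.m≤m⊔n (suc (l ℕ.+ l)) (proj₁ tail)) (ℕ.m≤m+n K₀ j)))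
          where
          co : ∀ (K : Vec Bool n) → size K ≡ k → co-size K ≡ n ℕ.∸ k
          co K e = trans (sym (ℕ.m+n∸m≡n (size K) (co-size K))) (cong₂ ℕ._∸_ (size+co-size K) e)
        go (inj₂ n≤k) = same-size (ℕ.m≤n⇒m<n∨m≡n n≤k)
          where
          same-size : n ℕ.< k ⊎ n ≡ k → subs k (λ K → graphE w (dominates c K K)) ≤ ½ ^ k
          same-size (inj₂ e) = go (inj₁ (ℕ.≤-reflexive (sym e)))
          same-size (inj₁ lt) = ≤-trans (≤-reflexive (trans (subs-cong k {g = λ _ → 0ℚ} (λ K e → contradiction
              (ℕ.≤-trans (ℕ.≤-reflexive (cong suc (size+co-size K))) (ℕ.≤-trans lt (ℕ.≤-trans (ℕ.≤-reflexive (sym e)) (ℕ.m≤m+n (size K) (co-size K))))) (ℕ.<-irrefl refl)))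
            (trans (subs-const k 0ℚ) (zeroʳ _)))) (^-nonneg k (<⇒≤ 0<½))
      total≤ : Sum (suc n) (λ j → ½ ^ K₀ * ½ ^ j) ≤ ½ * ε
      total≤ = ≤-trans (≤-reflexive (Sum-*ˡ (suc n) (½ ^ K₀) (½ ^_))) (≤-trans (*-monoˡ-≤ (^-nonneg K₀ (<⇒≤ 0<½)) (geometric-½ (suc n) (<⇒≤ 0<½) ≤-refl))
        (≤-trans (*-monoʳ-≤ (+-nonneg 0≤1 (+-nonneg (<⇒≤ 0<½) (<⇒≤ 0<½))) (subst (_≤ ½ * (½ * ε)) (*-identityˡ _) (proj₂ tail K₀ (ℕ.m≤n⊔m (suc (l ℕ.+ l)) (proj₁ tail)))))
          (≤-reflexive (solve 1 (λ e → con ½ :* (con ½ :* e) :* (con 1ℚ :+ (con ½ :+ con ½)) := con ½ :* e) refl ε))))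

Shape⇒Dominating : ∀ {n} (G : Graph n) {X s c t} → Shape (coloured G X) s c t → t (not c) ≡ false → Dominating c G
Shape⇒Dominating G {X} {s} {c} {t} S tf = K , clique-complete c K G (λ i j i≢j p q → homogeneous i j i≢j (inside i p) (inside j q)) ,
  λ b out → Bool.¬-not (λ h → let a , pa , e = diverse (not c) tf b (outside b out) in
    Bool.not-¬ (same⇒≡ {not c} (hom-sound (same (not c)) K (nbr G b) h a (member a pa))) (trans (lookup-nbr G b a) e))
  where
  open Shape S
  K = Vec.map (same s) X
  K≡ : ∀ i → lookup K i ≡ same s (lookup X i)
  K≡ i = Vec.lookup-map i (same s) X
  inside : ∀ i → lookup K i ≡ true → lookup X i ≡ s
  inside i p = same⇒≡ (trans (sym (K≡ i)) p)
  member : ∀ i → lookup X i ≡ s → lookup K i ≡ true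
  member i p = trans (K≡ i) (≡⇒same p)
  outside : ∀ i → lookup K i ≡ false → lookup X i ≡ not s
  outside i p = Bool.¬-not (λ q → case trans (sym p) (member i q) of λ ())

-- The zero-one law, uniformly in the edge probability

-- The function `sub` records on which side of the threshold each colour lies, the same for all
-- weight functions considered.
record Regime (ω₀ κ : ℚ) (sub : Bool → Bool) (w : Bool → ℚ) : Set where
  field
    bounded : Bounded ω₀ w
    below   : ∀ c → sub c ≡ true → Subcritical κ w c
    above   : ∀ c → sub c ≡ false → Supercritical κ w c

EventuallyRare : (ω₀ κ : ℚ) → (Bool → Bool) → (∀ {n} → Graph n → Set) → Set
EventuallyRare ω₀ κ sub P = ∀ ε → 0ℚ < ε → ∃ λ N → ∀ n → N ℕ.≤ n → ∀ w → Regime ω₀ κ sub w → Rare ε w {n} P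

-- The sentence is likely if it holds in some transferable coloured graph, or in one whose shape is
-- realised with high probability. Otherwise a typical graph satisfying it carries a shape with
-- `t (not c)` unset in a supercritical colour `c`, hence a dominating clique, and these are rare.
rare-zero-one : ExcludedMiddle 0ℓ → ∀ {ω₀ κ} → 0ℚ < ω₀ → 0ℚ < κ → κ ≤ ω₀ → κ ≤ 1ℚ → ∀ sub φ →
  EventuallyRare ω₀ κ sub (λ G → G ⊨ φ) ⊎ EventuallyRare ω₀ κ sub (λ G → ¬ G ⊨ φ)
rare-zero-one em {ω₀} {κ} 0<ω₀ 0<κ κ≤ω₀ κ≤1 sub φ = transferable em
  where
  Holds : Coloured → Set
  Holds M = Sat (graph M) (colours M) [] (matrix φ)
  Goal : Set
  Goal = EventuallyRare ω₀ κ sub (λ G → G ⊨ φ) ⊎ EventuallyRare ω₀ κ sub (λ G → ¬ G ⊨ φ)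
  Witness₁ Witness₂ : Set
  Witness₁ = ∃ λ M → Transferable M × Holds M
  Witness₂ = ∃ λ M → ∃ λ s → ∃ λ c → ∃ λ t → (t (not c) ≡ true ⊎ sub c ≡ true) × Shape M s c t × Holds M
  atypical : ∀ ε → 0ℚ < ε → ∃ λ N → ∀ n → N ℕ.≤ n → ∀ w → Bounded ω₀ w → Rare ε w {n} (λ G → ¬ Typical G)
  atypical ε 0<ε = rare-¬Ext em (3 ℕ.+ typeCount) 0<ω₀ 0<ε
  shaped : ¬ Witness₁ → Dec Witness₂ → Goal
  shaped _ (yes (M , s , c , t , alt , S , h)) = inj₂ λ ε 0<ε →
    let N , r = rare-¬Realised em 0<ω₀ 0<κ κ≤ω₀ 0<ε s c t
    in N , λ n l w R → rare-⊆ (λ G ¬φ (X , S′) → ¬φ (X , Sat-SameCode {M} {coloured G X} (Shape⇒SameCode S S′) (matrix φ) (depth≡2 φ) h))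
         (r n l w (Regime.bounded R) (regime R alt))
    where
    regime : ∀ {w} → Regime ω₀ κ sub w → t (not c) ≡ true ⊎ sub c ≡ true → t (not c) ≡ true ⊎ Subcritical κ w c
    regime R (inj₁ p) = inj₁ p
    regime R (inj₂ p) = inj₂ (Regime.below R c p)
  shaped ¬W₁ (no ¬W₂) = inj₁ λ ε 0<ε →
    let η = inv 4ℚ * ε
        0<4 = +-pos (+-pos 0<1 0≤1) (+-nonneg 0≤1 0≤1)
        0<η = *-pos (inv-pos 0<4) 0<ε
        N₁ , r₁ = atypical η 0<η
        N₂ , r₂ = rare-Dominating 0<ω₀ 0<κ κ≤1 0<η true
        N₃ , r₃ = rare-Dominating 0<ω₀ 0<κ κ≤1 0<η false
    in N₁ ⊔ (N₂ ⊔ N₃) , λ n l w R →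
      let l₁ = ℕ.m⊔n≤o⇒m≤o N₁ (N₂ ⊔ N₃) l
          l₂₃ = ℕ.m⊔n≤o⇒n≤o N₁ (N₂ ⊔ N₃) l
          bd = Regime.bounded R
      in rare-≤ (≤-trans (≤-by η (<⇒≤ 0<η) (solve 1 (λ e → (con 1ℚ :+ con 1ℚ :+ (con 1ℚ :+ con 1ℚ)) :* e := e :+ (e :+ e) :+ e) refl η))
           (≤-reflexive (trans (sym (*-assoc _ _ _)) (trans (cong (_* ε) (*-inv 0<4)) (*-identityˡ ε)))))
           (rare-⊆ (λ G → cover R G) (rare-∪ (r₁ n l₁ w bd)
             (rare-∪ (dominated R true r₂ n (ℕ.m⊔n≤o⇒m≤o N₂ N₃ l₂₃) 0<η) (dominated R false r₃ n (ℕ.m⊔n≤o⇒n≤o N₂ N₃ l₂₃) 0<η))))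
    where
    Bad : Bool → ∀ {n} → Graph n → Set
    Bad c G = sub c ≡ false × Dominating c G
    dominated : ∀ {w η N} → Regime ω₀ κ sub w → ∀ c → (∀ n → N ℕ.≤ n → ∀ w → Bounded ω₀ w → Supercritical κ w c → Rare η w {n} (Dominating c)) →
      ∀ n → N ℕ.≤ n → 0ℚ < η → Rare η w {n} (Bad c)
    dominated {w} {η} R c r n l 0<η = go (sub c) refl
      where
      go : ∀ b → sub c ≡ b → Rare η w (Bad c)
      go false e = rare-⊆ (λ G → proj₂) (r n l w (Regime.bounded R) (Regime.above R c e))
      go true e = (λ _ → 0ℚ) , (λ _ → ≤-refl) , (λ G (e′ , _) → case trans (sym e) e′ of λ ()) , ≤-trans (≤-reflexive (graphE-0 w)) (<⇒≤ 0<η)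
    cover : ∀ {w} → Regime ω₀ κ sub w → ∀ {n} (G : Graph n) → G ⊨ φ → ¬ Typical G ⊎ (Bad true G ⊎ Bad false G)
    cover R G (X , h) = typical? em
      where
      M = coloured G X
      place : ∀ c → Bad c G → Bad true G ⊎ Bad false G
      place true b = inj₁ b
      place false b = inj₂ b
      typical? : Dec (Typical G) → ¬ Typical G ⊎ (Bad true G ⊎ Bad false G)
      typical? (no p) = inj₁ p
      typical? (yes p) = inj₂ (alternatives (dichotomy em M p))
        where
        alternatives : Transferable M ⊎ (∃ λ s → ∃ λ c → ∃ λ t → Shape M s c t) → Bad true G ⊎ Bad false G
        alternatives (inj₁ tr) = contradiction (M , tr , h) ¬W₁
        alternatives (inj₂ (s , c , t , S)) = flags (t (not c)) refl (sub c) refl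
          where
          flags : ∀ a → t (not c) ≡ a → ∀ b → sub c ≡ b → Bad true G ⊎ Bad false G
          flags true e b e′ = contradiction (M , s , c , t , inj₁ e , S , h) ¬W₂
          flags false e true e′ = contradiction (M , s , c , t , inj₂ e′ , S , h) ¬W₂
          flags false e false e′ = place c (e′ , Shape⇒Dominating G S e)
  transferable : Dec Witness₁ → Goal
  transferable (yes (M , tr , h)) = inj₂ λ ε 0<ε →
    let N , r = atypical ε 0<ε
    in N , λ n l w R → rare-⊆ (λ G ¬φ ext → let X , same-code = tr n G ext in ¬φ (X , Sat-SameCode {M} {coloured G X} same-code (matrix φ) (depth≡2 φ) h))
         (r n l w (Regime.bounded R))
  transferable (no ¬W₁) = shaped ¬W₁ em

-- Probabilities as real numbers

listSum : ∀ {A : Set} → List A → (A → ℚ) → ℚ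
listSum List.[] f = 0ℚ
listSum (x List.∷ xs) f = f x + listSum xs f

listSum-cong : ∀ {A : Set} (xs : List A) {f g : A → ℚ} → (∀ x → f x ≡ g x) → listSum xs f ≡ listSum xs g
listSum-cong List.[] e = refl
listSum-cong (x List.∷ xs) e = cong₂ _+_ (e x) (listSum-cong xs e)

listSum-*ˡ : ∀ {A : Set} (xs : List A) c (f : A → ℚ) → listSum xs (λ x → c * f x) ≡ c * listSum xs f
listSum-*ˡ List.[] c f = sym (zeroʳ c)
listSum-*ˡ (x List.∷ xs) c f = trans (cong (c * f x +_) (listSum-*ˡ xs c f)) (sym (distribˡ c _ _))

listSum-++ : ∀ {A : Set} (xs ys : List A) (f : A → ℚ) → listSum (xs List.++ ys) f ≡ listSum xs f + listSum ys f
listSum-++ List.[] ys f = sym (+-identityˡ _)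
listSum-++ (x List.∷ xs) ys f = trans (cong (f x +_) (listSum-++ xs ys f)) (sym (+-assoc _ _ _))

listSum-map : ∀ {A B : Set} (h : A → B) (xs : List A) (f : B → ℚ) → listSum (List.map h xs) f ≡ listSum xs (f ∘ h)
listSum-map h List.[] f = refl
listSum-map h (x List.∷ xs) f = cong (f (h x) +_) (listSum-map h xs f)

listSum-× : ∀ {A B C : Set} (h : A → B → C) (xs : List A) (ys : List B) (f : C → ℚ) →
  listSum (cartesianProductWith h xs ys) f ≡ listSum xs (λ x → listSum ys (λ y → f (h x y)))
listSum-× h List.[] ys f = refl
listSum-× h (x List.∷ xs) ys f = trans (listSum-++ (List.map (h x) ys) _ f) (cong₂ _+_ (listSum-map (h x) ys f) (listSum-× h xs ys f))

weights : ℝ → ℕ → Bool → ℚ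
weights p i true = seq p i
weights p i false = 1ℚ - seq p i

opaque
  unfolding rowE

  seq-bit : ∀ p i b → seq (if b then p else (1ℝ Defs.- p)) i ≡ weights p i b
  seq-bit p i true = refl
  seq-bit p i false = sym (trans (+≡ 1ℚ (- seq p i)) (cong (1ℚ ℚ.+_) (-≡ (seq p i))))

  rowE-listSum : ∀ p i {n} (f : Vec Bool n → ℚ) → rowE (weights p i) f ≡ listSum (allRows n) (λ r → seq (rowWeight p r) i * f r)
  rowE-listSum p i {zero} f = sym (trans (+-identityʳ _) (*-identityˡ (f [])))
  rowE-listSum p i {suc n} f = sym (trans (listSum-× _∷_ (true List.∷ false List.∷ List.[]) (allRows n) _)
      (trans (cong₂ (λ x y → x + (y + 0ℚ)) (part true) (part false)) (cong (weights p i true * rowE (weights p i) (f ∘ (true ∷_)) +_) (+-identityʳ _))))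
    where
    part : ∀ b → listSum (allRows n) (λ r → seq (rowWeight p (b ∷ r)) i * f (b ∷ r)) ≡ weights p i b * rowE (weights p i) (f ∘ (b ∷_))
    part b = trans (listSum-cong (allRows n) (λ r → trans (cong (_* f (b ∷ r)) (trans (sym (*≡ _ _)) (cong (_* seq (rowWeight p r) i) (seq-bit p i b)))) (*-assoc _ _ _)))
      (trans (listSum-*ˡ (allRows n) (weights p i b) _) (cong (weights p i b *_) (sym (rowE-listSum p i (f ∘ (b ∷_))))))

  graphE-listSum : ∀ p i {n} (f : Graph n → ℚ) → graphE (weights p i) f ≡ listSum (allGraphs n) (λ G → seq (weight p G) i * f G)
  graphE-listSum p i {zero} f = sym (trans (+-identityʳ _) (*-identityˡ (f [])))
  graphE-listSum p i {suc n} f = trans (rowE-listSum p i {n} (λ r → graphE (weights p i) (λ G → f (r ∷ G))))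
    (sym (trans (listSum-× _∷_ (allRows n) (allGraphs n) _) (listSum-cong (allRows n) (λ r → trans
      (listSum-cong (allGraphs n) (λ G → trans (cong (_* f (r ∷ G)) (sym (*≡ _ _))) (*-assoc _ _ _)))
      (trans (listSum-*ˡ (allGraphs n) (seq (rowWeight p r) i) _) (cong (seq (rowWeight p r) i *_) (sym (graphE-listSum p i (λ G → f (r ∷ G))))))))))

seq-filter : ∀ p i {n} {E : Graph n → Set} (E? : ∀ G → Dec (E G)) (xs : List (Graph n)) →
  seq (sumℝ (List.map (weight p) (List.filter E? xs))) i ≡ listSum xs (λ G → seq (weight p G) i * 𝟙 (does (E? G)))
seq-filter p i E? List.[] = refl
seq-filter p i E? (G List.∷ xs) = go (E? G) refl
  where
  Result : Set
  Result = seq (sumℝ (List.map (weight p) (List.filter E? (G List.∷ xs)))) i ≡ seq (weight p G) i * 𝟙 (does (E? G)) + listSum xs (λ G → seq (weight p G) i * 𝟙 (does (E? G)))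
  go : (d : Dec _) → E? G ≡ d → Result
  go (yes e) eq = trans (cong (λ l → seq (sumℝ (List.map (weight p) l)) i) (List.filter-accept E? e))
    (trans (sym (+≡ _ _)) (cong₂ _+_ (sym (trans (cong (λ d → seq (weight p G) i * 𝟙 (does d)) eq) (*-identityʳ _))) (seq-filter p i E? xs)))
  go (no ¬e) eq = trans (cong (λ l → seq (sumℝ (List.map (weight p) l)) i) (List.filter-reject E? ¬e))
    (trans (seq-filter p i E? xs) (sym (trans (cong (_+ listSum xs (λ G → seq (weight p G) i * 𝟙 (does (E? G)))) (trans (cong (λ d → seq (weight p G) i * 𝟙 (does d)) eq) (zeroʳ _))) (+-identityˡ _))))

truth : 𝓔₁² → ∀ {n} → Graph n → ℚ
truth φ G = 𝟙 (does (G ⊨? φ))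

-- Sums and products of Cauchy reals are formed termwise, so this is an equality at every index and
-- not just in the limit.
seq-probability : ∀ p φ n i → seq (probability p φ n) i ≡ graphE (weights p i) {n} (truth φ)
seq-probability p φ n i = trans (seq-filter p i (_⊨? φ) (allGraphs n)) (sym (graphE-listSum p i {n} (truth φ)))

rare-truth : ∀ {w ε n} φ → (∀ b → 0ℚ ≤ w b) → Rare ε w {n} (λ G → G ⊨ φ) → graphE w {n} (truth φ) ≤ ε
rare-truth φ w≥0 (f , f≥0 , f≥1 , Ef) = ≤-trans (graphE-mono w≥0 (λ G → bound G (G ⊨? φ))) Ef
  where
  bound : ∀ G (d : Dec (G ⊨ φ)) → 𝟙 (does d) ≤ f G
  bound G (yes h) = f≥1 G h
  bound G (no _) = f≥0 G

rare-falsity : ∀ {w ε n} φ → IsDistribution w → Rare ε w {n} (λ G → ¬ G ⊨ φ) → 1ℚ - ε ≤ graphE w {n} (truth φ)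
rare-falsity {w} {ε} {n} φ d (f , f≥0 , f≥1 , Ef) = ≤-trans (complement-anti Ef) (≤-trans (≤-reflexive (sym E≡)) (graphE-mono (IsDistribution.nonneg d) (λ G → bound G (G ⊨? φ))))
  where
  E≡ : graphE w (λ G → 1ℚ + (- 1ℚ) * f G) ≡ 1ℚ - graphE w f
  E≡ = trans (graphE-+ w (λ _ → 1ℚ) _) (trans (cong₂ _+_ (graphE-const d 1ℚ) (graphE-*ˡ w (- 1ℚ) f)) (solve 1 (λ x → con 1ℚ :+ (:- con 1ℚ) :* x := con 1ℚ :- x) refl (graphE w f)))
  bound : ∀ G (d : Dec (G ⊨ φ)) → 1ℚ + (- 1ℚ) * f G ≤ 𝟙 (does d)
  bound G (yes _) = ≤-by (f G) (f≥0 G) (solve 1 (λ x → con 1ℚ := con 1ℚ :+ (:- con 1ℚ) :* x :+ x) refl (f G))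
  bound G (no h) = ≤-by (f G - 1ℚ) (≤⇒0≤ (f≥1 G h)) (solve 1 (λ x → con 0ℚ := con 1ℚ :+ (:- con 1ℚ) :* x :+ (x :- con 1ℚ)) refl (f G))

truth-nonneg : ∀ φ {w} → (∀ b → 0ℚ ≤ w b) → ∀ n → 0ℚ ≤ graphE w {n} (truth φ)
truth-nonneg φ w≥0 n = graphE-nonneg w≥0 (λ G → 𝟙-nonneg (does (G ⊨? φ)))

truth-≤1 : ∀ φ {w} → IsDistribution w → ∀ n → graphE w {n} (truth φ) ≤ 1ℚ
truth-≤1 φ d n = ≤-trans (graphE-mono (IsDistribution.nonneg d) (λ G → 𝟙≤1 (does (G ⊨? φ)))) (≤-reflexive (graphE-const d 1ℚ))

-- The threshold in n comes before i, while the one in i may depend on n; estimates uniform in the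
-- weights supply just this order.
limit-const : ∀ (a : ℕ → ℝ) ℓ → (∀ e → 0ℚ < e → ∃ λ N → ∀ n → N ℕ.≤ n → ∃ λ I → ∀ i → I ℕ.≤ i → ℓ - e ≤ seq (a n) i × seq (a n) i ≤ ℓ + e) → a ⟶ fromℚ ℓ
limit-const a ℓ h ε (e , 0<e , M , ε>e) = proj₁ (h ¼e 0<¼e) , λ n N≤n →
  let I , close = proj₂ (h ¼e 0<¼e) n N≤n
      big = λ i l → subst (_< seq ε i) (trans (sym (+≡ 0ℚ e)) (+-identityˡ e)) (ε>e i (ℕ.m⊔n≤o⇒n≤o I M l))
      near = λ i l → close i (ℕ.m⊔n≤o⇒m≤o I M l)
  in (½e , 0<½e , I ⊔ M , λ i l → subst₂ _<_ (trans (cong (_+ ½e) (trans (+≡ ℓ _) (cong (ℓ ℚ.+_) (-≡ _)))) (+≡ _ ½e)) refl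
        (<-≤-trans (below (seq ε i) (big i l)) (proj₁ (near i l)))) ,
     (½e , 0<½e , I ⊔ M , λ i l → subst₂ _<_ (+≡ (seq (a n) i) ½e) (+≡ ℓ (seq ε i))
        (≤-<-trans (+-monoʳ-≤ ½e (proj₂ (near i l))) (above (seq ε i) (big i l))))
  where
  ½e = ½ * e
  ¼e = ½ * ½e
  0<½e = *-pos 0<½ 0<e
  0<¼e = *-pos 0<½ 0<½e
  below : ∀ x → e < x → ℓ - x + ½e < ℓ - ¼e
  below x e<x = 0<⇒< (subst (0ℚ <_) (solve 3 (λ l x e → x :- e :+ con ½ :* (con ½ :* e) := l :- con ½ :* (con ½ :* e) :- (l :- x :+ con ½ :* e)) refl ℓ x e) (+-pos (<⇒0< e<x) (<⇒≤ 0<¼e)))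
  above : ∀ x → e < x → ℓ + ¼e + ½e < ℓ + x
  above x e<x = 0<⇒< (subst (0ℚ <_) (solve 3 (λ l x e → x :- e :+ con ½ :* (con ½ :* e) := l :+ x :- (l :+ con ½ :* (con ½ :* e) :+ con ½ :* e)) refl ℓ x e) (+-pos (<⇒0< e<x) (<⇒≤ 0<¼e)))

≃-refl : ∀ x → x ≃ x
≃-refl x ε 0<ε = 0 , λ n _ → subst (λ t → ∣ t ∣ < ε) (sym (ℚ.+-inverseʳ (seq x n))) 0<ε

EventuallyRegime : ℝ → Set
EventuallyRegime p = ∃ λ ω₀ → ∃ λ κ → ∃ λ sub → 0ℚ < ω₀ × 0ℚ < κ × κ ≤ ω₀ × κ ≤ 1ℚ × ∃ λ I → ∀ i → I ℕ.≤ i → Regime ω₀ κ sub (weights p i)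

regime⇒ZeroOneLaw : ExcludedMiddle 0ℓ → ∀ p → EventuallyRegime p → ZeroOneLaw p
regime⇒ZeroOneLaw em p (ω₀ , κ , sub , 0<ω₀ , 0<κ , κ≤ω₀ , κ≤1 , I , reg) φ = go (rare-zero-one em 0<ω₀ 0<κ κ≤ω₀ κ≤1 sub φ)
  where
  dist : ∀ i → I ℕ.≤ i → IsDistribution (weights p i)
  dist i l = Bounded.dist (Regime.bounded (reg i l))
  go : EventuallyRare ω₀ κ sub (λ G → G ⊨ φ) ⊎ EventuallyRare ω₀ κ sub (λ G → ¬ G ⊨ φ) → ∃ λ L → probability p φ ⟶ L × (L ≃ 0ℝ ⊎ L ≃ 1ℝ)
  go (inj₁ rare) = 0ℝ , limit-const (probability p φ) 0ℚ (λ e 0<e → let N , h = rare e 0<e in N , λ n l → I , λ i l′ →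
      subst (λ x → 0ℚ - e ≤ x × x ≤ 0ℚ + e) (sym (seq-probability p φ n i))
        (≤-trans (≤-by e (<⇒≤ 0<e) (solve 1 (λ e → con 0ℚ := con 0ℚ :- e :+ e) refl e)) (truth-nonneg φ (IsDistribution.nonneg (dist i l′)) n) ,
         subst (_ ≤_) (sym (+-identityˡ e)) (rare-truth φ (IsDistribution.nonneg (dist i l′)) (h n l _ (reg i l′))))) , inj₁ (≃-refl 0ℝ)
  go (inj₂ rare) = 1ℝ , limit-const (probability p φ) 1ℚ (λ e 0<e → let N , h = rare e 0<e in N , λ n l → I , λ i l′ →
      subst (λ x → 1ℚ - e ≤ x × x ≤ 1ℚ + e) (sym (seq-probability p φ n i))
        (rare-falsity φ (dist i l′) (h n l _ (reg i l′)) , ≤-trans (truth-≤1 φ (dist i l′) n) (≤-+ʳ (<⇒≤ 0<e)))) , inj₂ (≃-refl 1ℝ)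

-- The polynomial (1 − r)² − r and its root (3 − √5)/2

discriminant : ℝ → ℝ
discriminant r = (1ℝ Defs.- r) Defs.* (1ℝ Defs.- r) Defs.- r

goldenRoot : ℝ
goldenRoot = (fromℕ 3 Defs.- √5) Defs.* ½ℝ

seq-discriminant : ∀ r i → seq (discriminant r) i ≡ (1ℚ - seq r i) * (1ℚ - seq r i) - seq r i
seq-discriminant r i = sym (trans (+≡ _ _) (cong₂ ℚ._+_ (trans (*≡ _ _) (cong₂ ℚ._*_ e e)) (-≡ _)))
  where
  e : 1ℚ - seq r i ≡ 1ℚ ℚ.+ (ℚ.- seq r i)
  e = trans (+≡ _ _) (cong (1ℚ ℚ.+_) (-≡ _))

3ℚ : ℚ
3ℚ = ℤ.+ 3 ℚ./ 1

5ℚ : ℚ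
5ℚ = ℤ.+ 5 ℚ./ 1

seq-goldenRoot : ∀ i → seq goldenRoot i ≡ (3ℚ - seq √5 i) * ½
seq-goldenRoot i = sym (trans (*≡ _ _) (cong (ℚ._* ½) (trans (+≡ _ _) (cong (3ℚ ℚ.+_) (-≡ _)))))

-- The critical sentence: X is a clique, dominating but not maximal

∑ : ∀ n → (Fin n → ℚ) → ℚ
∑ zero f = 0ℚ
∑ (suc n) f = f zero + ∑ n (f ∘ suc)

∑-cong : ∀ n {f g : Fin n → ℚ} → (∀ i → f i ≡ g i) → ∑ n f ≡ ∑ n g
∑-cong zero e = refl
∑-cong (suc n) e = cong₂ _+_ (e zero) (∑-cong n (e ∘ suc))

∑-mono : ∀ n {f g : Fin n → ℚ} → (∀ i → f i ≤ g i) → ∑ n f ≤ ∑ n g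
∑-mono zero e = ≤-refl
∑-mono (suc n) e = +-mono-≤ (e zero) (∑-mono n (e ∘ suc))

∑-nonneg : ∀ n {f : Fin n → ℚ} → (∀ i → 0ℚ ≤ f i) → 0ℚ ≤ ∑ n f
∑-nonneg zero e = ≤-refl
∑-nonneg (suc n) e = +-nonneg (e zero) (∑-nonneg n (e ∘ suc))

≤-∑ : ∀ n {f : Fin n → ℚ} → (∀ i → 0ℚ ≤ f i) → ∀ i → f i ≤ ∑ n f
≤-∑ (suc n) e zero = ≤-+ʳ (∑-nonneg n (e ∘ suc))
≤-∑ (suc n) e (suc i) = ≤-trans (≤-∑ n (e ∘ suc) i) (≤-+ˡ (e zero))

∑-*ˡ : ∀ n c (f : Fin n → ℚ) → ∑ n (λ i → c * f i) ≡ c * ∑ n f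
∑-*ˡ zero c f = sym (zeroʳ c)
∑-*ˡ (suc n) c f = trans (cong (c * f zero +_) (∑-*ˡ n c (f ∘ suc))) (sym (distribˡ c _ _))

∑-graphE : ∀ w {n} k (f : Fin k → Graph n → ℚ) → graphE w (λ G → ∑ k (λ i → f i G)) ≡ ∑ k (λ i → graphE w (f i))
∑-graphE w zero f = graphE-0 w
∑-graphE w (suc k) f = trans (graphE-+ w _ _) (cong (graphE w (f zero) +_) (∑-graphE w k (f ∘ suc)))

∑-member : ∀ {n} (K : Vec Bool n) x → ∑ n (λ b → 𝟙 (lookup K b) * x) ≡ ι (size K) * x
∑-member [] x = sym (zeroˡ x)
∑-member (true ∷ K) x = trans (cong (1ℚ * x +_) (∑-member K x)) (sym (distribʳ x 1ℚ (ι (size K))))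
∑-member (false ∷ K) x = trans (cong (_+ ∑ _ (λ b → 𝟙 (lookup K b) * x)) (zeroˡ x)) (trans (+-identityˡ _) (∑-member K x))

remove : ∀ {n} → Fin n → Vec Bool n → Vec Bool n
remove zero (_ ∷ K) = false ∷ K
remove (suc b) (k ∷ K) = k ∷ remove b K

remove-⊑ : ∀ {n} (b : Fin n) K → remove b K ⊑ K
remove-⊑ zero (_ ∷ K) = skip (⊑-refl K)
remove-⊑ (suc b) (true ∷ K) = keep (remove-⊑ b K)
remove-⊑ (suc b) (false ∷ K) = skip (remove-⊑ b K)

size-remove : ∀ {n} (b : Fin n) K → lookup K b ≡ true → suc (size (remove b K)) ≡ size K
size-remove zero (true ∷ K) refl = refl
size-remove (suc b) (true ∷ K) e = cong suc (size-remove b K e)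
size-remove (suc b) (false ∷ K) e = size-remove b K e

lookup-remove : ∀ {n} (b : Fin n) K i → i ≢ b → lookup (remove b K) i ≡ lookup K i
lookup-remove zero (k ∷ K) zero ne = contradiction refl ne
lookup-remove zero (k ∷ K) (suc i) ne = refl
lookup-remove (suc b) (k ∷ K) zero ne = refl
lookup-remove (suc b) (k ∷ K) (suc i) ne = lookup-remove b K i (ne ∘ cong suc)

lookup-removed : ∀ {n} (b : Fin n) K → lookup (remove b K) b ≡ false
lookup-removed zero (k ∷ K) = refl
lookup-removed (suc b) (k ∷ K) = lookup-removed b K

insert : ∀ {n} → Fin n → Vec Bool n → Vec Bool n
insert zero (_ ∷ K) = true ∷ K
insert (suc b) (k ∷ K) = k ∷ insert b K

remove-insert : ∀ {n} (b : Fin n) A → lookup A b ≡ false → remove b (insert b A) ≡ A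
remove-insert zero (false ∷ A) refl = refl
remove-insert (suc b) (a ∷ A) e = cong (a ∷_) (remove-insert b A e)

lookup-insert : ∀ {n} (b : Fin n) A → lookup (insert b A) b ≡ true
lookup-insert zero (a ∷ A) = refl
lookup-insert (suc b) (a ∷ A) = lookup-insert b A

-- Here K - b is the dominating clique and b a vertex extending it; a clique is counted once for
-- each such b. Counting pairs is what makes the mean a binomial probability.
witnesses : Bool → ∀ {n} → ℕ → Graph n → ℚ
witnesses c {n} m G = subs m (λ K → ∑ n (λ b → 𝟙 (lookup K b) * dominates c (remove b K) K G))

𝟙*-member : ∀ b {x y} → (b ≡ true → x ≡ y) → 𝟙 b * x ≡ 𝟙 b * y
𝟙*-member true e = cong (1ℚ *_) (e refl)
𝟙*-member false e = trans (zeroˡ _) (sym (zeroˡ _))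

co-size≡ : ∀ {n} (K : Vec Bool n) {m i} → size K ≡ m → m ℕ.+ i ≡ n → co-size K ≡ i
co-size≡ K {m} {i} e e′ = ℕ.+-cancelˡ-≡ m (co-size K) i (trans (cong (ℕ._+ co-size K) (sym e)) (trans (size+co-size K) (sym e′)))

graphE-witnesses : ∀ {w} → IsDistribution w → ∀ c n k i → suc k ℕ.+ i ≡ n →
  graphE w (witnesses c {n} (suc k)) ≡ B n (suc k) * (ι (suc k) * (w c ^ tri (suc k) * (1ℚ - w (not c) ^ k) ^ i))
graphE-witnesses {w} d c n k i eq = trans (subs-graphE w (suc k) (λ K G → ∑ n (λ b → 𝟙 (lookup K b) * dominates c (remove b K) K G)))
  (trans (subs-cong (suc k) each) (subs-const (suc k) _))
  where
  each : ∀ K → size K ≡ suc k → graphE w (λ G → ∑ n (λ b → 𝟙 (lookup K b) * dominates c (remove b K) K G)) ≡ ι (suc k) * (w c ^ tri (suc k) * (1ℚ - w (not c) ^ k) ^ i)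
  each K e = trans (∑-graphE w n (λ b G → 𝟙 (lookup K b) * dominates c (remove b K) K G))
    (trans (∑-cong n (λ b → trans (graphE-*ˡ w (𝟙 (lookup K b)) _) (𝟙*-member (lookup K b) (λ l → trans (graphE-dominates d c (remove-⊑ b K))
        (cong₂ (λ x y → w c ^ tri x * y) e (cong₂ (λ a j → (1ℚ - w (not c) ^ a) ^ j) (ℕ.suc-injective (trans (size-remove b K l) e)) (co-size≡ K e eq)))))))
      (trans (∑-member K _) (cong (λ x → ι x * _) e)))

relation : Bool → ∀ {k} → Fin k → Fin k → Formula k
relation true x y = x ∼ᶠ y
relation false x y = ¬ᶠ (x ∼ᶠ y)

-- One formula serves both colours: the first conjunct excepts equal vertices, and in the other two
-- the vertices compared lie on different sides of X, so that non-adjacency there is between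
-- distinct vertices.
critical : Bool → 𝓔₁²
critical c = ∃X
  (∀ᶠ (∀ᶠ (Xᶠ zero ∧ᶠ Xᶠ (suc zero) ⇒ᶠ (zero =ᶠ suc zero ∨ᶠ relation c zero (suc zero))))
    ∧ᶠ ∀ᶠ (¬ᶠ Xᶠ zero ⇒ᶠ ∃ᶠ (Xᶠ zero ∧ᶠ relation c (suc zero) zero))
    ∧ᶠ ∃ᶠ (¬ᶠ Xᶠ zero ∧ᶠ ∀ᶠ (Xᶠ zero ⇒ᶠ relation c (suc zero) zero)))
  (depth≡2′ c)
  where
  depth≡2′ : ∀ c → depth (∀ᶠ (∀ᶠ (Xᶠ zero ∧ᶠ Xᶠ (suc zero) ⇒ᶠ (zero =ᶠ suc zero ∨ᶠ relation c zero (suc zero))))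
    ∧ᶠ ∀ᶠ (¬ᶠ Xᶠ zero ⇒ᶠ ∃ᶠ (Xᶠ zero ∧ᶠ relation c (suc zero) zero))
    ∧ᶠ ∃ᶠ (¬ᶠ Xᶠ zero ∧ᶠ ∀ᶠ (Xᶠ zero ⇒ᶠ relation c (suc zero) zero))) ≡ 2
  depth≡2′ true = refl
  depth≡2′ false = refl

T⇒≡ : ∀ {b} → T b → b ≡ true
T⇒≡ {true} _ = refl

≡⇒T : ∀ {b} → b ≡ true → T b
≡⇒T refl = _

relation-sound : ∀ c {n k} (G : Graph n) X (ρ : Vec (Fin n) k) x y → Sat G X ρ (relation c x y) → adjacent G (lookup ρ x) (lookup ρ y) ≡ c
relation-sound true G X ρ x y h = T⇒≡ h
relation-sound false G X ρ x y h = Bool.¬-not (λ e → h (≡⇒T e))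

relation-complete : ∀ c {n k} (G : Graph n) X (ρ : Vec (Fin n) k) x y → adjacent G (lookup ρ x) (lookup ρ y) ≡ c → Sat G X ρ (relation c x y)
relation-complete true G X ρ x y h = ≡⇒T h
relation-complete false G X ρ x y h t = Bool.not-¬ h (T⇒≡ t)

Critical : Bool → ∀ {n} → Graph n → Set
Critical c {n} G = ∃ λ (K : Vec Bool n) → ∃ λ b → lookup K b ≡ true × clique c K G ≡ true
  × ∀ v → lookup K v ≡ false → hom (same (not c)) (remove b K) (nbr G v) ≡ false

∈⇒ : ∀ {n} {X : Vec Bool n} {v} → v ∈ X → lookup X v ≡ true
∈⇒ = Vec.[]=⇒lookup

⇒∈ : ∀ {n} {X : Vec Bool n} {v} → lookup X v ≡ true → v ∈ X
⇒∈ {X = X} {v} = Vec.lookup⇒[]= v X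

¬∈⇒ : ∀ {n} {X : Vec Bool n} {v} → ¬ v ∈ X → lookup X v ≡ false
¬∈⇒ h = Bool.¬-not (λ e → h (⇒∈ e))

⇒¬∈ : ∀ {n} {X : Vec Bool n} {v} → lookup X v ≡ false → ¬ v ∈ X
⇒¬∈ e h = case trans (sym e) (∈⇒ h) of λ ()

lookup-insert-other : ∀ {n} (b : Fin n) A v → v ≢ b → lookup (insert b A) v ≡ lookup A v
lookup-insert-other zero (a ∷ A) zero ne = contradiction refl ne
lookup-insert-other zero (a ∷ A) (suc v) ne = refl
lookup-insert-other (suc b) (a ∷ A) zero ne = refl
lookup-insert-other (suc b) (a ∷ A) (suc v) ne = lookup-insert-other b A v (ne ∘ cong suc)

⊨critical⇒ : ∀ c {n} (G : Graph n) → G ⊨ critical c → Critical c G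
⊨critical⇒ c {n} G (A , cl , dm , b , b∉ , all-b) = insert b A , b , lookup-insert b A ,
  clique-complete c (insert b A) G edge ,
  λ v out → subst (λ S → hom (same (not c)) S (nbr G v) ≡ false) (sym (remove-insert b A (¬∈⇒ b∉))) (hit v out)
  where
  inA : ∀ v → v ≢ b → lookup (insert b A) v ≡ true → v ∈ A
  inA v ne e = ⇒∈ (trans (sym (lookup-insert-other b A v ne)) e)
  to-b : ∀ v → v ∈ A → adjacent G b v ≡ c
  to-b v h = relation-sound c G A (v ∷ b ∷ []) (suc zero) zero (all-b v h)
  edge : ∀ i j → i ≢ j → lookup (insert b A) i ≡ true → lookup (insert b A) j ≡ true → adjacent G i j ≡ c
  edge i j i≢j p q = cases (i Fin.≟ b) (j Fin.≟ b)
    where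
    cases : Dec (i ≡ b) → Dec (j ≡ b) → adjacent G i j ≡ c
    cases (yes refl) (yes refl) = contradiction refl i≢j
    cases (yes refl) (no ne) = to-b j (inA j ne q)
    cases (no ne) (yes refl) = trans (adjacent-sym G i j) (to-b i (inA i ne p))
    cases (no ne) (no ne′) = both (cl j i (inA i ne p , inA j ne′ q))
      where
      both : i ≡ j ⊎ Sat G A (i ∷ j ∷ []) (relation c zero (suc zero)) → adjacent G i j ≡ c
      both (inj₁ e) = contradiction e i≢j
      both (inj₂ h) = relation-sound c G A (i ∷ j ∷ []) zero (suc zero) h
  hit : ∀ v → lookup (insert b A) v ≡ false → hom (same (not c)) A (nbr G v) ≡ false
  hit v out = Bool.¬-not λ h →
    let v≢b = λ e → case trans (sym out) (trans (cong (lookup (insert b A)) e) (lookup-insert b A)) of λ ()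
        a , a∈ , e = dm v (⇒¬∈ (trans (sym (lookup-insert-other b A v v≢b)) out))
    in Bool.not-¬ (relation-sound c G A (a ∷ v ∷ []) (suc zero) zero e)
         (trans (sym (lookup-nbr G v a)) (same⇒≡ {not c} (hom-sound (same (not c)) A (nbr G v) h a (∈⇒ a∈))))

-- Two elements in K make K - b nonempty, so that b, which lies outside of it, is dominated as well.
⇒⊨critical : ∀ c {n} (G : Graph n) → (∃ λ K → 2 ℕ.≤ size K × ∃ λ b → lookup K b ≡ true × clique c K G ≡ true
  × ∀ v → lookup K v ≡ false → hom (same (not c)) (remove b K) (nbr G v) ≡ false) → G ⊨ critical c
⇒⊨critical c G (K , 2≤ , b , b∈ , cl , dm) = A ,
  (λ y x (p , q) → decide x y p q (x Fin.≟ y)) ,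
  (λ v v∉ → reach v v∉ (v Fin.≟ b)) ,
  b , ⇒¬∈ (lookup-removed b K) , λ a a∈ → relation-complete c G A (a ∷ b ∷ []) (suc zero) zero (clique-sound c K G cl b a (≢b a a∈ ∘ sym) b∈ (inK a a∈))
  where
  A = remove b K
  ≢b : ∀ a → a ∈ A → a ≢ b
  ≢b a a∈ refl = ⇒¬∈ (lookup-removed b K) a∈
  inK : ∀ a → a ∈ A → lookup K a ≡ true
  inK a a∈ = trans (sym (lookup-remove b K a (≢b a a∈))) (∈⇒ a∈)
  decide : ∀ x y → x ∈ A → y ∈ A → Dec (x ≡ y) → x ≡ y ⊎ Sat G A (x ∷ y ∷ []) (relation c zero (suc zero))
  decide x y p q (yes e) = inj₁ e
  decide x y p q (no ne) = inj₂ (relation-complete c G A (x ∷ y ∷ []) zero (suc zero) (clique-sound c K G cl x y ne (inK x p) (inK y q)))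
  reach : ∀ v → ¬ v ∈ A → Dec (v ≡ b) → ∃ λ a → a ∈ A × Sat G A (a ∷ v ∷ []) (relation c (suc zero) zero)
  reach v v∉ (yes refl) = let a , e = one-element A (ℕ.s≤s⁻¹ (subst (2 ℕ.≤_) (sym (size-remove b K b∈)) 2≤)) in
    a , ⇒∈ e , relation-complete c G A (a ∷ v ∷ []) (suc zero) zero (clique-sound c K G cl v a (≢b a (⇒∈ e) ∘ sym) b∈ (inK a (⇒∈ e)))
  reach v v∉ (no ne) = let a , e , h = hom-false (same (not c)) A (nbr G v) (dm v (trans (sym (lookup-remove b K v ne)) (¬∈⇒ v∉))) in
    a , ⇒∈ e , relation-complete c G A (a ∷ v ∷ []) (suc zero) zero (trans (sym (lookup-nbr G v a)) (trans (Bool.¬-not (λ e′ → Bool.not-¬ (≡⇒same {not c} e′) h)) (Bool.not-involutive c)))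

critical⇒witnesses : ∀ c {n} (G : Graph n) → Critical c G → 1ℚ ≤ Sum n (λ k → witnesses c (suc k) G)
critical⇒witnesses c {n} G (K , b , b∈ , cl , dm) = ≤-trans
  (≤-reflexive (sym (trans (cong₂ (λ x y → 𝟙 x * y) b∈ (dominates-one c (remove b K) K G cl dm)) (*-identityˡ 1ℚ))))
  (≤-trans (≤-∑ n (λ b → term≥0 K b) b) (≤-trans (≤-subs (λ K → ∑-nonneg n (term≥0 K)) K)
    (≤-trans (≤-reflexive (cong (λ m → witnesses c m G) (sym (size-remove b K b∈))))
      (≤-Sum n (λ k → subs-nonneg (suc k) (λ K → ∑-nonneg n (term≥0 K))) (size (remove b K))
        (ℕ.≤-trans (ℕ.≤-reflexive (size-remove b K b∈)) (subst (size K ℕ.≤_) (size+co-size K) (ℕ.m≤m+n _ _)))))))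
  where
  term≥0 : ∀ K b → 0ℚ ≤ 𝟙 (lookup K b) * dominates c (remove b K) K G
  term≥0 K b = *-nonneg (𝟙-nonneg (lookup K b)) (dominates-nonneg c (remove b K) K G)

-- A rational approximation of the critical probability satisfies ω = q² only up to such an error.
record Close (J : ℕ) (ω q : ℚ) : Set where
  field
    ω≤q : ∀ j → j ℕ.≤ J → ω ^ j ≤ 2ℚ * (q * q) ^ j
    q≤ω : ∀ j → j ℕ.≤ J → (q * q) ^ j ≤ 2ℚ * ω ^ j

-- Chernoff bounds, and orders at which the critical sentence is improbable

tri-mono : ∀ {m n} → m ℕ.≤ n → tri m ℕ.≤ tri n
tri-mono ℕ.z≤n = ℕ.z≤n
tri-mono (ℕ.s≤s l) = ℕ.+-mono-≤ l (tri-mono l)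

-- The product k(k + 1) is twice the number of pairs in k + 1 elements; the clique weight thus
-- becomes the success factor of a binomial variable with rate qᵏ.
q^tri : ∀ q k → (q * q) ^ tri (suc k) ≡ (q ^ k) ^ suc k
q^tri q k = trans (*-^ q q (tri (suc k))) (trans (sym (^-+ q (tri (suc k)) (tri (suc k)))) (trans (cong (q ^_) e) (^-* q (suc k) k)))
  where
  e : tri (suc k) ℕ.+ tri (suc k) ≡ suc k ℕ.* k
  e = ℕ.+-cancelʳ-≡ (suc k) _ _ (trans (tri-double (suc k)) (trans (ℕ.*-suc (suc k) k) (ℕ.+-comm (suc k) (suc k ℕ.* k))))

frac : ℕ → (d : ℕ) → .{{_ : ℕ.NonZero d}} → ℚ
frac a d = ℤ.+ a ℚ./ d

0≤2 : 0ℚ ≤ 2ℚ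
0≤2 = +-nonneg 0≤1 0≤1

-- One term of the generating function (sx + 1 - x)ⁿ; a parameter s < 1 is used below the mean and s
-- > 1 above it.
chernoff : ∀ {x} s → 0ℚ ≤ s → 0ℚ ≤ x → x ≤ 1ℚ → ∀ n m i → m ℕ.+ i ≡ n → B n m * (x ^ m * (1ℚ - x) ^ i) * s ^ m ≤ (s * x + (1ℚ - x)) ^ n
chernoff {x} s 0≤s 0≤x x≤1 n m i eq = ≤-trans (≤-reflexive (trans
    (solve 4 (λ b x y s → b :* (x :* y) :* s := b :* (s :* x) :* y) refl (B n m) (x ^ m) ((1ℚ - x) ^ i) (s ^ m))
    (cong (λ z → B n m * z * (1ℚ - x) ^ i) (sym (*-^ s x m)))))
  (binomial-term≤ (*-nonneg 0≤s 0≤x) (≤⇒0≤ x≤1) n m i eq)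

≤-power : ∀ {b u ρ} m → 0ℚ ≤ ρ → u * ρ ≡ 1ℚ → b * u ^ m ≤ 1ℚ → b ≤ ρ ^ m
≤-power {b} {u} {ρ} m 0≤ρ uρ h = subst₂ _≤_ (trans (*-assoc _ _ _) (trans (cong (b *_) (trans (sym (*-^ u ρ m)) (trans (cong (_^ m) uρ) (1^ m)))) (*-identityʳ b))) (*-identityˡ _)
  (*-monoʳ-≤ (^-nonneg m 0≤ρ) h)

-- The mean nx is at least 6m₀/5. The parameter s = 11/12 gives (1 - z)ⁿ with z = x₀/12; since tz ≥
-- 1/10, the m₀-th power of 11/10 is at most (1 + z)ⁿ. The product of the two bounds is at most 1,
-- and 11/12 · 11/10 = 121/120.
binomial-below : ∀ {x x₀} n m i m₀ t → m ℕ.+ i ≡ n → n ≡ t ℕ.* m₀ → m ℕ.≤ m₀ → 0ℚ ≤ x₀ → x₀ ≤ x → x ≤ 1ℚ → frac 6 5 ≤ ι t * x₀ →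
  B n m * (x ^ m * (1ℚ - x) ^ i) ≤ frac 120 121 ^ m₀
binomial-below {x} {x₀} n m i m₀ t m+i≡n n≡ m≤m₀ 0≤x₀ x₀≤x x≤1 big = ≤-power {u = s * r} m₀ (ℚ.nonNegative⁻¹ (frac 120 121))
  (solve 0 (con (frac 11 12) :* con (frac 11 10) :* con (frac 120 121) := con 1ℚ) refl)
  (≤-trans (≤-reflexive (trans (cong (b *_) (*-^ s r m₀)) (sym (*-assoc _ _ _))))
    (≤-trans (*-mono-≤ (*-nonneg 0≤b (^-nonneg m₀ 0≤s)) left (^-nonneg m₀ 0≤r) right)
      (≤-trans (≤-reflexive (sym (*-^ (1ℚ - z) (1ℚ + z) n))) (^≤1 n (*-nonneg (≤⇒0≤ z≤1) (+-nonneg 0≤1 0≤z))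
        (≤-by (z * z) (square-nonneg z) (solve 1 (λ z → con 1ℚ := (con 1ℚ :- z) :* (con 1ℚ :+ z) :+ z :* z) refl z))))))
  where
  s r z b : ℚ
  s = frac 11 12
  r = frac 11 10
  z = frac 1 12 * x₀
  b = B n m * (x ^ m * (1ℚ - x) ^ i)
  0≤s : 0ℚ ≤ s
  0≤s = ℚ.nonNegative⁻¹ (frac 11 12)
  0≤r : 0ℚ ≤ r
  0≤r = ℚ.nonNegative⁻¹ (frac 11 10)
  0≤z : 0ℚ ≤ z
  0≤z = *-nonneg (ℚ.nonNegative⁻¹ (frac 1 12)) 0≤x₀
  0≤x = ≤-trans 0≤x₀ x₀≤x
  z≤1 : z ≤ 1ℚ
  z≤1 = ≤-trans (*-mono-≤ (ℚ.nonNegative⁻¹ (frac 1 12)) (toWitness {a? = frac 1 12 ℚ.≤? 1ℚ} _) 0≤x₀ (≤-trans x₀≤x x≤1)) (≤-reflexive (*-identityˡ 1ℚ))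
  0≤b : 0ℚ ≤ b
  0≤b = *-nonneg (B-nonneg n m) (*-nonneg (^-nonneg m 0≤x) (^-nonneg i (≤⇒0≤ x≤1)))
  left : b * s ^ m₀ ≤ (1ℚ - z) ^ n
  left = ≤-trans (*-monoˡ-≤ 0≤b (^-antitone 0≤s (toWitness {a? = frac 11 12 ℚ.≤? 1ℚ} _) m≤m₀))
    (≤-trans (chernoff s 0≤s 0≤x x≤1 n m i m+i≡n) (^-mono n (+-nonneg (*-nonneg 0≤s 0≤x) (≤⇒0≤ x≤1))
      (≤-by (frac 1 12 * (x - x₀)) (*-nonneg (ℚ.nonNegative⁻¹ (frac 1 12)) (≤⇒0≤ x₀≤x))
        (solve 2 (λ x y → con 1ℚ :- con (frac 1 12) :* y := con (frac 11 12) :* x :+ (con 1ℚ :- x) :+ con (frac 1 12) :* (x :- y)) refl x x₀))))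
  right : r ^ m₀ ≤ (1ℚ + z) ^ n
  right = ≤-trans (^-mono m₀ 0≤r (≤-trans
      (≤-trans (≤-reflexive (solve 0 (con (frac 11 10) := con 1ℚ :+ con (frac 1 12) :* con (frac 6 5)) refl)) (+-monoˡ-≤ 1ℚ (≤-trans (*-monoˡ-≤ (ℚ.nonNegative⁻¹ (frac 1 12)) big)
        (≤-reflexive (solve 3 (λ a t x → a :* (t :* x) := t :* (a :* x)) refl (frac 1 12) (ι t) x₀)))))
      (bernoulli t 0≤z)))
    (≤-reflexive (trans (sym (^-* (1ℚ + z) m₀ t)) (cong ((1ℚ + z) ^_) (trans (ℕ.*-comm m₀ t) (sym n≡)))))

-- Here nx ≤ 4m/5. The parameter 11/10 costs (1 + z)ⁿ with z = x/10, where (1 + z)ᵗ ≤ 1/(1 - tz) ≤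
-- 25/23; and 11/10 · 23/25 = 253/250.
binomial-above : ∀ {x} n m i t → m ℕ.+ i ≡ n → n ℕ.≤ t ℕ.* m → 0ℚ ≤ x → x ≤ 1ℚ → ι t * x ≤ frac 4 5 →
  B n m * (x ^ m * (1ℚ - x) ^ i) ≤ frac 250 253 ^ m
binomial-above {x} n m i t m+i≡n n≤ 0≤x x≤1 small = ≤-power {u = r * s} m (ℚ.nonNegative⁻¹ (frac 250 253))
  (solve 0 (con (frac 11 10) :* con (frac 23 25) :* con (frac 250 253) := con 1ℚ) refl)
  (≤-trans (≤-reflexive (trans (cong (b *_) (*-^ r s m)) (sym (*-assoc _ _ _))))
    (≤-trans (*-monoʳ-≤ (^-nonneg m 0≤s) (≤-trans (chernoff r 0≤r 0≤x x≤1 n m i m+i≡n) (≤-trans (≤-reflexive (cong (_^ n) (solve 1 (λ x → con (frac 11 10) :* x :+ (con 1ℚ :- x) := con 1ℚ :+ con (frac 1 10) :* x) refl x)))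
        (≤-trans (^-monotone (≤-+ʳ 0≤z) n≤) (≤-reflexive (trans (cong ((1ℚ + z) ^_) (ℕ.*-comm t m)) (^-* (1ℚ + z) m t)))))))
      (≤-trans (≤-reflexive (sym (*-^ ((1ℚ + z) ^ t) s m))) (^≤1 m (*-nonneg (^-nonneg t (+-nonneg 0≤1 0≤z)) 0≤s)
        (≤-trans (*-monoˡ-≤ (^-nonneg t (+-nonneg 0≤1 0≤z)) s≤) ([1+u]^n*[1-nu]≤1 t 0≤z))))))
  where
  s r z b : ℚ
  s = frac 23 25
  r = frac 11 10
  z = frac 1 10 * x
  b = B n m * (x ^ m * (1ℚ - x) ^ i)
  0≤s : 0ℚ ≤ s
  0≤s = ℚ.nonNegative⁻¹ (frac 23 25)
  0≤r : 0ℚ ≤ r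
  0≤r = ℚ.nonNegative⁻¹ (frac 11 10)
  0≤z : 0ℚ ≤ z
  0≤z = *-nonneg (ℚ.nonNegative⁻¹ (frac 1 10)) 0≤x
  s≤ : s ≤ 1ℚ - ι t * z
  s≤ = ≤-trans (≤-reflexive (solve 0 (con (frac 23 25) := con 1ℚ :- con (frac 1 10) :* con (frac 4 5)) refl)) (complement-anti (≤-trans
    (≤-reflexive (solve 3 (λ a t x → t :* (a :* x) := a :* (t :* x)) refl (frac 1 10) (ι t) x)) (*-monoˡ-≤ (ℚ.nonNegative⁻¹ (frac 1 10)) small)))

pow2 : ℕ → ℕ
pow2 zero = 1
pow2 (suc k) = pow2 k ℕ.+ pow2 k

pow2*^ : ∀ {q} k → ½ ≤ q → 1ℚ ≤ ι (pow2 k) * q ^ k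
pow2*^ zero h = ≤-reflexive (solve 0 (con 1ℚ := (con 1ℚ :+ con 0ℚ) :* con 1ℚ) refl)
pow2*^ {q} (suc k) h = ≤-trans (pow2*^ k h) (≤-trans (≤-reflexive (trans (solve 2 (λ p x → p :* x := (p :+ p) :* (con ½ :* x)) refl (ι (pow2 k)) (q ^ k)) (cong (_* (½ * q ^ k)) (sym (ι-+ (pow2 k) (pow2 k))))))
  (*-monoˡ-≤ (ι-nonneg (pow2 (suc k))) (*-monoʳ-≤ (^-nonneg k (≤-trans (<⇒≤ 0<½) h)) h)))

-- Since 2ᵏqᵏ ≥ 1 for every q ≥ 1/2, this bounds the orders found below by k alone, before an
-- approximation is chosen.
orderBound : ℕ → ℕ
orderBound k = (pow2 k ℕ.+ pow2 k) ℕ.* suc k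

-- The order is n = t(k + 1), where t qᵏ has just reached 6/5; then n qʲ/(j + 1) ≥ 6/5 for j ≤ k.
-- The overshoot is at most qᵏ ≤ 2/25, and one more factor q ≤ 5/8 turns 32/25 into 4/5, which
-- bounds the ratio for j > k. The two Chernoff bounds cover all clique sizes.
critical-rare : ∀ {ε} → 0ℚ < ε → ∃ λ k₁ → ∀ k → k₁ ℕ.≤ k → ∀ {w} c → IsDistribution w → ½ ≤ w (not c) → w (not c) ≤ frac 5 8 →
  Close (tri (orderBound k)) (w c) (w (not c)) → ∃ λ n → k ℕ.≤ n × n ℕ.≤ orderBound k × Rare ε w {n} (λ G → G ⊨ critical c)
critical-rare {ε} 0<ε = k₁ , main
  where
  ρ₁ ρ₂ : ℚ
  ρ₁ = frac 120 121
  ρ₂ = frac 250 253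
  -- With ρ₂ ≤ σ², one factor σᵐ absorbs the linear factor m and the other feeds the geometric
  -- series.
  root = √-bound {ρ₂} (ℚ.nonNegative⁻¹ ρ₂) (toWitness {a? = frac 250 253 ℚ.<? 1ℚ} _)
  σ = proj₁ root
  0≤σ = proj₁ (proj₂ root)
  σ<1 = proj₁ (proj₂ (proj₂ root))
  ρ₂≤σ² = proj₂ (proj₂ (proj₂ root))
  C = inv (1ℚ - σ)
  0<C : 0ℚ < C
  0<C = inv-pos (<⇒0< σ<1)
  ¼ε = ½ * (½ * ε)
  0<¼ε : 0ℚ < ¼ε
  0<¼ε = *-pos 0<½ (*-pos 0<½ 0<ε)
  decay₁ = poly*exp→0 2 {ρ₁} (ℚ.nonNegative⁻¹ ρ₁) (toWitness {a? = frac 120 121 ℚ.<? 1ℚ} _) 0<¼ε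
  decay₂ = poly*exp→0 0 0≤σ σ<1 (*-pos 0<¼ε (inv-pos (*-pos 0<C 0<C)))
  decay₃ = poly*exp→0 0 {frac 5 8} (ℚ.nonNegative⁻¹ (frac 5 8)) (toWitness {a? = frac 5 8 ℚ.<? 1ℚ} _) (ℚ.positive⁻¹ (frac 2 25))
  k₁ = proj₁ decay₁ ⊔ (proj₁ decay₂ ⊔ proj₁ decay₃)
  main : ∀ k → k₁ ℕ.≤ k → ∀ {w} c → IsDistribution w → ½ ≤ w (not c) → w (not c) ≤ frac 5 8 →
    Close (tri (orderBound k)) (w c) (w (not c)) → ∃ λ n → k ℕ.≤ n × n ℕ.≤ orderBound k × Rare ε w {n} (λ G → G ⊨ critical c)
  main k₀ k₁≤ {w} c d ½≤q q≤ close = n , ℕ.≤-trans (ℕ.n≤1+n k₀) m₀≤n , ℕ.*-monoˡ-≤ m₀ t≤ ,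
      (λ G → Sum n (λ k → witnesses c (suc k) G)) , (λ G → Sum-nonneg n (λ k → witnesses≥0 k G)) , (λ G h → critical⇒witnesses c G (⊨critical⇒ c G h)) ,
      ≤-trans (≤-reflexive (trans (graphE-Sum w n (λ k → witnesses c (suc k))) (trans (cong (λ j → Sum j (λ k → graphE w (witnesses c {n} (suc k)))) (sym (ℕ.m+[n∸m]≡n m₀≤n))) (Sum-++ m₀ n′ (λ k → graphE w (witnesses c {n} (suc k))))))) total≤
    where
    open IsDistribution d
    q = w (not c)
    m₀ = suc k₀
    0≤q = ≤-trans (<⇒≤ 0<½) ½≤q
    q≤1 = ≤1 (not c)
    x₀ = q ^ k₀
    0≤x₀ = ^-nonneg k₀ 0≤q
    le₁ = ℕ.m⊔n≤o⇒m≤o (proj₁ decay₁) (proj₁ decay₂ ⊔ proj₁ decay₃) k₁≤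
    le₂₃ = ℕ.m⊔n≤o⇒n≤o (proj₁ decay₁) (proj₁ decay₂ ⊔ proj₁ decay₃) k₁≤
    le₂ = ℕ.m⊔n≤o⇒m≤o (proj₁ decay₂) (proj₁ decay₃) le₂₃
    le₃ = ℕ.m⊔n≤o⇒n≤o (proj₁ decay₂) (proj₁ decay₃) le₂₃
    P : ℕ → Set
    P t = frac 6 5 ≤ ι t * x₀
    cr = crossing {P} (λ t → frac 6 5 ℚ.≤? ι t * x₀)
      (λ h → <-irrefl refl (<-≤-trans (ℚ.positive⁻¹ (frac 6 5)) (≤-trans h (≤-reflexive (zeroˡ x₀)))))
      (pow2 k₀ ℕ.+ pow2 k₀)
      (≤-trans (toWitness {a? = frac 6 5 ℚ.≤? frac 2 1} _) (≤-trans (≤-reflexive (solve 0 (con (frac 2 1) := con 1ℚ :+ con 1ℚ) refl))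
        (≤-trans (+-mono-≤ (pow2*^ k₀ ½≤q) (pow2*^ k₀ ½≤q)) (≤-reflexive (trans (sym (distribʳ x₀ _ _)) (cong (_* x₀) (sym (ι-+ (pow2 k₀) (pow2 k₀)))))))))
    t′ = proj₁ cr
    t = suc t′
    t≤ = proj₁ (proj₂ cr)
    Pt : frac 6 5 ≤ ι t * x₀
    Pt = proj₂ (proj₂ (proj₂ cr))
    n = t ℕ.* m₀
    m₀≤n : m₀ ℕ.≤ n
    m₀≤n = ℕ.m≤m+n m₀ (t′ ℕ.* m₀)
    n′ = n ℕ.∸ m₀
    tx₀ : ι t * x₀ ≤ frac 32 25
    tx₀ = ≤-trans (≤-reflexive (solve 2 (λ t x → (con 1ℚ :+ t) :* x := x :+ t :* x) refl (ι t′) x₀))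
      (≤-trans (+-mono-≤ (≤-trans (^-mono k₀ 0≤q q≤) (subst (_≤ frac 2 25) (*-identityˡ _) (proj₂ decay₃ k₀ le₃))) (<⇒≤ (ℚ.≰⇒> (proj₁ (proj₂ (proj₂ cr))))))
        (≤-reflexive (solve 0 (con (frac 2 25) :+ con (frac 6 5) := con (frac 32 25)) refl)))
    witnesses≥0 : ∀ k (G : Graph n) → 0ℚ ≤ witnesses c (suc k) G
    witnesses≥0 k G = subs-nonneg (suc k) (λ K → ∑-nonneg n (λ b → *-nonneg (𝟙-nonneg (lookup K b)) (dominates-nonneg c (remove b K) K G)))
    b : ℕ → ℚ
    b k = B n (suc k) * ((q ^ k) ^ suc k * (1ℚ - q ^ k) ^ (n ℕ.∸ suc k))
    x≤1 : ∀ k → q ^ k ≤ 1ℚ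
    x≤1 k = ^≤1 k 0≤q q≤1
    mean : ∀ k → k ℕ.< n → graphE w (witnesses c {n} (suc k)) ≤ 2ℚ * (ι (suc k) * b k)
    mean k k<n = ≤-trans (≤-reflexive (graphE-witnesses d c n k (n ℕ.∸ suc k) (ℕ.m+[n∸m]≡n k<n)))
      (≤-trans (*-monoˡ-≤ (B-nonneg n (suc k)) (*-monoˡ-≤ (ι-nonneg (suc k)) (*-monoʳ-≤ (^-nonneg (n ℕ.∸ suc k) (≤⇒0≤ (x≤1 k)))
          (≤-trans (Close.ω≤q close (tri (suc k)) (tri-mono (ℕ.≤-trans k<n (ℕ.*-monoˡ-≤ m₀ t≤)))) (≤-reflexive (cong (2ℚ *_) (q^tri q k)))))))
        (≤-reflexive (solve 5 (λ B i u x y → B :* (i :* (u :* x :* y)) := u :* (i :* (B :* (x :* y)))) refl (B n (suc k)) (ι (suc k)) 2ℚ ((q ^ k) ^ suc k) ((1ℚ - q ^ k) ^ (n ℕ.∸ suc k)))))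
    low : ∀ k → k ℕ.< m₀ → graphE w (witnesses c {n} (suc k)) ≤ 2ℚ * (ι m₀ * ρ₁ ^ m₀)
    low k k<m₀ = ≤-trans (mean k (ℕ.≤-trans k<m₀ m₀≤n)) (*-monoˡ-≤ 0≤2 (≤-trans
      (*-monoˡ-≤ (ι-nonneg (suc k)) (binomial-below n (suc k) (n ℕ.∸ suc k) m₀ t (ℕ.m+[n∸m]≡n (ℕ.≤-trans k<m₀ m₀≤n)) refl k<m₀ 0≤x₀ (^-antitone 0≤q q≤1 (ℕ.s≤s⁻¹ k<m₀)) (x≤1 k) Pt))
      (*-monoʳ-≤ (^-nonneg m₀ (ℚ.nonNegative⁻¹ ρ₁)) (ι-mono k<m₀))))
    high : ∀ j → j ℕ.< n′ → graphE w (witnesses c {n} (suc (m₀ ℕ.+ j))) ≤ 2ℚ * (C * σ ^ k₀) * σ ^ j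
    high j j<n′ = ≤-trans (mean k k<n) (≤-trans (*-monoˡ-≤ 0≤2 (≤-trans
        (*-monoˡ-≤ (ι-nonneg m) (binomial-above n m (n ℕ.∸ m) t (ℕ.m+[n∸m]≡n k<n) (ℕ.*-monoʳ-≤ t (ℕ.≤-trans (ℕ.m≤m+n m₀ j) (ℕ.n≤1+n _))) (^-nonneg k 0≤q) (x≤1 k) tx))
        (≤-trans (*-monoˡ-≤ (ι-nonneg m) (≤-trans (^-mono m (ℚ.nonNegative⁻¹ ρ₂) ρ₂≤σ²) (≤-reflexive (*-^ σ σ m))))
          (≤-trans (≤-reflexive (sym (*-assoc _ _ _))) (*-mono-≤ (*-nonneg (ι-nonneg m) (^-nonneg m 0≤σ)) (n*ρ^n-bounded 0≤σ σ<1 m) (^-nonneg m 0≤σ)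
            (^-antitone {m = k₀ ℕ.+ j} 0≤σ (<⇒≤ σ<1) (ℕ.≤-trans (ℕ.n≤1+n _) (ℕ.n≤1+n _))))))))
        (≤-reflexive (trans (cong (λ z → 2ℚ * (C * z)) (^-+ σ k₀ j)) (solve 4 (λ a c x y → a :* (c :* (x :* y)) := a :* (c :* x) :* y) refl 2ℚ C (σ ^ k₀) (σ ^ j)))))
      where
      k = m₀ ℕ.+ j
      m = suc k
      k<n : k ℕ.< n
      k<n = subst (suc k ℕ.≤_) (ℕ.m+[n∸m]≡n m₀≤n) (subst (ℕ._≤ m₀ ℕ.+ n′) (ℕ.+-suc m₀ j) (ℕ.+-monoʳ-≤ m₀ j<n′))
      tx : ι t * q ^ k ≤ frac 4 5
      tx = ≤-trans (*-monoˡ-≤ (ι-nonneg t) (^-antitone 0≤q q≤1 (ℕ.m≤m+n m₀ j))) (≤-trans (≤-reflexive (solve 3 (λ t q x → t :* (q :* x) := q :* (t :* x)) refl (ι t) q x₀))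
        (≤-trans (*-mono-≤ 0≤q q≤ (*-nonneg (ι-nonneg t) 0≤x₀) tx₀) (≤-reflexive (solve 0 (con (frac 5 8) :* con (frac 32 25) := con (frac 4 5)) refl))))
    total≤ : Sum m₀ (λ k → graphE w (witnesses c {n} (suc k))) + Sum n′ (λ j → graphE w (witnesses c {n} (suc (m₀ ℕ.+ j)))) ≤ ε
    total≤ = ≤-trans (+-mono-≤
        (≤-trans (Sum-mono m₀ low) (≤-trans (≤-reflexive (trans (Sum-const m₀ _) (solve 3 (λ a m r → m :* (a :* (m :* r)) := a :* (m :* (m :* con 1ℚ) :* r)) refl 2ℚ (ι m₀) (ρ₁ ^ m₀))))
          (*-monoˡ-≤ 0≤2 (proj₂ decay₁ m₀ (ℕ.m≤n⇒m≤1+n le₁)))))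
        (≤-trans (Sum-mono n′ high) (≤-trans (≤-reflexive (Sum-*ˡ n′ (2ℚ * (C * σ ^ k₀)) (σ ^_)))
          (≤-trans (*-monoˡ-≤ (*-nonneg 0≤2 (*-nonneg (<⇒≤ 0<C) (^-nonneg k₀ 0≤σ))) (subst (Sum n′ (σ ^_) ≤_) (*-identityˡ C) (*≤⇒≤*inv (<⇒0< σ<1) (geometric n′ 0≤σ σ<1))))
            (≤-trans (≤-reflexive (solve 3 (λ a c s → a :* (c :* s) :* c := a :* (s :* (c :* c))) refl 2ℚ C (σ ^ k₀)))
              (*-monoˡ-≤ 0≤2 (≤-trans (*-monoʳ-≤ (<⇒≤ (*-pos 0<C 0<C)) (subst (_≤ _) (*-identityˡ _) (proj₂ decay₂ k₀ le₂))) (≤-reflexive (*-inv-cancel ¼ε (*-pos 0<C 0<C))))))))))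
      (≤-reflexive (solve 1 (λ e → (con 1ℚ :+ con 1ℚ) :* (con ½ :* (con ½ :* e)) :+ (con 1ℚ :+ con 1ℚ) :* (con ½ :* (con ½ :* e)) := e) refl ε))

-- The mode of a binomial distribution

isSize : ∀ {n} → ℕ → Vec Bool n → Bool
isSize j (false ∷ s) = isSize j s
isSize zero [] = true
isSize (suc j) [] = false
isSize zero (true ∷ s) = false
isSize (suc j) (true ∷ s) = isSize j s

isSize-size : ∀ {n} (s : Vec Bool n) → isSize (size s) s ≡ true
isSize-size [] = refl
isSize-size (true ∷ s) = isSize-size s
isSize-size (false ∷ s) = isSize-size s

coin : ℚ → Bool → ℚ
coin x true = x
coin x false = 1ℚ - x

coin-dist : ∀ {x} → 0ℚ ≤ x → x ≤ 1ℚ → IsDistribution (coin x)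
coin-dist {x} p q = record { nonneg = λ { true → p ; false → ≤⇒0≤ q } ; total = 1-x+x x }

opaque
  unfolding rowE

  rowE-isSize : ∀ x n j i → j ℕ.+ i ≡ n → rowE (coin x) {n} (λ s → 𝟙 (isSize j s)) ≡ B n j * (x ^ j * (1ℚ - x) ^ i)
  rowE-isSize x zero zero zero refl = solve 0 (con 1ℚ := con 1ℚ :* (con 1ℚ :* con 1ℚ)) refl
  rowE-isSize x (suc n) zero (suc i) refl = trans
    (cong₂ (λ a b → x * a + (1ℚ - x) * b) (rowE-0 (coin x) {n}) (rowE-isSize x n zero n refl))
    (solve 3 (λ x y z → x :* con 0ℚ :+ y :* (con 1ℚ :* (con 1ℚ :* z)) := con 1ℚ :* (con 1ℚ :* (y :* z))) refl x (1ℚ - x) ((1ℚ - x) ^ n))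
  rowE-isSize x (suc n) (suc j) zero eq = trans
    (cong₂ (λ a b → x * a + (1ℚ - x) * b) (rowE-isSize x n j zero (ℕ.suc-injective eq)) (too-big n (suc j) (ℕ.s≤s (ℕ.≤-reflexive n≡j))))
    (trans (solve 4 (λ x y b u → x :* (b :* (u :* con 1ℚ)) :+ y :* con 0ℚ := (b :+ con 0ℚ) :* (x :* u :* con 1ℚ)) refl x (1ℚ - x) (B n j) (x ^ j))
      (cong (λ b → (B n j + b) * (x * x ^ j * 1ℚ)) (sym (B-zero (ℕ.s≤s (ℕ.≤-reflexive n≡j))))))
    where
    n≡j : n ≡ j
    n≡j = trans (sym (ℕ.suc-injective eq)) (ℕ.+-identityʳ j)
    too-big : ∀ n j → n ℕ.< j → rowE (coin x) {n} (λ s → 𝟙 (isSize j s)) ≡ 0ℚ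
    too-big zero (suc j) _ = refl
    too-big (suc n) (suc j) (ℕ.s≤s l) = trans (cong₂ (λ a b → x * a + (1ℚ - x) * b) (too-big n j l) (too-big n (suc j) (ℕ.m≤n⇒m≤1+n l)))
      (solve 2 (λ x y → x :* con 0ℚ :+ y :* con 0ℚ := con 0ℚ) refl x (1ℚ - x))
  rowE-isSize x (suc n) (suc j) (suc i) eq = trans
    (cong₂ (λ a b → x * a + (1ℚ - x) * b) (rowE-isSize x n j (suc i) (ℕ.suc-injective eq)) (rowE-isSize x n (suc j) i (trans (sym (ℕ.+-suc j i)) (ℕ.suc-injective eq))))
    (solve 6 (λ x y a b u v → x :* (a :* (u :* (y :* v))) :+ y :* (b :* (x :* u :* v)) := (a :+ b) :* (x :* u :* (y :* v))) refl x (1ℚ - x) (B n j) (B n (suc j)) (x ^ j) ((1ℚ - x) ^ i))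

  rowE-size : ∀ {x} → 0ℚ ≤ x → x ≤ 1ℚ → ∀ n → rowE (coin x) {n} (ι ∘ size) ≡ ι n * x
  rowE-size {x} p q zero = sym (zeroˡ x)
  rowE-size {x} p q (suc n) = trans
    (cong₂ (λ a b → x * a + (1ℚ - x) * b) (trans (rowE-+ (coin x) {n} (λ _ → 1ℚ) (ι ∘ size)) (cong₂ _+_ (rowE-const (coin-dist p q) {n} 1ℚ) (rowE-size p q n))) (rowE-size p q n))
    (solve 2 (λ x n → x :* (con 1ℚ :+ n :* x) :+ (con 1ℚ :- x) :* (n :* x) := (con 1ℚ :+ n) :* x) refl x (ι n))

  rowE-Sum : ∀ w {n} k (f : ℕ → Vec Bool n → ℚ) → rowE w (λ s → Sum k (λ j → f j s)) ≡ Sum k (λ j → rowE w (f j))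
  rowE-Sum w {n} zero f = rowE-0 w {n}
  rowE-Sum w {n} (suc k) f = trans (rowE-+ w {n} (f 0) _) (cong (rowE w (f 0) +_) (rowE-Sum w {n} k (f ∘ suc)))

-- If the mode m exceeds the mean, Markov's inequality leaves mass ½ on the 2m values below 2m.
binomial-mode : ∀ {x} n m i → m ℕ.+ i ≡ n → 0ℚ < x → x ≤ ½ → 1 ℕ.≤ m → m ℕ.+ m ℕ.≤ n → ι n * x ≤ ι m → ι m ≤ ι (suc n) * x →
  ½ * ½ ≤ ι m * (B n m * (x ^ m * (1ℚ - x) ^ i))
binomial-mode {x} n m i m+i≡n 0<x x≤½ 1≤m 2m≤n below above = subst (λ k → ½ * ½ ≤ ι m * (B n m * (x ^ m * (1ℚ - x) ^ k))) (trans (cong (ℕ._∸ m) (sym m+i≡n)) (ℕ.m+n∸m≡n m i))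
    (≤-trans (≤-reflexive (solve 0 (con ½ :* con ½ := con ½ :* (con 1ℚ :- con ½)) refl))
      (≤-trans (*-monoˡ-≤ (<⇒≤ 0<½) (≤-trans (≤-by 0ℚ ≤-refl (sym (+-identityʳ _))) low-mass)) (≤-reflexive (solve 2 (λ m a → con ½ :* ((m :+ m) :* a) := m :* a) refl (ι m) (a m)))))
  where
  y = 1ℚ - x
  x≤1 : x ≤ 1ℚ
  x≤1 = ≤-trans x≤½ (toWitness {a? = ½ ℚ.≤? 1ℚ} _)
  0<y : 0ℚ < y
  0<y = <-≤-trans 0<½ (≤-trans (≤-reflexive (solve 0 (con ½ := con 1ℚ :- con ½) refl)) (complement-anti x≤½))
  0≤x = <⇒≤ 0<x
  a : ℕ → ℚ
  a j = B n j * (x ^ j * y ^ (n ℕ.∸ j))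
  0≤a : ∀ j → 0ℚ ≤ a j
  0≤a j = *-nonneg (B-nonneg n j) (*-nonneg (^-nonneg j 0≤x) (^-nonneg (n ℕ.∸ j) (<⇒≤ 0<y)))
  ratio : ∀ j → j ℕ.< n → a (suc j) * (ι (suc j) * y) ≡ a j * ((ι n - ι j) * x)
  ratio j j<n = trans (solve 5 (λ b x u v iy → b :* (x :* u :* v) :* iy := b :* (x :* u :* v) :* iy) refl (B n (suc j)) x (x ^ j) (y ^ (n ℕ.∸ suc j)) (ι (suc j) * y))
    (trans (solve 6 (λ b x u v i y → b :* (x :* u :* v) :* (i :* y) := i :* b :* (x :* (u :* (y :* v)))) refl (B n (suc j)) x (x ^ j) (y ^ (n ℕ.∸ suc j)) (ι (suc j)) y)
      (trans (cong₂ (λ b z → b * (x * (x ^ j * z))) (B-absorb n j) (cong (y ^_) (sym (ℕ.+-∸-assoc 1 j<n))))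
        (solve 5 (λ r b x u v → r :* b :* (x :* (u :* v)) := b :* (u :* v) :* (r :* x)) refl (ι n - ι j) (B n j) x (x ^ j) (y ^ (n ℕ.∸ j)))))
  -- The sign of this difference decides whether the probabilities rise from j to j + 1: they do as
  -- long as j + 1 ≤ (n + 1)x.
  gap : ∀ j → (ι n - ι j) * x - ι (suc j) * y ≡ ι (suc n) * x - ι (suc j)
  gap j = solve 3 (λ n j x → (n :- j) :* x :- (con 1ℚ :+ j) :* (con 1ℚ :- x) := (con 1ℚ :+ n) :* x :- (con 1ℚ :+ j)) refl (ι n) (ι j) x
  up : ∀ j → j ℕ.< m → a j ≤ a (suc j)
  up j j<m = *-cancelʳ-≤ (*-pos (ι-pos j) 0<y) (≤-trans (*-monoˡ-≤ (0≤a j) (0≤⇒≤ (subst (0ℚ ≤_) (sym (gap j)) (≤⇒0≤ (≤-trans (ι-mono j<m) above)))))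
    (≤-reflexive (sym (ratio j (ℕ.≤-trans j<m m≤n)))))
    where
    m≤n = ℕ.≤-trans (ℕ.m≤m+n m m) 2m≤n
  down : ∀ j → m ℕ.≤ j → j ℕ.< n → a (suc j) ≤ a j
  down j m≤j j<n = *-cancelʳ-≤ (*-pos (ι-pos j) 0<y) (≤-trans (≤-reflexive (ratio j j<n)) (*-monoˡ-≤ (0≤a j) (0≤⇒≤ (subst (0ℚ ≤_) lemma (≤⇒0≤ bound)))))
    where
    bound : ι (suc n) * x ≤ ι (suc j)
    bound = ≤-trans (≤-reflexive (solve 2 (λ n x → (con 1ℚ :+ n) :* x := x :+ n :* x) refl (ι n) x)) (+-mono-≤ x≤1 (≤-trans below (ι-mono m≤j)))
    lemma : ι (suc j) - ι (suc n) * x ≡ ι (suc j) * y - (ι n - ι j) * x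
    lemma = trans (solve 2 (λ u v → v :- u := :- (u :- v)) refl (ι (suc n) * x) (ι (suc j))) (trans (cong -_ (sym (gap j))) (solve 2 (λ u v → :- (u :- v) := v :- u) refl ((ι n - ι j) * x) (ι (suc j) * y)))
  rising : ∀ d j → j ℕ.+ d ≡ m → a j ≤ a m
  rising zero j eq = ≤-reflexive (cong a (trans (sym (ℕ.+-identityʳ j)) eq))
  rising (suc d) j eq = ≤-trans (up j (subst (suc j ℕ.≤_) eq (ℕ.≤-trans (ℕ.s≤s (ℕ.m≤m+n j d)) (ℕ.≤-reflexive (sym (ℕ.+-suc j d)))))) (rising d (suc j) (trans (sym (ℕ.+-suc j d)) eq))
  falling : ∀ d → m ℕ.+ d ℕ.≤ n → a (m ℕ.+ d) ≤ a m
  falling zero l = ≤-reflexive (cong a (ℕ.+-identityʳ m))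
  falling (suc d) l = ≤-trans (≤-reflexive (cong a (ℕ.+-suc m d))) (≤-trans (down (m ℕ.+ d) (ℕ.m≤m+n m d) l′) (falling d (ℕ.<⇒≤ l′)))
    where
    l′ = subst (ℕ._≤ n) (ℕ.+-suc m d) l
  top : ∀ j → j ℕ.≤ n → a j ≤ a m
  top j j≤n = cases (ℕ.≤-total j m)
    where
    cases : j ℕ.≤ m ⊎ m ℕ.≤ j → a j ≤ a m
    cases (inj₁ l) = rising (m ℕ.∸ j) j (ℕ.m+[n∸m]≡n l)
    cases (inj₂ l) = subst (λ j → a j ≤ a m) (ℕ.m+[n∸m]≡n l) (falling (j ℕ.∸ m) (subst (ℕ._≤ n) (sym (ℕ.m+[n∸m]≡n l)) j≤n))
  L = m ℕ.+ m
  0<L : 0ℚ < ι L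
  0<L = <-≤-trans (ι-pos 0) (ι-mono (ℕ.≤-trans 1≤m (ℕ.m≤m+n m m)))
  pointwise : ∀ (s : Vec Bool n) → 1ℚ ≤ Sum L (λ j → 𝟙 (isSize j s)) + inv (ι L) * ι (size s)
  pointwise s = cases (size s ℕ.<? L)
    where
    cases : Dec (size s ℕ.< L) → 1ℚ ≤ Sum L (λ j → 𝟙 (isSize j s)) + inv (ι L) * ι (size s)
    cases (yes l) = ≤-trans (≤-trans (≤-reflexive (cong 𝟙 (sym (isSize-size s)))) (≤-Sum L (λ j → 𝟙-nonneg (isSize j s)) (size s) l)) (≤-+ʳ (*-nonneg (inv-nonneg 0<L) (ι-nonneg (size s))))
    cases (no l) = ≤-trans (≤-trans (≤-reflexive (sym (trans (*-comm _ _) (*-inv 0<L)))) (*-monoˡ-≤ (inv-nonneg 0<L) (ι-mono (ℕ.≮⇒≥ l)))) (≤-+ˡ (Sum-nonneg L (λ j → 𝟙-nonneg (isSize j s))))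
  d = coin-dist 0≤x x≤1
  mass : 1ℚ ≤ Sum L a + inv (ι L) * (ι n * x)
  mass = ≤-trans (≤-reflexive (sym (rowE-const d {n} 1ℚ))) (≤-trans (rowE-mono (IsDistribution.nonneg d) pointwise)
    (≤-trans (≤-reflexive (trans (rowE-+ (coin x) _ _) (cong₂ _+_ (rowE-Sum (coin x) L (λ j s → 𝟙 (isSize j s))) (trans (rowE-*ˡ (coin x) (inv (ι L)) (ι ∘ size)) (cong (inv (ι L) *_) (rowE-size 0≤x x≤1 n))))))
      (+-monoʳ-≤ _ (Sum-mono L (λ j j<L → ≤-reflexive (rowE-isSize x n j (n ℕ.∸ j) (ℕ.m+[n∸m]≡n (ℕ.≤-trans (ℕ.<⇒≤ j<L) 2m≤n))))))))
  low-mass : 1ℚ - ½ ≤ (ι m + ι m) * a m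
  low-mass = ≤-trans (≤-trans (+-mono-≤ mass (≤-refl { - ½})) (≤-by (½ - inv (ι L) * (ι n * x)) (≤⇒0≤ tail≤) (solve 2 (λ s t → s := s :+ t :- con ½ :+ (con ½ :- t)) refl (Sum L a) (inv (ι L) * (ι n * x)))))
    (≤-trans (Sum-mono L (λ j j<L → top j (ℕ.≤-trans (ℕ.<⇒≤ j<L) 2m≤n))) (≤-reflexive (trans (Sum-const L (a m)) (cong (_* a m) (ι-+ m m)))))
    where
    tail≤ : inv (ι L) * (ι n * x) ≤ ½
    tail≤ = ≤-trans (*-monoˡ-≤ (inv-nonneg 0<L) (≤-trans below (≤-reflexive (solve 1 (λ m → m := (m :+ m) :* con ½) refl (ι m)))))
      (≤-reflexive (trans (sym (*-assoc _ _ _)) (trans (cong (λ z → inv (ι L) * z * ½) (sym (ι-+ m m))) (trans (cong (_* ½) (trans (*-comm _ _) (*-inv 0<L))) (*-identityˡ ½)))))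

-- Joint probabilities of two witnesses

tri-+ : ∀ j l → tri (j ℕ.+ l) ≡ tri j ℕ.+ (tri l ℕ.+ j ℕ.* l)
tri-+ zero l = sym (ℕ.+-identityʳ (tri l))
tri-+ (suc j) l = trans (cong (j ℕ.+ l ℕ.+_) (tri-+ j l)) (lemma j l (tri j) (tri l) (j ℕ.* l))
  where
  lemma : ∀ j l a b c → j ℕ.+ l ℕ.+ (a ℕ.+ (b ℕ.+ c)) ≡ j ℕ.+ a ℕ.+ (b ℕ.+ (l ℕ.+ c))
  lemma = solveℕ 5 (λ j l a b c → j ⊹ l ⊹ (a ⊹ (b ⊹ c)) ≋ j ⊹ a ⊹ (b ⊹ (l ⊹ c))) refl

outside-* : ∀ {n} (K L : Vec Bool n) i {a b} → 0ℚ ≤ a → a ≤ 1ℚ → 0ℚ ≤ b → b ≤ 1ℚ → outside-of K i a * outside-of L i b ≤ outside-of (K ∪ L) i (a * b)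
outside-* (true ∷ K) (true ∷ L) zero _ _ _ _ = ≤-reflexive (*-identityˡ 1ℚ)
outside-* (true ∷ K) (false ∷ L) zero _ _ _ b≤1 = ≤-trans (≤-reflexive (*-identityˡ _)) b≤1
outside-* (false ∷ K) (true ∷ L) zero _ a≤1 _ _ = ≤-trans (≤-reflexive (*-identityʳ _)) a≤1
outside-* (false ∷ K) (false ∷ L) zero _ _ _ _ = ≤-refl
outside-* (_ ∷ K) (_ ∷ L) (suc i) = outside-* K L i

K⊑removals : ∀ {n} (b b′ : Fin n) K → b ≢ b′ → K ⊑ remove b K ∪ remove b′ K
K⊑removals zero zero (k ∷ K) ne = contradiction refl ne
K⊑removals zero (suc b′) (true ∷ K) ne = keep (⊑-∪ˡ K (remove b′ K))
K⊑removals zero (suc b′) (false ∷ K) ne = skip (⊑-∪ˡ K (remove b′ K))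
K⊑removals (suc b) zero (true ∷ K) ne = subst (λ z → (true ∷ K) ⊑ (z ∷ remove b K ∪ K)) refl (keep (⊑-∪ʳ (remove b K) K))
K⊑removals (suc b) zero (false ∷ K) ne = skip (⊑-∪ʳ (remove b K) K)
K⊑removals (suc b) (suc b′) (true ∷ K) ne = keep (K⊑removals b b′ K (ne ∘ cong suc))
K⊑removals (suc b) (suc b′) (false ∷ K) ne = skip (K⊑removals b b′ K (ne ∘ cong suc))

rowE-not-hom² : ∀ {w} → IsDistribution w → ∀ e {n} (A A′ : Vec Bool n) →
  rowE w (λ v → 𝟙 (not (hom (same e) A v)) * 𝟙 (not (hom (same e) A′ v))) ≡ 1ℚ - w e ^ size A - w e ^ size A′ + w e ^ size (A ∪ A′)
rowE-not-hom² {w} d e A A′ = trans (rowE-cong w (λ v → trans (cong₂ _*_ (𝟙-not (hom (same e) A v)) (𝟙-not (hom (same e) A′ v)))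
    (trans (solve 2 (λ a b → (con 1ℚ :- a) :* (con 1ℚ :- b) := (con 1ℚ :- a) :+ ((:- con 1ℚ) :* b :+ a :* b)) refl (𝟙 (hom (same e) A v)) (𝟙 (hom (same e) A′ v)))
      (cong (λ z → (1ℚ - 𝟙 (hom (same e) A v)) + ((- 1ℚ) * 𝟙 (hom (same e) A′ v) + z)) (𝟙-hom-∪ (same e) A A′ v)))))
  (trans (rowE-+ w _ _) (trans (cong₂ _+_ (trans (rowE-complement d _) (cong (λ z → 1ℚ - z) (rowE-hom-same d e A)))
      (trans (rowE-+ w _ _) (cong₂ _+_ (trans (rowE-*ˡ w (- 1ℚ) _) (cong ((- 1ℚ) *_) (rowE-hom-same d e A′))) (rowE-hom-same d e (A ∪ A′)))))
    (solve 3 (λ a b c → (con 1ℚ :- a) :+ ((:- con 1ℚ) :* b :+ c) := con 1ℚ :- a :- b :+ c) refl (w e ^ size A) (w e ^ size A′) (w e ^ size (A ∪ A′)))))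

-- For a vertex outside K ∪ L the two conditions have a joint probability given by inclusion and
-- exclusion; for a vertex in just one of the sets, the condition imposed by the other is estimated
-- by 1.
graphE-dominates² : ∀ {w} → IsDistribution w → ∀ c {n} {A K A′ L : Vec Bool n} → A ⊑ K → A′ ⊑ L →
  graphE w (λ G → dominates c A K G * dominates c A′ L G)
    ≤ graphE w (λ G → 𝟙 (clique c K G) * 𝟙 (clique c L G)) * (1ℚ - w (not c) ^ size A - w (not c) ^ size A′ + w (not c) ^ size (A ∪ A′)) ^ co-size (K ∪ L)
graphE-dominates² {w} d c {n} {A} {K} {A′} {L} A⊑K A′⊑L = ≤-trans (graphE-mono (IsDistribution.nonneg d) bound)
  (≤-reflexive (trans (graphE-clique²-outside d c K L h loc) (cong (λ z → graphE w (λ G → 𝟙 (clique c K G) * 𝟙 (clique c L G)) * z ^ co-size (K ∪ L)) (rowE-not-hom² d (not c) A A′))))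
  where
  f f′ h : Vec Bool n → ℚ
  f v = 𝟙 (not (hom (same (not c)) A v))
  f′ v = 𝟙 (not (hom (same (not c)) A′ v))
  h v = f v * f′ v
  loc : Local (K ∪ L) h
  loc v = cong₂ (λ a b → 𝟙 (not a) * 𝟙 (not b)) (hom-local (same (not c)) (⊑-trans A⊑K (⊑-∪ˡ K L)) v) (hom-local (same (not c)) (⊑-trans A′⊑L (⊑-∪ʳ K L)) v)
  bound : ∀ G → dominates c A K G * dominates c A′ L G ≤ 𝟙 (clique c K G) * 𝟙 (clique c L G) * ∏ n (λ i → outside-of (K ∪ L) i (h (nbr G i)))
  bound G = ≤-trans (≤-reflexive (solve 4 (λ a b x y → a :* b :* (x :* y) := a :* x :* (b :* y)) refl (𝟙 (clique c K G)) (∏ n (λ i → outside-of K i (f (nbr G i)))) (𝟙 (clique c L G)) (∏ n (λ i → outside-of L i (f′ (nbr G i))))))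
    (*-monoˡ-≤ (*-nonneg (𝟙-nonneg (clique c K G)) (𝟙-nonneg (clique c L G))) (≤-trans (≤-reflexive (sym (∏-* n _ _)))
      (∏-mono n (λ i → *-nonneg (outside-nonneg K i (𝟙-nonneg (not (hom (same (not c)) A (nbr G i))))) (outside-nonneg L i (𝟙-nonneg (not (hom (same (not c)) A′ (nbr G i))))))
        (λ i → outside-* K L i (𝟙-nonneg (not (hom (same (not c)) A (nbr G i)))) (𝟙≤1 (not (hom (same (not c)) A (nbr G i)))) (𝟙-nonneg (not (hom (same (not c)) A′ (nbr G i)))) (𝟙≤1 (not (hom (same (not c)) A′ (nbr G i))))))))

∩⊑ˡ : ∀ {n} (K L : Vec Bool n) → K ∩ L ⊑ K
∩⊑ˡ [] [] = []
∩⊑ˡ (true ∷ K) (true ∷ L) = keep (∩⊑ˡ K L)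
∩⊑ˡ (true ∷ K) (false ∷ L) = skip (∩⊑ˡ K L)
∩⊑ˡ (false ∷ K) (_ ∷ L) = skip (∩⊑ˡ K L)

∩⊑ʳ : ∀ {n} (K L : Vec Bool n) → K ∩ L ⊑ L
∩⊑ʳ [] [] = []
∩⊑ʳ (true ∷ K) (true ∷ L) = keep (∩⊑ʳ K L)
∩⊑ʳ (true ∷ K) (false ∷ L) = skip (∩⊑ʳ K L)
∩⊑ʳ (false ∷ K) (_ ∷ L) = skip (∩⊑ʳ K L)

size-∩⇒≡ : ∀ {n} (K L : Vec Bool n) → size K ℕ.≤ size (K ∩ L) → size L ℕ.≤ size (K ∩ L) → K ≡ L
size-∩⇒≡ [] [] _ _ = refl
size-∩⇒≡ (true ∷ K) (true ∷ L) p q = cong (true ∷_) (size-∩⇒≡ K L (ℕ.s≤s⁻¹ p) (ℕ.s≤s⁻¹ q))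
size-∩⇒≡ (true ∷ K) (false ∷ L) p q = contradiction (ℕ.≤-trans p (size-mono (∩⊑ˡ K L))) (ℕ.<-irrefl refl)
size-∩⇒≡ (false ∷ K) (true ∷ L) p q = contradiction (ℕ.≤-trans q (size-mono (∩⊑ʳ K L))) (ℕ.<-irrefl refl)
size-∩⇒≡ (false ∷ K) (false ∷ L) p q = cong (false ∷_) (size-∩⇒≡ K L p q)

∑-delta : ∀ {n} (b : Fin n) z → ∑ n (λ b′ → if does (b Fin.≟ b′) then z else 0ℚ) ≡ z
∑-delta {suc n} zero z = trans (cong (z +_) (∑-0 n)) (+-identityʳ z)
  where
  ∑-0 : ∀ n → ∑ n (λ b′ → if does (zero Fin.≟ Fin.suc b′) then z else 0ℚ) ≡ 0ℚ
  ∑-0 zero = refl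
  ∑-0 (suc n) = trans (+-identityˡ _) (∑-0 n)
∑-delta {suc n} (suc b) z = trans (+-identityˡ _) (∑-delta b z)

-- At the critical probability the critical sentence is likely for suitable orders

antidiag-second : ∀ m (f : ℕ → ℚ) → antidiag m (λ _ i → f i) ≡ Sum (suc m) f
antidiag-second zero f = sym (+-identityʳ _)
antidiag-second (suc m) f = trans (antidiag-last m (λ _ i → f i)) (trans (cong (_+ f 0) (antidiag-second m (f ∘ suc))) (+-comm _ (f 0)))

∪-idem : ∀ {n} (K : Vec Bool n) → K ∪ K ≡ K
∪-idem [] = refl
∪-idem (true ∷ K) = cong (true ∷_) (∪-idem K)
∪-idem (false ∷ K) = cong (false ∷_) (∪-idem K)

∩-idem : ∀ {n} (K : Vec Bool n) → K ∩ K ≡ K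
∩-idem [] = refl
∩-idem (true ∷ K) = cong (true ∷_) (∩-idem K)
∩-idem (false ∷ K) = cong (false ∷_) (∩-idem K)

rooted : Bool → ∀ {n} → Vec Bool n → Graph n → ℚ
rooted c {n} K G = ∑ n (λ b → 𝟙 (lookup K b) * dominates c (remove b K) K G)

graphE-rooted² : ∀ w c {n} (K L : Vec Bool n) → graphE w (λ G → rooted c K G * rooted c L G)
  ≡ ∑ n (λ b → 𝟙 (lookup K b) * ∑ n (λ b′ → 𝟙 (lookup L b′) * graphE w (λ G → dominates c (remove b K) K G * dominates c (remove b′ L) L G)))
graphE-rooted² w c {n} K L = trans (graphE-cong w expand) (trans (∑-graphE w n _) (∑-cong n (λ b → trans (graphE-*ˡ w (𝟙 (lookup K b)) _)
    (cong (𝟙 (lookup K b) *_) (trans (∑-graphE w n _) (∑-cong n (λ b′ → graphE-*ˡ w (𝟙 (lookup L b′)) _)))))))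
  where
  expand : ∀ G → rooted c K G * rooted c L G ≡ ∑ n (λ b → 𝟙 (lookup K b) * ∑ n (λ b′ → 𝟙 (lookup L b′) * (dominates c (remove b K) K G * dominates c (remove b′ L) L G)))
  expand G = trans (*-comm _ _) (trans (sym (∑-*ˡ n (rooted c L G) _)) (∑-cong n (λ b →
    trans (solve 3 (λ z i x → z :* (i :* x) := i :* (x :* z)) refl (rooted c L G) (𝟙 (lookup K b)) (dominates c (remove b K) K G))
      (cong (𝟙 (lookup K b) *_) (trans (sym (∑-*ˡ n (dominates c (remove b K) K G) _)) (∑-cong n (λ b′ →
        solve 3 (λ x i y → x :* (i :* y) := i :* (x :* y)) refl (dominates c (remove b K) K G) (𝟙 (lookup L b′)) (dominates c (remove b′ L) L G))))))))

𝟙*-mono : ∀ b {x y} → (b ≡ true → x ≤ y) → 𝟙 b * x ≤ 𝟙 b * y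
𝟙*-mono true e = *-monoˡ-≤ 0≤1 (e refl)
𝟙*-mono false e = ≤-reflexive (trans (zeroˡ _) (sym (zeroˡ _)))

graphE-rooted²≤ : ∀ {w} c {n m} (K L : Vec Bool n) → size K ≡ m → size L ≡ m → ∀ {β} →
  (∀ b b′ → lookup K b ≡ true → lookup L b′ ≡ true → graphE w (λ G → dominates c (remove b K) K G * dominates c (remove b′ L) L G) ≤ β) →
  graphE w (λ G → rooted c K G * rooted c L G) ≤ ι m * (ι m * β)
graphE-rooted²≤ {w} c {n} {m} K L eK eL {β} h = ≤-trans (≤-reflexive (graphE-rooted² w c K L))
  (≤-trans (∑-mono n (λ b → 𝟙*-mono (lookup K b) (λ b∈ → ≤-trans (∑-mono n (λ b′ → 𝟙*-mono (lookup L b′) (h b b′ b∈))) (≤-reflexive (trans (∑-member L β) (cong (λ k → ι k * β) eL))))))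
    (≤-reflexive (trans (∑-member K (ι m * β)) (cong (λ k → ι k * (ι m * β)) eK))))

-- The order n makes m = k + 1 the mode of Bin(n, qᵏ), whence the mean μ of the count Z is at least
-- 1/8. In the second moment, overlaps up to h, about k/2, behave nearly independently and
-- contribute at most 4μ²; larger overlaps and the diagonal add at most 24μ. Then Z > 0 has
-- probability at least μ/(4μ + 24) ≥ 1/200.
critical-likely : ∃ λ k₁ → ∀ k → k₁ ℕ.≤ k → ∀ {w} c → IsDistribution w → ½ ≤ w (not c) → w (not c) ≤ frac 5 8 →
  Close (tri (orderBound k)) (w c) (w (not c)) → ∃ λ n → k ℕ.≤ n × n ℕ.≤ orderBound k × frac 1 200 ≤ graphE w {n} (truth (critical c))
critical-likely = k₁ , main
  where
  r ζ : ℚ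
  r = frac 5 8
  ζ = frac 1 64
  -- As m ≤ 4h, this gives m³qʰ ≤ 64/4096 = 1/64, from which the other smallness conditions follow.
  decay = poly*exp→0 3 {r} (ℚ.nonNegative⁻¹ r) (toWitness {a? = frac 5 8 ℚ.<? 1ℚ} _) (ℚ.positive⁻¹ (frac 1 4096))
  H = suc (proj₁ decay)
  k₁ = suc (suc (H ℕ.+ H))
  main : ∀ k → k₁ ℕ.≤ k → ∀ {w} c → IsDistribution w → ½ ≤ w (not c) → w (not c) ≤ frac 5 8 →
    Close (tri (orderBound k)) (w c) (w (not c)) → ∃ λ n → k ℕ.≤ n × n ℕ.≤ orderBound k × frac 1 200 ≤ graphE w {n} (truth (critical c))
  main k k₁≤k {w} c dst ½≤q q≤r close = n , ℕ.≤-trans (ℕ.n≤1+n k) m≤n , n≤ , likely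
    where
    open IsDistribution dst
    ω = w c
    q = w (not c)
    m = suc k
    0<q : 0ℚ < q
    0<q = <-≤-trans 0<½ ½≤q
    0≤q = <⇒≤ 0<q
    q≤1 = ≤1 (not c)
    ω+q : ω + q ≡ 1ℚ
    ω+q = lemma c
      where
      lemma : ∀ c → w c + w (not c) ≡ 1ℚ
      lemma true = total
      lemma false = trans (+-comm _ _) total
    ω≥ : frac 3 8 ≤ ω
    ω≥ = ≤-trans (≤-reflexive (solve 0 (con (frac 3 8) := con 1ℚ :- con (frac 5 8)) refl)) (≤-trans (complement-anti q≤r) (≤-reflexive (trans (cong (_- q) (sym ω+q)) (solve 2 (λ o q → o :+ q :- q := o) refl ω q))))
    0<ω : 0ℚ < ω
    0<ω = <-≤-trans (ℚ.positive⁻¹ (frac 3 8)) ω≥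
    h = proj₁ (halve k)
    k≤2h+1 = proj₁ (proj₂ (halve k))
    2h≤k = proj₂ (proj₂ (halve k))
    h≤k : h ℕ.≤ k
    h≤k = ℕ.≤-trans (ℕ.m≤m+n h h) 2h≤k
    H≤h : H ℕ.≤ h
    H≤h = ℕ.≮⇒≥ λ h<H → ℕ.<-irrefl refl (ℕ.≤-trans k₁≤k (ℕ.≤-trans k≤2h+1 (ℕ.s≤s (ℕ.+-mono-≤ (ℕ.<⇒≤ h<H) (ℕ.<⇒≤ h<H)))))
    s = q ^ h
    x = q ^ k
    0<s = ^-pos h 0<q
    0≤s = <⇒≤ 0<s
    0<x = ^-pos k 0<q
    0≤x = <⇒≤ 0<x
    x≤s : x ≤ s
    x≤s = ^-antitone 0≤q q≤1 h≤k
    M = ι m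
    0≤M = ι-nonneg m
    1≤M : 1ℚ ≤ M
    1≤M = 1≤ι-suc k
    4F = frac 4 1
    M≤4h : M ≤ 4F * ι h
    M≤4h = ≤-trans (ι-mono (ℕ.s≤s k≤2h+1)) (≤-trans (≤-reflexive (cong (λ z → 1ℚ + (1ℚ + z)) (ι-+ h h)))
      (≤-by ((ι h - 1ℚ) + (ι h - 1ℚ)) (+-nonneg (≤⇒0≤ 1≤h) (≤⇒0≤ 1≤h)) (solve 1 (λ h → con (frac 4 1) :* h := con 1ℚ :+ (con 1ℚ :+ (h :+ h)) :+ ((h :- con 1ℚ) :+ (h :- con 1ℚ))) refl (ι h))))
      where
      1≤h : 1ℚ ≤ ι h
      1≤h = ≤-trans (1≤ι-suc (proj₁ decay)) (ι-mono H≤h)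
    M³s≤ζ : M * (M * M) * s ≤ ζ
    M³s≤ζ = ≤-trans (≤-reflexive (solve 2 (λ m s → m :* (m :* m) :* s := m :* (m :* (m :* con 1ℚ)) :* s) refl M s))
      (≤-trans (*-mono-≤ (^-nonneg 3 0≤M) (≤-trans (^-mono 3 0≤M M≤4h) (≤-reflexive (*-^ 4F (ι h) 3))) 0≤s (^-mono h 0≤q q≤r))
        (≤-trans (≤-reflexive (*-assoc _ _ _)) (≤-trans (*-monoˡ-≤ (^-nonneg 3 (ℚ.nonNegative⁻¹ 4F)) (proj₂ decay h (ℕ.≤-trans (ℕ.n≤1+n _) H≤h)))
          (≤-reflexive (solve 0 (con (frac 4 1) :* (con (frac 4 1) :* (con (frac 4 1) :* con 1ℚ)) :* con (frac 1 4096) := con (frac 1 64)) refl)))))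
    drop : ∀ {a} → 0ℚ ≤ a → a ≤ M * a
    drop {a} p = ≤-trans (≤-reflexive (sym (*-identityˡ a))) (*-monoʳ-≤ p 1≤M)
    M²s≤ζ : M * M * s ≤ ζ
    M²s≤ζ = ≤-trans (drop (*-nonneg (*-nonneg 0≤M 0≤M) 0≤s)) (≤-trans (≤-reflexive (sym (*-assoc _ _ _))) M³s≤ζ)
    Ms≤ζ : M * s ≤ ζ
    Ms≤ζ = ≤-trans (drop (*-nonneg 0≤M 0≤s)) (≤-trans (≤-reflexive (sym (*-assoc _ _ _))) M²s≤ζ)
    s≤ζ : s ≤ ζ
    s≤ζ = ≤-trans (drop 0≤s) Ms≤ζ
    x≤ζ = ≤-trans x≤s s≤ζ
    Mx≤ζ : M * x ≤ ζ
    Mx≤ζ = ≤-trans (*-monoˡ-≤ 0≤M x≤s) Ms≤ζ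
    ζ≤½ : ζ ≤ ½
    ζ≤½ = toWitness {a? = frac 1 64 ℚ.≤? ½} _
    x≤½ = ≤-trans x≤ζ ζ≤½
    x≤1 : x ≤ 1ℚ
    x≤1 = ^≤1 k 0≤q q≤1
    -- The crossing point n satisfies nqᵏ ≤ m ≤ (n + 1)qᵏ, the hypotheses of `binomial-mode`.
    P : ℕ → Set
    P N = M ≤ ι N * x
    cr = crossing {P} (λ N → M ℚ.≤? ι N * x) (λ p → <-irrefl refl (<-≤-trans 0<1 (≤-trans 1≤M (≤-trans p (≤-reflexive (zeroˡ x))))))
      (m ℕ.* pow2 k) (≤-trans (≤-trans (≤-reflexive (sym (*-identityʳ M))) (*-monoˡ-≤ 0≤M (pow2*^ k ½≤q))) (≤-reflexive (trans (sym (*-assoc _ _ _)) (cong (_* x) (sym (ι-* m (pow2 k)))))))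
    n = proj₁ cr
    below : ι n * x ≤ M
    below = <⇒≤ (ℚ.≰⇒> (proj₁ (proj₂ (proj₂ cr))))
    above : M ≤ ι (suc n) * x
    above = proj₂ (proj₂ (proj₂ cr))
    n≤ : n ℕ.≤ orderBound k
    n≤ = ℕ.≤-trans (ℕ.n≤1+n n) (ℕ.≤-trans (proj₁ (proj₂ cr)) (ℕ.≤-trans (ℕ.≤-reflexive (ℕ.*-comm m (pow2 k))) (ℕ.*-monoˡ-≤ m (ℕ.m≤m+n (pow2 k) (pow2 k)))))
    above′ : M - x ≤ ι n * x
    above′ = ≤-trans (+-monoʳ-≤ (- x) above) (≤-reflexive (solve 2 (λ n x → (con 1ℚ :+ n) :* x :- x := n :* x) refl (ι n) x))
    2m≤n : m ℕ.+ m ℕ.≤ n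
    2m≤n = ℕ.≮⇒≥ λ n<2m → <-irrefl refl (<-≤-trans (ℚ.<-≤-trans (toWitness {a? = frac 3 64 ℚ.<? 1ℚ} _) 1≤M)
      (≤-trans (≤-by 0ℚ ≤-refl (solve 2 (λ m x → m :- x :+ x := m :+ con 0ℚ) refl M x)) (≤-trans (+-monoʳ-≤ x (≤-trans above′ (*-monoʳ-≤ 0≤x (≤-trans (ι-mono (ℕ.<⇒≤ n<2m)) (≤-reflexive (ι-+ m m))))))
        (≤-trans (+-mono-≤ (≤-trans (≤-reflexive (distribʳ x M M)) (+-mono-≤ Mx≤ζ Mx≤ζ)) x≤ζ) (≤-reflexive (solve 0 (con (frac 1 64) :+ con (frac 1 64) :+ con (frac 1 64) := con (frac 3 64)) refl))))))
    m≤n : m ℕ.≤ n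
    m≤n = ℕ.≤-trans (ℕ.m≤m+n m m) 2m≤n
    i = n ℕ.∸ m
    m+i≡n : m ℕ.+ i ≡ n
    m+i≡n = ℕ.m+[n∸m]≡n m≤n
    ν = ι n - M
    νx : ½ * M ≤ ν * x
    νx = ≤-trans (≤-by (½ * M - (x + M * x)) (≤⇒0≤ (≤-trans (+-mono-≤ x≤ζ Mx≤ζ) (≤-trans (toWitness {a? = frac 1 64 ℚ.+ frac 1 64 ℚ.≤? ½} _ ∘≤ +≡ ζ ζ) (≤-trans (≤-reflexive (sym (*-identityʳ ½))) (*-monoˡ-≤ (<⇒≤ 0<½) 1≤M)))))
        (solve 2 (λ m x → m :- x :- m :* x := con ½ :* m :+ (con ½ :* m :- (x :+ m :* x))) refl M x))
      (≤-trans (+-monoʳ-≤ (- (M * x)) above′) (≤-reflexive (solve 3 (λ n m x → n :* x :- m :* x := (n :- m) :* x) refl (ι n) M x)))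
      where
      _∘≤_ : ∀ {a b c} → b ≤ c → a ≡ b → a ≤ c
      p ∘≤ e = ≤-trans (≤-reflexive e) p
    0<ν : 0ℚ < ν
    0<ν = ℚ.≰⇒> λ ν≤0 → <-irrefl refl (<-≤-trans (*-pos 0<½ (<-≤-trans 0<1 1≤M)) (≤-trans νx (≤-trans (*-monoʳ-≤ 0≤x ν≤0) (≤-reflexive (zeroˡ x)))))
    d u D W β : ℚ
    d = 1ℚ - x
    u = ω ^ tri m
    D = d ^ i
    W = M * (u * D)
    β = B n m
    0≤d : 0ℚ ≤ d
    0≤d = ≤⇒0≤ x≤1
    d≤1 : d ≤ 1ℚ
    d≤1 = ≤-by x 0≤x (solve 1 (λ x → con 1ℚ := con 1ℚ :- x :+ x) refl x)
    0≤u : 0ℚ ≤ u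
    0≤u = ^-nonneg (tri m) (<⇒≤ 0<ω)
    0≤D : 0ℚ ≤ D
    0≤D = ^-nonneg i 0≤d
    0≤W : 0ℚ ≤ W
    0≤W = *-nonneg 0≤M (*-nonneg 0≤u 0≤D)
    μ = β * W
    tri-m≤ : tri m ℕ.≤ tri (orderBound k)
    tri-m≤ = tri-mono (ℕ.≤-trans m≤n n≤)
    -- The mode contributes 1/4; replacing powers of q² by powers of ω costs a factor 2.
    ⅛≤μ : ½ * (½ * ½) ≤ μ
    ⅛≤μ = ≤-trans (*-monoˡ-≤ (<⇒≤ 0<½) (binomial-mode n m i m+i≡n 0<x x≤½ (ℕ.s≤s ℕ.z≤n) 2m≤n below above))
      (≤-trans (≤-reflexive (solve 4 (λ m b y z → con ½ :* (m :* (b :* (y :* z))) := b :* (m :* (con ½ :* y :* z))) refl M β (x ^ m) D))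
        (*-monoˡ-≤ (B-nonneg n m) (*-monoˡ-≤ 0≤M (*-monoʳ-≤ 0≤D (≤-trans (*-monoˡ-≤ (<⇒≤ 0<½) (≤-trans (≤-reflexive (sym (q^tri q k))) (Close.q≤ω close (tri m) tri-m≤)))
          (≤-reflexive (solve 1 (λ u → con ½ :* ((con 1ℚ :+ con 1ℚ) :* u) := u) refl u)))))))
    ω⁻ : ℕ → ℚ
    ω⁻ j = inv ω ^ tri j
    0≤ω⁻ : ∀ j → 0ℚ ≤ ω⁻ j
    0≤ω⁻ j = ^-nonneg (tri j) (inv-nonneg 0<ω)
    cliques : ∀ K L → size K ≡ m → size L ≡ m → graphE w {n} (λ G → 𝟙 (clique c K G) * 𝟙 (clique c L G)) ≡ u * u * ω⁻ (size (K ∩ L))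
    cliques K L eK eL = trans (sym (*-identityʳ _)) (trans (cong (E *_) (sym (^-inv (tri (size (K ∩ L))) 0<ω)))
      (trans (sym (*-assoc _ _ _)) (cong (_* ω⁻ (size (K ∩ L))) (trans (graphE-clique² dst c K L) (cong₂ (λ a b → ω ^ tri a * ω ^ tri b) eK eL)))))
      where
      E = graphE w (λ G → 𝟙 (clique c K G) * 𝟙 (clique c L G))
    N≥ : ∀ K L → size K ≡ m → size L ≡ m → i ℕ.≤ m ℕ.+ co-size {n} (K ∪ L)
    N≥ K L eK eL = ℕ.+-cancelˡ-≤ m _ _ (ℕ.≤-trans (ℕ.≤-reflexive (trans m+i≡n (sym (size+co-size (K ∪ L)))))
      (ℕ.≤-trans (ℕ.+-monoˡ-≤ (co-size (K ∪ L)) (subst (size (K ∪ L) ℕ.≤_) (trans (size-∪+∩ K L) (cong₂ ℕ._+_ eK eL)) (ℕ.m≤m+n _ _))) (ℕ.≤-reflexive (ℕ.+-assoc m m _))))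
    pair-size : ∀ b (K : Vec Bool n) → size K ≡ m → lookup K b ≡ true → size (remove b K) ≡ k
    pair-size b K e l = ℕ.suc-injective (trans (size-remove b K l) e)
    -- The probability that two given k-sets whose union has that many elements both dominate an
    -- outside vertex.
    z : ℕ → ℚ
    z a = 1ℚ - x - x + q ^ a
    0≤z : ∀ a → 0ℚ ≤ z a
    0≤z a = +-nonneg (≤-trans (+-nonneg (≤⇒0≤ x≤½) (≤⇒0≤ x≤½)) (≤-reflexive (solve 1 (λ x → con ½ :- x :+ (con ½ :- x) := con 1ℚ :- x :- x) refl x))) (^-nonneg a 0≤q)
    joint : ∀ K L b b′ → size K ≡ m → size L ≡ m → lookup K b ≡ true → lookup L b′ ≡ true →
      graphE w {n} (λ G → dominates c (remove b K) K G * dominates c (remove b′ L) L G) ≤ u * u * ω⁻ (size (K ∩ L)) * z (size (remove b K ∪ remove b′ L)) ^ co-size (K ∪ L)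
    joint K L b b′ eK eL b∈ b′∈ = ≤-trans (graphE-dominates² dst c (remove-⊑ b K) (remove-⊑ b′ L))
      (≤-reflexive (cong₂ _*_ (cliques K L eK eL) (cong (_^ co-size (K ∪ L)) (cong₂ (λ a a′ → 1ℚ - q ^ a - q ^ a′ + q ^ size (remove b K ∪ remove b′ L)) (pair-size b K eK b∈) (pair-size b′ L eL b′∈)))))
    z≤d : ∀ {a} → k ℕ.≤ a → z a ≤ d
    z≤d {a} l = ≤-by (x - q ^ a) (≤⇒0≤ (^-antitone 0≤q q≤1 l)) (solve 2 (λ x y → con 1ℚ :- x := con 1ℚ :- x :- x :+ y :+ (x :- y)) refl x (q ^ a))
    k≤∪ : ∀ K L b b′ → size K ≡ m → lookup K b ≡ true → k ℕ.≤ size (remove b K ∪ remove b′ L)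
    k≤∪ K L b b′ eK b∈ = subst (ℕ._≤ size (remove b K ∪ remove b′ L)) (pair-size b K eK b∈) (size-mono (⊑-∪ˡ (remove b K) (remove b′ L)))
    ¾ : ℚ
    ¾ = frac 3 4
    0<¾ : 0ℚ < ¾
    0<¾ = ℚ.positive⁻¹ ¾
    -- The members of K ∪ L bring no factor, so only N ≥ i - m factors are available instead of i;
    -- the missing ones amount to aᵐ, and Bernoulli's inequality gives aᵐ ≥ 1 - 2ζ ≥ 3/4.
    shrink : ∀ {a e} N → 0ℚ ≤ a → a ≤ 1ℚ → i ℕ.≤ m ℕ.+ N → e ≤ ζ → M * (1ℚ - a) ≤ e + e → a ^ N * ¾ ≤ a ^ i
    shrink {a} {e} N 0≤a a≤1 l e≤ h = ≤-trans (*-monoˡ-≤ (^-nonneg N 0≤a) (≤-trans (≤-trans (toWitness {a? = ¾ ℚ.≤? 1ℚ ℚ.- (ζ ℚ.+ ζ)} _) (≤-reflexive (trans (cong (1ℚ ℚ.+_) (trans (cong ℚ.-_ (sym (+≡ ζ ζ))) (sym (-≡ _)))) (sym (+≡ 1ℚ _)))))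
        (≤-trans (complement-anti (≤-trans h (+-mono-≤ e≤ e≤))) (≤-trans (bernoulli⁻ m (≤⇒0≤ a≤1) (≤-by a 0≤a (solve 1 (λ a → con 1ℚ := con 1ℚ :- a :+ a) refl a))) (≤-reflexive (cong (_^ m) (solve 1 (λ a → con 1ℚ :- (con 1ℚ :- a) := a) refl a)))))))
      (≤-trans (≤-reflexive (trans (*-comm _ _) (sym (^-+ a m N)))) (^-antitone 0≤a a≤1 l))
    d-shrink : ∀ N → i ℕ.≤ m ℕ.+ N → d ^ N ≤ 2ℚ * D
    d-shrink N l = *-cancelʳ-≤ 0<¾ (≤-trans (shrink {e = ζ} N 0≤d d≤1 l ≤-refl (≤-trans (≤-reflexive (solve 2 (λ m x → m :* (con 1ℚ :- (con 1ℚ :- x)) := m :* x) refl M x)) (≤-trans Mx≤ζ (≤-+ʳ (ℚ.nonNegative⁻¹ ζ)))))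
      (≤-by (½ * D) (*-nonneg (<⇒≤ 0<½) 0≤D) (solve 1 (λ D → (con 1ℚ :+ con 1ℚ) :* D :* con (frac 3 4) := D :+ con ½ :* D) refl D)))
    far : ∀ K L b b′ → size K ≡ m → size L ≡ m → lookup K b ≡ true → lookup L b′ ≡ true →
      graphE w {n} (λ G → dominates c (remove b K) K G * dominates c (remove b′ L) L G) ≤ u * u * ω⁻ (size (K ∩ L)) * (2ℚ * D)
    far K L b b′ eK eL b∈ b′∈ = ≤-trans (joint K L b b′ eK eL b∈ b′∈) (*-monoˡ-≤ (*-nonneg (*-nonneg 0≤u 0≤u) (0≤ω⁻ (size (K ∩ L))))
      (≤-trans (^-mono (co-size (K ∪ L)) (0≤z (size (remove b K ∪ remove b′ L))) (z≤d (k≤∪ K L b b′ eK b∈))) (d-shrink (co-size (K ∪ L)) (N≥ K L eK eL))))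
    v : ℚ
    v = 4F * (x * s)
    0≤v : 0ℚ ≤ v
    0≤v = *-nonneg (ℚ.nonNegative⁻¹ 4F) (*-nonneg 0≤x 0≤s)
    -- The correlation qᵏ⁺ʰ is absorbed by 1 + v with v = 4qᵏqʰ. Since nqᵏ ≤ m, the quantity nv is
    -- at most 4mqʰ, so powers of 1 + v up to the n-th stay bounded.
    z-near : ∀ {a} → k ℕ.+ h ℕ.≤ a → z a ≤ d * d * (1ℚ + v)
    z-near {a} l = ≤-trans (+-monoˡ-≤ (1ℚ - x - x) (≤-trans (^-antitone 0≤q q≤1 l) (≤-reflexive (^-+ q k h))))
      (≤-by (x * x + x * s * ((½ - x + (½ - x)) * (1ℚ + d + d))) (+-nonneg (square-nonneg x) (*-nonneg (*-nonneg 0≤x 0≤s) (*-nonneg (+-nonneg (≤⇒0≤ x≤½) (≤⇒0≤ x≤½)) (+-nonneg (+-nonneg 0≤1 0≤d) 0≤d))))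
        (solve 2 (λ x s → (con 1ℚ :- x) :* (con 1ℚ :- x) :* (con 1ℚ :+ con (frac 4 1) :* (x :* s))
          := con 1ℚ :- x :- x :+ x :* s :+ (x :* x :+ x :* s :* ((con ½ :- x :+ (con ½ :- x)) :* (con 1ℚ :+ (con 1ℚ :- x) :+ (con 1ℚ :- x))))) refl x s))
    near-power : ∀ {a} N → k ℕ.+ h ℕ.≤ a → i ℕ.≤ m ℕ.+ N → N ℕ.≤ n → z a ^ N ≤ 2ℚ * (D * D)
    near-power {a} N l N≥ N≤n = *-cancelʳ-≤ (*-pos 0<¾ 0<¾) (≤-trans (*-monoʳ-≤ (<⇒≤ (*-pos 0<¾ 0<¾)) (≤-trans (^-mono N (0≤z a) (z-near l)) (≤-reflexive (*-^ (d * d) (1ℚ + v) N))))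
      (≤-trans (≤-reflexive (solve 4 (λ a b t t′ → a :* b :* (t :* t′) := a :* t :* (b :* t′)) refl ((d * d) ^ N) ((1ℚ + v) ^ N) ¾ ¾))
        (≤-trans (*-mono-≤ (*-nonneg (^-nonneg N (square-nonneg d)) (<⇒≤ 0<¾)) (≤-trans (shrink {e = ζ} N (square-nonneg d) (≤-trans (*-mono-≤ 0≤d d≤1 0≤d d≤1) (≤-reflexive (*-identityˡ 1ℚ))) N≥ ≤-refl dd) (≤-reflexive (*-^ d d i)))
            (*-nonneg (^-nonneg N (+-nonneg 0≤1 0≤v)) (<⇒≤ 0<¾)) vv)
          (≤-by (frac 1 8 * (D * D)) (*-nonneg (ℚ.nonNegative⁻¹ (frac 1 8)) (square-nonneg D)) (solve 1 (λ D → (con 1ℚ :+ con 1ℚ) :* (D :* D) :* (con (frac 3 4) :* con (frac 3 4)) := D :* D :* con 1ℚ :+ con (frac 1 8) :* (D :* D)) refl D)))))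
      where
      dd : M * (1ℚ - d * d) ≤ ζ + ζ
      dd = ≤-trans (≤-by (M * (x * x)) (*-nonneg 0≤M (square-nonneg x)) (solve 2 (λ m x → m :* x :+ m :* x := m :* (con 1ℚ :- (con 1ℚ :- x) :* (con 1ℚ :- x)) :+ m :* (x :* x)) refl M x)) (+-mono-≤ Mx≤ζ Mx≤ζ)
      vv : (1ℚ + v) ^ N * ¾ ≤ 1ℚ
      vv = ≤-trans (*-monoˡ-≤ (^-nonneg N (+-nonneg 0≤1 0≤v)) (≤-trans (≤-reflexive (solve 0 (con (frac 3 4) := con 1ℚ :- con (frac 1 4)) refl)) (complement-anti
          (≤-trans (*-monoʳ-≤ 0≤v (ι-mono N≤n)) (≤-trans (≤-reflexive (solve 4 (λ n f x s → n :* (f :* (x :* s)) := f :* (n :* x :* s)) refl (ι n) 4F x s))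
            (≤-trans (*-monoˡ-≤ (ℚ.nonNegative⁻¹ 4F) (≤-trans (*-monoʳ-≤ 0≤s below) Ms≤ζ)) (≤-trans (≤-reflexive (solve 0 (con (frac 4 1) :* con (frac 1 64) := con (frac 1 16)) refl)) (toWitness {a? = frac 1 16 ℚ.≤? frac 1 4} _))))))))
        ([1+u]^n*[1-nu]≤1 N 0≤v)
    near : ∀ K L b b′ → size K ≡ m → size L ≡ m → size (K ∩ L) ℕ.≤ h → lookup K b ≡ true → lookup L b′ ≡ true →
      graphE w {n} (λ G → dominates c (remove b K) K G * dominates c (remove b′ L) L G) ≤ u * u * ω⁻ (size (K ∩ L)) * (2ℚ * (D * D))
    near K L b b′ eK eL j≤h b∈ b′∈ = ≤-trans (joint K L b b′ eK eL b∈ b′∈) (*-monoˡ-≤ (*-nonneg (*-nonneg 0≤u 0≤u) (0≤ω⁻ (size (K ∩ L))))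
      (near-power (co-size (K ∪ L)) large (N≥ K L eK eL) (subst (co-size (K ∪ L) ℕ.≤_) (size+co-size (K ∪ L)) (ℕ.m≤n+m _ _))))
      where
      A = remove b K
      A′ = remove b′ L
      large : k ℕ.+ h ℕ.≤ size (A ∪ A′)
      large = ℕ.+-cancelʳ-≤ h _ _ (ℕ.≤-trans (ℕ.≤-trans (ℕ.≤-reflexive (ℕ.+-assoc k h h)) (ℕ.+-monoʳ-≤ k 2h≤k))
        (ℕ.≤-trans (ℕ.≤-reflexive (sym (trans (size-∪+∩ A A′) (cong₂ ℕ._+_ (pair-size b K eK b∈) (pair-size b′ L eL b′∈)))))
          (ℕ.+-monoʳ-≤ (size (A ∪ A′)) (ℕ.≤-trans (size-mono (∩-mono (remove-⊑ b K) (remove-⊑ b′ L))) j≤h))))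
    12F : ℚ
    12F = frac 12 1
    -- Equal roots contribute uD. For distinct roots the union of the two k-sets is K, hence z ≤ d(1
    -- - ωx); the factor (1 - ωx)ⁱ decays exponentially in m and compensates for the m choices of a
    -- second root.
    diagonal : ∀ K → size K ≡ m → graphE w {n} (λ G → rooted c K G * rooted c K G) ≤ 12F * W
    diagonal K eK = ≤-trans (≤-reflexive (graphE-rooted² w c K K)) (≤-trans (∑-mono n (λ b → 𝟙*-mono (lookup K b) (λ b∈ → row b b∈)))
      (≤-trans (≤-reflexive (trans (∑-member K (u * D + M * (u * (D * y)))) (cong (λ k → ι k * (u * D + M * (u * (D * y)))) eK)))
        (≤-trans (≤-reflexive (solve 4 (λ m u d y → m :* (u :* d :+ m :* (u :* (d :* y))) := (con 1ℚ :+ m :* y) :* (m :* (u :* d))) refl M u D y))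
          (*-monoʳ-≤ 0≤W (≤-trans (+-monoˡ-≤ 1ℚ My≤) (≤-reflexive (solve 0 (con 1ℚ :+ con (frac 11 1) := con (frac 12 1)) refl)))))))
      where
      y : ℚ
      y = (1ℚ - ω * x) ^ i
      ωx≤1 : ω * x ≤ 1ℚ
      ωx≤1 = ≤-trans (*-mono-≤ (nonneg c) (≤1 c) 0≤x x≤1) (≤-reflexive (*-identityˡ 1ℚ))
      0≤ωx : 0ℚ ≤ ω * x
      0≤ωx = *-nonneg (nonneg c) 0≤x
      0≤y : 0ℚ ≤ y
      0≤y = ^-nonneg i (≤⇒0≤ ωx≤1)
      ιi : ι i ≡ ν
      ιi = trans (solve 2 (λ m i → i := m :+ i :- m) refl M (ι i)) (cong (_- M) (trans (sym (ι-+ m i)) (cong ι m+i≡n)))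
      My≤ : M * y ≤ frac 11 1
      My≤ = *-cancelʳ-≤ (ℚ.positive⁻¹ (frac 3 16)) (≤-trans (≤-reflexive (solve 2 (λ m y → m :* y :* con (frac 3 16) := y :* (con (frac 3 8) :* (con ½ :* m))) refl M y))
        (≤-trans (*-monoˡ-≤ 0≤y (≤-trans (*-mono-≤ (ℚ.nonNegative⁻¹ (frac 3 8)) ω≥ (*-nonneg (<⇒≤ 0<½) 0≤M) νx) (≤-trans (≤-reflexive (trans (solve 3 (λ o v x → o :* (v :* x) := v :* (o :* x)) refl ω ν x) (cong (_* (ω * x)) (sym ιi)))) (≤-+ˡ 0≤1))))
          (≤-trans ([1-u]^n*[1+nu]≤1 i 0≤ωx ωx≤1) (≤-trans (toWitness {a? = 1ℚ ℚ.≤? frac 33 16} _) (≤-reflexive (solve 0 (con (frac 33 16) := con (frac 11 1) :* con (frac 3 16)) refl))))))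
      u≡ : u * u * ω⁻ (size (K ∩ K)) ≡ u
      u≡ = trans (cong (λ S → u * u * ω⁻ (size S)) (∩-idem K)) (trans (cong (λ k → u * u * ω⁻ k) eK) (trans (*-assoc _ _ _) (trans (cong (u *_) (^-inv (tri m) 0<ω)) (*-identityʳ u))))
      same-set : ∀ b b′ → lookup K b ≡ true → lookup K b′ ≡ true → ∀ {t} → z (size (remove b K ∪ remove b′ K)) ≤ t →
        graphE w {n} (λ G → dominates c (remove b K) K G * dominates c (remove b′ K) K G) ≤ u * t ^ i
      same-set b b′ b∈ b′∈ {t} z≤ = ≤-trans (joint K K b b′ eK eK b∈ b′∈) (≤-trans (≤-reflexive (cong₂ (λ a e → a * z (size (remove b K ∪ remove b′ K)) ^ e) u≡ (trans (cong co-size (∪-idem K)) (co-size≡ K eK m+i≡n))))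
        (*-monoˡ-≤ 0≤u (^-mono i (0≤z (size (remove b K ∪ remove b′ K))) z≤)))
      entry : ∀ b b′ → lookup K b ≡ true → lookup K b′ ≡ true → (e : Dec (b ≡ b′)) →
        graphE w {n} (λ G → dominates c (remove b K) K G * dominates c (remove b′ K) K G) ≤ (if does e then u * D else 0ℚ) + u * (D * y)
      entry b b′ b∈ b′∈ (yes _) = ≤-trans (same-set b b′ b∈ b′∈ (z≤d (k≤∪ K K b b′ eK b∈))) (≤-+ʳ (*-nonneg 0≤u (*-nonneg 0≤D 0≤y)))
      entry b b′ b∈ b′∈ (no b≢b′) = ≤-trans (same-set b b′ b∈ b′∈ {d * (1ℚ - ω * x)} (≤-trans (+-monoˡ-≤ (1ℚ - x - x) (^-antitone 0≤q q≤1 (subst (ℕ._≤ size (remove b K ∪ remove b′ K)) eK (size-mono (K⊑removals b b′ K b≢b′)))))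
          (≤-by (ω * (x * x)) (*-nonneg (nonneg c) (square-nonneg x)) (trans (solve 2 (λ o x → (con 1ℚ :- x) :* (con 1ℚ :- o :* x) := con 1ℚ :- x :- x :+ (con 1ℚ :- o) :* x :+ o :* (x :* x)) refl ω x)
            (cong (λ t → 1ℚ - x - x + t * x + ω * (x * x)) (trans (cong (_- ω) (sym ω+q)) (solve 2 (λ o q → o :+ q :- o := q) refl ω q)))))))
        (≤-trans (≤-reflexive (cong (u *_) (*-^ d (1ℚ - ω * x) i))) (≤-+ˡ ≤-refl))
      row : ∀ b → lookup K b ≡ true → ∑ n (λ b′ → 𝟙 (lookup K b′) * graphE w (λ G → dominates c (remove b K) K G * dominates c (remove b′ K) K G)) ≤ u * D + M * (u * (D * y))
      row b b∈ = ≤-trans (∑-mono n (λ b′ → cell b′ (lookup K b′) refl)) (≤-reflexive (trans (∑-+ n _ _) (cong₂ _+_ (∑-delta b (u * D)) (trans (∑-member K (u * (D * y))) (cong (λ k → ι k * (u * (D * y))) eK)))))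
        where
        ∑-+ : ∀ n (f g : Fin n → ℚ) → ∑ n (λ i → f i + g i) ≡ ∑ n f + ∑ n g
        ∑-+ zero f g = sym (+-identityˡ 0ℚ)
        ∑-+ (suc n) f g = trans (cong (f zero + g zero +_) (∑-+ n (f ∘ suc) (g ∘ suc))) (solve 4 (λ a b c d → a :+ b :+ (c :+ d) := a :+ c :+ (b :+ d)) refl (f zero) (g zero) (∑ n (f ∘ suc)) (∑ n (g ∘ suc)))
        delta≥0 : ∀ {b′} (e : Dec (b ≡ b′)) → 0ℚ ≤ (if does e then u * D else 0ℚ)
        delta≥0 (yes _) = *-nonneg 0≤u 0≤D
        delta≥0 (no _) = ≤-refl
        cell : ∀ b′ t → lookup K b′ ≡ t → 𝟙 t * graphE w (λ G → dominates c (remove b K) K G * dominates c (remove b′ K) K G) ≤ (if does (b Fin.≟ b′) then u * D else 0ℚ) + 𝟙 t * (u * (D * y))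
        cell b′ true e = ≤-trans (≤-reflexive (*-identityˡ _)) (≤-trans (entry b b′ b∈ e (b Fin.≟ b′)) (≤-reflexive (cong ((if does (b Fin.≟ b′) then u * D else 0ℚ) +_) (sym (*-identityˡ _)))))
        cell b′ false e = ≤-trans (≤-reflexive (zeroˡ _)) (+-nonneg (delta≥0 (b Fin.≟ b′)) (≤-reflexive (sym (zeroˡ _))))
    bound : ∀ j → Dec (j ℕ.≤ h) → Dec (j ℕ.< m) → ℚ
    bound j (yes _) _ = M * (M * (u * u * ω⁻ j * (2ℚ * (D * D))))
    bound j (no _) (yes _) = M * (M * (u * u * ω⁻ j * (2ℚ * D)))
    bound j (no _) (no _) = 12F * W
    g : ℕ → ℚ
    g j = bound j (j ℕ.≤? h) (j ℕ.<? m)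
    pair≤ : ∀ K L → size K ≡ m → size L ≡ m → graphE w {n} (λ G → rooted c K G * rooted c L G) ≤ g (size (K ∩ L))
    pair≤ K L eK eL = cases (size (K ∩ L) ℕ.≤? h) (size (K ∩ L) ℕ.<? m)
      where
      cases : (p : Dec (size (K ∩ L) ℕ.≤ h)) (p′ : Dec (size (K ∩ L) ℕ.< m)) → graphE w (λ G → rooted c K G * rooted c L G) ≤ bound (size (K ∩ L)) p p′
      cases (yes j≤h) _ = graphE-rooted²≤ c K L eK eL (λ b b′ → near K L b b′ eK eL j≤h)
      cases (no _) (yes _) = graphE-rooted²≤ c K L eK eL (λ b b′ → far K L b b′ eK eL)
      cases (no _) (no j≮m) = subst (λ L → graphE w (λ G → rooted c K G * rooted c L G) ≤ 12F * W)
        (size-∩⇒≡ K L (ℕ.≤-trans (ℕ.≤-reflexive eK) (ℕ.≮⇒≥ j≮m)) (ℕ.≤-trans (ℕ.≤-reflexive eL) (ℕ.≮⇒≥ j≮m))) (diagonal K eK)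
    τ : ℚ
    τ = 2ℚ * inv q ^ h
    0≤q⁻ = inv-nonneg 0<q
    0≤τ : 0ℚ ≤ τ
    0≤τ = *-nonneg 0≤2 (^-nonneg h 0≤q⁻)
    1≤q⁻ : 1ℚ ≤ inv q
    1≤q⁻ = subst (1ℚ ≤_) (*-identityˡ _) (*≤⇒≤*inv 0<q (≤-trans (≤-reflexive (*-identityˡ q)) q≤1))
    -- Twice `tri j` is j(j - 1) ≤ jh, and the factor 2 from comparing ω with q² fits into 2ʲ once j
    -- ≥ 1.
    ω⁻≤ : ∀ j → j ℕ.≤ h → ω⁻ j ≤ τ ^ j
    ω⁻≤ zero _ = ≤-refl
    ω⁻≤ (suc j) j≤h = ≤-trans step₁ (≤-trans (*-mono-≤ 0≤2 2≤ (^-nonneg (tri (suc j)) (*-nonneg 0≤q⁻ 0≤q⁻)) step₂) (≤-reflexive (sym (*-^ 2ℚ (inv q ^ h) (suc j)))))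
      where
      t = tri (suc j)
      2≤ : 2ℚ ≤ 2ℚ ^ suc j
      2≤ = ≤-trans (≤-reflexive (sym (*-identityʳ 2ℚ))) (*-monoˡ-≤ 0≤2 (1≤^ j (≤-+ʳ 0≤1)))
      qq⁻ : (q * q) ^ t * (inv q * inv q) ^ t ≡ 1ℚ
      qq⁻ = trans (sym (*-^ (q * q) (inv q * inv q) t)) (trans (cong (_^ t) (trans (solve 2 (λ q i → q :* q :* (i :* i) := q :* i :* (q :* i)) refl q (inv q)) (trans (cong₂ _*_ (*-inv 0<q) (*-inv 0<q)) (*-identityˡ 1ℚ)))) (1^ t))
      step₁ : ω⁻ (suc j) ≤ 2ℚ * (inv q * inv q) ^ t
      step₁ = ≤-trans (≤-reflexive (trans (sym (*-identityʳ _)) (cong (ω⁻ (suc j) *_) (sym qq⁻))))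
        (≤-trans (*-monoˡ-≤ (0≤ω⁻ (suc j)) (*-monoʳ-≤ (^-nonneg t (*-nonneg 0≤q⁻ 0≤q⁻)) (Close.q≤ω close t (ℕ.≤-trans (tri-mono (ℕ.≤-trans j≤h (ℕ.≤-trans h≤k (ℕ.n≤1+n k)))) tri-m≤))))
          (≤-reflexive (trans (solve 4 (λ a t w i → a :* (t :* w :* i) := t :* (w :* a) :* i) refl (ω⁻ (suc j)) 2ℚ (ω ^ t) ((inv q * inv q) ^ t)) (cong (λ e → 2ℚ * e * (inv q * inv q) ^ t) (^-inv t 0<ω)) ⨾ cong (_* (inv q * inv q) ^ t) (*-identityʳ 2ℚ))))
        where
        _⨾_ : ∀ {a b c : ℚ} → a ≡ b → b ≡ c → a ≡ c
        _⨾_ = trans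
      step₂ : (inv q * inv q) ^ t ≤ (inv q ^ h) ^ suc j
      step₂ = ≤-trans (≤-reflexive (trans (*-^ (inv q) (inv q) t) (sym (^-+ (inv q) t t)))) (≤-trans (^-monotone 1≤q⁻ 2t≤) (≤-reflexive (^-* (inv q) (suc j) h)))
        where
        2t≤ : t ℕ.+ t ℕ.≤ suc j ℕ.* h
        2t≤ = ℕ.+-cancelʳ-≤ (suc j) _ _ (ℕ.≤-trans (ℕ.≤-reflexive (tri-double (suc j))) (ℕ.≤-trans (ℕ.*-monoʳ-≤ (suc j) (ℕ.≤-trans j≤h (ℕ.n≤1+n h))) (ℕ.≤-reflexive (trans (ℕ.*-suc (suc j) h) (ℕ.+-comm (suc j) _)))))
    τ-small : M * M * τ ≤ ½ * ν
    τ-small = *-cancelʳ-≤ 0<x (≤-trans (≤-reflexive (solve 4 (λ m t i x → m :* m :* (t :* i) :* x := t :* (m :* m :* (i :* x))) refl M 2ℚ (inv q ^ h) x))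
      (≤-trans (*-monoˡ-≤ 0≤2 (≤-trans (*-monoˡ-≤ (*-nonneg 0≤M 0≤M) q⁻x) M²s≤ζ))
        (≤-trans (≤-trans (≤-reflexive (solve 0 ((con 1ℚ :+ con 1ℚ) :* con (frac 1 64) := con (frac 1 32)) refl)) (≤-trans (toWitness {a? = frac 1 32 ℚ.≤? frac 1 4} _) (≤-reflexive (solve 0 (con (frac 1 4) := con ½ :* (con ½ :* con 1ℚ)) refl))))
          (≤-trans (*-monoˡ-≤ (<⇒≤ 0<½) (≤-trans (*-monoˡ-≤ (<⇒≤ 0<½) 1≤M) νx)) (≤-reflexive (sym (*-assoc _ _ _)))))))
      where
      q⁻x : inv q ^ h * x ≤ s
      q⁻x = ≤-trans (*-monoˡ-≤ (^-nonneg h 0≤q⁻) (≤-trans (^-antitone 0≤q q≤1 2h≤k) (≤-reflexive (^-+ q h h))))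
        (≤-reflexive (trans (sym (*-assoc _ _ _)) (trans (cong (_* s) (trans (*-comm _ _) (^-inv h 0<q))) (*-identityˡ s))))
    term : ∀ b → b ℕ.≤ n → ∀ j l → j ℕ.+ l ≡ m → B m j * B b l * g j ≤ 2ℚ * (W * W) * β * ½ ^ j + 12F * W * ½ ^ l
    term b b≤n j l eq = cases (j ℕ.≤? h) (j ℕ.<? m)
      where
      first≥0 : 0ℚ ≤ 2ℚ * (W * W) * β * ½ ^ j
      first≥0 = *-nonneg (*-nonneg (*-nonneg 0≤2 (square-nonneg W)) (B-nonneg n m)) (^-nonneg j (<⇒≤ 0<½))
      second≥0 : 0ℚ ≤ 12F * W * ½ ^ l
      second≥0 = *-nonneg (*-nonneg (ℚ.nonNegative⁻¹ 12F) 0≤W) (^-nonneg l (<⇒≤ 0<½))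
      -- With l = m - j > 0 there are at most (mn)ˡ sets L, each adding e = tri l + jl edges, where
      -- 2e = l(j + k). Hence the added weight is at most 2(qʰqᵏ)ˡ, and nqᵏ ≤ m turns the product
      -- into a power of m²qʰ ≤ 1/2, up to factors bounded through m³qʰ.
      far-term : ∀ l → j ℕ.+ l ≡ m → j ℕ.< m → h ℕ.≤ j → B m j * B b l * (M * (M * (u * u * ω⁻ j * (2ℚ * D)))) ≤ 12F * W * ½ ^ l
      far-term zero eq j<m _ = contradiction (trans (sym (ℕ.+-identityʳ j)) eq) (ℕ.<⇒≢ j<m)
      far-term (suc l) eq j<m h≤j = ≤-trans (≤-reflexive (solve 7 (λ a b m u o t d → a :* b :* (m :* (m :* (u :* u :* o :* (t :* d)))) := m :* (u :* d) :* (t :* m) :* (a :* b :* (u :* o))) refl (B m j) (B b (suc l)) M u (ω⁻ j) 2ℚ D))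
        (≤-trans (*-monoˡ-≤ (*-nonneg 0≤W (*-nonneg 0≤2 0≤M)) (*-mono-≤ (*-nonneg (B-nonneg m j) (B-nonneg b (suc l))) (*-mono-≤ (B-nonneg m j) (B≤^′ m j (suc l) eq) (B-nonneg b (suc l)) (≤-trans (B-monoˡ (suc l) b≤n) (B≤^ n (suc l))))
            (*-nonneg 0≤u (0≤ω⁻ j)) u-bound))
          (≤-trans (≤-reflexive (trans (cong (λ t → W * (2ℚ * M) * t) (trans (solve 4 (λ a b t e → a :* b :* (t :* e) := t :* (a :* b :* e)) refl (M ^ suc l) (ι n ^ suc l) 2ℚ ((s * x) ^ suc l)) (cong (2ℚ *_) (trans (cong (_* (s * x) ^ suc l) (sym (*-^ M (ι n) (suc l)))) (sym (*-^ (M * ι n) (s * x) (suc l))))))) refl))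
            (≤-trans (*-monoˡ-≤ (*-nonneg 0≤W (*-nonneg 0≤2 0≤M)) (*-monoˡ-≤ 0≤2 (^-mono (suc l) (*-nonneg (*-nonneg 0≤M (ι-nonneg n)) (*-nonneg 0≤s 0≤x))
                (≤-trans (≤-reflexive (solve 4 (λ m n s x → m :* n :* (s :* x) := m :* (n :* x) :* s) refl M (ι n) s x)) (*-monoʳ-≤ 0≤s (*-monoˡ-≤ 0≤M below))))))
              (≤-trans (≤-reflexive (solve 5 (λ w t m s e → w :* (t :* m) :* (t :* (m :* m :* s :* e)) := w :* (t :* t :* (m :* (m :* m) :* s)) :* e) refl W 2ℚ M s ((M * M * s) ^ l)))
                (≤-trans (*-mono-≤ (*-nonneg 0≤W (*-nonneg (*-nonneg 0≤2 0≤2) (*-nonneg (*-nonneg 0≤M (*-nonneg 0≤M 0≤M)) 0≤s))) (*-monoˡ-≤ 0≤W (≤-trans (*-monoˡ-≤ (*-nonneg 0≤2 0≤2) M³s≤ζ) small))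
                    (^-nonneg l (*-nonneg (*-nonneg 0≤M 0≤M) 0≤s)) (^-mono l (*-nonneg (*-nonneg 0≤M 0≤M) 0≤s) (≤-trans M²s≤ζ ζ≤½)))
                  (≤-trans (≤-reflexive (*-assoc _ _ _)) (≤-trans (≤-by (frac 11 1 * (W * (½ * ½ ^ l))) (*-nonneg (ℚ.nonNegative⁻¹ (frac 11 1)) (*-nonneg 0≤W (*-nonneg (<⇒≤ 0<½) (^-nonneg l (<⇒≤ 0<½)))))
                    (solve 2 (λ w e → con (frac 12 1) :* w :* e := w :* e :+ con (frac 11 1) :* (w :* e)) refl W (½ * ½ ^ l))) ≤-refl)))))))
        where
        small : 2ℚ * 2ℚ * ζ ≤ ½
        small = ≤-trans (≤-reflexive (solve 0 ((con 1ℚ :+ con 1ℚ) :* (con 1ℚ :+ con 1ℚ) :* con (frac 1 64) := con (frac 1 16)) refl)) (toWitness {a? = frac 1 16 ℚ.≤? ½} _)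
        e = tri (suc l) ℕ.+ j ℕ.* suc l
        u≡ : u * ω⁻ j ≡ ω ^ e
        u≡ = trans (cong (_* ω⁻ j) (trans (cong (λ a → ω ^ tri a) (sym eq)) (trans (cong (ω ^_) (tri-+ j (suc l))) (^-+ ω (tri j) e))))
          (trans (solve 3 (λ a b c → a :* b :* c := b :* (a :* c)) refl (ω ^ tri j) (ω ^ e) (ω⁻ j)) (trans (cong (ω ^ e *_) (^-inv (tri j) 0<ω)) (*-identityʳ _)))
        e≤ : e ℕ.≤ tri m
        e≤ = ℕ.≤-trans (ℕ.m≤n+m e (tri j)) (ℕ.≤-reflexive (trans (sym (tri-+ j (suc l))) (cong tri eq)))
        2e : e ℕ.+ e ≡ suc l ℕ.* (j ℕ.+ k)
        2e = ℕ.+-cancelʳ-≡ (suc l) _ _ (trans (arrange (tri (suc l)) j (suc l)) (trans (cong (λ a → a ℕ.+ (j ℕ.* suc l ℕ.+ j ℕ.* suc l)) (tri-double (suc l)))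
            (trans (arrange′ j (suc l)) (trans (cong (λ a → suc l ℕ.* (j ℕ.+ a)) eq) (arrange″ (suc l) j k)))))
          where
          arrange : ∀ t j l → t ℕ.+ j ℕ.* l ℕ.+ (t ℕ.+ j ℕ.* l) ℕ.+ l ≡ t ℕ.+ t ℕ.+ l ℕ.+ (j ℕ.* l ℕ.+ j ℕ.* l)
          arrange = solveℕ 3 (λ t j l → t ⊹ j ⊛ l ⊹ (t ⊹ j ⊛ l) ⊹ l ≋ t ⊹ t ⊹ l ⊹ (j ⊛ l ⊹ j ⊛ l)) refl
          arrange′ : ∀ j l → l ℕ.* l ℕ.+ (j ℕ.* l ℕ.+ j ℕ.* l) ≡ l ℕ.* (j ℕ.+ (j ℕ.+ l))
          arrange′ = solveℕ 2 (λ j l → l ⊛ l ⊹ (j ⊛ l ⊹ j ⊛ l) ≋ l ⊛ (j ⊹ (j ⊹ l))) refl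
          arrange″ : ∀ l j k → l ℕ.* (j ℕ.+ suc k) ≡ l ℕ.* (j ℕ.+ k) ℕ.+ l
          arrange″ = solveℕ 3 (λ l j k → l ⊛ (j ⊹ (conℕ 1 ⊹ k)) ≋ l ⊛ (j ⊹ k) ⊹ l) refl
        u-bound : u * ω⁻ j ≤ 2ℚ * (s * x) ^ suc l
        u-bound = ≤-trans (≤-reflexive u≡) (≤-trans (Close.ω≤q close e (ℕ.≤-trans e≤ tri-m≤)) (*-monoˡ-≤ 0≤2 (≤-trans
          (≤-reflexive (trans (*-^ q q e) (trans (sym (^-+ q e e)) (trans (cong (q ^_) 2e) (^-* q (suc l) (j ℕ.+ k))))))
          (^-mono (suc l) (^-nonneg (j ℕ.+ k) 0≤q) (≤-trans (≤-reflexive (^-+ q j k)) (*-monoʳ-≤ 0≤x (^-antitone 0≤q q≤1 h≤j)))))))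
      cases : (p : Dec (j ℕ.≤ h)) (p′ : Dec (j ℕ.< m)) → B m j * B b l * bound j p p′ ≤ 2ℚ * (W * W) * β * ½ ^ j + 12F * W * ½ ^ l
      cases (yes j≤h) _ = ≤-trans (≤-reflexive (solve 7 (λ a b m u o t d → a :* b :* (m :* (m :* (u :* u :* o :* (t :* (d :* d))))) := t :* (m :* (u :* d) :* (m :* (u :* d))) :* (a :* b :* o)) refl (B m j) (B b l) M u (ω⁻ j) 2ℚ D))
        (≤-trans (*-monoˡ-≤ (*-nonneg 0≤2 (square-nonneg W)) (overlap-term n m 0<ν ≤-refl 0≤τ (<⇒≤ 0<½) τ-small {b} {j} {l} (ω⁻ j) b≤n eq (0≤ω⁻ j) (ω⁻≤ j j≤h)))
          (≤-trans (≤-reflexive (sym (*-assoc _ _ _))) (≤-+ʳ second≥0)))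
      cases (no j≰h) (yes j<m) = ≤-trans (far-term l eq j<m (ℕ.<⇒≤ (ℕ.≰⇒> j≰h))) (≤-+ˡ first≥0)
      cases (no _) (no j≮m) = ≤-trans (last l eq) (≤-+ˡ first≥0)
        where
        last : ∀ l → j ℕ.+ l ≡ m → B m j * B b l * (12F * W) ≤ 12F * W * ½ ^ l
        last zero eq = ≤-trans (*-monoʳ-≤ (*-nonneg (ℚ.nonNegative⁻¹ 12F) 0≤W) (≤-trans (≤-reflexive (*-identityʳ (B m j))) (B≤^′ m j 0 eq))) (≤-reflexive (*-comm 1ℚ _))
        last (suc l) eq = contradiction (ℕ.≤-trans (ℕ.≤-trans (ℕ.s≤s (ℕ.m≤m+n j l)) (ℕ.≤-reflexive (sym (ℕ.+-suc j l)))) (ℕ.≤-reflexive eq)) j≮m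
    row-sum : ∀ K → size K ≡ m → subs m (λ L → graphE w {n} (λ G → rooted c K G * rooted c L G)) ≤ 4F * (W * W) * β + frac 24 1 * W
    row-sum K eK = ≤-trans (subs-mono m (λ L eL → pair≤ K L eK eL)) (≤-trans (≤-reflexive (subs-∩ K m g)) (≤-trans
      (antidiag-mono m (λ j l eq → subst (λ a → B a j * B (co-size K) l * g j ≤ 2ℚ * (W * W) * β * ½ ^ j + 12F * W * ½ ^ l) (sym eK) (term (co-size K) (subst (co-size K ℕ.≤_) (size+co-size K) (ℕ.m≤n+m _ _)) j l eq)))
      (≤-trans (≤-reflexive (trans (antidiag-+ m (λ j _ → 2ℚ * (W * W) * β * ½ ^ j) (λ _ l → 12F * W * ½ ^ l))
          (cong₂ _+_ (trans (antidiag-*ˡ m (2ℚ * (W * W) * β) (λ j _ → ½ ^ j)) (cong (2ℚ * (W * W) * β *_) (antidiag-first m (½ ^_)))) (trans (antidiag-*ˡ m (12F * W) (λ _ l → ½ ^ l)) (cong (12F * W *_) (antidiag-second m (½ ^_)))))))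
        (≤-trans (+-mono-≤ (*-monoˡ-≤ (*-nonneg (*-nonneg 0≤2 (square-nonneg W)) (B-nonneg n m)) geo) (*-monoˡ-≤ (*-nonneg (ℚ.nonNegative⁻¹ 12F) 0≤W) geo))
          (≤-reflexive (solve 2 (λ w b → (con 1ℚ :+ con 1ℚ) :* (w :* w) :* b :* (con 1ℚ :+ (con ½ :+ con ½)) :+ con (frac 12 1) :* w :* (con 1ℚ :+ (con ½ :+ con ½)) := con (frac 4 1) :* (w :* w) :* b :+ con (frac 24 1) :* w) refl W β))))))
      where
      geo : Sum (suc m) (½ ^_) ≤ 1ℚ + (½ + ½)
      geo = geometric-½ (suc m) (<⇒≤ 0<½) ≤-refl
    Z : Graph n → ℚ
    Z = witnesses c m
    EZ : graphE w Z ≡ μ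
    EZ = graphE-witnesses dst c n k i m+i≡n
    EZ² : graphE w (λ G → Z G * Z G) ≤ 4F * (μ * μ) + frac 24 1 * μ
    EZ² = ≤-trans (≤-reflexive (trans (graphE-cong w (λ G → subs-square m (λ K → rooted c K G)))
        (trans (subs-graphE w m (λ K G → subs m (λ L → rooted c K G * rooted c L G))) (subs-cong m (λ K _ → subs-graphE w m (λ L G → rooted c K G * rooted c L G))))))
      (≤-trans (subs-mono m row-sum) (≤-reflexive (trans (subs-const m _) (solve 2 (λ b w → b :* (con (frac 4 1) :* (w :* w) :* b :+ con (frac 24 1) :* w) := con (frac 4 1) :* (b :* w :* (b :* w)) :+ con (frac 24 1) :* (b :* w)) refl β W))))
    -- The quadratic 2tE[Z] - t²E[Z²] is largest at t = E[Z]/E[Z²]; here E[Z²] is replaced by its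
    -- upper bound.
    Q t : ℚ
    Q = 4F * μ + frac 24 1
    t = inv Q
    0<μ : 0ℚ < μ
    0<μ = <-≤-trans (*-pos 0<½ (*-pos 0<½ 0<½)) ⅛≤μ
    0<Q : 0ℚ < Q
    0<Q = <-≤-trans (ℚ.positive⁻¹ (frac 24 1)) (≤-+ˡ (*-nonneg (ℚ.nonNegative⁻¹ 4F) (<⇒≤ 0<μ)))
    Z≡0 : ∀ G → ¬ G ⊨ critical c → Z G ≡ 0ℚ
    Z≡0 G ¬φ = trans (subs-cong m (λ K e → trans (∑-cong n (λ b → cell K e b (lookup K b) refl (clique c K G) refl)) (trans (∑-cong n (λ _ → sym (zeroˡ 0ℚ))) (trans (∑-*ˡ n 0ℚ (λ _ → 0ℚ)) (zeroˡ _)))))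
        (trans (subs-const m 0ℚ) (zeroʳ _))
      where
      2≤m : 2 ℕ.≤ m
      2≤m = ℕ.s≤s (ℕ.≤-trans (ℕ.s≤s ℕ.z≤n) k₁≤k)
      cell : ∀ K → size K ≡ m → ∀ b a → lookup K b ≡ a → ∀ a′ → clique c K G ≡ a′ → 𝟙 (lookup K b) * dominates c (remove b K) K G ≡ 0ℚ
      cell K e b false ea a′ ea′ = trans (cong (λ a → 𝟙 a * dominates c (remove b K) K G) ea) (zeroˡ _)
      cell K e b true ea false ea′ = trans (cong (𝟙 (lookup K b) *_) (trans (cong (λ a → 𝟙 a * ∏ n (λ i → outside-of K i (𝟙 (not (hom (same (not c)) (remove b K) (nbr G i)))))) ea′) (zeroˡ _))) (zeroʳ _)
      cell K e b true ea true ea′ = search (Fin.any? λ i → (lookup K i Bool.≟ false) ×-dec (hom (same (not c)) (remove b K) (nbr G i) Bool.≟ true))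
        where
        search : Dec (∃ λ i → lookup K i ≡ false × hom (same (not c)) (remove b K) (nbr G i) ≡ true) → 𝟙 (lookup K b) * dominates c (remove b K) K G ≡ 0ℚ
        search (yes (v , out , bad)) = trans (cong (λ a → 𝟙 (lookup K b) * (𝟙 (clique c K G) * a))
            (∏-zero n v (trans (cong (λ a → if a then 1ℚ else 𝟙 (not (hom (same (not c)) (remove b K) (nbr G v)))) out) (cong (𝟙 ∘ not) bad))))
          (trans (cong (𝟙 (lookup K b) *_) (zeroʳ _)) (zeroʳ _))
        search (no ¬bad) = contradiction (⇒⊨critical c G (K , subst (2 ℕ.≤_) (sym e) 2≤m , b , ea , ea′ , λ v out → Bool.¬-not (λ bad → ¬bad (v , out , bad)))) ¬φ
    -- 1[Z > 0] ≥ 1 − (1 − tZ)²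
    pointwise : ∀ G → (t + t) * Z G + (- (t * t)) * (Z G * Z G) ≤ truth (critical c) G
    pointwise G = cases (G ⊨? critical c)
      where
      cases : (p : Dec (G ⊨ critical c)) → (t + t) * Z G + (- (t * t)) * (Z G * Z G) ≤ 𝟙 (does p)
      cases (yes _) = ≤-by ((1ℚ - t * Z G) * (1ℚ - t * Z G)) (square-nonneg (1ℚ - t * Z G)) (solve 2 (λ t z → con 1ℚ := (t :+ t) :* z :+ (:- (t :* t)) :* (z :* z) :+ (con 1ℚ :- t :* z) :* (con 1ℚ :- t :* z)) refl t (Z G))
      cases (no ¬φ) = ≤-reflexive (trans (cong (λ z → (t + t) * z + (- (t * t)) * (z * z)) (Z≡0 G ¬φ)) (solve 1 (λ t → (t :+ t) :* con 0ℚ :+ (:- (t :* t)) :* (con 0ℚ :* con 0ℚ) := con 0ℚ) refl t))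
    likely : frac 1 200 ≤ graphE w {n} (truth (critical c))
    likely = ≤-trans (≤-trans 1/200≤ expectation) (graphE-mono nonneg pointwise)
      where
      tQ : t * Q ≡ 1ℚ
      tQ = trans (*-comm t Q) (*-inv 0<Q)
      expectation : t * μ ≤ graphE w (λ G → (t + t) * Z G + (- (t * t)) * (Z G * Z G))
      expectation = ≤-trans (≤-trans (≤-reflexive (trans (solve 2 (λ t m → t :* m := (t :+ t) :* m :- t :* m :* con 1ℚ) refl t μ) (trans (cong (λ e → (t + t) * μ - t * μ * e) (sym tQ))
            (solve 2 (λ t m → (t :+ t) :* m :- t :* m :* (t :* (con (frac 4 1) :* m :+ con (frac 24 1))) := (t :+ t) :* m :+ (:- (t :* t)) :* (con (frac 4 1) :* (m :* m) :+ con (frac 24 1) :* m)) refl t μ))))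
          (+-monoˡ-≤ ((t + t) * μ) (≤-by (t * t * (4F * (μ * μ) + frac 24 1 * μ - graphE w (λ G → Z G * Z G))) (*-nonneg (square-nonneg t) (≤⇒0≤ EZ²))
            (solve 3 (λ t a b → (:- (t :* t)) :* b := (:- (t :* t)) :* a :+ t :* t :* (a :- b)) refl t (4F * (μ * μ) + frac 24 1 * μ) (graphE w (λ G → Z G * Z G))))))
        (≤-reflexive (sym (trans (graphE-+ w _ _) (cong₂ _+_ (trans (graphE-*ˡ w (t + t) Z) (cong ((t + t) *_) EZ)) (graphE-*ˡ w (- (t * t)) (λ G → Z G * Z G))))))
      1/200≤ : frac 1 200 ≤ t * μ
      1/200≤ = ≤-trans (*≤⇒≤*inv 0<Q (≤-trans (≤-reflexive (solve 1 (λ m → con (frac 1 200) :* (con (frac 4 1) :* m :+ con (frac 24 1)) := con (frac 1 50) :* m :+ con (frac 3 25)) refl μ))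
          (≤-by (frac 49 50 * (μ - frac 1 8) + frac 1 400) (+-nonneg (*-nonneg (ℚ.nonNegative⁻¹ (frac 49 50)) (≤⇒0≤ (≤-trans (≤-reflexive (solve 0 (con (frac 1 8) := con ½ :* (con ½ :* con ½)) refl)) ⅛≤μ))) (ℚ.nonNegative⁻¹ (frac 1 400)))
            (solve 1 (λ m → m := con (frac 1 50) :* m :+ con (frac 3 25) :+ (con (frac 49 50) :* (m :- con (frac 1 8)) :+ con (frac 1 400))) refl μ))))
        (≤-reflexive (*-comm μ t))

-- Signs of Cauchy reals and the golden root

p≤∣p∣ : ∀ p → p ≤ ∣ p ∣
p≤∣p∣ p = cases (≤-total 0ℚ p)
  where
  cases : 0ℚ ≤ p ⊎ p ≤ 0ℚ → p ≤ ∣ p ∣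
  cases (inj₁ h) = ≤-reflexive (sym (ℚ.0≤p⇒∣p∣≡p h))
  cases (inj₂ h) = ≤-trans h (ℚ.0≤∣p∣ p)

abs<⇒ : ∀ {a b} → ∣ a ∣ < b → a < b × - b < a
abs<⇒ {a} {b} h = ≤-<-trans (p≤∣p∣ a) h ,
  0<⇒< (subst (0ℚ <_) (solve 2 (λ a b → b :- (:- a) := a :- (:- b)) refl a b)
    (<⇒0< (≤-<-trans (subst (_≤ ∣ ℚ.- a ∣) (sym (-≡ a)) (p≤∣p∣ (ℚ.- a))) (subst (_< b) (sym (ℚ.∣-p∣≡∣p∣ a)) h))))

⇒abs< : ∀ {a b} → a < b → - b < a → ∣ a ∣ < b
⇒abs< {a} {b} p q = cases (ℚ.∣p∣≡p∨∣p∣≡-p a)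
  where
  cases : ∣ a ∣ ≡ a ⊎ ∣ a ∣ ≡ ℚ.- a → ∣ a ∣ < b
  cases (inj₁ e) = subst (_< b) (sym e) p
  cases (inj₂ e) = subst (_< b) (sym (trans e (sym (-≡ a)))) (0<⇒< (subst (0ℚ <_) (solve 2 (λ a b → a :- (:- b) := b :- (:- a)) refl a b) (<⇒0< q)))

-ℚ≡ : ∀ a b → a - b ≡ a ℚ.- b
-ℚ≡ a b = trans (+≡ a (- b)) (cong (a ℚ.+_) (-≡ b))

Sign : ℝ → Set
Sign x = x ≃ 0ℝ ⊎ (∃ λ δ → 0ℚ < δ × ∃ λ I → ∀ i → I ℕ.≤ i → δ ≤ seq x i) ⊎ (∃ λ δ → 0ℚ < δ × ∃ λ I → ∀ i → I ℕ.≤ i → seq x i ≤ - δ)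

-- If a Cauchy sequence does not tend to 0, some ε is reached in absolute value by a term beyond the
-- modulus for ε/2; from that modulus on, all terms stay ε/2 away from 0 on the same side.
sign : ExcludedMiddle 0ℓ → ∀ x → Sign x
sign em x = go em
  where
  Small : ℚ → Set
  Small ε = ∃ λ N → ∀ n → N ℕ.≤ n → ∣ seq x n ℚ.- 0ℚ ∣ < ε
  Apart : Set
  Apart = ∃ λ ε → 0ℚ < ε × ¬ Small ε
  abs-bound : ∀ {ε a} → ¬ ∣ a ℚ.- 0ℚ ∣ < ε → ε ≤ a ⊎ a ≤ - ε
  abs-bound {ε} {a} ¬h = cases (ε ℚ.≤? a) (a ℚ.≤? - ε)
    where
    cases : Dec (ε ≤ a) → Dec (a ≤ - ε) → ε ≤ a ⊎ a ≤ - ε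
    cases (yes p) _ = inj₁ p
    cases (no _) (yes p) = inj₂ p
    cases (no p) (no q) = contradiction (subst (λ t → ∣ t ∣ < ε) (trans (solve 1 (λ a → a := a :- con 0ℚ) refl a) (-ℚ≡ a 0ℚ)) (⇒abs< (ℚ.≰⇒> p) (ℚ.≰⇒> q))) ¬h
  go : Dec Apart → Sign x
  go (no ¬apart) = inj₁ λ ε 0<ε → ¬¬-elim em (λ ¬small → ¬apart (ε , 0<ε , ¬small))
  go (yes (ε , 0<ε , ¬small)) = inj₂ (locate (¬¬-elim em λ none-far → ¬small (N , λ n l → ¬¬-elim em (λ ¬h → none-far (n , l , ¬h)))))
    where
    half = cauchy x (½ * ε) (*-pos 0<½ 0<ε)
    N = proj₁ half
    close : ∀ m n → N ℕ.≤ m → N ℕ.≤ n → seq x m - seq x n < ½ * ε × - (½ * ε) < seq x m - seq x n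
    close m n l l′ = abs<⇒ (subst (λ t → ∣ t ∣ < ½ * ε) (sym (-ℚ≡ (seq x m) (seq x n))) (proj₂ half m n l l′))
    locate : (∃ λ n → N ℕ.≤ n × ¬ ∣ seq x n ℚ.- 0ℚ ∣ < ε) → _
    locate (n , l , ¬h) = cases (abs-bound ¬h)
      where
      cases : ε ≤ seq x n ⊎ seq x n ≤ - ε → _
      cases (inj₁ p) = inj₁ (½ * ε , *-pos 0<½ 0<ε , N , λ i l′ → ≤-trans (≤-by (seq x n - ε) (≤⇒0≤ p) (solve 2 (λ a e → (:- (con ½ :* e)) :+ a := con ½ :* e :+ (a :- e)) refl (seq x n) ε))
        (≤-trans (+-monoʳ-≤ (seq x n) (<⇒≤ (proj₂ (close i n l′ l)))) (≤-reflexive (solve 2 (λ a b → a :- b :+ b := a) refl (seq x i) (seq x n)))))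
      cases (inj₂ p) = inj₂ (½ * ε , *-pos 0<½ 0<ε , N , λ i l′ → ≤-trans (≤-reflexive (solve 2 (λ a b → a := a :- b :+ b) refl (seq x i) (seq x n)))
        (≤-trans (+-monoʳ-≤ (seq x n) (<⇒≤ (proj₁ (close i n l′ l)))) (≤-by (- ε - seq x n) (≤⇒0≤ p) (solve 2 (λ a e → :- (con ½ :* e) := con ½ :* e :+ a :+ ((:- e) :- a)) refl (seq x n) ε))))

-- Division by a cofactor P ≥ 1/2 at most doubles the error.
squeeze : ∀ {X P E ε} → ½ ≤ P → X * P ≡ - E → E < ½ * ε → - (½ * ε) < E → 0ℚ < ε → X < ε × - ε < X
squeeze {X} {P} {E} {ε} ½≤P XP E< <E 0<ε =
  ℚ.≰⇒> (λ ε≤X → <-irrefl refl (≤-<-trans (≤-trans (≤-reflexive (*-comm ½ ε)) (≤-trans (*-mono-≤ (<⇒≤ 0<ε) ε≤X (<⇒≤ 0<½) ½≤P) (≤-reflexive XP)))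
    (0<⇒< (subst (0ℚ <_) (solve 2 (λ e t → e :- (:- t) := t :- (:- e)) refl E (½ * ε)) (<⇒0< <E))))) ,
  ℚ.≰⇒> (λ X≤ → <-irrefl refl (≤-<-trans (≤-trans (≤-reflexive (*-comm ½ ε)) (≤-trans (*-mono-≤ (<⇒≤ 0<ε) (≤-by (- ε - X) (≤⇒0≤ X≤) (solve 2 (λ x e → :- x := e :+ ((:- e) :- x)) refl X ε)) (<⇒≤ 0<½) ½≤P)
    (≤-reflexive (trans (solve 2 (λ x p → (:- x) :* p := :- (x :* p)) refl X P) (trans (cong -_ XP) (solve 1 (λ e → :- (:- e) := e) refl E)))))) E<))

Proper : ℝ → Set
Proper r = ∃ λ e → 0ℚ < e × ∃ λ I → ∀ i → I ℕ.≤ i → e ≤ seq r i × e ≤ 1ℚ - seq r i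

√5² : ∀ ε → 0ℚ < ε → ∃ λ N → ∀ n → N ℕ.≤ n → 5ℚ - seq √5 n * seq √5 n < ε × - ε < 5ℚ - seq √5 n * seq √5 n
√5² ε 0<ε = let N , h = √5-square ε 0<ε in N , λ n l →
  let p , q = abs<⇒ (subst (λ t → ∣ t ∣ < ε) (trans (cong (ℚ._- 5ℚ) (sym (*≡ _ _))) (sym (-ℚ≡ _ 5ℚ))) (h n l))
  in 0<⇒< (subst (0ℚ <_) (solve 2 (λ e y → y :- con 5ℚ :- (:- e) := e :- (con 5ℚ :- y)) refl ε (seq √5 n * seq √5 n)) (<⇒0< q)) ,
     0<⇒< (subst (0ℚ <_) (solve 2 (λ e y → e :- (y :- con 5ℚ) := con 5ℚ :- y :- (:- e)) refl ε (seq √5 n * seq √5 n)) (<⇒0< p))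

0≤√5 : ∃ λ I → ∀ i → I ℕ.≤ i → 0ℚ ≤ seq √5 i
0≤√5 = let e , 0<e , I , h = √5-positive in I , λ i l → <⇒≤ (<-trans (subst (0ℚ <_) (+≡ 0ℚ e) (subst (0ℚ <_) (sym (+-identityˡ e)) 0<e)) (h i l))

-- The factorisation of r² - 3r + 1 by the roots (3 - √5)/2 and (3 + √5)/2, with a rational z in
-- place of √5; the defect is (5 - z²)/4.
cofactor : ∀ r z → (r - (3ℚ - z) * ½) * ((3ℚ + z) * ½ - r) ≡ - (((1ℚ - r) * (1ℚ - r) - r) + ½ * (½ * (5ℚ - z * z)))
cofactor = solve 2 (λ r z → (r :- (con 3ℚ :- z) :* con ½) :* ((con 3ℚ :+ z) :* con ½ :- r) := :- (((con 1ℚ :- r) :* (con 1ℚ :- r) :- r) :+ con ½ :* (con ½ :* (con 5ℚ :- z :* z)))) refl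

-- As r < 1, the cofactor (3 + √5)/2 - r stays above 1/2, so a small discriminant forces r towards
-- the smaller root.
discriminant≃0⇒ : ∀ r → Proper r → discriminant r ≃ 0ℝ → r ≃ goldenRoot
discriminant≃0⇒ r (e , 0<e , I₁ , proper) D≃0 ε 0<ε =
  let ¼ε = ½ * (½ * ε)
      0<¼ε = *-pos 0<½ (*-pos 0<½ 0<ε)
      I₂ , small = D≃0 ¼ε 0<¼ε
      I₃ , root = √5² ε 0<ε
      I₄ , y≥0 = 0≤√5
  in I₁ ⊔ (I₂ ⊔ (I₃ ⊔ I₄)) , λ i l →
    let l₁ = ℕ.m⊔n≤o⇒m≤o I₁ (I₂ ⊔ (I₃ ⊔ I₄)) l
        l′ = ℕ.m⊔n≤o⇒n≤o I₁ (I₂ ⊔ (I₃ ⊔ I₄)) l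
        l₂ = ℕ.m⊔n≤o⇒m≤o I₂ (I₃ ⊔ I₄) l′
        l″ = ℕ.m⊔n≤o⇒n≤o I₂ (I₃ ⊔ I₄) l′
        l₃ = ℕ.m⊔n≤o⇒m≤o I₃ I₄ l″
        l₄ = ℕ.m⊔n≤o⇒n≤o I₃ I₄ l″
        R = seq r i
        Y = seq √5 i
        D = (1ℚ - R) * (1ℚ - R) - R
        D< , <D = abs<⇒ (subst (λ t → ∣ t ∣ < ¼ε) (trans (sym (-ℚ≡ _ 0ℚ)) (trans (cong (_- 0ℚ) (seq-discriminant r i)) (solve 1 (λ a → a :- con 0ℚ := a) refl D))) (small i l₂))
        F< , <F = root i l₃
        X< , <X = squeeze {R - (3ℚ - Y) * ½} {(3ℚ + Y) * ½ - R} {D + ½ * (½ * (5ℚ - Y * Y))} {ε}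
          (≤-by (½ * Y + (1ℚ - R)) (+-nonneg (*-nonneg (<⇒≤ 0<½) (y≥0 i l₄)) (≤-trans (<⇒≤ 0<e) (proj₂ (proper i l₁)))) (solve 2 (λ r y → (con 3ℚ :+ y) :* con ½ :- r := con ½ :+ (con ½ :* y :+ (con 1ℚ :- r))) refl R Y))
          (cofactor R Y)
          (0<⇒< (subst (0ℚ <_) (solve 3 (λ e d f → (con ½ :* (con ½ :* e) :- d) :+ con ½ :* (con ½ :* (e :- f)) := con ½ :* e :- (d :+ con ½ :* (con ½ :* f))) refl ε D (5ℚ - Y * Y)) (+-pos (<⇒0< D<) (*-nonneg (<⇒≤ 0<½) (*-nonneg (<⇒≤ 0<½) (<⇒≤ (<⇒0< F<)))))))
          (0<⇒< (subst (0ℚ <_) (solve 3 (λ e d f → (d :- (:- (con ½ :* (con ½ :* e)))) :+ con ½ :* (con ½ :* (f :- (:- e))) := d :+ con ½ :* (con ½ :* f) :- (:- (con ½ :* e))) refl ε D (5ℚ - Y * Y)) (+-pos (<⇒0< <D) (*-nonneg (<⇒≤ 0<½) (*-nonneg (<⇒≤ 0<½) (<⇒≤ (<⇒0< <F)))))))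
          0<ε
    in subst (λ t → ∣ t ∣ < ε) (trans (cong (λ z → R - z) (sym (seq-goldenRoot i))) (-ℚ≡ R _)) (⇒abs< X< <X)

⇒discriminant≃0 : ∀ r → Proper r → r ≃ goldenRoot → discriminant r ≃ 0ℝ
⇒discriminant≃0 r (e , 0<e , I₁ , proper) r≃ ε 0<ε =
  let η = frac 1 8 * ε
      0<η = *-pos (ℚ.positive⁻¹ (frac 1 8)) 0<ε
      I₂ , near = r≃ η 0<η
      I₃ , root = √5² ε 0<ε
      I₄ , y≥0 = 0≤√5
      I₅ , root′ = √5² 1ℚ 0<1
  in (I₁ ⊔ I₂) ⊔ (I₃ ⊔ (I₄ ⊔ I₅)) , λ i l →
    let l₁₂ = ℕ.m⊔n≤o⇒m≤o (I₁ ⊔ I₂) (I₃ ⊔ (I₄ ⊔ I₅)) l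
        l₃₄₅ = ℕ.m⊔n≤o⇒n≤o (I₁ ⊔ I₂) (I₃ ⊔ (I₄ ⊔ I₅)) l
        l₁ = ℕ.m⊔n≤o⇒m≤o I₁ I₂ l₁₂
        l₂ = ℕ.m⊔n≤o⇒n≤o I₁ I₂ l₁₂
        l₃ = ℕ.m⊔n≤o⇒m≤o I₃ (I₄ ⊔ I₅) l₃₄₅
        l₄₅ = ℕ.m⊔n≤o⇒n≤o I₃ (I₄ ⊔ I₅) l₃₄₅
        l₄ = ℕ.m⊔n≤o⇒m≤o I₄ I₅ l₄₅
        l₅ = ℕ.m⊔n≤o⇒n≤o I₄ I₅ l₄₅
        R = seq r i
        Y = seq √5 i
        D = (1ℚ - R) * (1ℚ - R) - R
        X = R - (3ℚ - Y) * ½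
        P = (3ℚ + Y) * ½ - R
        F = 5ℚ - Y * Y
        X< , <X = abs<⇒ (subst (λ t → ∣ t ∣ < η) (trans (sym (-ℚ≡ R _)) (cong (λ z → R - z) (seq-goldenRoot i))) (near i l₂))
        F< , <F = root i l₃
        Y≤3 : Y ≤ 3ℚ
        Y≤3 = ≤-square (y≥0 i l₄) (proj₂ (root′ i l₅))
        P≤3 : P ≤ 3ℚ
        P≤3 = ≤-by (½ * (3ℚ - Y) + R) (+-nonneg (*-nonneg (<⇒≤ 0<½) (≤⇒0≤ Y≤3)) (≤-trans (<⇒≤ 0<e) (proj₁ (proper i l₁)))) (solve 2 (λ r y → con 3ℚ := (con 3ℚ :+ y) :* con ½ :- r :+ (con ½ :* (con 3ℚ :- y) :+ r)) refl R Y)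
        0≤P : 0ℚ ≤ P
        0≤P = ≤-trans (+-nonneg (+-nonneg (<⇒≤ 0<½) (*-nonneg (<⇒≤ 0<½) (y≥0 i l₄))) (≤-trans (<⇒≤ 0<e) (proj₂ (proper i l₁)))) (≤-reflexive (solve 2 (λ r y → con ½ :+ con ½ :* y :+ (con 1ℚ :- r) := (con 3ℚ :+ y) :* con ½ :- r) refl R Y))
        D≡ : D ≡ - (X * P) - ½ * (½ * F)
        D≡ = trans (solve 2 (λ d f → d := :- (:- (d :+ f)) :- f) refl D (½ * (½ * F))) (cong (λ t → - t - ½ * (½ * F)) (sym (cofactor R Y)))
        XP≤ : X * P ≤ frac 3 8 * ε
        XP≤ = ≤-trans (*-monoʳ-≤ 0≤P (<⇒≤ X<)) (≤-trans (*-monoˡ-≤ (<⇒≤ 0<η) P≤3) (≤-reflexive (solve 1 (λ e → con (frac 1 8) :* e :* con 3ℚ := con (frac 3 8) :* e) refl ε)))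
        -XP≤ : - (X * P) ≤ frac 3 8 * ε
        -XP≤ = ≤-trans (≤-reflexive (solve 2 (λ x p → :- (x :* p) := (:- x) :* p) refl X P)) (≤-trans (*-monoʳ-≤ 0≤P (≤-by (X - - η) (<⇒≤ (<⇒0< <X)) (solve 2 (λ x h → h := :- x :+ (x :- (:- h))) refl X η)))
          (≤-trans (*-monoˡ-≤ (<⇒≤ 0<η) P≤3) (≤-reflexive (solve 1 (λ e → con (frac 1 8) :* e :* con 3ℚ := con (frac 3 8) :* e) refl ε))))
        0<⅜ε = *-pos (ℚ.positive⁻¹ (frac 3 8)) 0<ε
    in subst (λ t → ∣ t ∣ < ε) (sym (trans (sym (-ℚ≡ _ 0ℚ)) (trans (cong (_- 0ℚ) (trans (seq-discriminant r i) D≡)) (solve 1 (λ a → a :- con 0ℚ := a) refl _))))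
      (⇒abs<
        (0<⇒< (subst (0ℚ <_) (solve 3 (λ e a f → con (frac 3 8) :* e :+ ((con (frac 3 8) :* e :- (:- a)) :+ con ½ :* (con ½ :* (f :- (:- e)))) := e :- (:- a :- con ½ :* (con ½ :* f))) refl ε (X * P) F)
          (+-pos 0<⅜ε (+-nonneg (≤⇒0≤ -XP≤) (*-nonneg (<⇒≤ 0<½) (*-nonneg (<⇒≤ 0<½) (<⇒≤ (<⇒0< <F))))))))
        (0<⇒< (subst (0ℚ <_) (solve 3 (λ e a f → con (frac 3 8) :* e :+ ((con (frac 3 8) :* e :- a) :+ con ½ :* (con ½ :* (e :- f))) := (:- a :- con ½ :* (con ½ :* f)) :- (:- e)) refl ε (X * P) F)
          (+-pos 0<⅜ε (+-nonneg (≤⇒0≤ XP≤) (*-nonneg (<⇒≤ 0<½) (*-nonneg (<⇒≤ 0<½) (<⇒≤ (<⇒0< F<)))))))))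
  where
  ≤-square : ∀ {Y} → 0ℚ ≤ Y → - 1ℚ < 5ℚ - Y * Y → Y ≤ 3ℚ
  ≤-square {Y} 0≤Y h = cases (Y ℚ.≤? 3ℚ)
    where
    cases : Dec (Y ≤ 3ℚ) → Y ≤ 3ℚ
    cases (yes p) = p
    cases (no p) = contradiction (<-≤-trans h (≤-trans (+-monoˡ-≤ 5ℚ (≤-by (Y * Y - 3ℚ * 3ℚ) (≤⇒0≤ (*-mono-≤ (ℚ.nonNegative⁻¹ 3ℚ) 3≤Y (ℚ.nonNegative⁻¹ 3ℚ) 3≤Y)) (solve 1 (λ y → :- (con 3ℚ :* con 3ℚ) := :- y :+ (y :- con 3ℚ :* con 3ℚ)) refl (Y * Y))))
        (≤-trans (≤-reflexive (solve 0 (con 5ℚ :- con 3ℚ :* con 3ℚ := :- con (frac 4 1)) refl)) (≤-by (frac 3 1) (ℚ.nonNegative⁻¹ (frac 3 1)) (solve 0 (:- con 1ℚ := :- con (frac 4 1) :+ con (frac 3 1)) refl))))) (<-irrefl refl)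
      where
      3≤Y = <⇒≤ (ℚ.≰⇒> p)

-- The edge probability as seen by the two colours

-- The probability of colour `c`. The two exceptional values of p are those for which one of the
-- colours has the golden root as its rate.
rate : ℝ → Bool → ℝ
rate p true = p
rate p false = 1ℝ Defs.- p

seq-complement : ∀ p i → seq (1ℝ Defs.- p) i ≡ 1ℚ - seq p i
seq-complement p i = sym (-ℚ≡ 1ℚ (seq p i))

rate≡ : ∀ p c i → seq (rate p c) i ≡ weights p i c
rate≡ p true i = refl
rate≡ p false i = seq-complement p i

1-rate≡ : ∀ p c i → 1ℚ - seq (rate p c) i ≡ weights p i (not c)
1-rate≡ p true i = refl
1-rate≡ p false i = trans (cong (λ x → 1ℚ - x) (seq-complement p i)) (solve 1 (λ x → con 1ℚ :- (con 1ℚ :- x) := x) refl (seq p i))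

⊓-pos : ∀ {a b} → 0ℚ < a → 0ℚ < b → 0ℚ < a ℚ.⊓ b
⊓-pos {a} {b} p q = cases (ℚ.⊓-sel a b)
  where
  cases : a ℚ.⊓ b ≡ a ⊎ a ℚ.⊓ b ≡ b → 0ℚ < a ℚ.⊓ b
  cases (inj₁ e) = subst (0ℚ <_) (sym e) p
  cases (inj₂ e) = subst (0ℚ <_) (sym e) q

EventuallyBounded : ℝ → Set
EventuallyBounded p = ∃ λ ω₀ → 0ℚ < ω₀ × ∃ λ I → ∀ i → I ℕ.≤ i → Bounded ω₀ (weights p i)

eventually-bounded : ∀ p → 0ℝ Defs.< p → p Defs.< 1ℝ → EventuallyBounded p
eventually-bounded p (e , 0<e , I , low) (e′ , 0<e′ , I′ , high) = e ℚ.⊓ e′ , ⊓-pos 0<e 0<e′ , I ⊔ I′ , λ i l →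
  let p> = ≤-trans (ℚ.p⊓q≤p e e′) (<⇒≤ (subst (_< seq p i) (trans (sym (+≡ 0ℚ e)) (+-identityˡ e)) (low i (ℕ.m⊔n≤o⇒m≤o I I′ l))))
      q> = ≤-trans (ℚ.p⊓q≤q e e′) (<⇒≤ (0<⇒< (subst (0ℚ <_) (solve 2 (λ p e → con 1ℚ :- (p :+ e) := con 1ℚ :- p :- e) refl (seq p i) e′)
             (<⇒0< (subst (_< 1ℚ) (sym (+≡ (seq p i) e′)) (high i (ℕ.m⊔n≤o⇒n≤o I I′ l)))))))
      0≤ω₀ = <⇒≤ (⊓-pos 0<e 0<e′)
  in record { dist = record { nonneg = λ { true → ≤-trans 0≤ω₀ p> ; false → ≤-trans 0≤ω₀ q> } ; total = 1-x+x (seq p i) } ; lower = λ { true → p> ; false → q> } }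

rate-proper : ∀ p → EventuallyBounded p → ∀ c → Proper (rate p c)
rate-proper p (ω₀ , 0<ω₀ , I , bd) c = ω₀ , 0<ω₀ , I , λ i l →
  subst (ω₀ ≤_) (sym (rate≡ p c i)) (Bounded.lower (bd i l) c) , subst (ω₀ ≤_) (sym (1-rate≡ p c i)) (Bounded.lower (bd i l) (not c))

discriminant-rate : ∀ p c i → seq (discriminant (rate p c)) i ≡ weights p i (not c) * weights p i (not c) - weights p i c
discriminant-rate p c i = trans (seq-discriminant (rate p c) i) (cong₂ (λ a b → a * a - b) (1-rate≡ p c i) (rate≡ p c i))

golden⇒Exceptional : ∀ p c → rate p c ≃ goldenRoot → Exceptional p
golden⇒Exceptional p true h = inj₁ h
golden⇒Exceptional p false h = inj₂ λ ε 0<ε → let N , close = h ε 0<ε in N , λ i l →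
  subst (_< ε) (trans (sym (ℚ.∣-p∣≡∣p∣ _)) (cong ∣_∣ (trans (sym (-≡ _)) (trans (cong -_ (trans (sym (-ℚ≡ _ _)) (cong₂ (λ a b → a - b) (seq-complement p i) (seq-goldenRoot i))))
    (trans (solve 2 (λ p y → :- ((con 1ℚ :- p) :- (con 3ℚ :- y) :* con ½) := p :- (y :- con 1ℚ) :* con ½) refl (seq p i) (seq √5 i))
      (trans (-ℚ≡ _ _) (cong (λ z → seq p i ℚ.- z) (trans (*≡ _ _) (cong (ℚ._* ½) (-ℚ≡ _ _))))))))))
    (close i l)

Exceptional⇒golden : ∀ p → Exceptional p → ∃ λ c → rate p c ≃ goldenRoot
Exceptional⇒golden p (inj₁ h) = true , h
Exceptional⇒golden p (inj₂ h) = false , λ ε 0<ε → let N , close = h ε 0<ε in N , λ i l →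
  subst (_< ε) (trans (sym (ℚ.∣-p∣≡∣p∣ _)) (cong ∣_∣ (trans (sym (-≡ _)) (trans (cong -_ (trans (sym (-ℚ≡ _ _)) (cong (λ z → seq p i - z) (sym (trans (*≡ _ _) (cong (ℚ._* ½) (-ℚ≡ _ _)))))))
    (trans (solve 2 (λ p y → :- (p :- (y :- con 1ℚ) :* con ½) := (con 1ℚ :- p) :- (con 3ℚ :- y) :* con ½) refl (seq p i) (seq √5 i))
      (trans (cong₂ (λ a b → a - b) (sym (seq-complement p i)) (sym (seq-goldenRoot i))) (-ℚ≡ _ _)))))))
    (close i l)

eventually-regime : ExcludedMiddle 0ℓ → ∀ p → EventuallyBounded p → ¬ Exceptional p → EventuallyRegime p
eventually-regime em p bounded@(ω₀ , 0<ω₀ , I₀ , bd) ¬exc = ω₀ , κ , sub , 0<ω₀ ,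
    ⊓-pos (⊓-pos (proj₁ (proj₂ (proj₂ (info true)))) (proj₁ (proj₂ (proj₂ (info false))))) (⊓-pos 0<ω₀ 0<1) ,
    ≤-trans κ≤ (ℚ.p⊓q≤p ω₀ 1ℚ) , ≤-trans κ≤ (ℚ.p⊓q≤q ω₀ 1ℚ) , I₀ ⊔ (index true ⊔ index false) , regime
  where
  Info : Bool → Set
  Info c = ∃ λ b → ∃ λ δ → 0ℚ < δ × ∃ λ I → ∀ i → I ℕ.≤ i →
    (b ≡ true → weights p i (not c) * weights p i (not c) ≤ weights p i c - δ) × (b ≡ false → weights p i c ≤ weights p i (not c) * weights p i (not c) - δ)
  info : ∀ c → Info c
  info c = cases (sign em (discriminant (rate p c)))
    where
    cases : Sign (discriminant (rate p c)) → Info c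
    cases (inj₁ zero-d) = contradiction (golden⇒Exceptional p c (discriminant≃0⇒ (rate p c) (rate-proper p bounded c) zero-d)) ¬exc
    cases (inj₂ (inj₁ (δ , 0<δ , I , h))) = false , δ , 0<δ , I , λ i l → (λ ()) , λ _ →
      ≤-by (weights p i (not c) * weights p i (not c) - weights p i c - δ) (≤⇒0≤ (subst (δ ≤_) (discriminant-rate p c i) (h i l)))
        (solve 3 (λ q o d → q :- d := o :+ (q :- o :- d)) refl (weights p i (not c) * weights p i (not c)) (weights p i c) δ)
    cases (inj₂ (inj₂ (δ , 0<δ , I , h))) = true , δ , 0<δ , I , λ i l → (λ _ →
      ≤-by (- δ - (weights p i (not c) * weights p i (not c) - weights p i c)) (≤⇒0≤ (subst (_≤ - δ) (discriminant-rate p c i) (h i l)))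
        (solve 3 (λ q o d → o :- d := q :+ ((:- d) :- (q :- o))) refl (weights p i (not c) * weights p i (not c)) (weights p i c) δ)) , λ ()
  sub : Bool → Bool
  sub c = proj₁ (info c)
  δ : Bool → ℚ
  δ c = proj₁ (proj₂ (info c))
  index : Bool → ℕ
  index c = proj₁ (proj₂ (proj₂ (proj₂ (info c))))
  κ = (δ true ℚ.⊓ δ false) ℚ.⊓ (ω₀ ℚ.⊓ 1ℚ)
  κ≤ : κ ≤ ω₀ ℚ.⊓ 1ℚ
  κ≤ = ℚ.p⊓q≤q (δ true ℚ.⊓ δ false) (ω₀ ℚ.⊓ 1ℚ)
  κ≤δ : ∀ c → κ ≤ δ c
  κ≤δ true = ≤-trans (ℚ.p⊓q≤p (δ true ℚ.⊓ δ false) (ω₀ ℚ.⊓ 1ℚ)) (ℚ.p⊓q≤p (δ true) (δ false))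
  κ≤δ false = ≤-trans (ℚ.p⊓q≤p (δ true ℚ.⊓ δ false) (ω₀ ℚ.⊓ 1ℚ)) (ℚ.p⊓q≤q (δ true) (δ false))
  0≤κ : 0ℚ ≤ κ
  0≤κ = <⇒≤ (⊓-pos (⊓-pos (proj₁ (proj₂ (proj₂ (info true)))) (proj₁ (proj₂ (proj₂ (info false))))) (⊓-pos 0<ω₀ 0<1))
  -- An additive gap becomes a relative one because the weights and their squares are at most 1.
  scale : ∀ {a} c → a ≤ 1ℚ → a - δ c ≤ a * (1ℚ - κ)
  scale {a} c a≤1 = ≤-by ((δ c - κ) + κ * (1ℚ - a)) (+-nonneg (≤⇒0≤ (κ≤δ c)) (*-nonneg 0≤κ (≤⇒0≤ a≤1))) (solve 3 (λ a d k → a :* (con 1ℚ :- k) := a :- d :+ ((d :- k) :+ k :* (con 1ℚ :- a))) refl a (δ c) κ)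
  regime : ∀ i → I₀ ⊔ (index true ⊔ index false) ℕ.≤ i → Regime ω₀ κ sub (weights p i)
  regime i l = record { bounded = b ; below = λ c e → ≤-trans (proj₁ (holds c) e) (scale c (D.≤1 c))
    ; above = λ c e → ≤-trans (proj₂ (holds c) e) (scale c (≤-trans (*-mono-≤ (D.nonneg (not c)) (D.≤1 (not c)) (D.nonneg (not c)) (D.≤1 (not c))) (≤-reflexive (*-identityˡ 1ℚ)))) }
    where
    b = bd i (ℕ.m⊔n≤o⇒m≤o I₀ (index true ⊔ index false) l)
    module D = IsDistribution (Bounded.dist b)
    l′ = ℕ.m⊔n≤o⇒n≤o I₀ (index true ⊔ index false) l
    index≤ : ∀ c → index c ℕ.≤ i
    index≤ true = ℕ.m⊔n≤o⇒m≤o (index true) (index false) l′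
    index≤ false = ℕ.m⊔n≤o⇒n≤o (index true) (index false) l′
    holds : ∀ c → (sub c ≡ true → weights p i (not c) * weights p i (not c) ≤ weights p i c - δ c) × (sub c ≡ false → weights p i c ≤ weights p i (not c) * weights p i (not c) - δ c)
    holds c = proj₂ (proj₂ (proj₂ (proj₂ (info c)))) i (index≤ c)

-- Divergence at the critical probabilities

-- With η = 1/(16 + 2J) one has (1 + η)ᴶ ≤ 2. The factor 1/4 turns the additive error into a
-- relative one, as ω and q² are at least 1/4. The summand 16 makes the tolerance at most 1/64, the
-- value of q² + q - 1 at q = 5/8, which helps to confine q to [1/2, 5/8].
tolerance : ℕ → ℚ
tolerance J = frac 1 4 * inv (ι (16 ℕ.+ (J ℕ.+ J)))

tolerance-pos : ∀ J → 0ℚ < tolerance J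
tolerance-pos J = *-pos (ℚ.positive⁻¹ (frac 1 4)) (inv-pos (ι-pos (15 ℕ.+ (J ℕ.+ J))))

near-critical : ∀ J {ω q} → 0ℚ ≤ q → ω + q ≡ 1ℚ → q * q - ω < tolerance J → - tolerance J < q * q - ω → ½ ≤ q × q ≤ frac 5 8 × Close J ω q
near-critical J {ω} {q} 0≤q ω+q D< <D = ½≤q , q≤⅝ , record
    { ω≤q = λ j j≤J → powers j j≤J 0≤ω (*-nonneg 0≤q 0≤q) (≤-by (η * (q * q - frac 1 4) + (q * q - ω - - tol)) (+-nonneg (*-nonneg 0≤η (≤⇒0≤ q²≥)) (<⇒≤ (<⇒0< <D)))
        (solve 3 (λ q o e → q :* (con 1ℚ :+ e) := o :+ (e :* (q :- con (frac 1 4)) :+ (q :- o :- (:- (con (frac 1 4) :* e))))) refl (q * q) ω η))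
    ; q≤ω = λ j j≤J → powers j j≤J (*-nonneg 0≤q 0≤q) 0≤ω (≤-by (η * (ω - frac 1 4) + (tol - (q * q - ω))) (+-nonneg (*-nonneg 0≤η (≤⇒0≤ ω≥)) (<⇒≤ (<⇒0< D<)))
        (solve 3 (λ q o e → o :* (con 1ℚ :+ e) := q :+ (e :* (o :- con (frac 1 4)) :+ (con (frac 1 4) :* e :- (q :- o)))) refl (q * q) ω η)) }
  where
  n₀ = 16 ℕ.+ (J ℕ.+ J)
  η = inv (ι n₀)
  tol = tolerance J
  0<n₀ = ι-pos (15 ℕ.+ (J ℕ.+ J))
  0≤η : 0ℚ ≤ η
  0≤η = inv-nonneg 0<n₀
  ω≡ : ω ≡ 1ℚ - q
  ω≡ = trans (solve 2 (λ o q → o := o :+ q :- q) refl ω q) (cong (_- q) ω+q)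
  tol≤ : tol ≤ frac 1 64
  tol≤ = ≤-trans (*-monoˡ-≤ (ℚ.nonNegative⁻¹ (frac 1 4)) (≤-trans (≤-reflexive (sym (*-identityˡ η))) (*-cancelʳ-≤ 0<n₀ (≤-trans (≤-reflexive (trans (cong (_* ι n₀) (*-identityˡ η)) (trans (*-comm η _) (*-inv 0<n₀))))
      (≤-trans (≤-reflexive 16/16) (*-monoˡ-≤ (ℚ.nonNegative⁻¹ (frac 1 16)) (ι-mono (ℕ.m≤m+n 16 (J ℕ.+ J)))))))))
    (≤-reflexive (solve 0 (con (frac 1 4) :* con (frac 1 16) := con (frac 1 64)) refl))
    where
    16/16 : 1ℚ ≡ frac 1 16 * ι 16
    16/16 = trans (solve 0 (con 1ℚ := con (frac 1 16) :* con (frac 16 1)) refl) (cong (frac 1 16 *_) (sym (ι≡ 16)))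
  D≡ : q * q - ω ≡ q * q + q - 1ℚ
  D≡ = trans (cong (λ o → q * q - o) ω≡) (solve 1 (λ q → q :* q :- (con 1ℚ :- q) := q :* q :+ q :- con 1ℚ) refl q)
  ½≤q : ½ ≤ q
  ½≤q = cases (½ ℚ.≤? q)
    where
    cases : Dec (½ ≤ q) → ½ ≤ q
    cases (yes h) = h
    cases (no h) = contradiction (<-≤-trans <D (≤-trans (≤-reflexive D≡) (≤-trans (≤-by (½ * ½ - q * q + (½ - q)) (+-nonneg (≤⇒0≤ (*-mono-≤ 0≤q q≤½ 0≤q q≤½)) (≤⇒0≤ q≤½)) (solve 1 (λ q → con ½ :* con ½ :+ con ½ :- con 1ℚ := q :* q :+ q :- con 1ℚ :+ (con ½ :* con ½ :- q :* q :+ (con ½ :- q))) refl q))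
        (≤-by (frac 1 4 - frac 1 64 + (frac 1 64 - tol)) (+-nonneg (≤⇒0≤ (toWitness {a? = frac 1 64 ℚ.≤? frac 1 4} _)) (≤⇒0≤ tol≤)) (solve 1 (λ t → :- t := con ½ :* con ½ :+ con ½ :- con 1ℚ :+ (con (frac 1 4) :- con (frac 1 64) :+ (con (frac 1 64) :- t))) refl tol))))) (<-irrefl refl)
      where
      q≤½ = <⇒≤ (ℚ.≰⇒> h)
  q≤⅝ : q ≤ frac 5 8
  q≤⅝ = cases (q ℚ.≤? frac 5 8)
    where
    cases : Dec (q ≤ frac 5 8) → q ≤ frac 5 8
    cases (yes h) = h
    cases (no h) = contradiction (<-≤-trans D< (≤-trans tol≤ (≤-trans (≤-by (q * q - frac 5 8 * frac 5 8 + (q - frac 5 8)) (+-nonneg (≤⇒0≤ (*-mono-≤ (ℚ.nonNegative⁻¹ (frac 5 8)) 5/8≤q (ℚ.nonNegative⁻¹ (frac 5 8)) 5/8≤q)) (≤⇒0≤ 5/8≤q))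
        (solve 1 (λ q → q :* q :+ q :- con 1ℚ := con (frac 1 64) :+ (q :* q :- con (frac 5 8) :* con (frac 5 8) :+ (q :- con (frac 5 8)))) refl q)) (≤-reflexive (sym D≡))))) (<-irrefl refl)
      where
      5/8≤q = <⇒≤ (ℚ.≰⇒> h)
  q²≥ : frac 1 4 ≤ q * q
  q²≥ = ≤-trans (≤-reflexive (solve 0 (con (frac 1 4) := con ½ :* con ½) refl)) (*-mono-≤ (<⇒≤ 0<½) ½≤q (<⇒≤ 0<½) ½≤q)
  ω≥ : frac 1 4 ≤ ω
  ω≥ = ≤-trans (toWitness {a? = frac 1 4 ℚ.≤? frac 3 8} _) (≤-trans (≤-reflexive (solve 0 (con (frac 3 8) := con 1ℚ :- con (frac 5 8)) refl)) (≤-trans (complement-anti q≤⅝) (≤-reflexive (sym ω≡))))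
  0≤ω : 0ℚ ≤ ω
  0≤ω = ≤-trans (ℚ.nonNegative⁻¹ (frac 1 4)) ω≥
  powers : ∀ j → j ℕ.≤ J → ∀ {a b} → 0ℚ ≤ a → 0ℚ ≤ b → a ≤ b * (1ℚ + η) → a ^ j ≤ 2ℚ * b ^ j
  powers j j≤J {a} {b} 0≤a 0≤b h = ≤-trans (^-mono j 0≤a h) (≤-trans (≤-reflexive (*-^ b (1ℚ + η) j)) (≤-trans (*-monoˡ-≤ (^-nonneg j 0≤b) two) (≤-reflexive (*-comm _ _))))
    where
    jη≤½ : ι j * η ≤ ½
    jη≤½ = *-cancelʳ-≤ 0<n₀ (≤-trans (≤-reflexive (*-inv-cancel (ι j) 0<n₀)) (≤-trans (ι-mono j≤J) (≤-trans (≤-reflexive (solve 1 (λ j → j := con ½ :* (j :+ j)) refl (ι J)))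
      (*-monoˡ-≤ (<⇒≤ 0<½) (≤-trans (≤-reflexive (sym (ι-+ J J))) (ι-mono (ℕ.m≤n+m (J ℕ.+ J) 16)))))))
    two : (1ℚ + η) ^ j ≤ 2ℚ
    two = *-cancelʳ-≤ 0<½ (≤-trans (*-monoˡ-≤ (^-nonneg j (+-nonneg 0≤1 0≤η)) (≤-trans (≤-reflexive (solve 0 (con ½ := con 1ℚ :- con ½) refl)) (complement-anti jη≤½)))
      (≤-trans ([1+u]^n*[1-nu]≤1 j 0≤η) (≤-reflexive (solve 0 (con 1ℚ := (con 1ℚ :+ con 1ℚ) :* con ½) refl))))

maximum : ℕ → (ℕ → ℕ) → ℕ
maximum zero f = f 0
maximum (suc b) f = f (suc b) ⊔ maximum b f

≤-maximum : ∀ b f n → n ℕ.≤ b → f n ℕ.≤ maximum b f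
≤-maximum zero f zero l = ℕ.≤-refl
≤-maximum (suc b) f n l = cases (ℕ.m≤n⇒m<n∨m≡n l)
  where
  cases : n ℕ.< suc b ⊎ n ≡ suc b → f n ℕ.≤ f (suc b) ⊔ maximum b f
  cases (inj₁ (ℕ.s≤s l′)) = ℕ.≤-trans (≤-maximum b f n l′) (ℕ.m≤n⊔m (f (suc b)) _)
  cases (inj₂ refl) = ℕ.m≤m⊔n (f (suc b)) _

-- A limit is refuted at a single index i: its i-th term would lie within 1/1000 of a probability
-- that is at most 1/1000 at one order and at least 1/200 at another. Both orders lie between N and
-- `orderBound k`, so i can be taken beforehand beyond the thresholds of all candidates.
critical-diverges : ∀ p → EventuallyBounded p → ∀ c → rate p c ≃ goldenRoot → ¬ Converges (probability p (critical c))
critical-diverges p bounded@(ω₀ , 0<ω₀ , I₀ , bd) c h (L , conv) = <-irrefl refl (<-≤-trans (<-trans above below) (toWitness {a? = frac 2 1000 ℚ.≤? frac 4 1000} _))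
  where
  φ = critical c
  ε : ℚ
  ε = frac 1 1000
  0<ε : 0ℚ < ε
  0<ε = ℚ.positive⁻¹ (frac 1 1000)
  0<εℝ : 0ℝ Defs.< fromℚ ε
  0<εℝ = frac 1 2000 , ℚ.positive⁻¹ (frac 1 2000) , 0 , λ _ _ → toWitness {a? = 0ℚ ℚ.+ frac 1 2000 ℚ.<? frac 1 1000} _
  N = proj₁ (conv (fromℚ ε) 0<εℝ)
  limit = proj₂ (conv (fromℚ ε) 0<εℝ)
  threshold′ : ∀ n → Dec (N ℕ.≤ n) → ℕ
  threshold′ n (yes l) = let (_ , _ , a , _) , (_ , _ , b , _) = limit n l in a ⊔ b
  -- Orders below N impose no condition on i.
  threshold′ n (no _) = 0
  threshold : ℕ → ℕ
  threshold n = threshold′ n (N ℕ.≤? n)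
  close : ∀ n → N ℕ.≤ n → ∀ i → threshold n ℕ.≤ i → seq L i < seq (probability p φ n) i + ε × seq (probability p φ n) i < seq L i + ε
  close n l i = go (N ℕ.≤? n)
    where
    go : (d : Dec (N ℕ.≤ n)) → threshold′ n d ℕ.≤ i → seq L i < seq (probability p φ n) i + ε × seq (probability p φ n) i < seq L i + ε
    go (no ¬l) _ = contradiction l ¬l
    go (yes l) t = let (e , 0<e , a , low) , (e′ , 0<e′ , b , high) = limit n l in
      0<⇒< (subst (0ℚ <_) (solve 4 (λ q l t e → q :- (l :- t :+ e) :+ e := q :+ t :- l) refl (seq (probability p φ n) i) (seq L i) ε e)
        (+-pos (<⇒0< (subst (_< seq (probability p φ n) i) (sym (trans (+≡ _ e) (cong (ℚ._+ e) (-ℚ≡ (seq L i) ε)))) (low i (ℕ.m⊔n≤o⇒m≤o a b t)))) (<⇒≤ 0<e))) ,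
      ≤-<-trans (≤-+ʳ (<⇒≤ 0<e′)) (subst₂ _<_ (sym (+≡ _ e′)) (sym (+≡ _ ε)) (high i (ℕ.m⊔n≤o⇒n≤o a b t)))
  rare = critical-rare 0<ε
  k = proj₁ rare ⊔ (proj₁ critical-likely ⊔ N)
  J = tri (orderBound k)
  D≃0 = ⇒discriminant≃0 (rate p c) (rate-proper p bounded c) h (tolerance J) (tolerance-pos J)
  i = I₀ ⊔ (proj₁ D≃0 ⊔ maximum (orderBound k) threshold)
  i≥ = ℕ.m⊔n≤o⇒n≤o I₀ (proj₁ D≃0 ⊔ maximum (orderBound k) threshold) (ℕ.≤-refl {i})
  w = weights p i
  dst : IsDistribution w
  dst = Bounded.dist (bd i (ℕ.m≤m⊔n I₀ _))
  w-total : ∀ c → w c + w (not c) ≡ 1ℚ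
  w-total true = IsDistribution.total dst
  w-total false = trans (+-comm _ _) (IsDistribution.total dst)
  D-small = abs<⇒ (subst (λ t → ∣ t ∣ < tolerance J) (trans (sym (-ℚ≡ _ 0ℚ)) (trans (cong (_- 0ℚ) (discriminant-rate p c i)) (solve 1 (λ a → a :- con 0ℚ := a) refl _)))
    (proj₂ D≃0 i (ℕ.m⊔n≤o⇒m≤o (proj₁ D≃0) (maximum (orderBound k) threshold) i≥)))
  critical-weights = near-critical J (IsDistribution.nonneg dst (not c)) (w-total c) (proj₁ D-small) (proj₂ D-small)
  ½≤q = proj₁ critical-weights
  q≤⅝ = proj₁ (proj₂ critical-weights)
  close-powers = proj₂ (proj₂ critical-weights)
  N≤k : N ℕ.≤ k
  N≤k = ℕ.≤-trans (ℕ.m≤n⊔m (proj₁ critical-likely) N) (ℕ.m≤n⊔m (proj₁ rare) (proj₁ critical-likely ⊔ N))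
  threshold≤ : ∀ n → n ℕ.≤ orderBound k → threshold n ℕ.≤ i
  threshold≤ n l = ℕ.≤-trans (≤-maximum (orderBound k) threshold n l) (ℕ.m⊔n≤o⇒n≤o (proj₁ D≃0) (maximum (orderBound k) threshold) i≥)
  unlikely = proj₂ rare k (ℕ.m≤m⊔n (proj₁ rare) (proj₁ critical-likely ⊔ N)) c dst ½≤q q≤⅝ close-powers
  likely = proj₂ critical-likely k (ℕ.≤-trans (ℕ.m≤m⊔n (proj₁ critical-likely) N) (ℕ.m≤n⊔m (proj₁ rare) (proj₁ critical-likely ⊔ N))) c dst ½≤q q≤⅝ close-powers
  below : seq L i < frac 2 1000
  below = let n , k≤n , n≤ , r = unlikely in <-≤-trans (proj₁ (close n (ℕ.≤-trans N≤k k≤n) i (threshold≤ n n≤)))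
    (≤-trans (+-monoʳ-≤ ε (≤-trans (≤-reflexive (seq-probability p φ n i)) (rare-truth φ (IsDistribution.nonneg dst) r))) (≤-reflexive (solve 0 (con (frac 1 1000) :+ con (frac 1 1000) := con (frac 2 1000)) refl)))
  above : frac 4 1000 < seq L i
  above = let n , k≤n , n≤ , g = likely in 0<⇒< (subst (0ℚ <_) (solve 1 (λ l → l :+ con (frac 1 1000) :- con (frac 1 200) := l :- con (frac 4 1000)) refl (seq L i))
    (<⇒0< (≤-<-trans (≤-trans g (≤-reflexive (sym (seq-probability p φ n i)))) (proj₂ (close n (ℕ.≤-trans N≤k k≤n) i (threshold≤ n n≤))))))

theorem2 : ExcludedMiddle 0ℓ → (p : ℝ) → 0ℝ Defs.< p → p Defs.< 1ℝ →
           (ZeroOneLaw p ⇔ (¬ Exceptional p)) ×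
           (Exceptional p → ∃ λ (φ : 𝓔₁²) → ¬ Converges (probability p φ))
theorem2 em p 0<p p<1 = mk⇔ no-law
    (λ ¬exc → regime⇒ZeroOneLaw em p (eventually-regime em p bounded ¬exc)) , divergent
  where
  bounded : EventuallyBounded p
  bounded = eventually-bounded p 0<p p<1
  divergent : Exceptional p → ∃ λ (φ : 𝓔₁²) → ¬ Converges (probability p φ)
  divergent exc = let c , h = Exceptional⇒golden p exc in critical c , critical-diverges p bounded c h
  no-law : ZeroOneLaw p → ¬ Exceptional p
  no-law law exc =
    let φ , diverges = divergent exc
        L , conv , _ = law φ
    in diverges (L , conv)
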